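{- Assume the Elliott–Halberstam conjecture for $\mathcal{P}$ and for $E_2$, i.e. assume $BV[1,\mathcal{P}]$ and $BV[1,E_2]$. Then there exist infinitely many positive integers $n$ such that all of $n$, $n+2$, $n+6$ lie in $\mathcal{P}_2=\mathcal{P}\cup E_2$. In particular, if $r_n$ denotes the $n$-th element of $\mathcal{P}_2$, then \[ \liminf_{n\to\infty}(r_{n+2}-r_n)\le 6. \]
   Context: $\mathcal{P}$ is the set of primes and $E_2$ is the set of products of two distinct primes. For $N$ large let $\pi^\flat(N)=\#\{p\in\mathcal{P}: N\le p<2N\}$ and $\pi^\flat(N;q,a)=\#\{p\in\mathcal{P}: N\le p<2N,\ p\equiv a \pmod q\}$. $BV[\theta,\mathcal{P}]$ means: for every $\epsilon>0$ and every $A>0$, \[ \sum_{q\le N^{\theta-\epsilon}}\mu^2(q)\max_{(a,q)=1}\left|\pi^\flat(N;q,a)-\frac{\pi^\flat(N)}{\varphi(q)}\right|\ll_A \frac{N}{(\log N)^A}\quad(N\to\infty). \] For fixed $0<\eta<1/4$ and $Y=N^\eta$, let $\beta(n)=1$ if $n=p_1p_2$ with primes $Y<p_1\le N^{1/2}<p_2$, and $\beta(n)=0$ otherwise; let $\pi_{\beta,q}(N)=\sum_{N<n\le 2N,\,(n,q)=1}\beta(n)$ and $\pi_\beta(N;q,a)=\sum_{N<n\le 2N,\,n\equiv a\ (\mathrm{mod}\ q)}\beta(n)$. $BV[\theta,E_2]$ means: for every fixed $\eta\in(0,1/4)$, every $\epsilon>0$ and every $A>0$, \[ \sum_{q\le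 N^{\theta-\epsilon}}\mu^2(q)\max_{(a,q)=1}\left|\pi_\beta(N;q,a)-\frac{\pi_{\beta,q}(N)}{\varphi(q)}\right|\ll_A\frac{N}{(\log N)^A}\quad(N\to\infty). \] -}

module Defs where

open import Data.Nat using (ℕ; zero; suc; _+_; _*_; _^_; _≤_; _<_; _∸_; _%_; _/_; _≡ᵇ_; _≤ᵇ_; _<ᵇ_)
open import Data.Nat.Primality using (Prime; prime?)
open import Data.Nat.Divisibility using (_∣?_)
open import Data.Nat.GCD using (gcd)
open import Data.Nat.Logarithm using (⌊log₂_⌋)
open import Data.Bool using (Bool; true; false; _∧_; not)
open import Data.List using (List; map; foldr; upTo; filterᵇ; length)
open import Data.Bool.ListAction using (any; all)
open import Data.Integer using (+_)
open import Data.Rational as ℚ using (ℚ; 0ℚ; _⊔_; ∣_∣)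
open import Data.Product using (Σ; ∃; ∃-syntax; _×_)
open import Data.Sum using (_⊎_)
open import Relation.Nullary using (does)
open import Relation.Binary.PropositionalEquality using (_≡_)

E₂ : ℕ → Set
E₂ n = ∃[ p ] ∃[ q ] (Prime p × Prime q × p < q × n ≡ p * q)

P₂ : ℕ → Set
P₂ n = Prime n ⊎ E₂ n

range : ℕ → ℕ → List ℕ
range a b = map (λ i → a + i) (upTo (b ∸ a))

count : (ℕ → Bool) → List ℕ → ℕ
count f xs = length (filterᵇ f xs)

isPrimeᵇ : ℕ → Bool
isPrimeᵇ n = does (prime? n)

divides : ℕ → ℕ → Bool
divides d n = does (d ∣? n)

coprimeᵇ : ℕ → ℕ → Bool
coprimeᵇ a q = gcd a q ≡ᵇ 1

-- x mod q (only used for q ≥ 1)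
modℕ : ℕ → ℕ → ℕ
modℕ zero x = x
modℕ (suc k) x = x % suc k

-- x / d (only used for d ≥ 1)
divℕ : ℕ → ℕ → ℕ
divℕ x zero = 0
divℕ x (suc k) = x / suc k

congᵇ : ℕ → ℕ → ℕ → Bool
congᵇ q n a = modℕ q n ≡ᵇ modℕ q a

squarefreeᵇ : ℕ → Bool
squarefreeᵇ q = all (λ d → not (divides (d * d) q)) (range 2 (suc q))

φ : ℕ → ℕ
φ q = count (λ a → coprimeᵇ a q) (range 1 (suc q))

toℚ : ℕ → ℚ
toℚ n = (+ n) ℚ./ 1

-- x / n in ℚ (n = 0 never occurs in use: φ(q) ≥ 1 for q ≥ 1)
divQ : ℚ → ℕ → ℚ
divQ x zero = 0ℚ
divQ x (suc k) = x ℚ.* ((+ 1) ℚ./ suc k)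

sumQ : List ℚ → ℚ
sumQ = foldr ℚ._+_ 0ℚ

maxQ : List ℚ → ℚ
maxQ = foldr _⊔_ 0ℚ

-- max over reduced residues a mod q (0 ≤ a < q, gcd(a,q)=1) of a
-- nonnegative quantity
maxRes : ℕ → (ℕ → ℚ) → ℚ
maxRes q f = maxQ (map f (filterᵇ (λ a → coprimeᵇ a q) (upTo q)))

-- squarefree q with 1 ≤ q ≤ N^(1 - j/k), i.e. q^k * N^j ≤ N^k
moduli : ℕ → ℕ → ℕ → List ℕ
moduli j k N = filterᵇ (λ q → squarefreeᵇ q ∧ (q ^ k * N ^ j ≤ᵇ N ^ k)) (range 1 (suc N))

-- S(N) ≪_A N / (log N)^A for every A (log taken as ⌊log₂ N⌋)
LogPowerSaving : (ℕ → ℚ) → Set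
LogPowerSaving S =
  ∀ (A : ℕ) → ∃[ C ] ∃[ N₀ ] ∀ N → N₀ ≤ N →
    S N ℚ.* toℚ (⌊log₂ N ⌋ ^ A) ℚ.≤ toℚ (C * N)

πflat : ℕ → ℕ
πflat N = count isPrimeᵇ (range N (2 * N))

πflatAP : ℕ → ℕ → ℕ → ℕ
πflatAP N q a = count (λ p → isPrimeᵇ p ∧ congᵇ q p a) (range N (2 * N))

BVsumP : ℕ → ℕ → ℕ → ℚ
BVsumP j k N =
  sumQ (map (λ q → maxRes q (λ a →
           ∣ toℚ (πflatAP N q a) ℚ.- divQ (toℚ (πflat N)) (φ q) ∣))
         (moduli j k N))

-- for every ε = j/k > 0 and every A
BV1-P : Set
BV1-P = ∀ (j k : ℕ) → 1 ≤ j → 1 ≤ k → LogPowerSaving (BVsumP j k)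

-- BV[1, E₂]   (η = u/v ∈ (0, 1/4), Y = N^η)

-- β(n) = 1 iff n = p₁ p₂ with Y < p₁ ≤ N^{1/2} < p₂
βᵇ : ℕ → ℕ → ℕ → ℕ → Bool
βᵇ u v N n = any (λ d → isPrimeᵇ d ∧ divides d n ∧ isPrimeᵇ (divℕ n d)
                        ∧ (N ^ u <ᵇ d ^ v) ∧ (d * d ≤ᵇ N)
                        ∧ (N <ᵇ divℕ n d * divℕ n d))
                 (range 1 (suc n))

πβq : ℕ → ℕ → ℕ → ℕ → ℕ
πβq u v N q = count (λ n → βᵇ u v N n ∧ coprimeᵇ n q) (range (suc N) (suc (2 * N)))

πβAP : ℕ → ℕ → ℕ → ℕ → ℕ → ℕ
πβAP u v N q a = count (λ n → βᵇ u v N n ∧ congᵇ q n a) (range (suc N) (suc (2 * N)))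

BVsumE₂ : ℕ → ℕ → ℕ → ℕ → ℕ → ℚ
BVsumE₂ u v j k N =
  sumQ (map (λ q → maxRes q (λ a →
           ∣ toℚ (πβAP u v N q a) ℚ.- divQ (toℚ (πβq u v N q)) (φ q) ∣))
         (moduli j k N))

-- for every rational η = u/v ∈ (0,1/4), every ε = j/k > 0, every A
BV1-E₂ : Set
BV1-E₂ = ∀ (u v : ℕ) → 1 ≤ u → 4 * u < v →
         ∀ (j k : ℕ) → 1 ≤ j → 1 ≤ k → LogPowerSaving (BVsumE₂ u v j k)

{-# OPTIONS --safe #-}
-- If n, n+2, n+6 never all lie in P₂, then Σ Λ(n)² (1(n) + 1(n+2) + 1(n+6) - 2) ≤ 0 for a Selberg weight Λ and the
-- indicator 1 of the primes and the numbers counted by β. The weight is Σ y(m) Π w_p over products m of primes D < p < R,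
-- where y(m) = F(i) for B^i ≤ m < B^(i+1), so the main terms become finite sums of values of F; for n + h = p₁p₂ with
-- p₁ < R, y(m) changes to y(m) - y(p₁m). The tangent line X² ≥ 2tX - t² bounds the diagonalised forms below. Averaging
-- over N with weight 1/N² turns prime counts into sums of 1/p, and a linear F makes the total positive.
module Submission where

import Data.Bool as Bool
import Data.Integer as ℤ
import Data.Integer.Properties as ℤ
import Data.List.Properties as List
import Data.List.Relation.Unary.All as All
import Data.List.Relation.Unary.Unique.Propositional.Properties as Uniqueₚ
import Data.Nat as N
import Data.Nat.Divisibility as ℕ∣
import Data.Nat.Properties as N
import Data.Rational as ℚ
import Data.Rational.Properties as ℚ
import Data.Rational.Unnormalised as ℚᵘ
import Data.Rational.Unnormalised.Properties as ℚᵘ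
open import Relation.Binary.PropositionalEquality
open import Data.Bool using (Bool; true; false; _∧_; if_then_else_; not)
open import Data.Bool.ListAction using (any)
open import Data.Bool.Properties using (T?)
open import Data.Empty using (⊥-elim; ⊥)
open import Data.Integer using (ℤ)
open import Data.List using (_∷_; []; List; map; filterᵇ; length; upTo; _++_)
open import Data.List.Membership.Propositional using (_∈_)
open import Data.List.Membership.Propositional.Properties using (∈-map⁻; ∈-map⁺; ∈-upTo⁻; ∈-upTo⁺; ∈-filter⁻; ∈-filter⁺)
open import Data.List.Relation.Unary.All using (All; []; _∷_)
open import Data.List.Relation.Unary.AllPairs using (AllPairs; []; _∷_)
open import Data.List.Relation.Unary.Any using (here; there)
open import Data.List.Relation.Unary.Unique.Propositional using (Unique)
open import Data.Nat using () renaming (_*_ to _·_; _≤_ to _≦_)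
open import Data.Nat using (_^_; >-nonZero; >-nonZero⁻¹; nonTrivial⇒n>1; s≤s; z≤n; ℕ; zero; suc; _<ᵇ_; _∸_; _≡ᵇ_; _≤ᵇ_)
open import Data.Nat.Combinatorics using (k![n∸k]!∣n!)
open import Data.Nat.Coprimality using (Coprime; coprime⇒gcd≡1; gcd≡1⇒coprime; coprime-Bézout)
open import Data.Nat.DivMod using (m≡m%n+[m/n]*n; m%n<n; m*n/n≡m; m/n*n≤m; /-monoˡ-≤; m<n⇒m%n≡m)
open import Data.Nat.Divisibility using (_∤_; _∣_; _∣?_; ∣1⇒≡1; ∣m∣n⇒∣m+n; ∣m+n∣m⇒∣n; m∣m*n; ∣m⇒∣m*n; ∣n⇒∣m*n; ∣-trans; ∣-refl; ∣⇒≤; _∣0; *-monoʳ-∣; *-monoˡ-∣; *-cancelˡ-∣; >⇒∤)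
open import Data.Nat.GCD using (module Bézout)
open import Data.Nat.Logarithm using (⌊log₂_⌋; ⌊log₂⌋-mono-≤; ⌊log₂[2^n]⌋≡n)
open import Data.Nat.Primality using (Prime; euclidsLemma; ¬prime[0]; ¬prime[1]; prime⇒irreducible; prime?; prime⇒nonTrivial)
open import Data.Nat.Primality.Factorisation using (factorise)
open import Data.Product using (_×_; _,_; proj₁; proj₂; ∃-syntax)
open import Data.Sum using (_⊎_; inj₁; inj₂; [_,_]′)
open import Data.Unit using (⊤; tt)
open import Function using (_∘_)
open import Relation.Binary.Definitions using (tri<; tri≈; tri>)
open import Relation.Nullary using (contradiction; ¬_; yes; no; does; Dec)
open import Relation.Nullary.Decidable using (dec⇒maybe; dec-true; dec-false; toWitness; _×-dec_; _⊎-dec_; map′)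
open import Tactic.RingSolver.Core.AlmostCommutativeRing using (AlmostCommutativeRing; fromCommutativeRing)
open import Tactic.RingSolver using () renaming (solve-∀ to ring)
open import Data.Nat.Tactic.RingSolver using () renaming (solve-∀ to solve-ℕ)
open import Data.Nat.Properties using () renaming (≤-trans to ≦-trans)
open import Data.Nat.Properties using (*-cancelʳ-<; *-cancelʳ-≤; *-cancelˡ-<; *-cancelˡ-≡; *-cancelˡ-≤; *-comm; *-mono-<; *-mono-≤; *-monoʳ-<; *-monoʳ-≤; *-monoˡ-<; *-monoˡ-≤; *-suc; +-assoc; +-comm; +-mono-≤; +-monoʳ-<; +-monoˡ-<; +-suc; +-∸-assoc; +-∸-comm; 0∸n≡0; <-cmp; <-irrefl; <-trans; <-≤-trans; <ᵇ⇒<; <⇒<ᵇ; <⇒≢; <⇒≤; <⇒≱; [m+n]∸[m+o]≡n∸o; ^-*-assoc; ^-distribˡ-+-*; ^-identityʳ; ^-monoʳ-<; ^-monoʳ-≤; ^-monoˡ-<; ^-monoˡ-≤; anyUpTo?; m+[n∸m]≡n; m+n∸m≡n; m+n∸n≡m; m<m+n; m<n⇒0<n∸m; m^n>0; m^n≢0; m∸n+n≡m; m∸n≢0⇒n<m; m∸n≤m; m≤m*n; m≤m+n; m≤n*m; m≤n+m; m≤n+m∸n; m≤n⇒m<n∨m≡n; m≤n⇒m∸n≡0; m≤n⇒m≤1+n; m≤n⇒m≤n+o; n<1+n; n∸n≡0; n≢0⇒n>0; n≤1+n; n≮0; ∸-monoʳ-≤; ∸-monoˡ-<; ∸-monoˡ-≤;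 ≡ᵇ⇒≡; ≤-<-trans; ≤-antisym; ≤-pred; ≤-total; ≤ᵇ⇒≤; ≤⇒≤ᵇ; ≤⇒≯; ≤∧≢⇒<; ≮⇒≥; ≰⇒>)

module Rationals where
 open import Data.Rational public using (nonNegative; positive; toℚᵘ; ℚ; 0ℚ; 1ℚ; _+_; _*_; _-_; -_; _≤_; _⊔_; ∣_∣)
 open import Data.Rational.Properties public using () renaming (≤-reflexive to ≡⇒≤; *-identityˡ to *-idˡ; *-identityʳ to *-idʳ; +-identityˡ to +-idˡ; +-identityʳ to +-idʳ)
 open import Data.Rational.Properties public using (≤-refl; ≤-trans; *-assoc; *-cancelˡ-≤-pos; *-distribʳ-+; *-distribˡ-+; *-monoʳ-≤-nonNeg; *-monoˡ-≤-nonNeg; *-zeroʳ; *-zeroˡ; +-*-commutativeRing; +-inverseʳ; +-monoʳ-≤; +-monoˡ-≤; 0≤p⇒∣p∣≡p; 0≤∣p∣; neg-antimono-≤; neg-distrib-+; nonPositive⁻¹; toℚᵘ-cancel-≤; toℚᵘ-fromℚᵘ; toℚᵘ-homo-*; toℚᵘ-homo-+; toℚᵘ-injective; toℚᵘ-mono-≤; ∣-p∣≡∣p∣; ∣p*q∣≡∣p∣*∣q∣; ∣p+q∣≤∣p∣+∣q∣; ∣p∣≡p∨∣p∣≡-p)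

 ≡≤ : ∀ {a b c : ℚ} -> a ≡ b -> b ≤ c -> a ≤ c
 ≡≤ refl h = h

 ≤≡ : ∀ {a b c : ℚ} -> a ≤ b -> b ≡ c -> a ≤ c
 ≤≡ h refl = h

 ≡≤ℕ : ∀ {a b c} -> a ≡ b -> b ≦ c -> a ≦ c
 ≡≤ℕ refl h = h

 ≤≡ℕ : ∀ {a b c} -> a ≦ b -> b ≡ c -> a ≦ c
 ≤≡ℕ h refl = h

module Field where

 open import Defs using (toℚ; divQ)
 open Rationals
 open import Data.Rational using (_<_)

 Rℚ : AlmostCommutativeRing _ _
 Rℚ = fromCommutativeRing +-*-commutativeRing (\x -> dec⇒maybe (0ℚ ℚ.≟ x))

 0≤+ : ∀ {a b} -> 0ℚ ≤ a -> 0ℚ ≤ b -> 0ℚ ≤ a + b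
 0≤+ p q = ≡≤ (sym (+-idˡ 0ℚ)) (ℚ.+-mono-≤ p q)

 *-monoˡ : ∀ {a b} c -> 0ℚ ≤ c -> a ≤ b -> c * a ≤ c * b
 *-monoˡ c h = *-monoˡ-≤-nonNeg c {{nonNegative h}}

 *-monoʳ : ∀ {a b} c -> 0ℚ ≤ c -> a ≤ b -> a * c ≤ b * c
 *-monoʳ c h = *-monoʳ-≤-nonNeg c {{nonNegative h}}

 0≤* : ∀ {a b} -> 0ℚ ≤ a -> 0ℚ ≤ b -> 0ℚ ≤ a * b
 0≤* {a} p q = ≡≤ (sym (*-zeroʳ a)) (*-monoˡ a p q)

 *-mono : ∀ {a b c d} -> 0ℚ ≤ a -> 0ℚ ≤ d -> a ≤ b -> c ≤ d -> a * c ≤ b * d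
 *-mono {a} {d = d} ha hd p q = ≤-trans (*-monoˡ a ha q) (*-monoʳ d hd p)

 +-mono : ∀ {a b c d} -> a ≤ b -> c ≤ d -> a + c ≤ b + d
 +-mono = ℚ.+-mono-≤

 diff : ∀ {a b} -> a ≤ b -> 0ℚ ≤ b - a
 diff {a} {b} p = ≡≤ (sym (+-inverseʳ a)) (+-monoˡ-≤ (- a) p)

 ≤by : ∀ {a b} d -> 0ℚ ≤ d -> a + d ≡ b -> a ≤ b
 ≤by {a} d h e = ≡≤ (sym (+-idʳ a)) (≤≡ (+-monoʳ-≤ a h) e)

 undiff : ∀ {a b} -> 0ℚ ≤ b - a -> a ≤ b
 undiff {a} {b} h = ≤by (b - a) h (e a b) where
  e : ∀ a b -> a + (b - a) ≡ b
  e = ring Rℚ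

 0≤sq : ∀ a -> 0ℚ ≤ a * a
 0≤sq a with ℚ.≤-total 0ℚ a
 ... | inj₁ p = 0≤* p p
 ... | inj₂ p = ≤≡ (0≤* (neg-antimono-≤ p) (neg-antimono-≤ p)) (e a) where
  e : ∀ a -> - a * - a ≡ a * a
  e = ring Rℚ

 ≤+ʳ : ∀ {a b} -> 0ℚ ≤ b -> a ≤ a + b
 ≤+ʳ h = ≤by _ h refl

 ≤+ˡ : ∀ {a b} -> 0ℚ ≤ b -> a ≤ b + a
 ≤+ˡ {a} {b} h = ≤by b h (ℚ.+-comm a b)

 0≤1 : 0ℚ ≤ 1ℚ
 0≤1 = ℚ.≤ᵇ⇒≤ _

 -≤ : ∀ {a b} -> 0ℚ ≤ b -> a - b ≤ a
 -≤ {a} {b} h = ≤by b h (e a b) where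
  e : ∀ a b -> a - b + b ≡ a
  e = ring Rℚ

 abs≤ : ∀ {a b} -> - b ≤ a -> a ≤ b -> ∣ a ∣ ≤ b
 abs≤ {a} p q with ∣p∣≡p∨∣p∣≡-p a
 ... | inj₁ e = ≡≤ e q
 ... | inj₂ e = ≡≤ e (≤≡ (neg-antimono-≤ p) (n _)) where
  n : ∀ b -> - (- b) ≡ b
  n = ring Rℚ

 ≤abs : ∀ a -> a ≤ ∣ a ∣
 ≤abs a with ℚ.≤-total 0ℚ a
 ... | inj₁ p = ≡⇒≤ (sym (0≤p⇒∣p∣≡p p))
 ... | inj₂ p = ≤-trans p (0≤∣p∣ a)

 -≤abs : ∀ a -> - a ≤ ∣ a ∣
 -≤abs a = ≤≡ (≤abs (- a)) (∣-p∣≡∣p∣ a)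

 abs≤⇒ub : ∀ {x m e} -> ∣ x - m ∣ ≤ e -> x ≤ m + e
 abs≤⇒ub {x} {m} {e} h = undiff (≤≡ (diff (≤-trans (≤abs (x - m)) h)) (r x m e)) where
  r : ∀ x m e -> e - (x - m) ≡ (m + e) - x
  r = ring Rℚ

 abs≤⇒lb : ∀ {x m e} -> ∣ x - m ∣ ≤ e -> m - e ≤ x
 abs≤⇒lb {x} {m} {e} h = undiff (≤≡ (diff (≤-trans (-≤abs (x - m)) h)) (r x m e)) where
  r : ∀ x m e -> e - (- (x - m)) ≡ x - (m - e)
  r = ring Rℚ

 abs-tri : ∀ a b -> ∣ a + b ∣ ≤ ∣ a ∣ + ∣ b ∣
 abs-tri = ∣p+q∣≤∣p∣+∣q∣

 abs* : ∀ {a b c} -> 0ℚ ≤ c -> ∣ a ∣ ≤ b -> ∣ c * a ∣ ≤ c * b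
 abs* {a} {b} {c} h p = ≡≤ (trans (∣p*q∣≡∣p∣*∣q∣ c a) (cong (_* ∣ a ∣) (0≤p⇒∣p∣≡p h))) (*-monoˡ c h p)

 opaque
  ι : ℕ -> ℚ
  ι n = toℚ n
  -- inv 0 = 0
  inv : ℕ -> ℚ
  inv n = divQ 1ℚ n
  ι-def : ∀ n -> ι n ≡ toℚ n
  ι-def n = refl
  divQ≡ : ∀ x n -> divQ x n ≡ x * inv n
  divQ≡ x zero = sym (*-zeroʳ x)
  divQ≡ x (suc n) = cong (x *_) (sym (*-idˡ _))
  inv-0 : inv 0 ≡ 0ℚ
  inv-0 = refl
  ι-u : ∀ n -> toℚᵘ (ι n) ℚᵘ.≃ ((ℤ.+ n) ℚᵘ./ 1)
  ι-u n = toℚᵘ-fromℚᵘ ((ℤ.+ n) ℚᵘ./ 1)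
  inv-u : ∀ k -> toℚᵘ (inv (suc k)) ℚᵘ.≃ ((ℤ.+ 1) ℚᵘ./ suc k)
  inv-u k = ℚᵘ.≃-trans (ℚᵘ.≃-reflexive (cong toℚᵘ (*-idˡ ((ℤ.+ 1) ℚ./ suc k)))) (toℚᵘ-fromℚᵘ ((ℤ.+ 1) ℚᵘ./ suc k))

 ι-+ : ∀ m n -> ι (m N.+ n) ≡ ι m + ι n
 ι-+ m n = toℚᵘ-injective (ℚᵘ.≃-trans (ι-u (m N.+ n)) (ℚᵘ.≃-sym (ℚᵘ.≃-trans (toℚᵘ-homo-+ (ι m) (ι n))
  (ℚᵘ.≃-trans (ℚᵘ.+-cong (ι-u m) (ι-u n)) (ℚᵘ.*≡* (cong (ℤ._* ℤ.+ 1) (cong₂ ℤ._+_ (ℤ.*-identityʳ (ℤ.+ m)) (ℤ.*-identityʳ (ℤ.+ n)))))))))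

 ι-* : ∀ m n -> ι (m · n) ≡ ι m * ι n
 ι-* m n = toℚᵘ-injective (ℚᵘ.≃-trans (ι-u (m · n)) (ℚᵘ.≃-sym (ℚᵘ.≃-trans (toℚᵘ-homo-* (ι m) (ι n))
  (ℚᵘ.≃-trans (ℚᵘ.*-cong (ι-u m) (ι-u n)) (ℚᵘ.*≡* (cong (ℤ._* ℤ.+ 1) (sym (ℤ.pos-* m n))))))))

 ι-mono : ∀ {m n} -> m ≦ n -> ι m ≤ ι n
 ι-mono {m} {n} h = toℚᵘ-cancel-≤ (ℚᵘ.≤-respˡ-≃ (ℚᵘ.≃-sym (ι-u m)) (ℚᵘ.≤-respʳ-≃ (ℚᵘ.≃-sym (ι-u n))
  (ℚᵘ.*≤* (ℤ.*-monoʳ-≤-nonNeg (ℤ.+ 1) (ℤ.+≤+ h)))))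

 ι-cancel : ∀ {m n} -> ι m ≤ ι n -> m ≦ n
 ι-cancel {m} {n} h with ℚᵘ.≤-respˡ-≃ (ι-u m) (ℚᵘ.≤-respʳ-≃ (ι-u n) (toℚᵘ-mono-≤ h))
 ... | ℚᵘ.*≤* q = ℤ.drop‿+≤+ (ℤ.*-cancelʳ-≤-pos (ℤ.+ m) (ℤ.+ n) (ℤ.+ 1) q)

 0≤ι : ∀ n -> 0ℚ ≤ ι n
 0≤ι n = ≡≤ (sym (ι-def 0)) (ι-mono {0} {n} z≤n)

 *-inv : ∀ n -> 1 ≦ n -> ι n * inv n ≡ 1ℚ
 *-inv (suc k) _ = toℚᵘ-injective (ℚᵘ.≃-trans (toℚᵘ-homo-* (ι (suc k)) (inv (suc k)))
  (ℚᵘ.≃-trans (ℚᵘ.*-cong (ι-u (suc k)) (inv-u k)) (ℚᵘ.*≡* e))) where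
  e : ((ℤ.+ suc k) ℤ.* ℤ.+ 1) ℤ.* ℤ.+ 1 ≡ ℤ.+ 1 ℤ.* (ℤ.+ (1 · suc k))
  e = trans (ℤ.*-identityʳ _) (trans (ℤ.*-identityʳ _) (trans (cong ℤ.+_ (sym (N.*-identityˡ (suc k)))) (sym (ℤ.*-identityˡ _))))

 0<ι : ∀ {n} -> 1 ≦ n -> 0ℚ < ι n
 0<ι h = ℚ.<-≤-trans {0ℚ} {1ℚ} (ℚ.*<* (ℤ.+<+ N.z<s)) (≡≤ (sym (ι-def 1)) (ι-mono h))

 *-cancel : ∀ {a b} c -> 0ℚ < c -> c * a ≤ c * b -> a ≤ b
 *-cancel c h = *-cancelˡ-≤-pos c {{positive h}}

 *-cancel-≡ : ∀ {a b} c -> 0ℚ < c -> c * a ≡ c * b -> a ≡ b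
 *-cancel-≡ c h e = ℚ.≤-antisym (*-cancel c h (≡⇒≤ e)) (*-cancel c h (≡⇒≤ (sym e)))

 0≤inv : ∀ n -> 0ℚ ≤ inv n
 0≤inv zero = ≡⇒≤ (sym inv-0)
 0≤inv n@(suc _) = *-cancel (ι n) (0<ι N.z<s) (≡≤ (*-zeroʳ (ι n)) (≤≡ 0≤1 (sym (*-inv n N.z<s))))

 inv-* : ∀ m n -> inv (m · n) ≡ inv m * inv n
 inv-* zero n = trans inv-0 (trans (sym (*-zeroˡ (inv n))) (cong (_* inv n) (sym inv-0)))
 inv-* m@(suc _) zero = trans (cong inv (N.*-zeroʳ m)) (trans inv-0 (trans (sym (*-zeroʳ (inv m))) (cong (inv m *_) (sym inv-0))))
 inv-* m@(suc _) n@(suc _) = *-cancel-≡ (ι (m · n)) (0<ι N.z<s) (begin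
  ι (m · n) * inv (m · n)   ≡⟨ *-inv (m · n) N.z<s ⟩
  1ℚ * 1ℚ                         ≡⟨ cong₂ _*_ (*-inv m N.z<s) (*-inv n N.z<s) ⟨
  ι m * inv m * (ι n * inv n) ≡⟨ e (ι m) (inv m) (ι n) (inv n) ⟩
  ι m * ι n * (inv m * inv n) ≡⟨ cong (_* (inv m * inv n)) (ι-* m n) ⟨
  ι (m · n) * (inv m * inv n) ∎) where
  open ≡-Reasoning
  e : ∀ a b c d -> a * b * (c * d) ≡ a * c * (b * d)
  e = ring Rℚ

 ≤inv : ∀ {a b} n -> 1 ≦ n -> ι n * a ≤ b -> a ≤ inv n * b
 ≤inv {a} {b} n h p = ≡≤ (sym e) (*-monoˡ (inv n) (0≤inv n) p) where
  e : inv n * (ι n * a) ≡ a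
  e = trans (sym (*-assoc (inv n) (ι n) a)) (trans (cong (_* a) (trans (ℚ.*-comm (inv n) (ι n)) (*-inv n h))) (*-idˡ a))

 inv≤ : ∀ {a b} n -> 1 ≦ n -> a ≤ ι n * b -> inv n * a ≤ b
 inv≤ {a} {b} n h p = ≤≡ (*-monoˡ (inv n) (0≤inv n) p) e where
  e : inv n * (ι n * b) ≡ b
  e = trans (sym (*-assoc (inv n) (ι n) b)) (trans (cong (_* b) (trans (ℚ.*-comm (inv n) (ι n)) (*-inv n h))) (*-idˡ b))

 inv-anti : ∀ {m n} -> 1 ≦ m -> m ≦ n -> inv n ≤ inv m
 inv-anti {m} {n} h p = ≤≡ (≤inv m h (≤≡ (*-monoʳ (inv n) (0≤inv n) (ι-mono p)) (*-inv n (≦-trans h p)))) (*-idʳ (inv m))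

module Sums where

 open Field
 open import Defs using (range; count; toℚ; sumQ; maxQ)
 open Rationals
 open import Data.Rational using (_<_)

 private variable
  A B : Set

 ∑ : List A -> (A -> ℚ) -> ℚ
 ∑ [] f = 0ℚ
 ∑ (x ∷ xs) f = f x + ∑ xs f

 ∑-mono∈ : ∀ (xs : List A) {f g : A -> ℚ} -> (∀ x -> x ∈ xs -> f x ≤ g x) -> ∑ xs f ≤ ∑ xs g
 ∑-mono∈ [] h = ≤-refl
 ∑-mono∈ (x ∷ xs) h = +-mono (h x (here refl)) (∑-mono∈ xs (\y m -> h y (there m)))

 ∑-mono : ∀ (xs : List A) {f g : A -> ℚ} -> (∀ x -> f x ≤ g x) -> ∑ xs f ≤ ∑ xs g
 ∑-mono xs h = ∑-mono∈ xs (\x _ -> h x)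

 ∑-cong∈ : ∀ (xs : List A) {f g : A -> ℚ} -> (∀ x -> x ∈ xs -> f x ≡ g x) -> ∑ xs f ≡ ∑ xs g
 ∑-cong∈ [] h = refl
 ∑-cong∈ (x ∷ xs) h = cong₂ _+_ (h x (here refl)) (∑-cong∈ xs (\y m -> h y (there m)))

 ∑-cong : ∀ (xs : List A) {f g : A -> ℚ} -> (∀ x -> f x ≡ g x) -> ∑ xs f ≡ ∑ xs g
 ∑-cong xs h = ∑-cong∈ xs (\x _ -> h x)

 ∑-0 : ∀ (xs : List A) -> ∑ xs (\_ -> 0ℚ) ≡ 0ℚ
 ∑-0 [] = refl
 ∑-0 (x ∷ xs) = trans (+-idˡ _) (∑-0 xs)

 ∑-nonneg∈ : ∀ (xs : List A) {f : A -> ℚ} -> (∀ x -> x ∈ xs -> 0ℚ ≤ f x) -> 0ℚ ≤ ∑ xs f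
 ∑-nonneg∈ xs h = ≡≤ (sym (∑-0 xs)) (∑-mono∈ xs h)

 ∑-nonneg : ∀ (xs : List A) {f : A -> ℚ} -> (∀ x -> 0ℚ ≤ f x) -> 0ℚ ≤ ∑ xs f
 ∑-nonneg xs h = ∑-nonneg∈ xs (\x _ -> h x)

 private
  swap4 : ∀ a b c d -> (a + b) + (c + d) ≡ (a + c) + (b + d)
  swap4 = ring Rℚ

 ∑-+ : ∀ (xs : List A) (f g : A -> ℚ) -> ∑ xs (\x -> f x + g x) ≡ ∑ xs f + ∑ xs g
 ∑-+ [] f g = refl
 ∑-+ (x ∷ xs) f g = trans (cong (f x + g x +_) (∑-+ xs f g)) (swap4 (f x) (g x) _ _)

 ∑-*ˡ : ∀ (xs : List A) c (f : A -> ℚ) -> ∑ xs (\x -> c * f x) ≡ c * ∑ xs f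
 ∑-*ˡ [] c f = sym (*-zeroʳ c)
 ∑-*ˡ (x ∷ xs) c f = trans (cong (c * f x +_) (∑-*ˡ xs c f)) (sym (*-distribˡ-+ c (f x) _))

 ∑-*ʳ : ∀ (xs : List A) c (f : A -> ℚ) -> ∑ xs (\x -> f x * c) ≡ ∑ xs f * c
 ∑-*ʳ xs c f = trans (∑-cong xs (\x -> ℚ.*-comm (f x) c)) (trans (∑-*ˡ xs c f) (ℚ.*-comm c _))

 ∑-neg : ∀ (xs : List A) (f : A -> ℚ) -> ∑ xs (\x -> - f x) ≡ - ∑ xs f
 ∑-neg [] f = refl
 ∑-neg (x ∷ xs) f = trans (cong (- f x +_) (∑-neg xs f)) (sym (neg-distrib-+ (f x) _))

 ∑-- : ∀ (xs : List A) (f g : A -> ℚ) -> ∑ xs (\x -> f x - g x) ≡ ∑ xs f - ∑ xs g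
 ∑-- xs f g = trans (∑-+ xs f (\x -> - g x)) (cong (∑ xs f +_) (∑-neg xs g))

 ∑-swap : ∀ (xs : List A) (ys : List B) (f : A -> B -> ℚ) -> ∑ xs (\x -> ∑ ys (f x)) ≡ ∑ ys (\y -> ∑ xs (\x -> f x y))
 ∑-swap [] ys f = sym (∑-0 ys)
 ∑-swap (x ∷ xs) ys f = trans (cong (∑ ys (f x) +_) (∑-swap xs ys f)) (sym (∑-+ ys (f x) _))

 ∑-++ : ∀ (xs ys : List A) (f : A -> ℚ) -> ∑ (xs ++ ys) f ≡ ∑ xs f + ∑ ys f
 ∑-++ [] ys f = sym (+-idˡ _)
 ∑-++ (x ∷ xs) ys f = trans (cong (f x +_) (∑-++ xs ys f)) (sym (ℚ.+-assoc (f x) _ _))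

 ∑-map : ∀ (h : A -> B) (xs : List A) (f : B -> ℚ) -> ∑ (map h xs) f ≡ ∑ xs (f ∘ h)
 ∑-map h [] f = refl
 ∑-map h (x ∷ xs) f = cong (f (h x) +_) (∑-map h xs f)

 ∑-abs : ∀ (xs : List A) (f : A -> ℚ) -> ∣ ∑ xs f ∣ ≤ ∑ xs (\x -> ∣ f x ∣)
 ∑-abs [] f = ≤-refl
 ∑-abs (x ∷ xs) f = ≤-trans (abs-tri (f x) _) (+-monoʳ-≤ ∣ f x ∣ (∑-abs xs f))

 ∑-≥-term : ∀ {xs : List A} {f : A -> ℚ} {x} -> (∀ y -> y ∈ xs -> 0ℚ ≤ f y) -> x ∈ xs -> f x ≤ ∑ xs f
 ∑-≥-term {xs = _ ∷ xs} h (here refl) = ≤+ʳ (∑-nonneg∈ xs (\y m -> h y (there m)))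
 ∑-≥-term {xs = y ∷ xs} h (there m) = ≤-trans (∑-≥-term (\z k -> h z (there k)) m) (≤+ˡ (h y (here refl)))

 ∑-const : ∀ (xs : List A) c -> ∑ xs (\_ -> c) ≡ ι (length xs) * c
 ∑-const [] c = sym (trans (cong (_* c) (ι-def 0)) (*-zeroˡ c))
 ∑-const (x ∷ xs) c = trans (cong (c +_) (∑-const xs c)) (trans (e c (ι (length xs))) (cong (_* c) (sym (trans (ι-+ 1 _) (cong (_+ ι (length xs)) (ι-def 1)))))) where
  e : ∀ c l -> c + l * c ≡ (1ℚ + l) * c
  e = ring Rℚ

 ind : Bool -> ℚ
 ind true = 1ℚ
 ind false = 0ℚ

 0≤ind : ∀ b -> 0ℚ ≤ ind b
 0≤ind true = 0≤1
 0≤ind false = ≤-refl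

 ind≤1 : ∀ b -> ind b ≤ 1ℚ
 ind≤1 true = ≤-refl
 ind≤1 false = 0≤1

 ind-∧ : ∀ a b -> ind (a ∧ b) ≡ ind a * ind b
 ind-∧ true b = sym (*-idˡ (ind b))
 ind-∧ false b = sym (*-zeroˡ (ind b))

 ∑-filter : ∀ (p : A -> Bool) xs (f : A -> ℚ) -> ∑ (filterᵇ p xs) f ≡ ∑ xs (\x -> ind (p x) * f x)
 ∑-filter p [] f = refl
 ∑-filter p (x ∷ xs) f with p x
 ... | true = cong₂ _+_ (sym (*-idˡ (f x))) (∑-filter p xs f)
 ... | false = trans (∑-filter p xs f) (sym (trans (cong (_+ _) (*-zeroˡ (f x))) (+-idˡ _)))

 count≡∑ : ∀ (p : ℕ -> Bool) xs -> ι (count p xs) ≡ ∑ xs (\x -> ind (p x))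
 count≡∑ p [] = ι-def 0
 count≡∑ p (x ∷ xs) with p x
 ... | true = trans (ι-+ 1 _) (cong₂ _+_ (ι-def 1) (count≡∑ p xs))
 ... | false = trans (count≡∑ p xs) (sym (+-idˡ _))

 sumQ≡∑ : ∀ (xs : List A) (f : A -> ℚ) -> sumQ (map f xs) ≡ ∑ xs f
 sumQ≡∑ [] f = refl
 sumQ≡∑ (x ∷ xs) f = cong (f x +_) (sumQ≡∑ xs f)

 ≤maxQ : ∀ {xs : List A} {f : A -> ℚ} {x} -> x ∈ xs -> f x ≤ maxQ (map f xs)
 ≤maxQ {f = f} (here refl) = ℚ.p≤p⊔q _ _
 ≤maxQ {f = f} (there m) = ≤-trans (≤maxQ {f = f} m) (ℚ.p≤q⊔p (f _) _)

 maxQ≤ : ∀ (xs : List A) {f : A -> ℚ} {c} -> 0ℚ ≤ c -> (∀ x -> x ∈ xs -> f x ≤ c) -> maxQ (map f xs) ≤ c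
 maxQ≤ [] hc h = hc
 maxQ≤ (x ∷ xs) hc h = ℚ.⊔-lub (h x (here refl)) (maxQ≤ xs hc (\y m -> h y (there m)))

 0≤maxQ : ∀ (xs : List ℚ) -> 0ℚ ≤ maxQ xs
 0≤maxQ [] = ≤-refl
 0≤maxQ (x ∷ xs) = ≤-trans (0≤maxQ xs) (ℚ.p≤q⊔p x _)

 ∈-range⁻ : ∀ {a b x} -> x ∈ range a b -> a ≦ x × x N.< b
 ∈-range⁻ {a} {b} m with ∈-map⁻ (\i -> a N.+ i) m
 ... | i , i∈ , refl = m≤m+n a i , <-≤-trans (+-monoʳ-< a i<) (N.≤-reflexive (m+[n∸m]≡n a≤b)) where
  i< : i N.< b N.∸ a
  i< = ∈-upTo⁻ i∈
  a≤b : a ≦ b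
  a≤b = <⇒≤ (m∸n≢0⇒n<m {b} {a} (\e -> n≮0 (subst (i N.<_) e i<)))

 ∈-range⁺ : ∀ {a b x} -> a ≦ x -> x N.< b -> x ∈ range a b
 ∈-range⁺ {a} {b} {x} p q = subst (_∈ range a b) (m+[n∸m]≡n p) (∈-map⁺ (\i -> a N.+ i) (∈-upTo⁺ (∸-monoˡ-< q p)))

 range-[] : ∀ a -> range a a ≡ []
 range-[] a = cong (map (a N.+_) ∘ upTo) (n∸n≡0 a)

 private
  upTo-+ : ∀ m n -> upTo (m N.+ n) ≡ upTo m ++ map (m N.+_) (upTo n)
  upTo-+ m zero = trans (cong upTo (N.+-identityʳ m)) (sym (List.++-identityʳ _))
  upTo-+ m (suc n) = begin
   upTo (m N.+ suc n)                                 ≡⟨ cong upTo (+-suc m n) ⟩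
   upTo (suc (m N.+ n))                               ≡⟨ List.upTo-∷ʳ (m N.+ n) ⟨
   upTo (m N.+ n) ++ (m N.+ n ∷ [])                   ≡⟨ cong (_++ (m N.+ n ∷ [])) (upTo-+ m n) ⟩
   (upTo m ++ map (m N.+_) (upTo n)) ++ (m N.+ n ∷ []) ≡⟨ List.++-assoc (upTo m) _ _ ⟩
   upTo m ++ (map (m N.+_) (upTo n) ++ map (m N.+_) (n ∷ [])) ≡⟨ cong (upTo m ++_) (List.map-++ (m N.+_) (upTo n) (n ∷ [])) ⟨
   upTo m ++ map (m N.+_) (upTo n ++ (n ∷ []))        ≡⟨ cong (\l -> upTo m ++ map (m N.+_) l) (List.upTo-∷ʳ n) ⟩
   upTo m ++ map (m N.+_) (upTo (suc n)) ∎ where open ≡-Reasoning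

 range-++ : ∀ {a b c} -> a ≦ b -> b ≦ c -> range a c ≡ range a b ++ range b c
 range-++ {a} {b} {c} p q = begin
  map (a N.+_) (upTo (c N.∸ a))                      ≡⟨ cong (map (a N.+_) ∘ upTo) e ⟩
  map (a N.+_) (upTo ((b N.∸ a) N.+ (c N.∸ b)))      ≡⟨ cong (map (a N.+_)) (upTo-+ (b N.∸ a) _) ⟩
  map (a N.+_) (upTo (b N.∸ a) ++ map (b N.∸ a N.+_) (upTo (c N.∸ b)))
   ≡⟨ List.map-++ (a N.+_) (upTo (b N.∸ a)) _ ⟩
  range a b ++ map (a N.+_) (map (b N.∸ a N.+_) (upTo (c N.∸ b)))
   ≡⟨ cong (range a b ++_) (trans (sym (List.map-∘ (upTo (c N.∸ b)))) (List.map-cong (\i -> trans (sym (+-assoc a _ i)) (cong (N._+ i) (m+[n∸m]≡n p))) (upTo (c N.∸ b)))) ⟩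
  range a b ++ range b c ∎ where
  open ≡-Reasoning
  e : c N.∸ a ≡ (b N.∸ a) N.+ (c N.∸ b)
  e = trans (cong (N._∸ a) (sym (m+[n∸m]≡n q))) (+-∸-comm (c N.∸ b) p)

 ∑-range-split : ∀ a b c (f : ℕ -> ℚ) -> a ≦ b -> b ≦ c -> ∑ (range a c) f ≡ ∑ (range a b) f + ∑ (range b c) f
 ∑-range-split a b c f p q = trans (cong (\l -> ∑ l f) (range-++ p q)) (∑-++ (range a b) (range b c) f)

 range-suc : ∀ a -> range a (suc a) ≡ a ∷ []
 range-suc a = trans (cong (map (a N.+_) ∘ upTo) (m+n∸n≡m 1 a)) (cong (_∷ []) (N.+-identityʳ a))

 ∑-range-last : ∀ a b (f : ℕ -> ℚ) -> a ≦ b -> ∑ (range a (suc b)) f ≡ ∑ (range a b) f + f b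
 ∑-range-last a b f p = trans (∑-range-split a b (suc b) f p (n≤1+n b)) (cong (∑ (range a b) f +_) (trans (cong (\l -> ∑ l f) (range-suc b)) (+-idʳ (f b))))

 ∑-range-shift : ∀ a b k (f : ℕ -> ℚ) -> ∑ (range (k N.+ a) (k N.+ b)) f ≡ ∑ (range a b) (\i -> f (k N.+ i))
 ∑-range-shift a b k f = trans (∑-map (k N.+ a N.+_) (upTo (k N.+ b N.∸ (k N.+ a))) f)
  (trans (cong (\l -> ∑ (upTo l) (\i -> f (k N.+ a N.+ i))) ([m+n]∸[m+o]≡n∸o k b a))
  (trans (∑-cong (upTo (b N.∸ a)) (\i -> cong f (+-assoc k a i))) (sym (∑-map (a N.+_) (upTo (b N.∸ a)) (\i -> f (k N.+ i))))))

 length-range : ∀ a b -> length (range a b) ≡ b N.∸ a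
 length-range a b = trans (List.length-map (a N.+_) (upTo (b N.∸ a))) (List.length-upTo (b N.∸ a))

 ∑-blocks : ∀ c a k (f : ℕ -> ℚ) -> ∑ (range (c · a) (c · (a N.+ k))) f ≡ ∑ (range a (a N.+ k)) (\i -> ∑ (range 0 c) (\r -> f (c · i N.+ r)))
 ∑-blocks c a zero f = trans (cong (\l -> ∑ l f) (trans (cong (\z -> range (c · a) (c · z)) (N.+-identityʳ a)) (range-[] (c · a))))
  (sym (cong (\l -> ∑ l _) (trans (cong (range a) (N.+-identityʳ a)) (range-[] a))))
 ∑-blocks c a (suc k) f = begin
  ∑ (range (c · a) (c · (a N.+ suc k))) f ≡⟨ cong (\z -> ∑ (range (c · a) z) f) e ⟩
  ∑ (range (c · a) (c · (a N.+ k) N.+ c)) f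
   ≡⟨ ∑-range-split (c · a) (c · (a N.+ k)) (c · (a N.+ k) N.+ c) f (*-monoʳ-≤ c (m≤m+n a k)) (m≤m+n _ c) ⟩
  ∑ (range (c · a) (c · (a N.+ k))) f + ∑ (range (c · (a N.+ k)) (c · (a N.+ k) N.+ c)) f
   ≡⟨ cong₂ _+_ (∑-blocks c a k f) (trans (cong (\z -> ∑ (range z (c · (a N.+ k) N.+ c)) f) (sym (N.+-identityʳ (c · (a N.+ k))))) (∑-range-shift 0 c (c · (a N.+ k)) f)) ⟩
  ∑ (range a (a N.+ k)) g + g (a N.+ k) ≡⟨ ∑-range-last a (a N.+ k) g (m≤m+n a k) ⟨
  ∑ (range a (suc (a N.+ k))) g ≡⟨ cong (\z -> ∑ (range a z) g) (+-suc a k) ⟨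
  ∑ (range a (a N.+ suc k)) g ∎ where
  open ≡-Reasoning
  g : ℕ -> ℚ
  g i = ∑ (range 0 c) (\r -> f (c · i N.+ r))
  e : c · (a N.+ suc k) ≡ c · (a N.+ k) N.+ c
  e = trans (cong (c N.*_) (+-suc a k)) (trans (*-suc c (a N.+ k)) (+-comm c _))

module Forms where

 open Field
 open Sums
 open Rationals

 2ℚ = 1ℚ + 1ℚ
 3ℚ = 2ℚ + 1ℚ

 0≤2 : 0ℚ ≤ 2ℚ
 0≤2 = 0≤+ 0≤1 0≤1

 0≤3 : 0ℚ ≤ 3ℚ
 0≤3 = 0≤+ 0≤2 0≤1

 sh : ℕ -> (ℕ -> ℚ) -> ℕ -> ℚ
 sh p f m = f (p · m)

 -- the sum of g(m) f(m) over the products m of distinct members of P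
 wsum : List ℕ -> (ℕ -> ℚ) -> (ℕ -> ℚ) -> ℚ
 wsum [] g f = f 1
 wsum (p ∷ P) g f = wsum P g f + g p * wsum P g (sh p f)

 wsum-mono : ∀ P {g f f' : ℕ -> ℚ} -> (∀ p -> 0ℚ ≤ g p) -> (∀ m -> f m ≤ f' m) -> wsum P g f ≤ wsum P g f'
 wsum-mono [] hg h = h 1
 wsum-mono (p ∷ P) hg h = +-mono (wsum-mono P hg h) (*-monoˡ _ (hg p) (wsum-mono P hg (\m -> h (p · m))))

 wsum-0 : ∀ P g -> wsum P g (\_ -> 0ℚ) ≡ 0ℚ
 wsum-0 [] g = refl
 wsum-0 (p ∷ P) g = trans (cong₂ (\a b -> a + g p * b) (wsum-0 P g) (wsum-0 P g)) (trans (+-idˡ _) (*-zeroʳ (g p)))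

 wsum-nonneg : ∀ P {g f : ℕ -> ℚ} -> (∀ p -> 0ℚ ≤ g p) -> (∀ m -> 0ℚ ≤ f m) -> 0ℚ ≤ wsum P g f
 wsum-nonneg P {g} hg h = ≡≤ (sym (wsum-0 P g)) (wsum-mono P hg h)

 wsum-cong : ∀ P {g f f' : ℕ -> ℚ} -> (∀ m -> f m ≡ f' m) -> wsum P g f ≡ wsum P g f'
 wsum-cong [] h = h 1
 wsum-cong (p ∷ P) {g} h = cong₂ (\a b -> a + g p * b) (wsum-cong P h) (wsum-cong P (\m -> h (p · m)))

 wsum-lin : ∀ P g k (f f' : ℕ -> ℚ) -> wsum P g (\m -> f m + k * f' m) ≡ wsum P g f + k * wsum P g f'
 wsum-lin [] g k f f' = refl
 wsum-lin (p ∷ P) g k f f' = trans (cong₂ (\a b -> a + g p * b) (wsum-lin P g k f f') (wsum-lin P g k (sh p f) (sh p f')))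
  (e (g p) k (wsum P g f) (wsum P g f') (wsum P g (sh p f)) (wsum P g (sh p f'))) where
  e : ∀ g k a b c d -> (a + k * b) + g * (c + k * d) ≡ (a + g * c) + k * (b + g * d)
  e = ring Rℚ

 wsum-*ˡ : ∀ P g k (f : ℕ -> ℚ) -> wsum P g (\m -> k * f m) ≡ k * wsum P g f
 wsum-*ˡ [] g k f = refl
 wsum-*ˡ (p ∷ P) g k f = trans (cong₂ (\a b -> a + g p * b) (wsum-*ˡ P g k f) (wsum-*ˡ P g k (sh p f))) (e (g p) k (wsum P g f) (wsum P g (sh p f))) where
  e : ∀ g k a b -> k * a + g * (k * b) ≡ k * (a + g * b)
  e = ring Rℚ

 wsum-∑ : ∀ {A : Set} P g (xs : List A) (f : A -> ℕ -> ℚ) -> wsum P g (\m -> ∑ xs (\x -> f x m)) ≡ ∑ xs (\x -> wsum P g (f x))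
 wsum-∑ P g [] f = wsum-0 P g
 wsum-∑ P g (x ∷ xs) f = trans (wsum-cong P (\m -> cong (f x m +_) (sym (*-idˡ (∑ xs (\x -> f x m))))))
  (trans (wsum-lin P g 1ℚ (f x) (\m -> ∑ xs (\x -> f x m))) (cong (wsum P g (f x) +_) (trans (*-idˡ (wsum P g (\m -> ∑ xs (\x -> f x m)))) (wsum-∑ P g xs f))))

 wsum-g-mono : ∀ P {g g' f : ℕ -> ℚ} -> (∀ p -> 0ℚ ≤ g p) -> (∀ p -> p ∈ P -> g p ≤ g' p) -> (∀ m -> 0ℚ ≤ f m) -> wsum P g f ≤ wsum P g' f
 wsum-g-mono [] hg h hf = ≤-refl
 wsum-g-mono (p ∷ P) {g} {g'} {f} hg h hf = +-mono (wsum-g-mono P hg (\q m -> h q (there m)) hf)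
  (*-mono (hg p) (≤-trans (wsum-nonneg P hg (\m -> hf (p · m))) ih) (h p (here refl)) ih) where
  ih : wsum P g (sh p f) ≤ wsum P g' (sh p f)
  ih = wsum-g-mono P hg (\q m -> h q (there m)) (\m -> hf (p · m))

 -- the second moment of Σ y(m) Π w_p over m, for independent w_p with mean τ p and second moment σ p
 Form : List ℕ -> (τ σ : ℕ -> ℚ) -> (u v : ℕ -> ℚ) -> ℚ
 Form [] τ σ u v = u 1 * v 1
 Form (p ∷ P) τ σ u v = Form P τ σ u v + τ p * (Form P τ σ u (sh p v) + Form P τ σ (sh p u) v) + σ p * Form P τ σ (sh p u) (sh p v)

 Form-cong : ∀ P {τ σ τ' σ' : ℕ -> ℚ} u v -> (∀ p -> p ∈ P -> τ p ≡ τ' p) -> (∀ p -> p ∈ P -> σ p ≡ σ' p) -> Form P τ σ u v ≡ Form P τ' σ' u v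
 Form-cong [] u v hτ hσ = refl
 Form-cong (p ∷ P) {τ} {σ} {τ'} {σ'} u v hτ hσ = cong₂ _+_ (cong₂ _+_ (ih u v) (cong₂ _*_ (hτ p (here refl)) (cong₂ _+_ (ih u (sh p v)) (ih (sh p u) v))))
  (cong₂ _*_ (hσ p (here refl)) (ih (sh p u) (sh p v))) where
  ih : ∀ u v -> Form P τ σ u v ≡ Form P τ' σ' u v
  ih u v = Form-cong P u v (\q m -> hτ q (there m)) (\q m -> hσ q (there m))

 Form-linˡ : ∀ P τ σ k a b v -> Form P τ σ (\m -> a m + k * b m) v ≡ Form P τ σ a v + k * Form P τ σ b v
 Form-linˡ [] τ σ k a b v = e (a 1) (b 1) k (v 1) where
  e : ∀ a b k v -> (a + k * b) * v ≡ a * v + k * (b * v)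
  e = ring Rℚ
 Form-linˡ (p ∷ P) τ σ k a b v
  rewrite Form-linˡ P τ σ k a b v | Form-linˡ P τ σ k a b (sh p v) | Form-linˡ P τ σ k (sh p a) (sh p b) v | Form-linˡ P τ σ k (sh p a) (sh p b) (sh p v)
  = e k (τ p) (σ p) (Form P τ σ a v) (Form P τ σ b v) (Form P τ σ a (sh p v)) (Form P τ σ b (sh p v)) (Form P τ σ (sh p a) v) (Form P τ σ (sh p b) v) (Form P τ σ (sh p a) (sh p v)) (Form P τ σ (sh p b) (sh p v)) where
  e : ∀ k t s a b c d x y z w -> (a + k * b) + t * ((c + k * d) + (x + k * y)) + s * (z + k * w) ≡ (a + t * (c + x) + s * z) + k * (b + t * (d + y) + s * w)
  e = ring Rℚ

 Form-sym : ∀ P τ σ u v -> Form P τ σ u v ≡ Form P τ σ v u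
 Form-sym [] τ σ u v = ℚ.*-comm (u 1) (v 1)
 Form-sym (p ∷ P) τ σ u v = cong₂ _+_ (cong₂ _+_ (Form-sym P τ σ u v) (cong (τ p *_) (trans (ℚ.+-comm (Form P τ σ u (sh p v)) (Form P τ σ (sh p u) v)) (cong₂ _+_ (Form-sym P τ σ (sh p u) v) (Form-sym P τ σ u (sh p v))))))
  (cong (σ p *_) (Form-sym P τ σ (sh p u) (sh p v)))

 Form-square : ∀ P τ σ k a b -> Form P τ σ (\m -> a m + k * b m) (\m -> a m + k * b m) ≡ Form P τ σ a a + 2ℚ * k * Form P τ σ a b + k * k * Form P τ σ b b
 Form-square P τ σ k a b = begin
  Form P τ σ f f                                      ≡⟨ Form-linˡ P τ σ k a b f ⟩
  Form P τ σ a f + k * Form P τ σ b f                 ≡⟨ cong₂ (\x y -> x + k * y) (Form-sym P τ σ a f) (Form-sym P τ σ b f) ⟩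
  Form P τ σ f a + k * Form P τ σ f b                 ≡⟨ cong₂ (\x y -> x + k * y) (Form-linˡ P τ σ k a b a) (Form-linˡ P τ σ k a b b) ⟩
  (Form P τ σ a a + k * Form P τ σ b a) + k * (Form P τ σ a b + k * Form P τ σ b b) ≡⟨ cong (\z -> (Form P τ σ a a + k * z) + k * (Form P τ σ a b + k * Form P τ σ b b)) (Form-sym P τ σ b a) ⟩
  (Form P τ σ a a + k * Form P τ σ a b) + k * (Form P τ σ a b + k * Form P τ σ b b) ≡⟨ e k (Form P τ σ a a) (Form P τ σ a b) (Form P τ σ b b) ⟩
  Form P τ σ a a + 2ℚ * k * Form P τ σ a b + k * k * Form P τ σ b b ∎ where
  open ≡-Reasoning
  f : ℕ -> ℚ
  f m = a m + k * b m
  e : ∀ k x y z -> (x + k * y) + k * (y + k * z) ≡ x + 2ℚ * k * y + k * k * z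
  e = ring Rℚ

 Form-diag : ∀ P (σ y : ℕ -> ℚ) -> Form P (\_ -> 0ℚ) σ y y ≡ wsum P σ (\m -> y m * y m)
 Form-diag [] σ y = refl
 Form-diag (p ∷ P) σ y = cong₂ (\a b -> a + σ p * b)
  (trans (cong (Form P _ σ y y +_) (*-zeroˡ (Form P (\_ -> 0ℚ) σ y (sh p y) + Form P (\_ -> 0ℚ) σ (sh p y) y))) (trans (+-idʳ _) (Form-diag P σ y))) (Form-diag P σ (sh p y))

 -- completing the square in the variable p
 Form-step : ∀ p P τ σ f -> Form (p ∷ P) τ σ f f ≡
  Form P τ σ (\m -> f m + τ p * f (p · m)) (\m -> f m + τ p * f (p · m)) + (σ p - τ p * τ p) * Form P τ σ (sh p f) (sh p f)
 Form-step p P τ σ f = trans (cong (\z -> Form P τ σ f f + τ p * (Form P τ σ f (sh p f) + z) + σ p * Form P τ σ (sh p f) (sh p f)) (Form-sym P τ σ (sh p f) f))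
  (trans (e (τ p) (σ p) (Form P τ σ f f) (Form P τ σ f (sh p f)) (Form P τ σ (sh p f) (sh p f))) (cong (_+ (σ p - τ p * τ p) * Form P τ σ (sh p f) (sh p f)) (sym (Form-square P τ σ (τ p) f (sh p f))))) where
  e : ∀ t s a b c -> a + t * (b + b) + s * c ≡ (a + 2ℚ * t * b + t * t * c) + (s - t * t) * c
  e = ring Rℚ

 Form-nonneg : ∀ P (τ σ : ℕ -> ℚ) f -> (∀ p -> p ∈ P -> 0ℚ ≤ σ p - τ p * τ p) -> 0ℚ ≤ Form P τ σ f f
 Form-nonneg [] τ σ f h = 0≤sq (f 1)
 Form-nonneg (p ∷ P) τ σ f h = ≤≡ (0≤+ (Form-nonneg P τ σ _ h') (0≤* (h p (here refl)) (Form-nonneg P τ σ (sh p f) h'))) (sym (Form-step p P τ σ f)) where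
  h' : ∀ q -> q ∈ P -> 0ℚ ≤ σ q - τ q * τ q
  h' q m = h q (there m)

 -- D2 and D3 sum over pairs and triples of pairwise coprime products
 D2 : List ℕ -> (ℕ -> ℚ) -> (ℕ -> ℕ -> ℚ) -> ℚ
 D2 [] κ G = G 1 1
 D2 (p ∷ P) κ G = D2 P κ G + κ p * (D2 P κ (\b c -> G (p · b) c) + D2 P κ (\b c -> G b (p · c)))

 D3 : List ℕ -> (ℕ -> ℚ) -> (ℕ -> ℕ -> ℕ -> ℚ) -> ℚ
 D3 [] κ G = G 1 1 1
 D3 (p ∷ P) κ G = D3 P κ G + κ p * (D3 P κ (\a b c -> G (p · a) b c) + D3 P κ (\a b c -> G a (p · b) c) + D3 P κ (\a b c -> G a b (p · c)))

 W2 : List ℕ -> (ℕ -> ℚ) -> (ℕ -> ℕ -> ℚ) -> ℚ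
 W2 P i G = wsum P i (\b -> wsum P i (G b))

 W3 : List ℕ -> (ℕ -> ℚ) -> (ℕ -> ℕ -> ℕ -> ℚ) -> ℚ
 W3 P i G = wsum P i (\a -> W2 P i (G a))

 D3-mono : ∀ P {κ : ℕ -> ℚ} {G H : ℕ -> ℕ -> ℕ -> ℚ} -> (∀ p -> 0ℚ ≤ κ p) -> (∀ a b c -> G a b c ≤ H a b c) -> D3 P κ G ≤ D3 P κ H
 D3-mono [] hκ h = h 1 1 1
 D3-mono (p ∷ P) hκ h = +-mono (D3-mono P hκ h) (*-monoˡ _ (hκ p) (+-mono (+-mono (D3-mono P hκ (\a b c -> h (p · a) b c)) (D3-mono P hκ (\a b c -> h a (p · b) c))) (D3-mono P hκ (\a b c -> h a b (p · c)))))

 D3-lin : ∀ P κ k (G H : ℕ -> ℕ -> ℕ -> ℚ) -> D3 P κ (\a b c -> G a b c + k * H a b c) ≡ D3 P κ G + k * D3 P κ H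
 D3-lin [] κ k G H = refl
 D3-lin (p ∷ P) κ k G H = trans (cong₂ (\x y -> x + κ p * y) (D3-lin P κ k G H) (cong₂ _+_ (cong₂ _+_ (D3-lin P κ k Ga Ha) (D3-lin P κ k Gb Hb)) (D3-lin P κ k Gc Hc)))
  (e (κ p) k (D3 P κ G) (D3 P κ H) (D3 P κ Ga) (D3 P κ Ha) (D3 P κ Gb) (D3 P κ Hb) (D3 P κ Gc) (D3 P κ Hc)) where
  Ga Gb Gc Ha Hb Hc : ℕ -> ℕ -> ℕ -> ℚ
  Ga a b c = G (p · a) b c
  Gb a b c = G a (p · b) c
  Gc a b c = G a b (p · c)
  Ha a b c = H (p · a) b c
  Hb a b c = H a (p · b) c
  Hc a b c = H a b (p · c)
  e : ∀ κ k a b c d x y z w -> (a + k * b) + κ * ((c + k * d) + (x + k * y) + (z + k * w)) ≡ (a + κ * (c + x + z)) + k * (b + κ * (d + y + w))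
  e = ring Rℚ

 D3-0 : ∀ P κ -> D3 P κ (λ _ _ _ -> 0ℚ) ≡ 0ℚ
 D3-0 [] κ = refl
 D3-0 (p ∷ P) κ rewrite D3-0 P κ = e (κ p) where
  e : ∀ κ -> 0ℚ + κ * (0ℚ + 0ℚ + 0ℚ) ≡ 0ℚ
  e = ring Rℚ

 D3-nonneg : ∀ P {κ : ℕ -> ℚ} {G : ℕ -> ℕ -> ℕ -> ℚ} -> (∀ p -> 0ℚ ≤ κ p) -> (∀ a b c -> 0ℚ ≤ G a b c) -> 0ℚ ≤ D3 P κ G
 D3-nonneg P {κ} hκ h = ≡≤ (sym (D3-0 P κ)) (D3-mono P hκ h)

 -- The tangent line inequality X² ≥ 2 t X - t², applied to each square in the diagonalised form; X is the inner sum over a.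
 Form-lower : ∀ P (τ σ κ : ℕ -> ℚ) f (t : ℕ -> ℕ -> ℚ) -> (∀ p -> 0ℚ ≤ κ p) ->
  (∀ p -> p ∈ P -> κ p ≤ τ p) -> (∀ p -> p ∈ P -> 2ℚ * κ p ≤ σ p - τ p * τ p) ->
  (∀ m -> 0ℚ ≤ f m) -> (∀ b c -> 0ℚ ≤ t b c) ->
  2ℚ * D3 P κ (\a b c -> t b c * f (a · (b · c))) - D2 P κ (\b c -> t b c * t b c) ≤ Form P τ σ f f
 Form-lower [] τ σ κ f t hκ hτ hσ hf ht = ≤by ((f 1 - t 1 1) * (f 1 - t 1 1)) (0≤sq (f 1 - t 1 1)) (e (f 1) (t 1 1)) where
  e : ∀ f t -> (2ℚ * (t * f) - t * t) + (f - t) * (f - t) ≡ f * f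
  e = ring Rℚ
 Form-lower (p ∷ P) τ σ κ f t hκ hτ hσ hf ht = ≡≤ e1 (≤≡ (+-mono low0 low1) (sym (Form-step p P τ σ f))) where
  f⁺ f1 : ℕ -> ℚ
  f⁺ m = f m + τ p * f (p · m)
  f1 = sh p f
  hτ' : ∀ q -> q ∈ P -> κ q ≤ τ q
  hτ' q m = hτ q (there m)
  hσ' : ∀ q -> q ∈ P -> 2ℚ * κ q ≤ σ q - τ q * τ q
  hσ' q m = hσ q (there m)
  hf1 : ∀ m -> 0ℚ ≤ f1 m
  hf1 m = hf (p · m)
  0≤τ : 0ℚ ≤ τ p
  0≤τ = ≤-trans (hκ p) (hτ p (here refl))
  T : (ℕ -> ℕ -> ℚ) -> ℚ
  T t = D2 P κ (\b c -> t b c * t b c)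
  E : (ℕ -> ℕ -> ℚ) -> (ℕ -> ℚ) -> ℚ
  E t f = D3 P κ (\a b c -> t b c * f (a · (b · c)))
  tb tc : ℕ -> ℕ -> ℚ
  tb b c = t (p · b) c
  tc b c = t b (p · c)
  Ea = D3 P κ (\a b c -> t b c * f (p · a · (b · c)))
  Eb = D3 P κ (\a b c -> t (p · b) c * f (a · (p · b · c)))
  Ec = D3 P κ (\a b c -> t b (p · c) * f (a · (b · (p · c))))
  E0 = E t f
  E1 = E t f1
  mulb : ∀ p a b c -> a · (p · b · c) ≡ p · (a · (b · c))
  mulb = solve-ℕ
  mulc : ∀ p a b c -> a · (b · (p · c)) ≡ p · (a · (b · c))
  mulc = solve-ℕ
  ea : Ea ≤ E1
  ea = D3-mono P hκ (\a b c -> ≡⇒≤ (cong (\z -> t b c * f z) (N.*-assoc p a (b · c))))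
  eb : Eb ≤ E tb f1
  eb = D3-mono P hκ (\a b c -> ≡⇒≤ (cong (\z -> tb b c * f z) (mulb p a b c)))
  ec : Ec ≤ E tc f1
  ec = D3-mono P hκ (\a b c -> ≡⇒≤ (cong (\z -> tc b c * f z) (mulc p a b c)))
  0≤Ea : 0ℚ ≤ E1
  0≤Ea = D3-nonneg P hκ (\a b c -> 0≤* (ht b c) (hf1 _))
  e1 : 2ℚ * (E0 + κ p * (Ea + Eb + Ec)) - (T t + κ p * (T tb + T tc)) ≡ (2ℚ * (E0 + κ p * Ea) - T t) + κ p * ((2ℚ * Eb - T tb) + (2ℚ * Ec - T tc))
  e1 = r (κ p) E0 Ea Eb Ec (T t) (T tb) (T tc) where
   r : ∀ k e a b c x y z -> (1ℚ + 1ℚ) * (e + k * (a + b + c)) - (x + k * (y + z)) ≡ ((1ℚ + 1ℚ) * (e + k * a) - x) + k * (((1ℚ + 1ℚ) * b - y) + ((1ℚ + 1ℚ) * c - z))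
   r = ring Rℚ
  E⁺ : E t f⁺ ≡ E0 + τ p * E1
  E⁺ = trans (ℚ.≤-antisym (D3-mono P hκ (\a b c -> ≡⇒≤ (d (t b c) (f (a · (b · c))) (τ p) (f1 (a · (b · c))))))
   (D3-mono P hκ (\a b c -> ≡⇒≤ (sym (d (t b c) (f (a · (b · c))) (τ p) (f1 (a · (b · c)))))))) (D3-lin P κ (τ p) (\a b c -> t b c * f (a · (b · c))) (\a b c -> t b c * f1 (a · (b · c)))) where
   d : ∀ t x k y -> t * (x + k * y) ≡ t * x + k * (t * y)
   d = ring Rℚ
  low0 : 2ℚ * (E0 + κ p * Ea) - T t ≤ Form P τ σ f⁺ f⁺
  low0 = ≤-trans (+-monoˡ-≤ (- T t) (*-monoˡ 2ℚ 0≤2 (≤≡ (+-monoʳ-≤ E0 (≤-trans (*-monoˡ (κ p) (hκ p) ea) (*-monoʳ E1 0≤Ea (hτ p (here refl))))) (sym E⁺))))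
   (Form-lower P τ σ κ f⁺ t hκ hτ' hσ' (\m -> 0≤+ (hf m) (0≤* 0≤τ (hf1 m))) ht)
  Q = Form P τ σ f1 f1
  lowb : 2ℚ * Eb - T tb ≤ Q
  lowb = ≤-trans (+-monoˡ-≤ (- T tb) (*-monoˡ 2ℚ 0≤2 eb)) (Form-lower P τ σ κ f1 tb hκ hτ' hσ' hf1 (\b c -> ht (p · b) c))
  lowc : 2ℚ * Ec - T tc ≤ Q
  lowc = ≤-trans (+-monoˡ-≤ (- T tc) (*-monoˡ 2ℚ 0≤2 ec)) (Form-lower P τ σ κ f1 tc hκ hτ' hσ' hf1 (\b c -> ht b (p · c)))
  0≤Q : 0ℚ ≤ Q
  0≤Q = Form-nonneg P τ σ f1 (\q m -> ≤-trans (0≤* 0≤2 (hκ q)) (hσ' q m))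
  low1 : κ p * ((2ℚ * Eb - T tb) + (2ℚ * Ec - T tc)) ≤ (σ p - τ p * τ p) * Q
  low1 = ≤-trans (*-monoˡ (κ p) (hκ p) (+-mono lowb lowc)) (≡≤ (r (κ p) Q) (*-monoʳ Q 0≤Q (hσ p (here refl)))) where
   r : ∀ k q -> k * (q + q) ≡ (1ℚ + 1ℚ) * k * q
   r = ring Rℚ

module Identities where

 open Field using (Rℚ)
 import Defs
 open import Tactic.RingSolver.NonReflective Rℚ using (solve; Expr) renaming (_⊕_ to _+_; _⊗_ to _*_; ⊝_ to -_; Κ to con)

 -- The operations and constants are those of polynomial expressions; solve proves the identity of their values in ℚ.
 private
  infix 4 _⊜_
  infixl 6 _-_
  Poly : ℕ -> Set
  Poly = Expr ℚ.ℚ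
  _⊜_ : ∀ {n} -> Poly n -> Poly n -> Poly n × Poly n
  _⊜_ = _,_
  _-_ : ∀ {n} -> Poly n -> Poly n -> Poly n
  x - y = x + - y
  0ℚ 1ℚ 2ℚ 3ℚ : ∀ {n} -> Poly n
  0ℚ = con ℚ.0ℚ
  1ℚ = con ℚ.1ℚ
  2ℚ = con Forms.2ℚ
  3ℚ = con Forms.3ℚ
  toℚ : ∀ {n} -> ℕ -> Poly n
  toℚ k = con (Defs.toℚ k)

 id1 = solve 5 (\ k x y z w -> x + k * (y + z) + k * k * w ⊜ (x + k * y) + k * (z + k * w)) refl
 id4 = solve 3 (\ k κ e -> κ + e - k ⊜ e - (k - κ)) refl
 id5 = solve 23 (\ M ε' x y z x1 y1 z1 k κ e d0 da db dc w0 wa wb wc wab wac wbc wabc -> w0 + k * (wa + wb + wc) + (k * k * (wab + wac + wbc) + k * k * k * wabc) + ((d0 + M * ε' * (x * (y * z)) - w0) + κ * ((da + M * ε' * (x1 * (y * z)) - wa) + ((db + M * ε' * (x * (y1 * z)) - wb) + (dc + M * ε' * (x * (y * z1)) - wc))) + (k - κ) * ((M * (x * (y * z)) - wa) + ((M * (x * (y * z)) - wb) + (M * (x * (y * z)) - wc))) + k * k * ((M * (x * (y * z)) - wab) + ((M * (x * (y * z)) - wac) + (M * (x * (y * z)) - wbc))) + k * k * k * (M * (x * (y * z)) - wabc) + 3ℚ * (M * (x * (y * z))) * (e - (k - κ)) + (k - κ) * (M * ε' * (x1 * (y * z) + (x * (y1 * z) + x * (y * z1)))) + M * ε' * (k *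 (k * (x1 * (y1 * z) + (x1 * (y * z1) + x * (y1 * z1))) + k * (k * (x1 * (y1 * z1))))) + M * (3ℚ * e + 3ℚ * (k * k) + k * k * k) * (k * (x1 * (y * z) + (x * (y1 * z) + x * (y * z1))) + k * (k * (x1 * (y1 * z) + (x1 * (y * z1) + x * (y1 * z1))) + k * (k * (x1 * (y1 * z1)))))) ⊜ (d0 + κ * (da + db + dc)) + M * ((3ℚ * e + 3ℚ * (k * k) + k * k * k) + ε') * ((x + k * x1) * ((y + k * y1) * (z + k * z1)))) refl
 id6 = solve 5 (\ k x y z w -> (x + k * y) + k * (z + k * w) ⊜ x + k * (z + y) + k * k * w) refl
 id7 = solve 9 (\ k g b c bc a ab ac abc -> ((g + k * b) + k * (c + k * bc)) + k * ((a + k * ab) + k * (ac + k * abc)) ⊜ g + k * (a + b + c) + (k * k * (ab + ac + bc) + k * k * k * abc)) refl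
 id8 = solve 2 (\ k x -> 3ℚ * k * x ⊜ k * (x + x + x)) refl
 id9 = solve 4 (\ m a b c -> m * (a * (b * c)) ⊜ m * a * b * c) refl
 id10 = solve 4 (\ m a b c -> m * a * b * c ⊜ m * a * c * b) refl
 id11 = solve 4 (\ m a c b -> m * a * c * b ⊜ m * (b * c) * a) refl
 id12 = solve 3 (\ m b a -> m * b * a ⊜ m * (a * b)) refl
 id13 = solve 3 (\ g m z -> g ⊜ g + m * 0ℚ * z) refl
 id14 = solve 7 (\ f g x a b c d -> f * ((a + (g - x) * b) * (c + (g - x) * d)) ⊜ f * (a * c) + g * (f * (a * d) + f * (b * c)) + g * g * (f * (b * d)) + (- (x * (f * (a * d)) + x * (f * (b * c))) + (x * x - 2ℚ * g * x) * (f * (b * d)))) refl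
 id15 = solve 7 (\ f g x a b c d -> f * (a * c) + g * (f * (a * d) + f * (b * c)) + g * g * (f * (b * d)) + (- (x * (f * (a * d)) + x * (f * (b * c))) + (x - 2ℚ * g * x) * (f * (b * d))) ⊜ f * (a * c) + g * (f * (a * d) + f * (b * c)) + g * g * (f * (b * d)) + (- (x * (f * (a * d)) + x * (f * (b * c))) + (1ℚ - 2ℚ * g) * (x * (f * (b * d))))) refl
 id16 = solve 3 (\ i f l -> i * (f * l) ⊜ f * i * l) refl
 id17 = solve 5 (\ u v a b e -> u * a * (v * b) * e ⊜ u * v * 1ℚ * (a * b * e)) refl
 id21 = solve 16 (\ γ r s s1 s2 s3 t1 t2 t3 m m1 m2 m3 n1 n2 n3 -> (s + γ * (s1 + s2) + γ * γ * s3 + (- (t1 + t2) + (1ℚ - 2ℚ * γ) * t3)) - (m + γ * (m1 + m2) + γ * γ * m3 - r * (n1 + n2) + (1ℚ - 2ℚ * γ) * (r * n3)) ⊜ ((s - m) + γ * ((s1 - m1) + (s2 - m2)) + γ * γ * (s3 - m3)) + (- ((t1 - r * n1) + (t2 - r * n2)) + (1ℚ - 2ℚ * γ) * (t3 - r * n3))) refl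
 id22 = solve 1 (\ g -> - 1ℚ + 2ℚ * (1ℚ - g) ⊜ 1ℚ - 2ℚ * g) refl
 id23 = solve 1 (\ g -> 1ℚ - 2ℚ * g + 2ℚ * g ⊜ 1ℚ) refl
 id25 = solve 7 (\ U V G g r a b -> (U * V * G * a + g * (U * V * G * a + U * V * G * a) + g * g * (U * V * G * a)) + ((r * (U * V * G * b) + r * (U * V * G * b)) + 1ℚ * (r * (U * V * G * b))) + (3ℚ * (3ℚ - r) * (U * V * G * b) + 3ℚ * 3ℚ * (g * (1ℚ + 1ℚ + g)) * (U * V * G * b)) ⊜ U * V * ((1ℚ + g) * (1ℚ + g) * G) * (a + 3ℚ * 3ℚ * b)) refl
 id26 = solve 4 (\ n u v m -> n * (u * v) - u * v * m ⊜ u * v * (n - m)) refl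
 id27 = solve 6 (\ k w a b c d -> (a + k * b) + w * (c + k * d) ⊜ (a + w * c) + k * (b + w * d)) refl
 id28 = solve 2 (\ g r -> 0ℚ + g * (0ℚ + 0ℚ) + g * g * 0ℚ - r * (0ℚ + 0ℚ) + (1ℚ - 2ℚ * g) * (r * 0ℚ) ⊜ 0ℚ) refl
 id29 = solve 16 (\ g r a b c d x y z a' b' c' d' x' y' z' -> (a + a') + g * ((b + b') + (c + c')) + g * g * (d + d') - r * ((x + x') + (y + y')) + (1ℚ - 2ℚ * g) * (r * (z + z')) ⊜ (a + g * (b + c) + g * g * d - r * (x + y) + (1ℚ - 2ℚ * g) * (r * z)) + (a' + g * (b' + c') + g * g * d' - r * (x' + y') + (1ℚ - 2ℚ * g) * (r * z'))) refl
 id30 = solve 2 (\ g a -> g * g + (1ℚ - 2ℚ * g) * a - (g - a) * (g - a) ⊜ a * (1ℚ - a)) refl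
 id31 = solve 8 (\ g r ρ m a b c d -> m * a + g * (m * b + m * c) + g * g * (m * d) - r * (ρ * m * b + ρ * m * c) + (1ℚ - 2ℚ * g) * (r * (ρ * m * d)) ⊜ m * (a + (g - r * ρ) * (b + c) + (g * g + (1ℚ - 2ℚ * g) * (r * ρ)) * d)) refl
 id32 = solve 2 (\ b x -> b * x ⊜ 0ℚ * x + 1ℚ * (b * x)) refl
 id33 = solve 2 (\ b x -> b * x ⊜ b * x + 0ℚ * (b * x)) refl
 id34 = solve 2 (\ a b -> a * (0ℚ * b) ⊜ 0ℚ) refl
 id35 = solve 1 (\ a -> (0ℚ + a) + 0ℚ ⊜ a) refl
 id36 = solve 4 (\ a b k f -> a * (b * (k * f)) ⊜ k * (a * (b * f))) refl
 id37 = solve 2 (\ a b -> a * (b * 0ℚ) ⊜ 0ℚ) refl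
 id38 = solve 4 (\ a p m f -> a * (p * m * f) ⊜ p * (a * (m * f))) refl
 id39 = solve 3 (\ f m n -> f + m * 0ℚ * n ⊜ f) refl
 id40 = solve 11 (\ k M ε a b c w w₁ n n₁ nA -> a + k * (b + k * c) + ((w + M * ε * n - a) + k * (w₁ + M * ε * n₁ - b) + k * k * (M * nA - c) + M * ε * (nA - (n + k * n₁))) ⊜ (w + k * w₁) + M * (k * k + ε) * nA) refl
 id41 = solve 1 (\ a -> 1ℚ * (a - 0ℚ) ⊜ a) refl
 id42 = solve 4 (\ i h n l -> (1ℚ + i) * h * ((1ℚ + n) - (1ℚ + l)) ⊜ h * ((1ℚ + i) * (n - l))) refl
 id43 = solve 3 (\ n i l -> (1ℚ + i) * (n - l) + i * l ⊜ n - l + n * i) refl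
 id44 = solve 2 (\ n l -> n - l + 1ℚ ⊜ (1ℚ + n) - l) refl
 id45 = solve 4 (\ n j p l -> n * (j * p) + p * (2ℚ * n - (2ℚ + j) * l) ⊜ (2ℚ + j) * (p * (n - l))) refl
 id47 = solve 1 (\ x -> x ⊜ 1ℚ * (x * 1ℚ)) refl
 id48 = solve 4 (\ a b c d -> a * b * (c * d) ⊜ a * c * (b * d)) refl
 id49 = solve 2 (\ k x -> 1ℚ + (1ℚ + k) * x + k * x * x ⊜ (1ℚ + x) * (1ℚ + k * x)) refl
 id50 = solve 3 (\ a b c -> a * (b * c) ⊜ b * (a * c)) refl
 id51 = solve 3 (\ h a b -> h * a * b ⊜ a * (h * b)) refl
 id53 = solve 4 (\ f x k b -> f * x + k * (b * f * x) ⊜ f * ((1ℚ + k * b) * x)) refl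
 id54 = solve 3 (\ h k w -> (h + k) - (1ℚ + 1ℚ) - w + ((1ℚ + 1ℚ) + (w - k)) ⊜ h) refl
 id55 = solve 5 (\ l w h j k -> l - (1ℚ + 1ℚ) - w + ((h - (l - 1ℚ)) + j + (1ℚ - k) + w) ⊜ (h + j) - k) refl
 id56 = solve 2 (\ k h -> (k + h) - k ⊜ h) refl
 id57 = solve 2 (\ h i -> h - 1ℚ + i ⊜ (h + i) - 1ℚ) refl
 id58 = solve 1 (\ h -> (1ℚ + h) - 1ℚ ⊜ h) refl
 id59 = solve 3 (\ a b c -> a * (0ℚ * b) ⊜ a * (0ℚ * c)) refl
 id60 = solve 1 (\ x -> 0ℚ + (x + 0ℚ) ⊜ x) refl
 id61 = solve 6 (\ x ε b n v a -> x - ε * b + (n - x + (v + 1ℚ * ε * a - n) + ε * (b - a)) ⊜ v) refl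
 id62 = solve 1 (\ l -> l * 0ℚ * (l * 0ℚ) ⊜ 0ℚ) refl
 id63 = solve 2 (\ l t -> l * t * (l * t) ⊜ l * l * (t * t)) refl
 id64 = solve 2 (\ l d -> l * 0ℚ * d ⊜ 0ℚ) refl
 id65 = solve 6 (\ a e w d x y -> a - e + ((w - a) + (d + x - w) + (e - x) + (y - d)) ⊜ y) refl
 id67 = solve 3 (\ i x t -> x * i * t ⊜ i * (x * t)) refl
 id68 = solve 3 (\ n q t -> 2ℚ * (n * (q * t)) ⊜ 2ℚ * n * t * q) refl
 id69 = solve 2 (\ c e -> c * (e + 2ℚ) ⊜ c * e + 1ℚ * (c * 2ℚ)) refl
 id70 = solve 6 (\ g x s c n i -> g * x * (s * (c * n * i)) ⊜ g * c * (n * (x * s * i))) refl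
 id71 = solve 4 (\ g t n h -> g * (t * (3ℚ * n * h)) ⊜ 3ℚ * n * t * (g * h)) refl
 id72 = solve 4 (\ n t g b -> 3ℚ * n * t * (g * b) ⊜ 3ℚ * g * (n * (b * t))) refl
 id73 = solve 4 (\ g n t h -> g * (2ℚ * n * t * h) ⊜ 2ℚ * n * t * (g * h)) refl
 id74 = solve 4 (\ n t g b -> 2ℚ * n * t * (g * b) ⊜ 2ℚ * g * n * (b * t)) refl
 id75 = solve 4 (\ g n c i -> 2ℚ * g * n * (c * i) ⊜ 2ℚ * g * c * (n * i)) refl
 id77 = solve 4 (\ g a b c -> g * (a + b + c) ⊜ g * a + g * b + g * c) refl
 id78 = solve 5 (\ a b c n i -> a * (n * i) + b * (n * i) + c * (n * i) ⊜ (a + b + c) * n * i) refl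
 id82 = solve 4 (\ s t i n -> s * i * (n * t) ⊜ s * t * (n * i)) refl
 id83 = solve 6 (\ s t i u v n -> n * (s * i * u + n * t * v) ⊜ s * (n * i) * u + t * (n * n * v)) refl
 id84 = solve 3 (\ s t f -> f + (t * (s - 1ℚ) * (s - 1ℚ) * f + f) ⊜ f + (s * t * s - s * t - s * t + t) * f + f) refl
 id85 = solve 3 (\ s t f -> f + (1ℚ * s - 1ℚ - 1ℚ + t) * f + f ⊜ s * f + t * f) refl
 id86 = solve 7 (\ s t a b u v k -> s * a + t * b + (s * 1ℚ * u + t * (k * v)) ⊜ s * (a + 1ℚ * u) + t * (b + k * v)) refl
 id89 = solve 1 (\ a -> a + - 1ℚ * 0ℚ ⊜ a) refl
 id90 = solve 3 (\ g a b -> a + (g - 1ℚ) * b ⊜ (a + - 1ℚ * b) + (g - 0ℚ) * b) refl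
 id93 = solve 1 (\ x -> 1ℚ + x + 1ℚ * 1ℚ ⊜ x + 2ℚ) refl
 id94 = solve 5 (\ I A P L φ -> I - L * φ ⊜ ((I - A) + (A - P * φ)) + - (L - P) * φ) refl
 id95 = solve 6 (\ i x a b c e -> i * (x * (a + 2ℚ * - 1ℚ * b + - 1ℚ * - 1ℚ * c)) - i * (x * a) - i * (3ℚ * e) - i * (x * c - 2ℚ * (x * b) - 3ℚ * e) ⊜ 0ℚ) refl
 id96 = solve 2 (\ a b -> (a + - 1ℚ * b) * (a + - 1ℚ * b) ⊜ a * a + (b * b - 2ℚ * (a * b))) refl
 id100 = solve 2 (\ a b -> a - (a + b) ⊜ - b) refl
 id101 = solve 5 (\ x y e s t -> x - 2ℚ * y - 3ℚ * e + ((s - (x - e)) + 2ℚ * ((y + e) - t)) ⊜ s - 2ℚ * t) refl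
 id102 = solve 3 (\ f b a -> f * (b * b - 2ℚ * (a * b)) ⊜ f * (b * b) - 2ℚ * (f * (a * b))) refl
 id103 = solve 8 (\ t a b s k y c l -> t - (a + b) + ((s - (k - a)) + (k - y) + (c - l)) ⊜ (t - y - b - l) + (s + c)) refl
 id104 = solve 2 (\ x y -> y ⊜ (x + y) - x) refl
 id106 = solve 1 (\ g -> g * g + (1ℚ - 2ℚ * g) * g ⊜ g - g * g) refl
 id107 = solve 1 (\ g -> g - g * g ⊜ g * (1ℚ - g)) refl
 id108 = solve 3 (\ s l j -> (s - j) + ((1ℚ + j) - l) ⊜ (s - l) - - 1ℚ) refl
 id109 = solve 3 (\ s l j -> ((1ℚ + j) - s) + (l - j) ⊜ 1ℚ - (s - l)) refl
 id112 = solve 4 (\ i l f t -> i * (l * f * t) ⊜ f * (i * (l * t))) refl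
 id113 = solve 2 (\ a b -> a ⊜ (a + b) - b) refl
 id114 = solve 9 (\ i π t T f m e a b -> i * (π * t + T) - (a + b) + ((i * π * f - i * π * t) + (m - e)) ⊜ (π * i * f - a) + (m - b) + (i * T - e)) refl
 id115 = solve 3 (\ a b c -> b + (c + 0ℚ) + a ⊜ a + (b + (c + 0ℚ))) refl
 id116 = solve 3 (\ a b c -> a + (c + 0ℚ) + b ⊜ a + (b + (c + 0ℚ))) refl
 id117 = solve 3 (\ a b c -> a + (b + 0ℚ) + c ⊜ a + (b + (c + 0ℚ))) refl
 id118 = solve 4 (\ a b c w -> a * w + b * w + c * w ⊜ (a + b + c) * w) refl
 id119 = solve 2 (\ i t -> i + t ⊜ 0ℚ + (t + i)) refl
 id120 = solve 2 (\ s t -> 3ℚ * (3ℚ * s + t) + 3ℚ * s + s ⊜ toℚ 13 * s + 3ℚ * t) refl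
 id121 = solve 1 (\ d -> toℚ 13 * (2ℚ * d) + 3ℚ * d ⊜ toℚ 29 * d) refl
 id122 = solve 4 (\ x y f g -> (x - f) + (g - y) ⊜ (x - y) - (f - g)) refl
 id123 = solve 10 (\ c e s0 s₂ s6 S l d ε G -> 3ℚ * c + ((s0 - (c - e)) + (s₂ - (c - e)) + (s6 - (c - e)) + (2ℚ * S - (s0 + s₂ + s6)) + 2ℚ * (l * d + ε - S) + 2ℚ * (l * G - l * d)) ⊜ 2ℚ * (l * G) + (3ℚ * e + 2ℚ * ε)) refl
 id124 = solve 1 (\ x -> 3ℚ + x - 3ℚ ⊜ x) refl
 id125 = solve 3 (\ x y z -> x - y + (y - z) ⊜ x + - 1ℚ * z) refl
 id126 = solve 2 (\ x z -> x - z ⊜ x + - 1ℚ * z) refl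
 id127 = solve 3 (\ p q i -> (q - (p - 3ℚ)) * (i * i) ⊜ q * (i * i) - (p * i * i - 3ℚ * (i * i))) refl
 id128 = solve 3 (\ x i j -> x * (i * j) ⊜ 3ℚ * i * ((2ℚ + x) * j) - 2ℚ * j * ((3ℚ + x) * i)) refl
 id129 = solve 2 (\ i j -> 3ℚ * i * 1ℚ - 2ℚ * j * 1ℚ ⊜ 3ℚ * i - 2ℚ * j) refl
 id130 = solve 2 (\ x j -> 2ℚ * (x * (j * j)) ⊜ 2ℚ * j * ((2ℚ + x) * j - 2ℚ * j)) refl
 id131 = solve 3 (\ k i t -> k - (i - t) ⊜ (k + t) - i) refl
 id132 = solve 3 (\ r i x -> r * r * i * x ⊜ r * i * (r * x)) refl
 id133 = solve 4 (\ r i p q -> r * i * (p * q) ⊜ p * (r * (i * q))) refl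
 id134 = solve 3 (\ m x y -> x * ((m + (1ℚ + 1ℚ)) * y) - (1ℚ + 1ℚ) * (x * y) ⊜ m * x * y) refl
 id135 = solve 4 (\ z x y a -> (1ℚ - z) * x + (x * (z - ((1ℚ + 1ℚ) + (1ℚ + 1ℚ)) * y) + (a - (1ℚ + 1ℚ) * y)) ⊜ a + (1ℚ + 1ℚ) * (x - (1ℚ + 1ℚ) * (x * y)) - (1ℚ + 1ℚ) * y - x) refl
 id136 = solve 3 (\ a x y -> a + (1ℚ + 1ℚ) * y - (1ℚ + 1ℚ) * y - x ⊜ a - x) refl
 id137 = solve 4 (\ s c i j -> s * c * ((1ℚ - j) * i) ⊜ s * i * (c - c * j)) refl
 id138 = solve 2 (\ i j -> i - j ⊜ 1ℚ * i - 1ℚ * j) refl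
 id139 = solve 3 (\ a i j -> (1ℚ + a) * j * i - a * i * j ⊜ i * j) refl
 id140 = solve 3 (\ x y z -> x - z ⊜ (x - y) + (y - z)) refl
 id143 = solve 3 (\ k i f -> k * (0ℚ * i) ⊜ 0ℚ * f) refl
 id144 = solve 4 (\ ρ t i h -> ρ * ρ * ρ * (t * (i * h)) ⊜ t * (ρ * ρ * h) * (ρ * i)) refl
 id145 = solve 4 (\ t ρ h s -> t * (ρ * ρ * h) * (1ℚ * s) ⊜ 1ℚ * (t * (ρ * ρ * s * h))) refl
 id146 = solve 3 (\ i π t -> i * (π * t) ⊜ t * (i * π)) refl
 id147 = solve 4 (\ i g l t -> i * (g * (l * t)) ⊜ t * (i * (g * l))) refl
 id148 = solve 4 (\ i h t s -> (1ℚ - i) * (1ℚ - i) * (1ℚ - i) * (h * t + s) + t * (i * ((1ℚ - i) * (1ℚ - i) * h)) ⊜ t * ((1ℚ - i) * (1ℚ - i) * h) + (1ℚ - i) * (1ℚ - i) * (1ℚ - i) * s) refl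
 id149 = solve 2 (\ i n -> i * (n + n) ⊜ 2ℚ * n * i) refl
 id150 = solve 4 (\ u k n i -> u * (k * n * i) ⊜ u * k * n * i) refl
 id151 = solve 5 (\ u k n p i -> 3ℚ * (u * (k * (2ℚ * n * p) * i)) ⊜ 2ℚ * 3ℚ * (u * k) * n * i * p) refl
 id152 = solve 5 (\ t n i g x -> t * n * i * (g * x) ⊜ t * g * n * (x * i)) refl
 id155 = solve 6 (\ a c t z n i -> 3ℚ * (a * n * i + (c * n * i + t * n * i)) + 2ℚ * (z * n * i) ⊜ (3ℚ * (a + (c + t)) + 2ℚ * z) * n * i) refl
 id156 = solve 2 (\ n i -> n * i + n * i ⊜ 2ℚ * n * i) refl
 id157 = solve 4 (\ x n i y -> - (3ℚ * n * i) + (x + (n * i - y) + 2ℚ * n * i) ⊜ x - y) refl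
 id158 = solve 4 (\ x n i y -> x - y + ((2ℚ * n * i - x) + y + n * i) ⊜ 3ℚ * n * i) refl
 id159 = solve 2 (\ i s -> 1ℚ + (i + s) + i * s ⊜ (1ℚ + i) * (1ℚ + s)) refl
 id160 = solve 7 (\ f φ w l L p x -> 3ℚ * (f * (p * (φ * w * l * L * x))) ⊜ φ * f * (w * (l * L * (3ℚ * (p * x))))) refl
 id161 = solve 3 (\ w i x -> w * i * x ⊜ i * (x * w)) refl
 id162 = solve 3 (\ c d w -> c * d * (2ℚ * w) ⊜ d * (2ℚ * c * w)) refl
 id163 = solve 2 (\ x w -> x + x * (w - 1ℚ) ⊜ x * w) refl
 id164 = solve 4 (\ c d w z -> c * d * (2ℚ * w * z) ⊜ d * (2ℚ * c * w * z)) refl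
 id165 = solve 3 (\ d l w -> (l + w) + ((d * l - 2ℚ * (w + 2ℚ)) + (w + 2ℚ * 2ℚ)) ⊜ (1ℚ + d) * l) refl
 id166 = solve 2 (\ d n -> 2ℚ * d * (n * 2ℚ) ⊜ 2ℚ * 2ℚ * n * d) refl
 id167 = solve 4 (\ n i h d -> 2ℚ * 2ℚ * n * (h * (h * h) * i * d) ⊜ 2ℚ * h * (2ℚ * h) * (n * i) * (h * d)) refl
 id168 = solve 1 (\ h -> h + h ⊜ 2ℚ * h) refl
 id169 = solve 8 (\ h d c l w ε n b -> (1ℚ - d) * (c * l) + ((h * d - ε * (n * 2ℚ)) * (c * l) + (c * (h * (d * l - 2ℚ * (w + 2ℚ))) + ε * n * (2ℚ * (c * l) - b))) ⊜ (1ℚ - d) * (c * l) + ((h + h) * d * (c * l) - c * ((h + h) * (w + 2ℚ)) - ε * (n * b))) refl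
 id170 = solve 5 (\ d c l w ε -> (1ℚ - d) * (c * l) + (1ℚ * d * (c * l) - c * (1ℚ * (w + 2ℚ)) - ε) ⊜ c * (l - 2ℚ - w) - ε) refl
 id171 = solve 6 (\ L n f t d s -> L * (n * f) * f * (t * d) * (n * (s * L) * (n * (s * L) * (n * (s * L)))) + L * (L * (L * L)) * (t * (n * n * n * n * (f * f)) * d) * (toℚ 8 - s * (s * s)) ⊜ L * (L * (L * L)) * (toℚ 8 * (t * (n * n * n * n * (f * f))) * d)) refl
 id172 = solve 5 (\ p s L a x -> L * (L * (L * L)) * ((2ℚ * (p * p * p) - s * s) * a - 2ℚ) + 2ℚ * (L * (L * (L * L)) - x) ⊜ 2ℚ * (p * L * (p * L * (p * L * (L * a))) - x) - s * L * (s * L * (L * L * a))) refl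
 id173 = solve 2 (\ j l -> (1ℚ + j) * l ⊜ j * l + l) refl
 id174 = solve 3 (\ f i m -> 3ℚ * (f * (i * i * m)) ⊜ i * i * (3ℚ * (f * m))) refl
 id175 = solve 9 (\ i n s w g e d k b -> i * i * (2ℚ * ((n + s) * w * g) + e) + (2ℚ * w * g * i * (d - s * i) + i * i * (k * n * b - e)) ⊜ 2ℚ * w * g * i * (n * i + d) + k * (n * i) * i * b) refl
 id176 = solve 6 (\ w g i d k b -> 2ℚ * w * g * i * (1ℚ + d) + k * 1ℚ * i * b ⊜ (2ℚ * (1ℚ + d) * w * g + k * b) * i) refl
 id177 = solve 7 (\ s w L g e k l -> (2ℚ * s * w * (s * L * (s * L * (s * L * g))) + e) * (k * l) + (w * (L * (L * L)) - e) * (k * l) ⊜ w * (l * (L * (L * L)) * (k * (2ℚ * (s * s * s * s) * g + 1ℚ)))) refl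
 id178 = solve 3 (\ a b c -> (a - b) * c ⊜ a * c - b * c) refl
 id179 = solve 5 (\ h a b x y -> h * (a - b) + (x - y) ⊜ (h * a + x) - (h * b + y)) refl
 id180 = solve 1 (\ d -> (1ℚ - d) * (1ℚ - d) * (1ℚ - d) + d * (1ℚ + (1ℚ - d) + (1ℚ - d) * (1ℚ - d)) ⊜ 1ℚ) refl
 id181 = solve 2 (\ x t -> x ⊜ t + x - t) refl
 id182 = solve 5 (\ Q C d i x -> Q * Q * C * (3ℚ * ((1ℚ - toℚ 12 * d) * (x * (i * i)))) ⊜ Q * i * (Q * i) * (3ℚ * x * (C - toℚ 12 * (C * d)))) refl
 id183 = solve 2 (\ x C -> 1ℚ * 1ℚ * (3ℚ * x * (C - toℚ 12 * 1ℚ)) ⊜ 3ℚ * x * (C - toℚ 12)) refl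
 id184 = solve 6 (\ Q C d k g m -> Q * Q * C * (k * (2ℚ * (1ℚ + toℚ 30 * d) * g + 1ℚ) + toℚ 6 * m) ⊜ Q * Q * (k * (2ℚ * g * (C + toℚ 30 * (C * d)) + C) + toℚ 6 * m * C)) refl
 id185 = solve 1 (\ d -> 1ℚ - toℚ 12 * d + 3ℚ * d ⊜ 1ℚ - toℚ 9 * d) refl
 id186 = solve 1 (\ d -> 1ℚ - toℚ 9 * d + (d + 3ℚ * (d * d) + 2ℚ * (d * d * (1ℚ - d))) ⊜ 2ℚ * ((1ℚ - d) * (1ℚ - d) * (1ℚ - d)) - (1ℚ + d) * (1ℚ + d)) refl
 id187 = solve 6 (\ d Y X m M w -> 3ℚ * ((1ℚ - toℚ 12 * d) * Y) - toℚ 6 * m + 3ℚ * ((2ℚ * (d * d) + d * d * (1ℚ - d)) * ((1ℚ - toℚ 9 * d) * Y) + toℚ 27 * (d * d) * Y + (1ℚ - d) * (1ℚ - d) * (1ℚ - d) * (1ℚ - toℚ 9 * d) * (X - Y) + (1ℚ - d) * (1ℚ - d) * (1ℚ - d) * (w - (1ℚ - toℚ 9 * d)) * X + 2ℚ * (m - M) + 2ℚ * ((1ℚ - (1ℚ - d) * (1ℚ - d) * (1ℚ - d)) * M)) ⊜ 3ℚ * ((1ℚ - d) * (1ℚ - d) * (1ℚ - d) * (w * X - 2ℚ * M))) refl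
 id188 = solve 1 (\ d -> (1ℚ + d) * (1ℚ + d) + d * (1ℚ - d) ⊜ 1ℚ + 3ℚ * d) refl
 id189 = solve 1 (\ d -> (1ℚ + 3ℚ * d) * (1ℚ + 3ℚ * d) + (toℚ 15 * d + toℚ 9 * (d * (1ℚ - d))) ⊜ 1ℚ + toℚ 30 * d) refl
 id190 = solve 5 (\ x m g c k -> x + ((g - (x - m)) + (c - g) + (k - c)) ⊜ k + m) refl
 id191 = solve 5 (\ q x a f i -> (q * x * a + f) * (i * i) ⊜ q * i * (x * i) * a + f * (i * i)) refl
 id192 = solve 4 (\ a x y i -> a * (x * y) * (i * i) ⊜ a * (x * i * (y * i))) refl
 id2 : ∀ p a b c -> a · (p · b · c) ≡ p · (a · (b · c))
 id2 = solve-ℕ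
 id3 : ∀ p a b c -> a · (b · (p · c)) ≡ p · (a · (b · c))
 id3 = solve-ℕ
 id18 : ∀ p x y -> p · (x · y) ≡ x · (p · y)
 id18 = solve-ℕ
 id19 : ∀ p x y -> p · (x · y) ≡ x · (y · p)
 id19 = solve-ℕ
 id20 : ∀ p x y -> p · (x · y) ≡ x · p · y
 id20 = solve-ℕ
 id24 : ∀ p q d -> p · q · d ≡ q · (p · d)
 id24 = solve-ℕ
 id46 : ∀ j -> (4 N.+ j) · ((4 N.+ j) · ((4 N.+ j) · ((4 N.+ j) · 1))) · (4 N.+ j) N.+ (226 N.+ 345 · j N.+ 160 · (j · j) N.+ 30 · (j · j · j) N.+ 2 · (j · j · j · j)) ≡ (2 N.+ j) · ((5 N.+ j) · ((5 N.+ j) · ((5 N.+ j) · ((5 N.+ j) · 1))))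
 id46 = solve-ℕ
 id52 : ∀ p q d -> q · (p · d) ≡ p · q · d
 id52 = solve-ℕ
 id66 : ∀ i j k -> suc i N.+ (suc j N.+ suc k) ≡ suc (i N.+ (j N.+ k) N.+ 2)
 id66 = solve-ℕ
 id76 : ∀ b n -> (b N.+ b) · n ≡ (2 · n) · b
 id76 = solve-ℕ
 id79 : ∀ p k r -> p · (k · r) ≡ r · (p · k)
 id79 = solve-ℕ
 id80 : ∀ a b c -> a · b · c ≡ a · c · b
 id80 = solve-ℕ
 id81 : ∀ a b c d -> a · b · (c · d) ≡ a · c · (b · d)
 id81 = solve-ℕ
 id87 : ∀ p q -> q · p N.+ p · 1 ≡ p N.+ p · q
 id87 = solve-ℕ
 id88 : ∀ k a b -> k N.+ a N.+ b ≡ k N.+ b N.+ a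
 id88 = solve-ℕ
 id91 : ∀ w h -> 2 N.+ w N.+ h ≡ w N.+ (2 N.+ h)
 id91 = solve-ℕ
 id92 : ∀ x p t -> x · (p · t N.+ 0) ≡ t · (p · x)
 id92 = solve-ℕ
 id97 : ∀ p n -> 2 · (p · n) ≡ p · (2 · n)
 id97 = solve-ℕ
 id98 : ∀ x -> 2 · suc x ≡ suc (suc (2 · x))
 id98 = solve-ℕ
 id99 : ∀ p x -> p · (2 · x) ≡ 2 · (p · x)
 id99 = solve-ℕ
 id105 : ∀ x q -> x N.+ q N.+ q · 0 ≡ x N.+ q · 1
 id105 = solve-ℕ
 id110 : ∀ l N -> l N.+ (N N.+ 7) ≡ l N.+ 6 N.+ suc N
 id110 = solve-ℕ
 id111 : ∀ N -> N N.+ suc N ≡ suc (2 · N)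
 id111 = solve-ℕ
 id141 : ∀ n k -> suc (n N.+ 2 N.+ k) ≡ n N.+ 1 N.+ (2 N.+ k)
 id141 = solve-ℕ
 id142 : ∀ n k -> n N.+ 2 N.+ k ≡ n N.+ 1 N.+ (1 N.+ k)
 id142 = solve-ℕ
 id153 : ∀ N -> N N.+ N ≡ 2 · N
 id153 = solve-ℕ
 id154 : ∀ N -> suc N N.+ N ≡ suc (2 · N)
 id154 = solve-ℕ

module Trip where

 open Identities
 open Field
 open Sums
 open Forms
 open Rationals

 W2-mono : ∀ P {i : ℕ -> ℚ} {G H : ℕ -> ℕ -> ℚ} -> (∀ p -> 0ℚ ≤ i p) -> (∀ b c -> G b c ≤ H b c) -> W2 P i G ≤ W2 P i H
 W2-mono P hi h = wsum-mono P hi (\b -> wsum-mono P hi (h b))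

 W3-mono : ∀ P {i : ℕ -> ℚ} {G H : ℕ -> ℕ -> ℕ -> ℚ} -> (∀ p -> 0ℚ ≤ i p) -> (∀ a b c -> G a b c ≤ H a b c) -> W3 P i G ≤ W3 P i H
 W3-mono P hi h = wsum-mono P hi (\a -> W2-mono P hi (h a))

 W2-step : ∀ p P i G -> W2 (p ∷ P) i G ≡ W2 P i G + i p * (W2 P i (\b c -> G (p · b) c) + W2 P i (\b c -> G b (p · c))) + i p * i p * W2 P i (\b c -> G (p · b) (p · c))
 W2-step p P i G = trans (cong₂ (\x y -> x + i p * y) (wsum-lin P i (i p) (\b -> wsum P i (G b)) (\b -> wsum P i (\c -> G b (p · c))))
  (wsum-lin P i (i p) (\b -> wsum P i (G (p · b))) (\b -> wsum P i (\c -> G (p · b) (p · c)))))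
  (id6 (i p) (W2 P i G) (W2 P i (\b c -> G b (p · c))) (W2 P i (\b c -> G (p · b) c)) (W2 P i (\b c -> G (p · b) (p · c))))

 W3-step : ∀ p P i G -> W3 (p ∷ P) i G ≡ W3 P i G
  + i p * (W3 P i (\a b c -> G (p · a) b c) + W3 P i (\a b c -> G a (p · b) c) + W3 P i (\a b c -> G a b (p · c)))
  + (i p * i p * (W3 P i (\a b c -> G (p · a) (p · b) c) + W3 P i (\a b c -> G (p · a) b (p · c)) + W3 P i (\a b c -> G a (p · b) (p · c)))
  + i p * i p * i p * W3 P i (\a b c -> G (p · a) (p · b) (p · c)))
 W3-step p P i G = trans (cong₂ (\x y -> x + i p * y) (h G) (h (\a -> G (p · a))))
  (id7 (i p) (W3 P i G) (W3 P i (\a b c -> G a (p · b) c)) (W3 P i (\a b c -> G a b (p · c))) (W3 P i (\a b c -> G a (p · b) (p · c)))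
   (W3 P i (\a b c -> G (p · a) b c)) (W3 P i (\a b c -> G (p · a) (p · b) c)) (W3 P i (\a b c -> G (p · a) b (p · c))) (W3 P i (\a b c -> G (p · a) (p · b) (p · c)))) where
  h : ∀ G -> wsum P i (\a -> W2 (p ∷ P) i (G a)) ≡ (W3 P i G + i p * W3 P i (\a b c -> G a (p · b) c)) + i p * (W3 P i (\a b c -> G a b (p · c)) + i p * W3 P i (\a b c -> G a (p · b) (p · c)))
  h G = trans (wsum-cong P (\a -> trans (W2-step p P i (G a)) (id1 (i p) (g₀ a) (gb a) (gc a) (gbc a))))
   (trans (wsum-lin P i (i p) (\a -> g₀ a + i p * gb a) (\a -> gc a + i p * gbc a)) (cong₂ (\x y -> x + i p * y) (wsum-lin P i (i p) g₀ gb) (wsum-lin P i (i p) gc gbc))) where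
   g₀ gb gc gbc : ℕ -> ℚ
   g₀ a = W2 P i (G a)
   gb a = W2 P i (\b c -> G a (p · b) c)
   gc a = W2 P i (\b c -> G a b (p · c))
   gbc a = W2 P i (\b c -> G a (p · b) (p · c))

 W3-nonneg : ∀ P {i : ℕ -> ℚ} {G : ℕ -> ℕ -> ℕ -> ℚ} -> (∀ p -> 0ℚ ≤ i p) -> (∀ a b c -> 0ℚ ≤ G a b c) -> 0ℚ ≤ W3 P i G
 W3-nonneg P hi h = wsum-nonneg P hi (\a -> wsum-nonneg P hi (\b -> wsum-nonneg P hi (h a b)))

 D2≤W2 : ∀ P {κ i : ℕ -> ℚ} {G : ℕ -> ℕ -> ℚ} -> (∀ p -> 0ℚ ≤ κ p) -> (∀ p -> κ p ≤ i p) -> (∀ b c -> 0ℚ ≤ G b c) -> D2 P κ G ≤ W2 P i G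
 D2≤W2 [] hκ h hG = ≤-refl
 D2≤W2 (p ∷ P) {κ} {i} {G} hκ h hG = ≤-trans (+-mono (D2≤W2 P hκ h hG) (*-mono (hκ p) (0≤+ (wn (\b c -> hG (p · b) c)) (wn (\b c -> hG b (p · c)))) (h p)
   (+-mono (D2≤W2 P hκ h (\b c -> hG (p · b) c)) (D2≤W2 P hκ h (\b c -> hG b (p · c))))))
  (≤≡ (≤+ʳ (0≤* (0≤* (hi p) (hi p)) (wn (\b c -> hG (p · b) (p · c))))) (sym (W2-step p P i G))) where
  hi : ∀ p -> 0ℚ ≤ i p
  hi p = ≤-trans (hκ p) (h p)
  wn : ∀ {H : ℕ -> ℕ -> ℚ} -> (∀ b c -> 0ℚ ≤ H b c) -> 0ℚ ≤ W2 P i H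
  wn h = wsum-nonneg P hi (\b -> wsum-nonneg P hi (h b))

 -- The left side is D3 of a function of abc.
 wsum≤W3 : ∀ P {i : ℕ -> ℚ} {f : ℕ -> ℚ} -> (∀ p -> 0ℚ ≤ i p) -> (∀ m -> 0ℚ ≤ f m) ->
  wsum P (\p -> 3ℚ * i p) f ≤ W3 P i (\a b c -> f (a · (b · c)))
 wsum≤W3 [] hi hf = ≤-refl
 wsum≤W3 (p ∷ P) {i} {f} hi hf = ≤-trans (+-mono (wsum≤W3 P hi hf) (≤≡ (*-monoˡ _ (0≤* 0≤3 (hi p)) (wsum≤W3 P hi (\m -> hf (p · m)))) e))
  (≤≡ (≤+ʳ (0≤+ (0≤* (0≤* (hi p) (hi p)) (0≤+ (0≤+ (wn (\a b c -> hf _)) (wn (\a b c -> hf _))) (wn (\a b c -> hf _)))) (0≤* (0≤* (0≤* (hi p) (hi p)) (hi p)) (wn (\a b c -> hf _)))))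
  (sym (W3-step p P i (\a b c -> f (a · (b · c)))))) where
  wn : ∀ {H : ℕ -> ℕ -> ℕ -> ℚ} -> (∀ a b c -> 0ℚ ≤ H a b c) -> 0ℚ ≤ W3 P i H
  wn = W3-nonneg P hi
  cong3 : ∀ {G H : ℕ -> ℕ -> ℕ -> ℚ} -> (∀ a b c -> G a b c ≡ H a b c) -> W3 P i G ≡ W3 P i H
  cong3 h = wsum-cong P (\a -> wsum-cong P (\b -> wsum-cong P (h a b)))
  X = W3 P i (\a b c -> f (p · (a · (b · c))))
  e : 3ℚ * i p * X ≡ i p * (W3 P i (\a b c -> f (p · a · (b · c))) + W3 P i (\a b c -> f (a · (p · b · c))) + W3 P i (\a b c -> f (a · (b · (p · c)))))
  e = trans (id8 (i p) X) (cong (i p *_) (cong₂ _+_ (cong₂ _+_ (cong3 (\a b c -> cong f (sym (N.*-assoc p a (b · c))))) (cong3 (\a b c -> cong f (sym (id2 p a b c))))) (cong3 (\a b c -> cong f (sym (id3 p a b c)))))) where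
   open import Data.Nat.Tactic.RingSolver using () renaming (solve-∀ to solve-ℕ)

 W3-prod : ∀ P i (A B C : ℕ -> ℚ) M -> W3 P i (\a b c -> M * (A a * (B b * C c))) ≡ M * (wsum P i A * (wsum P i B * wsum P i C))
 W3-prod P i A B C M = trans (wsum-cong P (\a -> trans (wsum-cong P (\b -> trans (wsum-cong P (\c -> id9 M (A a) (B b) (C c))) (trans (wsum-*ˡ P i (M * A a * B b) C) (id10 M (A a) (B b) (wsum P i C)))))
  (trans (wsum-*ˡ P i (M * A a * wsum P i C) B) (id11 M (A a) (wsum P i C) (wsum P i B)))))
  (trans (wsum-*ˡ P i (M * (wsum P i B * wsum P i C)) A) (id12 M (wsum P i B * wsum P i C) (wsum P i A)))

 -- The loss in passing from all triples to pairwise coprime ones, with the weight i p lowered to κ p ≥ i p - e p.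
 W3≤D3 : ∀ P (i κ e : ℕ -> ℚ) M (G : ℕ -> ℕ -> ℕ -> ℚ) (A B C : ℕ -> ℚ) -> (∀ p -> 0ℚ ≤ i p) -> (∀ p -> 0ℚ ≤ κ p) -> (∀ p -> 0ℚ ≤ e p) ->
  (∀ p -> κ p ≤ i p) -> (∀ p -> i p ≤ κ p + e p) -> 0ℚ ≤ M ->
  (∀ m -> 0ℚ ≤ A m) -> (∀ m -> 0ℚ ≤ B m) -> (∀ m -> 0ℚ ≤ C m) ->
  (∀ p m -> p ∈ P -> A (p · m) ≤ A m) -> (∀ p m -> p ∈ P -> B (p · m) ≤ B m) -> (∀ p m -> p ∈ P -> C (p · m) ≤ C m) ->
  (∀ a b c -> G a b c ≤ M * (A a * (B b * C c))) ->
  W3 P i G ≤ D3 P κ G + M * ∑ P (\p -> 3ℚ * e p + 3ℚ * (i p * i p) + i p * i p * i p) * (wsum P i A * (wsum P i B * wsum P i C))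
 W3≤D3 [] i κ e M G A B C hi hκ he hκi hie hM hA hB hC dA dB dC hG = ≡⇒≤ (id13 (G 1 1 1) M _)
 W3≤D3 (p ∷ P) i κ e M G A B C hi hκ he hκi hie hM hA hB hC dA dB dC hG = ≡≤ (W3-step p P i G) (≤by δ 0≤δ eq) where
  A1 B1 C1 : ℕ -> ℚ
  A1 = sh p A
  B1 = sh p B
  C1 = sh p C
  ε' ε x y z x1 y1 z1 k κp ep : ℚ
  ε' = ∑ P (\p -> 3ℚ * e p + 3ℚ * (i p * i p) + i p * i p * i p)
  ε = 3ℚ * ep + 3ℚ * (k * k) + k * k * k
  k = i p
  κp = κ p
  ep = e p
  x = wsum P i A
  y = wsum P i B
  z = wsum P i C
  x1 = wsum P i A1
  y1 = wsum P i B1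
  z1 = wsum P i C1
  hx : 0ℚ ≤ x
  hx = wsum-nonneg P hi hA
  hy : 0ℚ ≤ y
  hy = wsum-nonneg P hi hB
  hz : 0ℚ ≤ z
  hz = wsum-nonneg P hi hC
  hx1 : 0ℚ ≤ x1
  hx1 = wsum-nonneg P hi (\m -> hA _)
  hy1 : 0ℚ ≤ y1
  hy1 = wsum-nonneg P hi (\m -> hB _)
  hz1 : 0ℚ ≤ z1
  hz1 = wsum-nonneg P hi (\m -> hC _)
  Ga Gb Gc Gab Gac Gbc Gabc : ℕ -> ℕ -> ℕ -> ℚ
  Ga a b c = G (p · a) b c
  Gb a b c = G a (p · b) c
  Gc a b c = G a b (p · c)
  Gab a b c = G (p · a) (p · b) c
  Gac a b c = G (p · a) b (p · c)
  Gbc a b c = G a (p · b) (p · c)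
  Gabc a b c = G (p · a) (p · b) (p · c)
  ↓A : ∀ m -> A1 m ≤ A m
  ↓A m = dA p m (here refl)
  ↓B : ∀ m -> B1 m ≤ B m
  ↓B m = dB p m (here refl)
  ↓C : ∀ m -> C1 m ≤ C m
  ↓C m = dC p m (here refl)
  dw : (A : ℕ -> ℚ) -> Set
  dw A = ∀ q m -> q ∈ P -> A (q · m) ≤ A m
  dw1 : ∀ {A} -> (∀ q m -> q ∈ p ∷ P -> A (q · m) ≤ A m) -> dw (sh p A)
  dw1 {A} d q m h = ≡≤ (cong A (trans (sym (N.*-assoc p q m)) (trans (cong (N._* m) (*-comm p q)) (N.*-assoc q p m)))) (d q (p · m) (there h))
  dw0 : ∀ {A} -> (∀ q m -> q ∈ p ∷ P -> A (q · m) ≤ A m) -> dw A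
  dw0 d q m h = d q m (there h)
  ih : ∀ G A B C -> (∀ m -> 0ℚ ≤ A m) -> (∀ m -> 0ℚ ≤ B m) -> (∀ m -> 0ℚ ≤ C m) -> dw A -> dw B -> dw C ->
   (∀ a b c -> G a b c ≤ M * (A a * (B b * C c))) -> W3 P i G ≤ D3 P κ G + M * ε' * (wsum P i A * (wsum P i B * wsum P i C))
  ih G A B C hA hB hC dA dB dC = W3≤D3 P i κ e M G A B C hi hκ he hκi hie hM hA hB hC dA dB dC
  Mxyz = M * (x * (y * z))
  h₀ : 0ℚ ≤ D3 P κ G + M * ε' * (x * (y * z)) - W3 P i G
  h₀ = diff (ih G A B C hA hB hC (dw0 dA) (dw0 dB) (dw0 dC) hG)
  ha : 0ℚ ≤ D3 P κ Ga + M * ε' * (x1 * (y * z)) - W3 P i Ga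
  ha = diff (ih Ga A1 B C (\m -> hA _) hB hC (dw1 dA) (dw0 dB) (dw0 dC) (\a -> hG (p · a)))
  hb : 0ℚ ≤ D3 P κ Gb + M * ε' * (x * (y1 * z)) - W3 P i Gb
  hb = diff (ih Gb A B1 C hA (\m -> hB _) hC (dw0 dA) (dw1 dB) (dw0 dC) (\a b -> hG a (p · b)))
  hc : 0ℚ ≤ D3 P κ Gc + M * ε' * (x * (y * z1)) - W3 P i Gc
  hc = diff (ih Gc A B C1 hA hB (\m -> hC _) (dw0 dA) (dw0 dB) (dw1 dC) (\a b c -> hG a b (p · c)))
  lift : ∀ {a a' b b' c c' : ℚ} -> 0ℚ ≤ a -> 0ℚ ≤ b -> 0ℚ ≤ c -> 0ℚ ≤ a' -> 0ℚ ≤ b' -> 0ℚ ≤ c' -> a ≤ a' -> b ≤ b' -> c ≤ c' -> M * (a * (b * c)) ≤ M * (a' * (b' * c'))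
  lift ha hb hc ha' hb' hc' p q r = *-monoˡ M hM (*-mono ha (0≤* hb' hc') p (*-mono hb hc' q r))
  triv : ∀ {H : ℕ -> ℕ -> ℕ -> ℚ} -> (∀ a b c -> H a b c ≤ M * (A a * (B b * C c))) -> 0ℚ ≤ Mxyz - W3 P i H
  triv h = diff (≤≡ (W3-mono P hi h) (W3-prod P i A B C M))
  ta : 0ℚ ≤ Mxyz - W3 P i Ga
  ta = triv (\a b c -> ≤-trans (hG (p · a) b c) (lift (hA _) (hB b) (hC c) (hA a) (hB b) (hC c) (↓A a) ≤-refl ≤-refl))
  tb : 0ℚ ≤ Mxyz - W3 P i Gb
  tb = triv (\a b c -> ≤-trans (hG a (p · b) c) (lift (hA a) (hB _) (hC c) (hA a) (hB b) (hC c) ≤-refl (↓B b) ≤-refl))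
  tc : 0ℚ ≤ Mxyz - W3 P i Gc
  tc = triv (\a b c -> ≤-trans (hG a b (p · c)) (lift (hA a) (hB b) (hC _) (hA a) (hB b) (hC c) ≤-refl ≤-refl (↓C c)))
  tab : 0ℚ ≤ Mxyz - W3 P i Gab
  tab = triv (\a b c -> ≤-trans (hG (p · a) (p · b) c) (lift (hA _) (hB _) (hC c) (hA a) (hB b) (hC c) (↓A a) (↓B b) ≤-refl))
  tac : 0ℚ ≤ Mxyz - W3 P i Gac
  tac = triv (\a b c -> ≤-trans (hG (p · a) b (p · c)) (lift (hA _) (hB b) (hC _) (hA a) (hB b) (hC c) (↓A a) ≤-refl (↓C c)))
  tbc : 0ℚ ≤ Mxyz - W3 P i Gbc
  tbc = triv (\a b c -> ≤-trans (hG a (p · b) (p · c)) (lift (hA a) (hB _) (hC _) (hA a) (hB b) (hC c) ≤-refl (↓B b) (↓C c)))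
  tabc : 0ℚ ≤ Mxyz - W3 P i Gabc
  tabc = triv (\a b c -> ≤-trans (hG (p · a) (p · b) (p · c)) (lift (hA _) (hB _) (hC _) (hA a) (hB b) (hC c) (↓A a) (↓B b) (↓C c)))
  hk : 0ℚ ≤ k
  hk = hi p
  h3e : 0ℚ ≤ ep - (k - κp)
  h3e = ≤≡ (diff (hie p)) (id4 k κp ep)
  hM3 : 0ℚ ≤ Mxyz
  hM3 = 0≤* hM (0≤* hx (0≤* hy hz))
  hMε : 0ℚ ≤ M * ε'
  hMε = 0≤* hM (∑-nonneg P (\q -> 0≤+ (0≤+ (0≤* 0≤3 (he q)) (0≤* 0≤3 (0≤* (hi q) (hi q)))) (0≤* (0≤* (hi q) (hi q)) (hi q))))
  hε : 0ℚ ≤ ε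
  hε = 0≤+ (0≤+ (0≤* 0≤3 (he p)) (0≤* 0≤3 (0≤* hk hk))) (0≤* (0≤* hk hk) hk)
  R = k * (k * (x1 * (y1 * z) + (x1 * (y * z1) + x * (y1 * z1))) + k * (k * (x1 * (y1 * z1))))
  hR : 0ℚ ≤ R
  hR = 0≤* hk (0≤+ (0≤* hk (0≤+ (0≤* hx1 (0≤* hy1 hz)) (0≤+ (0≤* hx1 (0≤* hy hz1)) (0≤* hx (0≤* hy1 hz1))))) (0≤* hk (0≤* hk (0≤* hx1 (0≤* hy1 hz1)))))
  S = k * (x1 * (y * z) + (x * (y1 * z) + x * (y * z1)))
  hS : 0ℚ ≤ S
  hS = 0≤* hk (0≤+ (0≤* hx1 (0≤* hy hz)) (0≤+ (0≤* hx (0≤* hy1 hz)) (0≤* hx (0≤* hy hz1))))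
  d0 = D3 P κ G
  da = D3 P κ Ga
  db = D3 P κ Gb
  dc = D3 P κ Gc
  w0 = W3 P i G
  wa = W3 P i Ga
  wb = W3 P i Gb
  wc = W3 P i Gc
  wab = W3 P i Gab
  wac = W3 P i Gac
  wbc = W3 P i Gbc
  wabc = W3 P i Gabc
  α0 = d0 + M * ε' * (x * (y * z)) - w0
  αa = da + M * ε' * (x1 * (y * z)) - wa
  αb = db + M * ε' * (x * (y1 * z)) - wb
  αc = dc + M * ε' * (x * (y * z1)) - wc
  τa = Mxyz - wa
  τb = Mxyz - wb
  τc = Mxyz - wc
  δ = α0 + κp * (αa + (αb + αc)) + (k - κp) * (τa + (τb + τc)) + k * k * ((Mxyz - wab) + ((Mxyz - wac) + (Mxyz - wbc))) + k * k * k * (Mxyz - wabc)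
   + 3ℚ * Mxyz * (ep - (k - κp)) + (k - κp) * (M * ε' * (x1 * (y * z) + (x * (y1 * z) + x * (y * z1)))) + M * ε' * R + M * ε * (S + R)
  0≤δ : 0ℚ ≤ δ
  0≤δ = 0≤+ (0≤+ (0≤+ (0≤+ (0≤+ (0≤+ (0≤+ (0≤+ h₀ (0≤* (hκ p) (0≤+ ha (0≤+ hb hc)))) (0≤* (diff (hκi p)) (0≤+ ta (0≤+ tb tc))))
    (0≤* (0≤* hk hk) (0≤+ tab (0≤+ tac tbc)))) (0≤* (0≤* (0≤* hk hk) hk) tabc)) (0≤* (0≤* 0≤3 hM3) h3e))
    (0≤* (diff (hκi p)) (0≤* hMε (0≤+ (0≤* hx1 (0≤* hy hz)) (0≤+ (0≤* hx (0≤* hy1 hz)) (0≤* hx (0≤* hy hz1)))))))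
    (0≤* hMε hR)) (0≤* (0≤* hM hε) (0≤+ hS hR))
  eq : w0 + k * (wa + wb + wc) + (k * k * (wab + wac + wbc) + k * k * k * wabc) + δ ≡
   (d0 + κp * (da + db + dc)) + M * (ε + ε') * ((x + k * x1) * ((y + k * y1) * (z + k * z1)))
  eq = id5 M ε' x y z x1 y1 z1 k κp ep d0 da db dc w0 wa wb wc wab wac wbc wabc

module Sieve where

 open Identities
 open Field
 open Sums
 open Forms
 open import Defs using (congᵇ)
 open import Data.Bool using (T)
 open Rationals

 abs+ : ∀ {a b x y} -> ∣ a ∣ ≤ x -> ∣ b ∣ ≤ y -> ∣ a + b ∣ ≤ x + y
 abs+ {a} {b} p q = ≤-trans (abs-tri a b) (+-mono p q)

 absneg : ∀ {a x} -> ∣ a ∣ ≤ x -> ∣ - a ∣ ≤ x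
 absneg {a} p = ≡≤ (∣-p∣≡∣p∣ a) p

 abs** : ∀ {a b x y} -> ∣ a ∣ ≤ x -> ∣ b ∣ ≤ y -> ∣ a * b ∣ ≤ x * y
 abs** {a} {b} p q = ≡≤ (∣p*q∣≡∣p∣*∣q∣ a b) (*-mono (0≤∣p∣ a) (≤-trans (0≤∣p∣ b) q) p q)

 abs∑ : ∀ {A : Set} (xs : List A) (f : A -> ℚ) {y} -> (∀ x -> x ∈ xs -> ∣ f x ∣ ≤ y) -> ∣ ∑ xs f ∣ ≤ ι (length xs) * y
 abs∑ xs f h = ≤-trans (∑-abs xs f) (≤≡ (∑-mono∈ xs h) (∑-const xs _))

 below : ℕ -> ℕ -> ℚ
 below R x = ind (x <ᵇ R)

 below-true : ∀ {R x} -> x N.< R -> below R x ≡ 1ℚ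
 below-true {R} {x} h with x <ᵇ R | <⇒<ᵇ h
 ... | true | _ = refl

 below-anti : ∀ R {x y} -> x ≦ y -> below R y ≤ below R x
 below-anti R {x} {y} h with y <ᵇ R in eq
 ... | false = 0≤ind (x <ᵇ R)
 ... | true = ≡⇒≤ (sym (below-true (≤-<-trans h (<ᵇ⇒< y R (subst T (sym eq) tt)))))

 0≤below : ∀ R x -> 0ℚ ≤ below R x
 0≤below R x = 0≤ind (x <ᵇ R)

 -- Λ(n) = Σ y(m) Π_{p ∣ m} (γ p - χ p n)
 Λ : (γ : ℕ -> ℚ) (χ : ℕ -> ℕ -> ℚ) -> List ℕ -> (ℕ -> ℚ) -> ℕ -> ℚ
 Λ γ χ [] y n = y 1
 Λ γ χ (p ∷ P) y n = Λ γ χ P y n + (γ p - χ p n) * Λ γ χ P (sh p y) n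

 Λ-lin : ∀ γ χ P k a b n -> Λ γ χ P (\m -> a m + k * b m) n ≡ Λ γ χ P a n + k * Λ γ χ P b n
 Λ-lin γ χ [] k a b n = refl
 Λ-lin γ χ (p ∷ P) k a b n = trans (cong₂ (\x y -> x + (γ p - χ p n) * y) (Λ-lin γ χ P k a b n) (Λ-lin γ χ P k (sh p a) (sh p b) n))
  (id27 k (γ p - χ p n) (Λ γ χ P a n) (Λ γ χ P b n) (Λ γ χ P (sh p a) n) (Λ γ χ P (sh p b) n))

 Fresh : List ℕ -> ℕ -> Set
 Fresh [] q = ⊤
 Fresh (p ∷ P) q = Prime p × p ∤ q × Fresh P q × Fresh P (p · q)

 ∏ : List ℕ -> (ℕ -> ℚ) -> ℚ
 ∏ [] f = 1ℚ
 ∏ (p ∷ P) f = f p * ∏ P f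

 ∏-nonneg : ∀ P {f} -> (∀ p -> 0ℚ ≤ f p) -> 0ℚ ≤ ∏ P f
 ∏-nonneg [] h = 0≤1
 ∏-nonneg (p ∷ P) h = 0≤* (h p) (∏-nonneg P h)

 module Main (γ : ℕ -> ℚ) (r : ℕ -> ℚ) (M : ℕ -> ℚ) where
  main : List ℕ -> (u v : ℕ -> ℚ) -> ℕ -> ℚ
  main [] u v q = u 1 * v 1 * M q
  main (p ∷ P) u v q = main P u v q + γ p * (main P u (sh p v) q + main P (sh p u) v q) + γ p * γ p * main P (sh p u) (sh p v) q
   - r p * (main P u (sh p v) (p · q) + main P (sh p u) v (p · q)) + (1ℚ - 2ℚ * γ p) * (r p * main P (sh p u) (sh p v) (p · q))

 9ℚ = 3ℚ * 3ℚ

 module Error (γ : ℕ -> ℚ) (γ≥0 : ∀ p -> 0ℚ ≤ γ p) (Large : ℕ -> Set) (γ≤1 : ∀ p -> Large p -> γ p ≤ 1ℚ)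
  (ns : List ℕ) (res : ℕ -> List ℕ) (res≤3 : ∀ p -> length (res p) ≦ 3)
  (M e : ℕ -> ℚ) (e≥0 : ∀ q -> 0ℚ ≤ e q) (X R s : ℕ) (1≤X : 1 ≦ X) (Adm : ℕ -> ℕ -> Set)
  (crt : ∀ p q a c -> Large p -> Prime p -> p ∤ q -> Adm q a -> c ∈ res p ->
   ∃[ a' ] (Adm (p · q) a' × (∀ n -> n ∈ ns -> ind (congᵇ q n a) * ind (congᵇ p n c) ≡ ind (congᵇ (p · q) n a'))))
  (count : ∀ q a -> Adm q a -> ∣ ∑ ns (\n -> ind (congᵇ q n a)) - M q ∣ ≤ e q) where
  χ : ℕ -> ℕ -> ℚ
  χ p n = ∑ (res p) (\c -> ind (congᵇ p n c))
  r : ℕ -> ℚ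
  r p = ι (length (res p))
  open Main γ r M public
  S : (ℕ -> ℚ) -> List ℕ -> (u v : ℕ -> ℚ) -> ℚ
  S f P u v = ∑ ns (\n -> f n * (Λ γ χ P u n * Λ γ χ P v n))
  e' : ℕ -> ℚ
  e' q = below (X · (R · R)) (q · s) * e q
  0≤e' : ∀ q -> 0ℚ ≤ e' q
  0≤e' q = 0≤* (0≤below (X · (R · R)) (q · s)) (e≥0 q)
  w : List ℕ -> ℕ -> ℚ
  w P q = wsum P (\_ -> 9ℚ) (\d -> e' (q · d))
  Γ : List ℕ -> ℚ
  Γ P = ∏ P (\p -> (1ℚ + γ p) * (1ℚ + γ p))
  private
   1+γ≥0 : ∀ p -> 0ℚ ≤ 1ℚ + γ p
   1+γ≥0 p = 0≤+ 0≤1 (γ≥0 p)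
   Γ≥0 : ∀ P -> 0ℚ ≤ Γ P
   Γ≥0 P = ∏-nonneg P (\p -> 0≤* (1+γ≥0 p) (1+γ≥0 p))
   0≤9 : 0ℚ ≤ 9ℚ
   0≤9 = 0≤* 0≤3 0≤3
   w≥0 : ∀ P q -> 0ℚ ≤ w P q
   w≥0 P q = wsum-nonneg P (\_ -> 0≤9) (\d -> 0≤e' _)
  module _ (U V : ℚ) (U≥0 : 0ℚ ≤ U) (V≥0 : 0ℚ ≤ V) where
   error : ∀ P u v k l q a -> Fresh P q -> (∀ p n -> p ∈ P -> n ∈ ns -> χ p n * χ p n ≡ χ p n) -> (∀ p -> p ∈ P -> Large p) -> Adm q a ->
    (∀ m -> ∣ u m ∣ ≤ U * below R (k · m)) -> (∀ m -> ∣ v m ∣ ≤ V * below R (l · m)) -> q · s ≦ X · (k · l) ->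
    ∣ S (\n -> ind (congᵇ q n a)) P u v - main P u v q ∣ ≤ U * V * Γ P * w P q
   error [] u v k l q a fr χ² lg adm hu hv hq = ≡≤ (cong ∣_∣ (trans (cong (_- u 1 * v 1 * M q) (∑-*ʳ ns (u 1 * v 1) (\n -> ind (congᵇ q n a)))) (id26 (∑ ns (\n -> ind (congᵇ q n a))) (u 1) (v 1) (M q))))
    (≤-trans (abs** (abs** (hu 1) (hv 1)) (count q a adm)) base) where
    cut : below R (k · 1) * below R (l · 1) ≤ below (X · (R · R)) (q · 1 · s)
    cut with k · 1 <ᵇ R in ek | l · 1 <ᵇ R in el
    ... | false | b = ≡≤ (*-zeroˡ (ind b)) (0≤below (X · (R · R)) (q · 1 · s))
    ... | true | false = 0≤below (X · (R · R)) (q · 1 · s)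
    ... | true | true = ≡⇒≤ (sym (below-true (≤-<-trans (subst (\z -> z · s ≦ X · (k · l)) (sym (N.*-identityʳ q)) hq)
     (*-monoʳ-< X {{>-nonZero 1≤X}} (*-mono-< k<R l<R))))) where
     k<R : k N.< R
     k<R = subst (N._< R) (N.*-identityʳ k) (<ᵇ⇒< (k · 1) R (subst T (sym ek) tt))
     l<R : l N.< R
     l<R = subst (N._< R) (N.*-identityʳ l) (<ᵇ⇒< (l · 1) R (subst T (sym el) tt))
    base : U * below R (k · 1) * (V * below R (l · 1)) * e q ≤ U * V * 1ℚ * w [] q
    base = ≡≤ (id17 U V (below R (k · 1)) (below R (l · 1)) (e q))
     (*-monoˡ (U * V * 1ℚ) (0≤* (0≤* U≥0 V≥0) 0≤1) (≤≡ (*-monoʳ (e q) (e≥0 q) cut) (cong (\z -> below (X · (R · R)) (q · 1 · s) * e z) (sym (N.*-identityʳ q)))))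
   error (p ∷ P) u v k l q a (pr , p∤q , fr , fr') χ² lg adm hu hv hq = ≡≤ (cong ∣_∣ split) (≤-trans bound final) where
    f : ℕ -> ℚ
    f n = ind (congᵇ q n a)
    g : ℕ -> ℕ -> ℚ
    g c n = f n * ind (congᵇ p n c)
    u1 v1 : ℕ -> ℚ
    u1 = sh p u
    v1 = sh p v
    cs = res p
    C = U * V * Γ P
    0≤C : 0ℚ ≤ C
    0≤C = 0≤* (0≤* U≥0 V≥0) (Γ≥0 P)
    χ²' : ∀ q n -> q ∈ P -> n ∈ ns -> χ q n * χ q n ≡ χ q n
    χ²' q n m = χ² q n (there m)
    lg' : ∀ q -> q ∈ P -> Large q
    lg' q m = lg q (there m)
    1≤p : 1 ≦ p
    1≤p = n≢0⇒n>0 (λ { refl -> Data.Nat.Primality.¬prime[0] pr })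
    hu1 : ∀ m -> ∣ u1 m ∣ ≤ U * below R (k · m)
    hu1 m = ≤-trans (hu (p · m)) (*-monoˡ U U≥0 (below-anti R (*-monoʳ-≤ k (m≤n*m m p {{>-nonZero 1≤p}}))))
    hv1 : ∀ m -> ∣ v1 m ∣ ≤ V * below R (l · m)
    hv1 m = ≤-trans (hv (p · m)) (*-monoˡ V V≥0 (below-anti R (*-monoʳ-≤ l (m≤n*m m p {{>-nonZero 1≤p}}))))
    hu2 : ∀ m -> ∣ u1 m ∣ ≤ U * below R (k · p · m)
    hu2 m = subst (\z -> ∣ u1 m ∣ ≤ U * below R z) (sym (N.*-assoc k p m)) (hu (p · m))
    hv2 : ∀ m -> ∣ v1 m ∣ ≤ V * below R (l · p · m)
    hv2 m = subst (\z -> ∣ v1 m ∣ ≤ V * below R z) (sym (N.*-assoc l p m)) (hv (p · m))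
    E : (u v : ℕ -> ℚ) -> ℚ
    E u v = S f P u v - main P u v q
    E' : ℕ -> (u v : ℕ -> ℚ) -> ℚ
    E' c u v = S (g c) P u v - main P u v (p · q)
    b0 : ∀ u v -> (∀ m -> ∣ u m ∣ ≤ U * below R (k · m)) -> (∀ m -> ∣ v m ∣ ≤ V * below R (l · m)) -> ∣ E u v ∣ ≤ C * w P q
    b0 u v hu hv = error P u v k l q a fr χ²' lg' adm hu hv hq
    b1 : ∀ c -> c ∈ cs -> ∀ u v k' l' -> (∀ m -> ∣ u m ∣ ≤ U * below R (k' · m)) -> (∀ m -> ∣ v m ∣ ≤ V * below R (l' · m)) -> p · (k · l) ≦ k' · l' -> ∣ E' c u v ∣ ≤ C * w P (p · q)
    b1 c c∈ u v k' l' hu hv h with crt p q a c (lg p (here refl)) pr p∤q adm c∈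
    ... | a' , adm' , eq = ≡≤ (cong (\z -> ∣ z - main P u v (p · q) ∣) (∑-cong∈ ns (\n n∈ -> cong (_* (Λ γ χ P u n * Λ γ χ P v n)) (eq n n∈))))
     (error P u v k' l' (p · q) a' fr' χ²' lg' adm' hu hv (≡≤ℕ (N.*-assoc p q s) (≦-trans (*-monoʳ-≤ p hq) (≡≤ℕ (id18 p X (k · l)) (*-monoʳ-≤ X h)))))
    h01 : p · (k · l) ≦ k · (l · p)
    h01 = N.≤-reflexive (id19 p k l)
    h10 : p · (k · l) ≦ (k · p) · l
    h10 = N.≤-reflexive (id20 p k l)
    h11 : p · (k · l) ≦ (k · p) · (l · p)
    h11 = ≦-trans h10 (*-monoʳ-≤ (k · p) (m≤m*n l p {{>-nonZero 1≤p}}))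
    F1 F2 F3 : ℕ -> ℚ
    F1 c = E' c u v1
    F2 c = E' c u1 v
    F3 c = E' c u1 v1
    split : S f (p ∷ P) u v - main (p ∷ P) u v q ≡
     (E u v + γ p * (E u v1 + E u1 v) + γ p * γ p * E u1 v1) + (- (∑ cs F1 + ∑ cs F2) + (1ℚ - 2ℚ * γ p) * ∑ cs F3)
    split = trans (cong (_- main (p ∷ P) u v q) SS)
     (trans (id21 (γ p) (r p) (S f P u v) (S f P u v1) (S f P u1 v) (S f P u1 v1) (∑ cs (\c -> S (g c) P u v1)) (∑ cs (\c -> S (g c) P u1 v)) (∑ cs (\c -> S (g c) P u1 v1))
       (main P u v q) (main P u v1 q) (main P u1 v q) (main P u1 v1 q) (main P u v1 (p · q)) (main P u1 v (p · q)) (main P u1 v1 (p · q)))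
      (cong (\z -> (E u v + γ p * (E u v1 + E u1 v) + γ p * γ p * E u1 v1) + z) (cong₂ (\x y -> - x + (1ℚ - 2ℚ * γ p) * y) (cong₂ _+_ (sym (sumE u v1)) (sym (sumE u1 v))) (sym (sumE u1 v1))))) where
     sumE : ∀ u v -> ∑ cs (\c -> E' c u v) ≡ ∑ cs (\c -> S (g c) P u v) - r p * main P u v (p · q)
     sumE u v = trans (∑-- cs (\c -> S (g c) P u v) (\_ -> main P u v (p · q))) (cong (\z -> ∑ cs (\c -> S (g c) P u v) - z) (∑-const cs (main P u v (p · q))))
     L : (ℕ -> ℚ) -> ℕ -> ℚ
     L = Λ γ χ P
     ff : (u v : ℕ -> ℚ) -> ℕ -> ℚ
     ff u v n = f n * (L u n * L v n)
     gg : (u v : ℕ -> ℚ) -> ℕ -> ℚ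
     gg u v n = χ p n * ff u v n
     pt : ∀ n -> n ∈ ns -> f n * (Λ γ χ (p ∷ P) u n * Λ γ χ (p ∷ P) v n) ≡
      ff u v n + γ p * (ff u v1 n + ff u1 v n) + γ p * γ p * ff u1 v1 n + (- (gg u v1 n + gg u1 v n) + (1ℚ - 2ℚ * γ p) * gg u1 v1 n)
     pt n n∈ = trans (id14 (f n) (γ p) (χ p n) (L u n) (L u1 n) (L v n) (L v1 n))
      (trans (cong (\z -> f n * (L u n * L v n) + γ p * (f n * (L u n * L v1 n) + f n * (L u1 n * L v n)) + γ p * γ p * (f n * (L u1 n * L v1 n)) + (- (χ p n * (f n * (L u n * L v1 n)) + χ p n * (f n * (L u1 n * L v n))) + (z - 2ℚ * γ p * χ p n) * (f n * (L u1 n * L v1 n)))) (χ² p n (here refl) n∈))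
      (id15 (f n) (γ p) (χ p n) (L u n) (L u1 n) (L v n) (L v1 n)))
     ∑gg : ∀ u v -> ∑ ns (gg u v) ≡ ∑ cs (\c -> S (g c) P u v)
     ∑gg u v = trans (∑-cong ns (\n -> trans (sym (∑-*ʳ cs (ff u v n) (\c -> ind (congᵇ p n c)))) (∑-cong cs (\c -> id16 (ind (congᵇ p n c)) (f n) (L u n * L v n)))))
      (∑-swap ns cs (\n c -> g c n * (L u n * L v n)))
     SS : S f (p ∷ P) u v ≡ S f P u v + γ p * (S f P u v1 + S f P u1 v) + γ p * γ p * S f P u1 v1 + (- (∑ cs (\c -> S (g c) P u v1) + ∑ cs (\c -> S (g c) P u1 v)) + (1ℚ - 2ℚ * γ p) * ∑ cs (\c -> S (g c) P u1 v1))
     SS = trans (∑-cong∈ ns pt) (trans (∑-+ ns _ _) (cong₂ _+_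
      (trans (∑-+ ns _ _) (cong₂ _+_ (trans (∑-+ ns _ _) (cong (S f P u v +_) (trans (∑-*ˡ ns (γ p) _) (cong (γ p *_) (∑-+ ns (ff u v1) (ff u1 v)))))) (∑-*ˡ ns (γ p * γ p) (ff u1 v1))))
      (trans (∑-+ ns _ _) (cong₂ _+_ (trans (∑-neg ns _) (cong -_ (trans (∑-+ ns (gg u v1) (gg u1 v)) (cong₂ _+_ (∑gg u v1) (∑gg u1 v))))) (trans (∑-*ˡ ns (1ℚ - 2ℚ * γ p) (gg u1 v1)) (cong ((1ℚ - 2ℚ * γ p) *_) (∑gg u1 v1)))))))
    γp = γ p
    x = C * w P q
    y = C * w P (p · q)
    0≤y : 0ℚ ≤ y
    0≤y = 0≤* 0≤C (w≥0 P (p · q))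
    abs1 : ∣ 1ℚ - 2ℚ * γp ∣ ≤ 1ℚ
    abs1 = abs≤ (≤by (2ℚ * (1ℚ - γp)) (0≤* 0≤2 (diff (γ≤1 p (lg p (here refl))))) (id22 γp)) (≤by (2ℚ * γp) (0≤* 0≤2 (γ≥0 p)) (id23 γp))
    bound : ∣ (E u v + γp * (E u v1 + E u1 v) + γp * γp * E u1 v1) + (- (∑ cs F1 + ∑ cs F2) + (1ℚ - 2ℚ * γp) * ∑ cs F3) ∣ ≤
     (x + γp * (x + x) + γp * γp * x) + ((r p * y + r p * y) + 1ℚ * (r p * y))
    bound = abs+ (abs+ (abs+ (b0 u v hu hv) (abs* (γ≥0 p) (abs+ (b0 u v1 hu hv1) (b0 u1 v hu1 hv)))) (abs* (0≤* (γ≥0 p) (γ≥0 p)) (b0 u1 v1 hu1 hv1)))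
     (abs+ (absneg (abs+ (abs∑ cs F1 (\c c∈ -> b1 c c∈ u v1 k (l · p) hu hv2 h01)) (abs∑ cs F2 (\c c∈ -> b1 c c∈ u1 v (k · p) l hu2 hv h10))))
      (abs** abs1 (abs∑ cs F3 (\c c∈ -> b1 c c∈ u1 v1 (k · p) (l · p) hu2 hv2 h11))))
    r≤3 : r p ≤ 3ℚ
    r≤3 = ≤≡ (ι-mono (res≤3 p)) (ι-def 3)
    W1 = wsum P (\_ -> 9ℚ) (sh p (\d -> e' (q · d)))
    wW : w P (p · q) ≡ W1
    wW = wsum-cong P (\d -> cong e' (id24 p q d))
    final : (x + γp * (x + x) + γp * γp * x) + ((r p * y + r p * y) + 1ℚ * (r p * y)) ≤ U * V * Γ (p ∷ P) * (w P q + 9ℚ * W1)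
    final = ≤by (3ℚ * (3ℚ - r p) * y + 9ℚ * (γp * (1ℚ + 1ℚ + γp)) * y) (0≤+ (0≤* (0≤* 0≤3 (diff r≤3)) 0≤y) (0≤* (0≤* 0≤9 (0≤* (γ≥0 p) (0≤+ 0≤2 (γ≥0 p)))) 0≤y))
     (trans (id25 U V (Γ P) γp (r p) (w P q) (w P (p · q))) (cong (\z -> U * V * Γ (p ∷ P) * (w P q + 9ℚ * z)) wW))

module MainForm where

 open Identities
 open Field
 open Sums
 open Forms
 open Sieve
 open Rationals

 -- mean and second moment of γ p - χ p when χ p has mean α
 mean moment : (γ α : ℕ -> ℚ) -> ℕ -> ℚ
 mean γ α p = γ p - α p
 moment γ α p = γ p * γ p + (1ℚ - 2ℚ * γ p) * α p

 variance : ∀ γ α p -> moment γ α p - mean γ α p * mean γ α p ≡ α p * (1ℚ - α p)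
 variance γ α p = id30 (γ p) (α p)

 main-Form : ∀ (γ r M ρ : ℕ -> ℚ) P u v q -> Fresh P q -> (∀ p q -> p ∈ P -> Prime p -> p ∤ q -> M (p · q) ≡ ρ p * M q) ->
  Main.main γ r M P u v q ≡ M q * Form P (mean γ (\p -> r p * ρ p)) (moment γ (\p -> r p * ρ p)) u v
 main-Form γ r M ρ [] u v q fr h = ℚ.*-comm (u 1 * v 1) (M q)
 main-Form γ r M ρ (p ∷ P) u v q (pr , p∤q , fr , fr') h
  = trans (cong₂ (\a b -> a + (1ℚ - 2ℚ * γ p) * (r p * b)) (cong₂ (\a b -> a - r p * b) (cong₂ (\a b -> a + γ p * γ p * b) (cong₂ (\a b -> a + γ p * b) (ih u v) (cong₂ _+_ (ih u v1) (ih u1 v))) (ih u1 v1)) (cong₂ _+_ (ih' u v1) (ih' u1 v))) (ih' u1 v1))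
  (id31 (γ p) (r p) (ρ p) (M q) (F u v) (F u (sh p v)) (F (sh p u) v) (F (sh p u) (sh p v))) where
  u1 v1 : ℕ -> ℚ
  u1 = sh p u
  v1 = sh p v
  F : (u v : ℕ -> ℚ) -> ℚ
  F = Form P (mean γ (\p -> r p * ρ p)) (moment γ (\p -> r p * ρ p))
  h' : ∀ p q -> p ∈ P -> Prime p -> p ∤ q -> M (p · q) ≡ ρ p * M q
  h' p q m = h p q (there m)
  ih : ∀ u v -> Main.main γ r M P u v q ≡ M q * F u v
  ih u v = main-Form γ r M ρ P u v q fr h'
  ih' : ∀ u v -> Main.main γ r M P u v (p · q) ≡ ρ p * M q * F u v
  ih' u v = trans (main-Form γ r M ρ P u v (p · q) fr' h') (cong (_* F u v) (h p q (here refl) pr p∤q))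

 main-∑ : ∀ {J : Set} (γ r : ℕ -> ℚ) (js : List J) (M : J -> ℕ -> ℚ) P u v q ->
  Main.main γ r (\q -> ∑ js (\j -> M j q)) P u v q ≡ ∑ js (\j -> Main.main γ r (M j) P u v q)
 main-∑ γ r [] M [] u v q = *-zeroʳ (u 1 * v 1)
 main-∑ γ r (j ∷ js) M [] u v q = trans (*-distribˡ-+ (u 1 * v 1) (M j q) _) (cong (u 1 * v 1 * M j q +_) (main-∑ γ r js M [] u v q))
 main-∑ γ r js M (p ∷ P) u v q = trans (cong₂ (\a b -> a + (1ℚ - 2ℚ * γ p) * (r p * b)) (cong₂ (\a b -> a - r p * b) (cong₂ (\a b -> a + γ p * γ p * b) (cong₂ (\a b -> a + γ p * b) (ih u v) (cong₂ _+_ (ih u v1) (ih u1 v))) (ih u1 v1)) (cong₂ _+_ (ih' u v1) (ih' u1 v))) (ih' u1 v1))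
  (step js) where
  u1 v1 : ℕ -> ℚ
  u1 = sh p u
  v1 = sh p v
  ih : ∀ u v -> Main.main γ r (\q -> ∑ js (\j -> M j q)) P u v q ≡ ∑ js (\j -> Main.main γ r (M j) P u v q)
  ih u v = main-∑ γ r js M P u v q
  ih' : ∀ u v -> Main.main γ r (\q -> ∑ js (\j -> M j q)) P u v (p · q) ≡ ∑ js (\j -> Main.main γ r (M j) P u v (p · q))
  ih' u v = main-∑ γ r js M P u v (p · q)
  m : ∀ u v q j -> ℚ
  m u v q j = Main.main γ r (M j) P u v q
  step : ∀ js -> ∑ js (m u v q) + γ p * (∑ js (m u v1 q) + ∑ js (m u1 v q)) + γ p * γ p * ∑ js (m u1 v1 q)
   - r p * (∑ js (m u v1 (p · q)) + ∑ js (m u1 v (p · q))) + (1ℚ - 2ℚ * γ p) * (r p * ∑ js (m u1 v1 (p · q)))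
   ≡ ∑ js (\j -> Main.main γ r (M j) (p ∷ P) u v q)
  step [] = id28 (γ p) (r p)
  step (j ∷ js) = trans (id29 (γ p) (r p) (m u v q j) (m u v1 q j) (m u1 v q j) (m u1 v1 q j) (m u v1 (p · q) j) (m u1 v (p · q) j) (m u1 v1 (p · q) j)
    (∑ js (m u v q)) (∑ js (m u v1 q)) (∑ js (m u1 v q)) (∑ js (m u1 v1 q)) (∑ js (m u v1 (p · q))) (∑ js (m u1 v (p · q))) (∑ js (m u1 v1 (p · q))))
   (cong (Main.main γ r (M j) (p ∷ P) u v q +_) (step js))

module Smooth where

 open Identities
 open Field
 open Sums
 open Forms
 open import Defs using (range; divides)
 open Rationals

 divides-true : ∀ {d n} -> d ∣ n -> divides d n ≡ true
 divides-true {d} {n} h = dec-true (d ∣? n) h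

 divides-false : ∀ {d n} -> ¬ d ∣ n -> divides d n ≡ false
 divides-false {d} {n} h = dec-false (d ∣? n) h

 divides⇒∣ : ∀ d n -> divides d n ≡ true -> d ∣ n
 divides⇒∣ d n e with d ∣? n
 ... | yes h = h

 prime-∣-prime : ∀ {p q} -> Prime p -> Prime q -> q ∣ p -> q ≡ p
 prime-∣-prime pp pq h with prime⇒irreducible pp h
 ... | inj₁ refl = contradiction pq ¬prime[1]
 ... | inj₂ e = e

 1≤prime : ∀ {p} -> Prime p -> 1 ≦ p
 1≤prime {zero} pr = contradiction pr ¬prime[0]
 1≤prime {suc _} pr = s≤s z≤n

 ∑-multiples' : ∀ p X (F : ℕ -> ℚ) -> 1 ≦ p -> ∑ (range 0 (p · X)) (\m -> ind (divides p m) * F m) ≡ ∑ (range 0 X) (\m -> F (p · m))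
 ∑-multiples' p X F 1≤p = trans (cong (\z -> ∑ (range z (p · X)) G) (sym (N.*-zeroʳ p))) (trans (∑-blocks p 0 X G) (∑-cong (range 0 X) block)) where
  G : ℕ -> ℚ
  G m = ind (divides p m) * F m
  block : ∀ i -> ∑ (range 0 p) (\r -> G (p · i N.+ r)) ≡ F (p · i)
  block i = trans (∑-range-split 0 1 p (\r -> G (p · i N.+ r)) z≤n 1≤p) (trans (cong₂ _+_ (trans (+-idʳ _) fst) rest) (+-idʳ _)) where
   fst : G (p · i N.+ 0) ≡ F (p · i)
   fst = trans (cong G (N.+-identityʳ (p · i))) (trans (cong (\b -> ind b * F (p · i)) (divides-true {p} {p · i} (ℕ∣.m∣m*n i))) (*-idˡ _))
   rest : ∑ (range 1 p) (\r -> G (p · i N.+ r)) ≡ 0ℚ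
   rest = trans (∑-cong∈ (range 1 p) (\r r∈ -> trans (cong (\b -> ind b * F (p · i N.+ r)) (divides-false {p} {p · i N.+ r} (nd r r∈))) (*-zeroˡ (F (p · i N.+ r))))) (∑-0 (range 1 p)) where
    nd : ∀ r -> r ∈ range 1 p -> ¬ p ∣ p · i N.+ r
    nd r r∈ d = ℕ∣.>⇒∤ {{>-nonZero (proj₁ (∈-range⁻ {1} {p} r∈))}} (proj₂ (∈-range⁻ {1} {p} r∈)) (ℕ∣.∣m+n∣m⇒∣n d (ℕ∣.m∣m*n i))

 ∑-multiples : ∀ p X (F : ℕ -> ℚ) -> 1 ≦ p -> (∀ m -> X ≦ m -> F m ≡ 0ℚ) ->
  ∑ (range 0 X) (\m -> ind (divides p m) * F m) ≡ ∑ (range 0 X) (\m -> F (p · m))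
 ∑-multiples p X F 1≤p F0 = begin
  ∑ (range 0 X) G                                       ≡⟨ +-idʳ _ ⟨
  ∑ (range 0 X) G + 0ℚ                                  ≡⟨ cong (∑ (range 0 X) G +_) (sym tail) ⟩
  ∑ (range 0 X) G + ∑ (range X (p · X)) G             ≡⟨ ∑-range-split 0 X (p · X) G z≤n (m≤n*m X p {{>-nonZero 1≤p}}) ⟨
  ∑ (range 0 (p · X)) G                               ≡⟨ ∑-multiples' p X F 1≤p ⟩
  ∑ (range 0 X) (\m -> F (p · m)) ∎ where
  open ≡-Reasoning
  G : ℕ -> ℚ
  G m = ind (divides p m) * F m
  tail : ∑ (range X (p · X)) G ≡ 0ℚ
  tail = trans (∑-cong∈ (range X (p · X)) (\m m∈ -> trans (cong (ind (divides p m) *_) (F0 m (proj₁ (∈-range⁻ {X} {p · X} m∈)))) (*-zeroʳ (ind (divides p m))))) (∑-0 (range X (p · X)))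

 cop : List ℕ -> ℕ -> Bool
 cop [] m = true
 cop (q ∷ Q) m = not (divides q m) ∧ cop Q m

 cop-1 : ∀ Q -> (∀ q -> q ∈ Q -> Prime q) -> cop Q 1 ≡ true
 cop-1 [] h = refl
 cop-1 (q ∷ Q) h rewrite divides-false {q} {1} (\d -> ¬prime[1] (subst Prime (ℕ∣.∣1⇒≡1 d) (h q (here refl)))) = cop-1 Q (\p m -> h p (there m))

 cop-* : ∀ Q p m -> Prime p -> (∀ q -> q ∈ Q -> Prime q × q ≢ p) -> cop Q (p · m) ≡ cop Q m
 cop-* [] p m pp h = refl
 cop-* (q ∷ Q) p m pp h = cong₂ (\a b -> not a ∧ b) eq (cop-* Q p m pp (\r m -> h r (there m))) where
  eq : divides q (p · m) ≡ divides q m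
  eq with q ∣? m
  ... | yes d = divides-true (ℕ∣.∣n⇒∣m*n p d)
  ... | no nd = divides-false (\d -> [ (\d' -> proj₂ (h q (here refl)) (prime-∣-prime pp (proj₁ (h q (here refl))) d')) , nd ]′ (euclidsLemma p m (proj₁ (h q (here refl))) d))

 cop-false : ∀ Q q m -> q ∈ Q -> q ∣ m -> cop Q m ≡ false
 cop-false (q ∷ Q) q m (here refl) d rewrite divides-true d = refl
 cop-false (q' ∷ Q) q m (there q∈) d with divides q' m
 ... | true = refl
 ... | false = cop-false Q q m q∈ d

 Distinct : List ℕ -> List ℕ -> Set
 Distinct [] Q = ∀ q -> q ∈ Q -> Prime q
 Distinct (p ∷ P) Q = Prime p × (∀ q -> q ∈ Q -> Prime q × q ≢ p) × Distinct P (p ∷ Q)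

 module _ (X : ℕ) (1<X : 1 N.< X) where
  N : List ℕ -> (ℕ -> ℚ) -> ℚ
  N Q f = ∑ (range 0 X) (\m -> ind (cop Q m) * (inv m * f m))
  Supp : (ℕ -> ℚ) -> Set
  Supp f = ∀ m -> X ≦ m -> f m ≡ 0ℚ
  Supp-sh : ∀ {p f} -> 1 ≦ p -> Supp f -> Supp (sh p f)
  Supp-sh {p} h s m X≤m = s (p · m) (≦-trans X≤m (m≤n*m m p {{>-nonZero h}}))
  N-mono : ∀ Q {f g} -> (∀ m -> f m ≤ g m) -> N Q f ≤ N Q g
  N-mono Q h = ∑-mono (range 0 X) (\m -> *-monoˡ _ (0≤ind (cop Q m)) (*-monoˡ _ (0≤inv m) (h m)))
  N-*ˡ : ∀ Q k f -> N Q (\m -> k * f m) ≡ k * N Q f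
  N-*ˡ Q k f = trans (∑-cong (range 0 X) (\m -> id36 (ind (cop Q m)) (inv m) k (f m))) (∑-*ˡ (range 0 X) k _)
  N-anti : ∀ p Q {f} -> (∀ m -> 0ℚ ≤ f m) -> N (p ∷ Q) f ≤ N Q f
  N-anti p Q h = ∑-mono (range 0 X) (\m -> *-monoʳ _ (0≤* (0≤inv m) (h m)) (le (divides p m) (cop Q m))) where
   le : ∀ a b -> ind (not a ∧ b) ≤ ind b
   le true b = 0≤ind b
   le false b = ≤-refl
  N-step : ∀ p Q f -> Prime p -> (∀ q -> q ∈ Q -> Prime q × q ≢ p) -> Supp f -> N Q f ≡ N (p ∷ Q) f + inv p * N Q (sh p f)
  N-step p Q f pp h s = trans (∑-cong (range 0 X) (\m -> sp (divides p m) (cop Q m) (inv m * f m)))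
   (trans (∑-+ (range 0 X) _ _) (cong (N (p ∷ Q) f +_) (trans (∑-multiples p X (\m -> ind (cop Q m) * (inv m * f m)) (1≤prime pp) (\m hm -> trans (cong (\z -> ind (cop Q m) * (inv m * z)) (s m hm)) (id37 (ind (cop Q m)) (inv m))))
    (trans (∑-cong (range 0 X) (\m -> trans (cong₂ (\a b -> ind a * (b * f (p · m))) (cop-* Q p m pp h) (inv-* p m)) (id38 (ind (cop Q m)) (inv p) (inv m) (f (p · m))))) (∑-*ˡ (range 0 X) (inv p) _))))) where
   sp : ∀ a b x -> ind b * x ≡ ind (not a ∧ b) * x + ind a * (ind b * x)
   sp true b x = id32 (ind b) x
   sp false b x = id33 (ind b) x
  wsum≤N : ∀ P Q f -> Distinct P Q -> Supp f -> (∀ m -> 0ℚ ≤ f m) -> wsum P inv f ≤ N Q f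
  wsum≤N [] Q f d s hf = ≡≤ (sym t1) (∑-≥-term {xs = range 0 X} {f = \m -> ind (cop Q m) * (inv m * f m)} (\m _ -> 0≤* (0≤ind (cop Q m)) (0≤* (0≤inv m) (hf m))) (∈-range⁺ {0} {X} {1} z≤n 1<X)) where
   inv1 : inv 1 ≡ 1ℚ
   inv1 = trans (sym (*-idˡ (inv 1))) (trans (cong (_* inv 1) (sym (ι-def 1))) (*-inv 1 N.≤-refl))
   t1 : ind (cop Q 1) * (inv 1 * f 1) ≡ f 1
   t1 = trans (cong₂ (\a b -> ind a * (b * f 1)) (cop-1 Q d) inv1) (trans (*-idˡ _) (*-idˡ (f 1)))
  wsum≤N (p ∷ P) Q f (pp , h , d) s hf = ≤≡ (+-mono (wsum≤N P (p ∷ Q) f d s hf)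
    (*-monoˡ (inv p) (0≤inv p) (≤-trans (wsum≤N P (p ∷ Q) (sh p f) d (Supp-sh (1≤prime pp) s) (\m -> hf _)) (N-anti p Q (\m -> hf _)))))
   (sym (N-step p Q f pp h s))
  N≤wsum : ∀ P Q f A M -> Distinct P Q -> (∀ m -> 1 N.< m -> m N.< X -> ∃[ q ] (q ∣ m × (q ∈ P ⊎ q ∈ Q))) ->
   Supp f -> Supp A -> (∀ m -> 0ℚ ≤ f m) -> (∀ m -> 0ℚ ≤ A m) -> 0ℚ ≤ M -> (∀ p m -> p ∈ P -> A (p · m) ≤ A m) -> (∀ m -> f m ≤ M * A m) ->
   N Q f ≤ wsum P inv f + M * ∑ P (\p -> inv p * inv p) * N Q A
  N≤wsum [] Q f A M d cov s sA hf hA hM anti le = ≤≡ only1 (sym (id39 (f 1) M (N Q A))) where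
   inv1 : inv 1 ≡ 1ℚ
   inv1 = trans (sym (*-idˡ (inv 1))) (trans (cong (_* inv 1) (sym (ι-def 1))) (*-inv 1 N.≤-refl))
   F : ℕ -> ℚ
   F m = ind (cop Q m) * (inv m * f m)
   F0 : F 0 ≡ 0ℚ
   F0 = trans (cong (\z -> ind (cop Q 0) * (z * f 0)) inv-0) (id34 (ind (cop Q 0)) (f 0))
   big : ∑ (range 2 X) F ≡ 0ℚ
   big = trans (∑-cong∈ (range 2 X) (\m m∈ -> F≡0 m (∈-range⁻ {2} {X} m∈))) (∑-0 (range 2 X)) where
    F≡0 : ∀ m -> 2 ≦ m × m N.< X -> F m ≡ 0ℚ
    F≡0 m (h1 , h2) with cov m h1 h2
    ... | q , q∣m , inj₂ q∈ = trans (cong (\b -> ind b * (inv m * f m)) (cop-false Q q m q∈ q∣m)) (*-zeroˡ (inv m * f m))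
   only1 : N Q f ≤ f 1
   only1 = ≡≤ (trans (∑-range-split 0 2 X F z≤n 1<X) (trans (cong₂ _+_ (cong₂ _+_ F0 (+-idʳ (F 1))) big) (id35 (F 1))))
    (≤≡ (*-monoʳ (inv 1 * f 1) (0≤* (0≤inv 1) (hf 1)) (ind≤1 (cop Q 1))) (trans (*-idˡ _) (trans (cong (_* f 1) inv1) (*-idˡ (f 1)))))
  N≤wsum (p ∷ P) Q f A M (pp , h , d) cov s sA hf hA hM anti le = ≡≤ st
   (≤by (α0 + k * α1 + k * k * α2 + M * ε' * α3) (0≤+ (0≤+ (0≤+ h₀ (0≤* hk h1)) (0≤* (0≤* hk hk) h2)) (0≤* hMε h3))
    (id40 k M ε' (N Q' f) (N Q' f1) (N Q f2) (wsum P inv f) (wsum P inv f1) (N Q' A) (N Q' A1) (N Q A))) where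
   Q' = p ∷ Q
   f1 f2 A1 : ℕ -> ℚ
   f1 = sh p f
   f2 = sh p f1
   A1 = sh p A
   k = inv p
   ε' = ∑ P (\p -> inv p * inv p)
   hk : 0ℚ ≤ k
   hk = 0≤inv p
   1≤p : 1 ≦ p
   1≤p = 1≤prime pp
   hMε : 0ℚ ≤ M * ε'
   hMε = 0≤* hM (∑-nonneg P (\q -> 0≤* (0≤inv q) (0≤inv q)))
   st : N Q f ≡ N Q' f + k * (N Q' f1 + k * N Q f2)
   st = trans (N-step p Q f pp h s) (cong (\z -> N Q' f + k * z) (N-step p Q f1 pp h (Supp-sh 1≤p s)))
   cov' : ∀ m -> 1 N.< m -> m N.< X -> ∃[ q ] (q ∣ m × (q ∈ P ⊎ q ∈ Q'))
   cov' m a b with cov m a b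
   ... | q , dv , inj₁ (here refl) = q , dv , inj₂ (here refl)
   ... | q , dv , inj₁ (there x) = q , dv , inj₁ x
   ... | q , dv , inj₂ x = q , dv , inj₂ (there x)
   anti' : ∀ q m -> q ∈ P -> A (q · m) ≤ A m
   anti' q m x = anti q m (there x)
   anti1 : ∀ q m -> q ∈ P -> A1 (q · m) ≤ A1 m
   anti1 q m x = ≡≤ (cong A (trans (sym (N.*-assoc p q m)) (trans (cong (N._* m) (*-comm p q)) (N.*-assoc q p m)))) (anti q (p · m) (there x))
   α0 = wsum P inv f + M * ε' * N Q' A - N Q' f
   α1 = wsum P inv f1 + M * ε' * N Q' A1 - N Q' f1
   α2 = M * N Q A - N Q f2
   α3 = N Q A - (N Q' A + k * N Q' A1)
   h₀ : 0ℚ ≤ α0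
   h₀ = diff (N≤wsum P Q' f A M d cov' s sA hf hA hM anti' le)
   h1 : 0ℚ ≤ α1
   h1 = diff (N≤wsum P Q' f1 A1 M d cov' (Supp-sh 1≤p s) (Supp-sh 1≤p sA) (\m -> hf _) (\m -> hA _) hM anti1 (\m -> le (p · m)))
   h2 : 0ℚ ≤ α2
   h2 = diff (≤≡ (N-mono Q (\m -> ≤-trans (le (p · (p · m))) (*-monoˡ M hM (≤-trans (anti p (p · m) (here refl)) (anti p m (here refl)))))) (N-*ˡ Q M A))
   h3 : 0ℚ ≤ α3
   h3 = diff (≤≡ (+-monoʳ-≤ (N Q' A) (*-monoˡ k hk (N-anti p Q (\m -> hA _)))) (sym (N-step p Q A pp h sA)))

module Cheb where

 open Rationals using (≡≤ℕ; ≤≡ℕ)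
 open Sums using (∈-range⁻; ∈-range⁺; range-++; length-range)
 open Smooth using (prime-∣-prime; 1≤prime)
 open import Defs using (range; isPrimeᵇ)
 open import Data.Bool using (T)
 open import Data.Nat
 open import Data.Nat.Properties
 open import Data.Nat.Divisibility
 open import Data.Nat.Combinatorics using (_C_)

 ∏ℕ : {A : Set} -> List A -> (A -> ℕ) -> ℕ
 ∏ℕ [] f = 1
 ∏ℕ (p ∷ ps) f = f p * ∏ℕ ps f

 ∏ℕ-++ : ∀ {A : Set} (ps qs : List A) f -> ∏ℕ (ps ++ qs) f ≡ ∏ℕ ps f * ∏ℕ qs f
 ∏ℕ-++ [] qs f = sym (+-identityʳ _)
 ∏ℕ-++ (p ∷ ps) qs f = trans (cong (f p *_) (∏ℕ-++ ps qs f)) (sym (*-assoc (f p) _ _))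

 ∏ℕ-mono : ∀ {A : Set} (ps : List A) {f g : A -> ℕ} -> (∀ p -> p ∈ ps -> f p ≤ g p) -> ∏ℕ ps f ≤ ∏ℕ ps g
 ∏ℕ-mono [] h = ≤-refl
 ∏ℕ-mono (p ∷ ps) h = *-mono-≤ (h p (here refl)) (∏ℕ-mono ps (\q m -> h q (there m)))

 ∏ℕ-* : ∀ {A : Set} (ps : List A) (f g : A -> ℕ) -> ∏ℕ ps (\p -> f p * g p) ≡ ∏ℕ ps f * ∏ℕ ps g
 ∏ℕ-* [] f g = refl
 ∏ℕ-* (p ∷ ps) f g = trans (cong (f p * g p *_) (∏ℕ-* ps f g)) (e (f p) (g p) _ _) where
  e : ∀ a b c d -> a * b * (c * d) ≡ a * c * (b * d)
  e = solve-ℕ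

 primes : ℕ -> ℕ -> List ℕ
 primes a b = filterᵇ isPrimeᵇ (range a b)

 isPrime-true : ∀ {p} -> Prime p -> isPrimeᵇ p ≡ true
 isPrime-true {p} h = dec-true (prime? p) h

 isPrime⇒ : ∀ p -> isPrimeᵇ p ≡ true -> Prime p
 isPrime⇒ p e with prime? p
 ... | yes h = h

 ∈-primes⁻ : ∀ {a b p} -> p ∈ primes a b -> Prime p × a ≤ p × p < b
 ∈-primes⁻ {a} {b} {p} m with ∈-filter⁻ (T? ∘ isPrimeᵇ) {xs = range a b} m
 ... | r , t = isPrime⇒ p (T⇒≡ t) , ∈-range⁻ {a} {b} r where
  T⇒≡ : ∀ {x} -> T x -> x ≡ true
  T⇒≡ {true} _ = refl

 ∈-primes⁺ : ∀ {a b p} -> Prime p -> a ≤ p -> p < b -> p ∈ primes a b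
 ∈-primes⁺ {a} {b} {p} pp h1 h2 = ∈-filter⁺ (T? ∘ isPrimeᵇ) (∈-range⁺ {a} {b} h1 h2) (subst T (sym (isPrime-true pp)) tt)

 range-unique : ∀ a b -> Unique (range a b)
 range-unique a b = Uniqueₚ.map⁺ (+-cancelˡ-≡ a _ _) (Uniqueₚ.upTo⁺ (b ∸ a))

 primes-unique : ∀ a b -> Unique (primes a b)
 primes-unique a b = Uniqueₚ.filter⁺ (T? ∘ isPrimeᵇ) (range-unique a b)

 primes-++ : ∀ {a b c} -> a ≤ b -> b ≤ c -> primes a c ≡ primes a b ++ primes b c
 primes-++ {a} {b} {c} p q = trans (cong (filterᵇ isPrimeᵇ) (range-++ p q)) (List.filter-++ (T? ∘ isPrimeᵇ) (range a b) (range b c))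

 ∏-primes-∣ : ∀ ps c -> Unique ps -> (∀ p -> p ∈ ps -> Prime p × p ∣ c) -> ∏ℕ ps (\p -> p) ∣ c
 ∏-primes-∣ [] c u h = 1∣ c
 ∏-primes-∣ (p ∷ ps) c (np ∷ u) h with h p (here refl)
 ... | pp , divides k refl = subst (\z -> p * ∏ℕ ps (\p -> p) ∣ z) (*-comm p k) (*-monoʳ-∣ p (∏-primes-∣ ps k u (\q m -> proj₁ (h q (there m)) ,
  [ (\d -> d) , (\d -> contradiction (sym (prime-∣-prime pp (proj₁ (h q (there m))) d)) (All.lookup np m)) ]′ (euclidsLemma k p (proj₁ (h q (there m))) (proj₂ (h q (there m)))))))

 prime-∤! : ∀ {p} n -> Prime p -> n < p -> ¬ p ∣ n !
 prime-∤! zero pp h d = ¬prime[1] (subst Prime (∣1⇒≡1 d) pp)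
 prime-∤! (suc n) pp h d with euclidsLemma (suc n) (n !) pp d
 ... | inj₁ d' = >⇒∤ h d'
 ... | inj₂ d' = prime-∤! n pp (<-trans (n<1+n n) h) d'

 ∣! : ∀ {m} n -> 1 ≤ m -> m ≤ n -> m ∣ n !
 ∣! {m} zero 1≤m m≤0 = contradiction (≤-trans 1≤m m≤0) λ ()
 ∣! {m} (suc n) 1≤m m≤n with m≤n⇒m<n∨m≡n m≤n
 ... | inj₁ (s≤s lt) = ∣n⇒∣m*n (suc n) (∣! n 1≤m lt)
 ... | inj₂ refl = m∣m*n (n !)

 central : ∀ n -> ∃[ c ] (c * (n ! * n !) ≡ (n + n) ! × c ≤ 4 ^ n)
 central zero = 1 , refl , ≤-refl
 central (suc n) with central n | k![n∸k]!∣n! {suc n + suc n} {suc n} (m≤m+n (suc n) (suc n))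
 ... | c , ce , cb | divides d de = d , de' , *-cancelʳ-≤ d (4 ^ suc n) (suc n * suc n) (≡≤ℕ dd bound) where
  de' : d * (suc n ! * suc n !) ≡ (suc n + suc n) !
  de' = trans (cong (\z -> d * (suc n ! * z !)) (sym (m+n∸m≡n (suc n) (suc n)))) (sym de)
  F = n ! * n !
  0<F : 0 < F
  0<F = *-mono-≤ (1≤n! n) (1≤n! n)
  e1 : ∀ d n f -> d * (suc n * suc n) * (f * f) ≡ d * ((suc n * f) * (suc n * f))
  e1 = solve-ℕ
  e2 : ∀ n z -> suc (suc (n + n)) * (suc (n + n) * z) ≡ (2 + (n + n)) * (1 + (n + n)) * z
  e2 = solve-ℕ
  dd : d * (suc n * suc n) ≡ c * ((2 + (n + n)) * (1 + (n + n)))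
  dd = *-cancelʳ-≡ _ _ F {{>-nonZero 0<F}} (begin
   d * (suc n * suc n) * F                           ≡⟨ e1 d n (n !) ⟩
   d * (suc n ! * suc n !)                           ≡⟨ de' ⟩
   (suc n + suc n) !                                 ≡⟨ cong (\z -> suc z !) (+-suc n n) ⟩
   suc (suc (n + n)) * (suc (n + n) * (n + n) !)     ≡⟨ e2 n ((n + n) !) ⟩
   (2 + (n + n)) * (1 + (n + n)) * (n + n) !         ≡⟨ cong ((2 + (n + n)) * (1 + (n + n)) *_) ce ⟨
   (2 + (n + n)) * (1 + (n + n)) * (c * F)           ≡⟨ e3 ((2 + (n + n)) * (1 + (n + n))) c F ⟩
   c * ((2 + (n + n)) * (1 + (n + n))) * F ∎) where
   open ≡-Reasoning
   e3 : ∀ a c f -> a * (c * f) ≡ c * a * f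
   e3 = solve-ℕ
  bound : c * ((2 + (n + n)) * (1 + (n + n))) ≤ 4 ^ suc n * (suc n * suc n)
  bound = ≤≡ℕ (*-mono-≤ cb (*-monoʳ-≤ (2 + (n + n)) (n≤1+n (1 + (n + n))))) (e4 (4 ^ n) n) where
   e4 : ∀ f n -> f * ((2 + (n + n)) * (2 + (n + n))) ≡ 4 * f * (suc n * suc n)
   e4 = solve-ℕ

 chebyshev : ∀ n -> ∏ℕ (primes (suc n) (suc (n + n))) (\p -> p) ≤ 4 ^ n
 chebyshev n with central n
 ... | c , ce , cb = ≤-trans (∣⇒≤ {{>-nonZero 0<c}} (∏-primes-∣ (primes (suc n) (suc (n + n))) c (primes-unique (suc n) (suc (n + n))) (\p m -> proj₁ (∈-primes⁻ {suc n} {suc (n + n)} m) , pc p (∈-primes⁻ {suc n} {suc (n + n)} m)))) cb where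
  0<c : 0 < c
  0<c = n≢0⇒n>0 (λ { refl -> contradiction (subst (1 ≤_) (sym ce) (1≤n! (n + n))) λ () })
  pc : ∀ p -> Prime p × suc n ≤ p × p < suc (n + n) -> p ∣ c
  pc p (pp , h1 , s≤s h2) with euclidsLemma c (n ! * n !) pp (subst (p ∣_) (sym ce) (∣! (n + n) (1≤prime pp) h2))
  ... | inj₁ d = d
  ... | inj₂ d = [ (\d -> contradiction d (prime-∤! n pp h1)) , (\d -> contradiction d (prime-∤! n pp h1)) ]′ (euclidsLemma (n !) (n !) pp d)

 primorial-2^ : ∀ k -> ∏ℕ (primes 1 (suc (2 ^ k))) (\p -> p) ≤ 4 ^ (2 ^ k)
 primorial-2^ zero = s≤s z≤n
 primorial-2^ (suc k) = ≡≤ℕ (trans (cong (\l -> ∏ℕ l (\p -> p)) (trans (cong (\z -> primes 1 (suc z)) e) (primes-++ {1} {suc n} {suc (n + n)} (s≤s z≤n) (s≤s (m≤m+n n n))))) (∏ℕ-++ (primes 1 (suc n)) _ _))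
  (≤≡ℕ (*-mono-≤ (primorial-2^ k) (chebyshev n)) (trans (sym (^-distribˡ-+-* 4 n n)) (cong (4 ^_) (sym e)))) where
  n = 2 ^ k
  e : 2 ^ suc k ≡ n + n
  e = cong (n +_) (+-identityʳ n)

 2^-above : ∀ x -> 1 ≤ x -> ∃[ k ] (x ≤ 2 ^ k × 2 ^ k ≤ 2 * x)
 2^-above (suc zero) _ = 0 , s≤s z≤n , s≤s z≤n
 2^-above (suc x@(suc _)) _ with 2^-above x (s≤s z≤n)
 ... | k , a , b with suc x ≤? 2 ^ k
 ... | yes h = k , h , ≤-trans b (*-monoʳ-≤ 2 (n≤1+n x))
 ... | no h = suc k , ≤-trans (s≤s a) (≤≡ℕ (+-monoˡ-≤ (2 ^ k) (m^n>0 2 k)) (cong (2 ^ k +_) (sym (+-identityʳ _)))) , *-monoʳ-≤ 2 (≤-trans (≤-pred (≰⇒> h)) (n≤1+n x))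

 ∏ℕ≥1 : ∀ {A : Set} (ps : List A) {f : A -> ℕ} -> (∀ p -> p ∈ ps -> 1 ≤ f p) -> 1 ≤ ∏ℕ ps f
 ∏ℕ≥1 [] h = ≤-refl
 ∏ℕ≥1 (p ∷ ps) h = *-mono-≤ (h p (here refl)) (∏ℕ≥1 ps (\q m -> h q (there m)))

 primorial : ∀ x -> 1 ≤ x -> ∏ℕ (primes 1 (suc x)) (\p -> p) ≤ 16 ^ x
 primorial x 1≤x with 2^-above x 1≤x
 ... | k , a , b = ≤-trans (m≤m*n _ (∏ℕ (primes (suc x) (suc (2 ^ k))) (\p -> p)) {{>-nonZero (∏ℕ≥1 (primes (suc x) (suc (2 ^ k))) (\p m -> 1≤prime (proj₁ (∈-primes⁻ {suc x} {suc (2 ^ k)} m))))}})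
  (≡≤ℕ (trans (sym (∏ℕ-++ (primes 1 (suc x)) _ _)) (cong (\l -> ∏ℕ l (\p -> p)) (sym (primes-++ {1} {suc x} {suc (2 ^ k)} (s≤s z≤n) (s≤s a)))))
  (≤-trans (primorial-2^ k) (≤≡ℕ (^-monoʳ-≤ 4 b) (sym (^-*-assoc 4 2 x)))))

 n^n≤4^n*n! : ∀ n -> n ^ n ≤ 4 ^ n * n !
 n^n≤4^n*n! n with central n
 ... | c , ce , cb = *-cancelʳ-≤ (n ^ n) (4 ^ n * n !) (n !) {{>-nonZero (1≤n! n)}} (≤-trans (rising n) (≡≤ℕ (sym ce) (≤≡ℕ (*-monoˡ-≤ (n ! * n !) cb) (sym (*-assoc (4 ^ n) _ _))))) where
  rising : ∀ k -> n ^ k * n ! ≤ (n + k) !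
  rising zero = ≤-reflexive (trans (+-identityʳ _) (cong _! (sym (+-identityʳ n))))
  rising (suc k) = ≡≤ℕ (*-assoc n (n ^ k) (n !)) (≤≡ℕ (*-mono-≤ (≤-trans (m≤m+n n k) (n≤1+n _)) (rising k)) (cong _! (sym (+-suc n k))))

module Mertens where

 open Rationals using (≡≤; ≤≡; ≡≤ℕ; ≤≡ℕ)
 open Field
 open Sums
 open Smooth using (prime-∣-prime; 1≤prime; divides-true; divides-false)
 open Cheb
 open import Defs as D' using (range; isPrimeᵇ)
 open import Data.Nat
 open import Data.Nat.Properties
 open import Data.Nat.Divisibility
 open Rationals using (0ℚ; 1ℚ; ℚ)

 ∃-prime : ∀ n -> 2 ≤ n -> ∃[ p ] (Prime p × p ∣ n)
 ∃-prime n@(suc (suc _)) (s≤s (s≤s _)) with factorise n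
 ... | record { factors = p ∷ ps ; isFactorisation = e ; factorsPrime = pp ∷ _ } = p , pp , subst (p ∣_) (sym e) (m∣m*n _)
 ... | record { factors = [] ; isFactorisation = () }

 δ : ℕ -> ℕ -> ℕ
 δ d m = if D'.divides d m then 1 else 0

 δ-∣ : ∀ {d m} -> d ∣ m -> δ d m ≡ 1
 δ-∣ h rewrite divides-true h = refl

 δ-∤ : ∀ {d m} -> ¬ d ∣ m -> δ d m ≡ 0
 δ-∤ h rewrite divides-false h = refl

 δ-mono : ∀ {d m d' m'} -> (d ∣ m -> d' ∣ m') -> δ d m ≤ δ d' m'
 δ-mono {d} {m} h with d ∣? m
 ... | yes y rewrite divides-true (h y) = ≤-refl
 ... | no _ = z≤n

 -- the exponent of p in m, up to K
 val : ℕ -> ℕ -> ℕ -> ℕ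
 val zero p m = 0
 val (suc K) p m = val K p m + δ (p ^ suc K) m

 val-* : ∀ K q m -> 1 ≤ q -> val (suc K) q (q * m) ≡ suc (val K q m)
 val-* zero q m h = δ-∣ (subst (_∣ q * m) (sym (*-identityʳ q)) (m∣m*n m))
 val-* (suc K) q m h = cong₂ _+_ (val-* K q m h) (≤-antisym (δ-mono {q ^ suc (suc K)} {q * m} {q ^ suc K} {m} (*-cancelˡ-∣ q {{>-nonZero h}})) (δ-mono {q ^ suc K} {m} {q ^ suc (suc K)} {q * m} (*-monoʳ-∣ q)))

 val-mono : ∀ K p m q -> val K p m ≤ val (suc K) p (q * m)
 val-mono K p m q = ≤-trans (go K) (m≤m+n _ _) where
  go : ∀ K -> val K p m ≤ val K p (q * m)
  go zero = z≤n
  go (suc K) = +-mono-≤ (go K) (δ-mono {p ^ suc K} {m} {p ^ suc K} {q * m} (∣n⇒∣m*n q))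

 ∏-incr : ∀ ps q (f g : ℕ -> ℕ) -> q ∈ ps -> (∀ p -> p ∈ ps -> f p ≤ g p) -> q * f q ≤ g q -> q * ∏ℕ ps f ≤ ∏ℕ ps g
 ∏-incr (p ∷ ps) q f g (here refl) h hq = ≡≤ℕ (sym (*-assoc p (f p) _)) (*-mono-≤ hq (∏ℕ-mono ps (\r m -> h r (there m))))
 ∏-incr (p ∷ ps) q f g (there q∈) h hq = ≡≤ℕ (e q (f p) _) (*-mono-≤ (h p (here refl)) (∏-incr ps q f g q∈ (\r m -> h r (there m)) hq)) where
  e : ∀ q f z -> q * (f * z) ≡ f * (q * z)
  e = solve-ℕ

 ≤∏val : ∀ K x m -> 1 ≤ m -> m ≤ suc K -> m ≤ x -> m ≤ ∏ℕ (primes 1 (suc x)) (\p -> p ^ val K p m)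
 ≤∏val zero x m h1 h2 h3 = ≤-trans h2 (∏ℕ≥1 (primes 1 (suc x)) (\p _ -> ≤-refl))
 ≤∏val (suc K) x m h1 h2 h3 with m ≤? 1
 ... | yes h = ≤-trans h (∏ℕ≥1 (primes 1 (suc x)) (\p m∈ -> m^n>0 p {{>-nonZero (1≤prime (proj₁ (∈-primes⁻ {1} {suc x} m∈)))}} (val (suc K) p m)))
 ... | no h with ∃-prime m (≰⇒> h)
 ... | q , pq , divides k refl rewrite *-comm k q = ≤-trans (*-monoʳ-≤ q (≤∏val K x k 1≤k (≤-pred (≤-trans k<qk h2)) (≤-trans (<⇒≤ k<qk) h3)))
   (∏-incr (primes 1 (suc x)) q _ _ (∈-primes⁺ pq (1≤prime pq) (s≤s (≤-trans (m≤m*n q k {{>-nonZero 1≤k}}) h3)))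
    (\p m∈ -> ^-monoʳ-≤ p {{>-nonZero (1≤prime (proj₁ (∈-primes⁻ {1} {suc x} m∈)))}} (val-mono K p k q)) (≤-reflexive (cong (q ^_) (sym (val-* K q k (1≤prime pq)))))) where
  1≤k : 1 ≤ k
  1≤k = n≢0⇒n>0 λ { refl -> contradiction (≤≡ℕ h1 (*-zeroʳ q)) λ () }
  k<qk : k < q * k
  k<qk = subst (k <_) (*-comm k q) (m<m*n k q {{>-nonZero 1≤k}} (nonTrivial⇒n>1 q {{prime⇒nonTrivial pq}}))

 D : ℕ -> ℕ -> ℕ
 D zero d = 0
 D (suc x) d = D x d + δ d (suc x)

 D-spec : ∀ x d -> 1 ≤ d -> ∃[ r ] (r < d × d * D x d + r ≡ x)
 D-spec zero d h = 0 , h , trans (+-identityʳ _) (*-zeroʳ d)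
 D-spec (suc x) d h with D-spec x d h
 ... | r , r<d , e with suc r ≟ d
 ... | yes refl = 0 , s≤s z≤n , trans (+-identityʳ _) (trans (cong (\z -> suc r * (D x (suc r) + z)) (δ-∣ dv)) e2) where
  e1 : ∀ r z -> suc r * (z + 1) ≡ suc (suc r * z + r)
  e1 = solve-ℕ
  e2 : suc r * (D x (suc r) + 1) ≡ suc x
  e2 = trans (e1 r (D x (suc r))) (cong suc e)
  dv : suc r ∣ suc x
  dv = subst (suc r ∣_) e2 (m∣m*n _)
 ... | no ne = suc r , ≤∧≢⇒< r<d ne , trans (cong (\z -> d * (D x d + z) + suc r) (δ-∤ nd)) (trans (cong (\z -> d * z + suc r) (+-identityʳ (D x d))) (trans (+-suc _ r) (cong suc e))) where
  nd : ¬ d ∣ suc x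
  nd dv = >⇒∤ (≤∧≢⇒< r<d ne) (∣m+n∣m⇒∣n (subst (d ∣_) (trans (cong suc (sym e)) (sym (+-suc _ r))) dv) (m∣m*n (D x d)))

 D-≤ : ∀ x d -> 1 ≤ d -> d * D x d ≤ x
 D-≤ x d h with D-spec x d h
 ... | r , _ , e = ≤≡ℕ (m≤m+n _ r) e

 D-scale : ∀ B A d -> 1 ≤ d -> 1 ≤ B -> D (B * A) d ≤ B * D A d + B
 D-scale B A d h hB with D-spec A d h
 ... | r , r<d , e = <⇒≤ (*-cancelˡ-< d _ _ (≤-<-trans (D-≤ (B * A) d h) (subst (\z -> B * z < d * (B * D A d + B)) e
  (≤≡ℕ (*-monoʳ-< B {{>-nonZero hB}} (+-monoʳ-< (d * D A d) r<d)) (e1 d B (D A d))))))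
  where
  e1 : ∀ d B z -> B * (d * z + d) ≡ d * (B * z + B)
  e1 = solve-ℕ

 V : ℕ -> ℕ -> ℕ -> ℕ
 V zero x p = 0
 V (suc K) x p = V K x p + D x (p ^ suc K)

 V-zero : ∀ K p -> V K 0 p ≡ 0
 V-zero zero p = refl
 V-zero (suc K) p = cong (_+ 0) (V-zero K p)

 V-suc : ∀ K x p -> V K (suc x) p ≡ val K p (suc x) + V K x p
 V-suc zero x p = refl
 V-suc (suc K) x p = trans (cong (_+ (D x (p ^ suc K) + δ (p ^ suc K) (suc x))) (V-suc K x p)) (e (val K p (suc x)) (V K x p) (D x (p ^ suc K)) _) where
  e : ∀ a b c d -> a + b + (c + d) ≡ a + d + (b + c)
  e = solve-ℕ

 !≤∏ : ∀ K X x -> x ≤ suc K -> x ≤ X -> x ! ≤ ∏ℕ (primes 1 (suc X)) (\p -> p ^ V K x p)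
 !≤∏ K X zero h h' = ∏ℕ≥1 (primes 1 (suc X)) (\p m∈ -> m^n>0 p {{>-nonZero (1≤prime (proj₁ (∈-primes⁻ {1} {suc X} m∈)))}} (V K 0 p))
 !≤∏ K X (suc x) h h' = ≤≡ℕ (*-mono-≤ (≤∏val K X (suc x) (s≤s z≤n) h h') (!≤∏ K X x (<⇒≤ h) (<⇒≤ h')))
  (trans (sym (∏ℕ-* (primes 1 (suc X)) _ _)) (cong∏ (primes 1 (suc X)) (\p -> trans (sym (^-distribˡ-+-* p (val K p (suc x)) (V K x p))) (cong (p ^_) (sym (V-suc K x p)))))) where
  cong∏ : ∀ (ps : List ℕ) {f g : ℕ -> ℕ} -> (∀ p -> f p ≡ g p) -> ∏ℕ ps f ≡ ∏ℕ ps g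
  cong∏ [] h = refl
  cong∏ (p ∷ ps) h = cong₂ _*_ (h p) (cong∏ ps h)

 ∏δ∣ : ∀ ps c -> Unique ps -> (∀ p -> p ∈ ps -> Prime p) -> ∏ℕ ps (\p -> p ^ δ p c) ∣ c
 ∏δ∣ [] c u h = 1∣ c
 ∏δ∣ (p ∷ ps) c (np ∷ u) h with p ∣? c
 ... | no _ = subst (_∣ c) (sym (+-identityʳ _)) (∏δ∣ ps c u (\q m -> h q (there m)))
 ... | yes (divides k refl) = subst₂ _∣_ (sym (cong₂ _*_ (*-identityʳ p) (same ps (\q m -> h q (there m)) np))) (*-comm p k) (*-monoʳ-∣ p (∏δ∣ ps k u (\q m -> h q (there m)))) where
  same : ∀ ps -> (∀ q -> q ∈ ps -> Prime q) -> All (p ≢_) ps -> ∏ℕ ps (\q -> q ^ δ q (k * p)) ≡ ∏ℕ ps (\q -> q ^ δ q k)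
  same [] h np = refl
  same (q ∷ ps) hq (p≢q ∷ np) = cong₂ _*_ (cong (q ^_) (≤-antisym (δ-mono {q} {k * p} {q} {k} (\d -> [ (\d -> d) , (\d -> contradiction (sym (prime-∣-prime (h p (here refl)) (hq q (here refl)) d)) p≢q) ]′ (euclidsLemma k p (hq q (here refl)) d)))
   (δ-mono {q} {k} {q} {k * p} (∣m⇒∣m*n p)))) (same ps (\r m -> hq r (there m)) np)

 ∏D≤! : ∀ ps A -> Unique ps -> (∀ p -> p ∈ ps -> Prime p) -> ∏ℕ ps (\p -> p ^ D A p) ≤ A !
 ∏D≤! ps zero u h = ≤-reflexive (one ps) where
  one : ∀ (ps : List ℕ) -> ∏ℕ ps (\p -> 1) ≡ 1
  one [] = refl
  one (p ∷ ps) = trans (+-identityʳ _) (one ps)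
 ∏D≤! ps (suc A) u h = ≤-trans (∏ℕ-mono ps (\p _ -> ≤-reflexive (^-distribˡ-+-* p (D A p) (δ p (suc A)))))
  (≡≤ℕ (trans (∏ℕ-* ps _ _) (*-comm (∏ℕ ps (\p -> p ^ D A p)) _)) (*-mono-≤ (∣⇒≤ (∏δ∣ ps (suc A) u h)) (∏D≤! ps A u h)))

 !≤^ : ∀ A -> A ! ≤ A ^ A
 !≤^ zero = ≤-refl
 !≤^ (suc A) = *-monoʳ-≤ (suc A) (≤-trans (!≤^ A) (^-monoˡ-≤ A (n≤1+n A)))

 ∏^ : ∀ {I : Set} (ps : List I) (f : I -> ℕ) B -> ∏ℕ ps (\p -> f p ^ B) ≡ ∏ℕ ps f ^ B
 ∏^ [] f B = sym (^-zeroˡ B)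
 ∏^ (p ∷ ps) f B = trans (cong (f p ^ B *_) (∏^ ps f B)) (sym (^-distribʳ-* B (f p) (∏ℕ ps f)))
  where
  ^-distribʳ-* : ∀ B a b -> (a * b) ^ B ≡ a ^ B * b ^ B
  ^-distribʳ-* zero a b = refl
  ^-distribʳ-* (suc B) a b = trans (cong (a * b *_) (^-distribʳ-* B a b)) (e a b (a ^ B) (b ^ B)) where
   e : ∀ a b c d -> a * b * (c * d) ≡ a * c * (b * d)
   e = solve-ℕ

 low : ∀ A B -> 1 ≤ A -> 1 ≤ B -> ∏ℕ (primes 1 (suc A)) (\p -> p ^ D (B * A) p) ≤ A ^ (B * A) * 16 ^ (B * A)
 low A B hA hB = begin
  ∏ℕ ps (\p -> p ^ D (B * A) p)                   ≤⟨ ∏ℕ-mono ps (\p m -> ^-monoʳ-≤ p {{>-nonZero (1≤prime (pr p m))}} (D-scale B A p (1≤prime (pr p m)) hB)) ⟩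
  ∏ℕ ps (\p -> p ^ (B * D A p + B))               ≤⟨ ∏ℕ-mono ps (\p m -> ≤-reflexive (trans (^-distribˡ-+-* p (B * D A p) B) (cong (_* p ^ B) (trans (cong (p ^_) (*-comm B (D A p))) (sym (^-*-assoc p (D A p) B)))))) ⟩
  ∏ℕ ps (\p -> (p ^ D A p) ^ B * p ^ B)           ≡⟨ trans (∏ℕ-* ps _ _) (cong₂ _*_ (∏^ ps (\p -> p ^ D A p) B) (∏^ ps (\p -> p) B)) ⟩
  ∏ℕ ps (\p -> p ^ D A p) ^ B * ∏ℕ ps (\p -> p) ^ B ≤⟨ *-mono-≤ (^-monoˡ-≤ B (≤-trans (∏D≤! ps A (primes-unique 1 (suc A)) pr) (!≤^ A))) (^-monoˡ-≤ B (primorial A hA)) ⟩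
  (A ^ A) ^ B * (16 ^ A) ^ B                      ≡⟨ cong₂ _*_ (trans (^-*-assoc A A B) (cong (A ^_) (*-comm A B))) (trans (^-*-assoc 16 A B) (cong (16 ^_) (*-comm A B))) ⟩
  A ^ (B * A) * 16 ^ (B * A) ∎ where
  open ≤-Reasoning
  ps = primes 1 (suc A)
  pr : ∀ p -> p ∈ ps -> Prime p
  pr p m = proj₁ (∈-primes⁻ {1} {suc A} m)

 lam : ℕ -> ℕ -> ℕ
 lam zero p = 0
 lam (suc J) p = lam J p + (if 2 ^ J ≤ᵇ p then 1 else 0)

 lam-full : ∀ J p -> 2 ^ J ≤ p -> lam (suc J) p ≡ suc J
 lam-full zero p h with 1 ≤ᵇ p | ≤⇒≤ᵇ h
 ... | true | _ = refl
 lam-full (suc J) p h with 2 ^ suc J ≤ᵇ p | ≤⇒≤ᵇ h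
 ... | true | _ = trans (+-comm _ 1) (cong suc (lam-full J p (≤-trans (m≤m+n (2 ^ J) _) h)))

 ≤2^lam : ∀ J p -> p < 2 ^ J -> p ≤ 2 ^ lam J p
 ≤2^lam zero p (s≤s z≤n) = z≤n
 ≤2^lam (suc J) p h with 2 ^ J ≤? p
 ... | yes y = ≤≡ℕ (<⇒≤ h) (cong (2 ^_) (sym (lam-full J p y)))
 ... | no n = ≤-trans (≤2^lam J p (≰⇒> n)) (^-monoʳ-≤ 2 (m≤m+n (lam J p) _))

 ∑ℕ : List ℕ -> (ℕ -> ℕ) -> ℕ
 ∑ℕ [] f = 0
 ∑ℕ (p ∷ ps) f = f p + ∑ℕ ps f

 ι-∑ℕ : ∀ ps f -> ι (∑ℕ ps f) ≡ ∑ ps (\p -> ι (f p))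
 ι-∑ℕ [] f = ι-def 0
 ι-∑ℕ (p ∷ ps) f = trans (ι-+ (f p) _) (cong (ι (f p) ℚ.+_) (ι-∑ℕ ps f))

 ∏≤2^ : ∀ ps (f g : ℕ -> ℕ) -> (∀ p -> p ∈ ps -> p ≤ 2 ^ g p) -> ∏ℕ ps (\p -> p ^ f p) ≤ 2 ^ ∑ℕ ps (\p -> g p * f p)
 ∏≤2^ [] f g h = ≤-refl
 ∏≤2^ (p ∷ ps) f g h = ≤≡ℕ (*-mono-≤ (≤≡ℕ (^-monoˡ-≤ (f p) (h p (here refl))) (^-*-assoc 2 (g p) (f p))) (∏≤2^ ps f g (\q m -> h q (there m))))
  (sym (^-distribˡ-+-* 2 (g p * f p) _))

 ∏≤^∑ : ∀ ps (f : ℕ -> ℕ) x -> (∀ p -> p ∈ ps -> p ≤ x) -> ∏ℕ ps (\p -> p ^ f p) ≤ x ^ ∑ℕ ps f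
 ∏≤^∑ [] f x h = ≤-refl
 ∏≤^∑ (p ∷ ps) f x h = ≤≡ℕ (*-mono-≤ (^-monoˡ-≤ (f p) (h p (here refl))) (∏≤^∑ ps f x (\q m -> h q (there m)))) (sym (^-distribˡ-+-* x (f p) _))

 -- the contribution of the proper powers of p
 V2 : ℕ -> ℕ -> ℕ -> ℕ
 V2 zero x p = 0
 V2 (suc K) x p = V2 K x p + D x (p ^ (2 + K))

 V-split : ∀ K x p -> V (suc K) x p ≡ D x p + V2 K x p
 V-split zero x p = trans (cong (D x) (*-identityʳ p)) (sym (+-identityʳ _))
 V-split (suc K) x p = trans (cong (_+ D x (p ^ (2 + K))) (V-split K x p)) (+-assoc (D x p) _ _)

 inv1 : inv 1 ≡ 1ℚ
 inv1 = trans (sym (ℚ.*-identityˡ (inv 1))) (trans (cong (ℚ._* inv 1) (sym (ι-def 1))) (*-inv 1 ≤-refl))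

 D-inv : ∀ x d -> 1 ≤ d -> ι (D x d) ℚ.≤ ι x ℚ.* inv d
 D-inv x d h = ≤≡ (≤inv d h (≡≤ (sym (ι-* d (D x d))) (ι-mono (D-≤ x d h)))) (ℚ.*-comm (inv d) (ι x))

 2Q = 1ℚ ℚ.+ 1ℚ

 0≤2Q : 0ℚ ℚ.≤ 2Q
 0≤2Q = 0≤+ 0≤1 0≤1

 V2-inv : ∀ K x p -> 2 ≤ p -> ι (V2 K x p) ℚ.≤ ι x ℚ.* (2Q ℚ.* (inv p ℚ.* inv p))
 V2-inv K x p h = ℚ.≤-trans (go K) (*-monoˡ (ι x) (0≤ι x) (-≤ (0≤* 0≤2Q (0≤inv (p ^ (2 + K)))))) where
  1≤p : 1 ≤ p
  1≤p = <⇒≤ h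
  half : 2Q ℚ.* inv p ℚ.≤ 1ℚ
  half = ≤≡ (*-monoʳ (inv p) (0≤inv p) (≡≤ (sym (ι-def 2)) (ι-mono h))) (*-inv p 1≤p)
  go : ∀ K -> ι (V2 K x p) ℚ.≤ ι x ℚ.* (2Q ℚ.* (inv p ℚ.* inv p) ℚ.- 2Q ℚ.* inv (p ^ (2 + K)))
  go zero = ℚ.≤-reflexive (trans (ι-def 0) (sym (trans (cong (\z -> ι x ℚ.* (2Q ℚ.* (inv p ℚ.* inv p) ℚ.- 2Q ℚ.* z)) (trans (cong (\z -> inv (p * z)) (*-identityʳ p)) (inv-* p p))) (e (ι x) (inv p))))) where
   e : ∀ x a -> x ℚ.* ((1ℚ ℚ.+ 1ℚ) ℚ.* (a ℚ.* a) ℚ.- (1ℚ ℚ.+ 1ℚ) ℚ.* (a ℚ.* a)) ≡ 0ℚ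
   e = ring Rℚ
  go (suc K) = ≡≤ (ι-+ (V2 K x p) _) (ℚ.≤-trans (+-mono (go K) (D-inv x (p ^ (2 + K)) (m^n>0 p {{>-nonZero 1≤p}} (2 + K))))
   (≤by (ι x ℚ.* (i ℚ.* (1ℚ ℚ.- 2Q ℚ.* inv p))) (0≤* (0≤ι x) (0≤* (0≤inv (p ^ (2 + K))) (diff half))) (trans (e (ι x) (inv p) i) (cong (\z -> ι x ℚ.* (2Q ℚ.* (inv p ℚ.* inv p) ℚ.- 2Q ℚ.* z)) (sym (inv-* p (p ^ (2 + K)))))))) where
   i = inv (p ^ (2 + K))
   e : ∀ x a i -> (x ℚ.* ((1ℚ ℚ.+ 1ℚ) ℚ.* (a ℚ.* a) ℚ.- (1ℚ ℚ.+ 1ℚ) ℚ.* i) ℚ.+ x ℚ.* i) ℚ.+ x ℚ.* (i ℚ.* (1ℚ ℚ.- (1ℚ ℚ.+ 1ℚ) ℚ.* a)) ≡ x ℚ.* ((1ℚ ℚ.+ 1ℚ) ℚ.* (a ℚ.* a) ℚ.- (1ℚ ℚ.+ 1ℚ) ℚ.* (a ℚ.* i))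
   e = ring Rℚ

 inv-step : ∀ n -> 1 ≤ n -> inv n ℚ.- inv (suc n) ≡ inv n ℚ.* inv (suc n)
 inv-step n h = trans (cong₂ ℚ._-_ (trans (sym (ℚ.*-identityʳ (inv n))) (cong (inv n ℚ.*_) (trans (sym (*-inv (suc n) (s≤s z≤n))) (cong (ℚ._* inv (suc n)) (trans (ι-+ 1 n) (cong (ℚ._+ ι n) (ι-def 1)))))))
   (trans (sym (ℚ.*-identityˡ (inv (suc n)))) (cong (ℚ._* inv (suc n)) (sym (*-inv n h)))))
  (e (ι n) (inv n) (inv (suc n))) where
  e : ∀ n i j -> i ℚ.* ((1ℚ ℚ.+ n) ℚ.* j) ℚ.- n ℚ.* i ℚ.* j ≡ i ℚ.* j
  e = ring Rℚ

 ∑inv² : ∀ d k -> 1 ≤ d -> ∑ (range d (d + k)) (\n -> inv n ℚ.* inv n) ℚ.≤ 2Q ℚ.* inv d ℚ.- 2Q ℚ.* inv (d + k)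
 ∑inv² d zero h = ℚ.≤-reflexive (trans (cong (\l -> ∑ l (\n -> inv n ℚ.* inv n)) (trans (cong (range d) (+-identityʳ d)) (range-[] d)))
  (sym (trans (cong (\z -> 2Q ℚ.* inv d ℚ.- 2Q ℚ.* inv z) (+-identityʳ d)) (ℚ.+-inverseʳ (2Q ℚ.* inv d)))))
 ∑inv² d (suc k) h = ≡≤ (trans (cong (\z -> ∑ (range d z) f) (+-suc d k)) (∑-range-last d (d + k) f (m≤m+n d k)))
  (≤≡ (+-mono (∑inv² d k h) step) (trans (e (inv d) (inv (d + k)) (inv (suc (d + k)))) (cong (\z -> 2Q ℚ.* inv d ℚ.- 2Q ℚ.* inv z) (sym (+-suc d k))))) where
  f : ℕ -> ℚ
  f n = inv n ℚ.* inv n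
  m = d + k
  1≤m : 1 ≤ m
  1≤m = ≤-trans h (m≤m+n d k)
  m+1≤2m : inv m ℚ.≤ 2Q ℚ.* inv (suc m)
  m+1≤2m = ℚ.≤-trans (≤inv m 1≤m (ℚ.≤-reflexive (*-inv m 1≤m))) (inv≤ m 1≤m (≡≤ (sym (*-inv (suc m) (s≤s z≤n))) (≤≡ (*-monoʳ (inv (suc m)) (0≤inv (suc m)) (≤≡ (ι-mono (+-monoˡ-≤ m 1≤m)) (ι-+ m m))) (e2 (ι m) (inv (suc m))))))  where
   e2 : ∀ a b -> (a ℚ.+ a) ℚ.* b ≡ a ℚ.* ((1ℚ ℚ.+ 1ℚ) ℚ.* b)
   e2 = ring Rℚ
  step : inv m ℚ.* inv m ℚ.≤ 2Q ℚ.* (inv m ℚ.- inv (suc m))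
  step = ≤≡ (*-monoˡ (inv m) (0≤inv m) m+1≤2m) (trans (e2 (inv m) (inv (suc m))) (cong (2Q ℚ.*_) (sym (inv-step m 1≤m)))) where
   e2 : ∀ a b -> a ℚ.* ((1ℚ ℚ.+ 1ℚ) ℚ.* b) ≡ (1ℚ ℚ.+ 1ℚ) ℚ.* (a ℚ.* b)
   e2 = ring Rℚ
  e : ∀ a b c -> ((1ℚ ℚ.+ 1ℚ) ℚ.* a ℚ.- (1ℚ ℚ.+ 1ℚ) ℚ.* b) ℚ.+ (1ℚ ℚ.+ 1ℚ) ℚ.* (b ℚ.- c) ≡ (1ℚ ℚ.+ 1ℚ) ℚ.* a ℚ.- (1ℚ ℚ.+ 1ℚ) ℚ.* c
  e = ring Rℚ

 ∑inv²≤ : ∀ d Y -> 1 ≤ d -> ∑ (range 1 Y) (\n -> ι (if d ≤ᵇ n then 1 else 0) ℚ.* (inv n ℚ.* inv n)) ℚ.≤ 2Q ℚ.* inv d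
 ∑inv²≤ d Y h with d ≤? Y
 ... | yes y = ≡≤ (trans (∑-range-split 1 d Y g h y) (trans (cong (ℚ._+ ∑ (range d Y) g) small) (ℚ.+-identityˡ (∑ (range d Y) g))))
   (ℚ.≤-trans (∑-mono∈ (range d Y) big) (ℚ.≤-trans (subst (\z -> ∑ (range d z) (\n -> inv n ℚ.* inv n) ℚ.≤ 2Q ℚ.* inv d ℚ.- 2Q ℚ.* inv z) (m+[n∸m]≡n y) (∑inv² d (Y ∸ d) h)) (-≤ (0≤* 0≤2Q (0≤inv Y))))) where
  g : ℕ -> ℚ
  g n = ι (if d ≤ᵇ n then 1 else 0) ℚ.* (inv n ℚ.* inv n)
  le : ∀ b a -> 0ℚ ℚ.≤ a -> ι (if b then 1 else 0) ℚ.* a ℚ.≤ a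
  le true a ha = ℚ.≤-reflexive (trans (cong (ℚ._* a) (ι-def 1)) (ℚ.*-identityˡ a))
  le false a ha = ≡≤ (trans (cong (ℚ._* a) (ι-def 0)) (ℚ.*-zeroˡ a)) ha
  big : ∀ n -> n ∈ range d Y -> g n ℚ.≤ inv n ℚ.* inv n
  big n _ = le (d ≤ᵇ n) _ (0≤* (0≤inv n) (0≤inv n))
  small : ∑ (range 1 d) g ≡ 0ℚ
  small = trans (∑-cong∈ (range 1 d) (\n m -> nul n (proj₂ (∈-range⁻ {1} {d} m)))) (∑-0 (range 1 d)) where
   nul : ∀ n -> n < d -> g n ≡ 0ℚ
   nul n lt with d ≤ᵇ n in eq
   ... | false = trans (cong (ℚ._* (inv n ℚ.* inv n)) (ι-def 0)) (ℚ.*-zeroˡ (inv n ℚ.* inv n))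
   ... | true = contradiction (≤-trans lt (≤ᵇ⇒≤ d n (subst Data.Bool.T (sym eq) _))) (<-irrefl refl)
 ... | no ny = ≡≤ (trans (∑-cong∈ (range 1 Y) (\n m -> nul n (<-trans (proj₂ (∈-range⁻ {1} {Y} m)) (≰⇒> ny)))) (∑-0 (range 1 Y))) (0≤* 0≤2Q (0≤inv d)) where
  nul : ∀ n -> n < d -> ι (if d ≤ᵇ n then 1 else 0) ℚ.* (inv n ℚ.* inv n) ≡ 0ℚ
  nul n lt with d ≤ᵇ n in eq
  ... | false = trans (cong (ℚ._* (inv n ℚ.* inv n)) (ι-def 0)) (ℚ.*-zeroˡ (inv n ℚ.* inv n))
  ... | true = contradiction (≤-trans lt (≤ᵇ⇒≤ d n (subst Data.Bool.T (sym eq) _))) (<-irrefl refl)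

 -- the average of lam J against n ↦ 1 / n², one binary digit at a time
 ∑lam : ∀ J Y -> ∑ (range 1 Y) (\n -> ι (lam J n) ℚ.* (inv n ℚ.* inv n)) ℚ.≤ 2Q ℚ.* (2Q ℚ.- 2Q ℚ.* inv (2 ^ J))
 ∑lam zero Y = ℚ.≤-reflexive (trans (trans (∑-cong (range 1 Y) (\n -> trans (cong (ℚ._* (inv n ℚ.* inv n)) (ι-def 0)) (ℚ.*-zeroˡ (inv n ℚ.* inv n)))) (∑-0 (range 1 Y))) (sym (trans (cong (\z -> 2Q ℚ.* (2Q ℚ.- 2Q ℚ.* z)) inv1) refl)))
 ∑lam (suc J) Y = ≡≤ (trans (∑-cong (range 1 Y) (\n -> trans (cong (ℚ._* (inv n ℚ.* inv n)) (ι-+ (lam J n) (if 2 ^ J ≤ᵇ n then 1 else 0))) (ℚ.*-distribʳ-+ (inv n ℚ.* inv n) (ι (lam J n)) (ι (if 2 ^ J ≤ᵇ n then 1 else 0))))) (∑-+ (range 1 Y) _ _))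
  (≤≡ (+-mono (∑lam J Y) (∑inv²≤ (2 ^ J) Y (m^n>0 2 J))) (trans (cong (\z -> 2Q ℚ.* (2Q ℚ.- 2Q ℚ.* inv (2 ^ J)) ℚ.+ 2Q ℚ.* z) halve) (trans (e (inv (2 ^ J)) (inv (2 ^ suc J))) (cong (\z -> 2Q ℚ.* (2Q ℚ.+ z)) (e2 (inv (2 ^ J)) (inv (2 ^ suc J)) halve))))) where
  halve : inv (2 ^ J) ≡ 2Q ℚ.* inv (2 ^ suc J)
  halve = trans (sym (ℚ.*-identityˡ (inv (2 ^ J)))) (trans (cong (ℚ._* inv (2 ^ J)) (trans (sym (*-inv 2 (s≤s z≤n))) (cong (ℚ._* inv 2) (ι-def 2)))) (trans (ℚ.*-assoc 2Q (inv 2) (inv (2 ^ J))) (cong (2Q ℚ.*_) (sym (inv-* 2 (2 ^ J))))))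
  e : ∀ a b -> (1ℚ ℚ.+ 1ℚ) ℚ.* ((1ℚ ℚ.+ 1ℚ) ℚ.- (1ℚ ℚ.+ 1ℚ) ℚ.* a) ℚ.+ (1ℚ ℚ.+ 1ℚ) ℚ.* ((1ℚ ℚ.+ 1ℚ) ℚ.* b) ≡ (1ℚ ℚ.+ 1ℚ) ℚ.* ((1ℚ ℚ.+ 1ℚ) ℚ.+ ((1ℚ ℚ.+ 1ℚ) ℚ.* b ℚ.- (1ℚ ℚ.+ 1ℚ) ℚ.* a))
  e = ring Rℚ
  e2 : ∀ a b -> a ≡ 2Q ℚ.* b -> 2Q ℚ.* b ℚ.- 2Q ℚ.* a ≡ ℚ.- (2Q ℚ.* b)
  e2 a b refl = e3 b where
   e3 : ∀ b -> (1ℚ ℚ.+ 1ℚ) ℚ.* b ℚ.- (1ℚ ℚ.+ 1ℚ) ℚ.* ((1ℚ ℚ.+ 1ℚ) ℚ.* b) ≡ ℚ.- ((1ℚ ℚ.+ 1ℚ) ℚ.* b)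
   e3 = ring Rℚ

 high-powers : ∀ K x -> ∏ℕ (primes 1 (suc x)) (\p -> p ^ V2 K x p) ≤ 2 ^ (8 * x)
 high-powers K x = ≤-trans (∏≤2^ ps (V2 K x) (lam x) (\p m -> ≤2^lam x p (small p m))) (^-monoʳ-≤ 2 (ι-cancel (≡≤ (ι-∑ℕ ps (\p -> lam x p * V2 K x p)) bound))) where
  ps = primes 1 (suc x)
  n<2^n : ∀ n -> n < 2 ^ n
  n<2^n zero = s≤s z≤n
  n<2^n (suc n) = ≤≡ℕ (+-mono-≤ (m^n>0 2 n) (n<2^n n)) (cong (2 ^ n +_) (sym (+-identityʳ _)))
  small : ∀ p -> p ∈ ps -> p < 2 ^ x
  small p m = ≤-<-trans (≤-pred (proj₂ (proj₂ (∈-primes⁻ {1} {suc x} m)))) (n<2^n x)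
  g : ℕ -> ℚ
  g n = ι (lam x n) ℚ.* (inv n ℚ.* inv n)
  pt : ∀ p -> p ∈ ps -> ι (lam x p * V2 K x p) ℚ.≤ (ι x ℚ.* 2Q) ℚ.* g p
  pt p m = ≡≤ (ι-* (lam x p) (V2 K x p)) (≤≡ (*-monoˡ (ι (lam x p)) (0≤ι (lam x p)) (V2-inv K x p (nonTrivial⇒n>1 p {{prime⇒nonTrivial (proj₁ (∈-primes⁻ {1} {suc x} m))}}))) (e (ι (lam x p)) (ι x) (inv p ℚ.* inv p))) where
   e : ∀ l x i -> l ℚ.* (x ℚ.* ((1ℚ ℚ.+ 1ℚ) ℚ.* i)) ≡ x ℚ.* (1ℚ ℚ.+ 1ℚ) ℚ.* (l ℚ.* i)
   e = ring Rℚ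
  bound : ∑ ps (\p -> ι (lam x p * V2 K x p)) ℚ.≤ ι (8 * x)
  bound = ℚ.≤-trans (∑-mono∈ ps pt) (≡≤ (trans (∑-*ˡ ps (ι x ℚ.* 2Q) g) (cong (ι x ℚ.* 2Q ℚ.*_) (∑-filter isPrimeᵇ (range 1 (suc x)) g)))
   (≤≡ (*-monoˡ (ι x ℚ.* 2Q) (0≤* (0≤ι x) 0≤2Q) (ℚ.≤-trans (∑-mono (range 1 (suc x)) (\n -> ≤≡ (*-monoʳ (g n) (0≤g n) (ind≤1 (isPrimeᵇ n))) (ℚ.*-identityˡ (g n)))) (ℚ.≤-trans (∑lam x (suc x)) (*-monoˡ 2Q 0≤2Q (-≤ (0≤* 0≤2Q (0≤inv (2 ^ x))))))))
   (trans (e (ι x)) (trans (cong (ℚ._* ι x) (sym (ι-def 8))) (sym (ι-* 8 x)))))) where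
   0≤g : ∀ n -> 0ℚ ℚ.≤ g n
   0≤g n = 0≤* (0≤ι (lam x n)) (0≤* (0≤inv n) (0≤inv n))
   e : ∀ x -> x ℚ.* (1ℚ ℚ.+ 1ℚ) ℚ.* ((1ℚ ℚ.+ 1ℚ) ℚ.* (1ℚ ℚ.+ 1ℚ)) ≡ ((1ℚ ℚ.+ 1ℚ) ℚ.* (1ℚ ℚ.+ 1ℚ) ℚ.* (1ℚ ℚ.+ 1ℚ)) ℚ.* x
   e = ring Rℚ

 mertens : ∀ B c i -> 1 ≤ c -> 2 ^ (14 * c) ≤ B -> ι c ℚ.- 1ℚ ℚ.≤ ι (suc i) ℚ.* ι c ℚ.* ∑ (primes (suc (B ^ i)) (suc (B ^ suc i))) inv
 mertens B c i 1≤c hB = *-cancel (ι x) (0<ι 1≤x) (undiff (≤≡ (diff final) (e0 (ι x) (ι c) (ι (suc i)) S))) where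
  e0 : ∀ x c i s -> (x ℚ.+ i ℚ.* (x ℚ.* s) ℚ.* c) ℚ.- x ℚ.* c ≡ x ℚ.* (i ℚ.* c ℚ.* s) ℚ.- x ℚ.* (c ℚ.- 1ℚ)
  e0 = ring Rℚ
  A x E : ℕ
  A = B ^ i
  x = B * A
  2≤B : 2 ≤ B
  2≤B = ≤-trans (≤-trans (≤-trans (n≤1+n 2) (n≤1+n 3)) (^-monoʳ-≤ 2 {2} {14 * c} (≤-trans (m≤m+n 2 12) (*-monoʳ-≤ 14 1≤c)))) hB
  instance
   _ : NonZero B
   _ = >-nonZero (<⇒≤ 2≤B)
  1≤A : 1 ≤ A
  1≤A = m^n>0 B i
  1≤x : 1 ≤ x
  1≤x = *-mono-≤ (<⇒≤ 2≤B) 1≤A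
  A≤x : A ≤ x
  A≤x = m≤n*m A B
  ps = primes 1 (suc x)
  hi = primes (suc A) (suc x)
  S = ∑ hi inv
  E = ∑ℕ hi (D x)
  ps≡ : ps ≡ primes 1 (suc A) ++ hi
  ps≡ = primes-++ {1} {suc A} {suc x} (s≤s z≤n) (s≤s A≤x)
  fact : x ! ≤ (A ^ x * 16 ^ x * x ^ E) * 2 ^ (8 * x)
  fact = ≤-trans (!≤∏ (suc x) x x (≤-trans (n≤1+n x) (n≤1+n (suc x))) ≤-refl) (≤-trans (∏ℕ-mono ps (\p _ -> ≤-reflexive (trans (cong (p ^_) (V-split x x p)) (^-distribˡ-+-* p (D x p) (V2 x x p)))))
   (≡≤ℕ (∏ℕ-* ps (\p -> p ^ D x p) (\p -> p ^ V2 x x p)) (*-mono-≤ (≡≤ℕ (trans (cong (\l -> ∏ℕ l (\p -> p ^ D x p)) ps≡) (∏ℕ-++ (primes 1 (suc A)) hi (\p -> p ^ D x p)))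
    (*-mono-≤ (low A B 1≤A (<⇒≤ 2≤B)) (∏≤^∑ hi (D x) x (\p m -> ≤-pred (proj₂ (proj₂ (∈-primes⁻ {suc A} {suc x} m))))))) (high-powers x x))))
  ^-distribʳ-* : ∀ n a b -> (a * b) ^ n ≡ a ^ n * b ^ n
  ^-distribʳ-* zero a b = refl
  ^-distribʳ-* (suc n) a b = trans (cong (a * b *_) (^-distribʳ-* n a b)) (e a b (a ^ n) (b ^ n)) where
   e : ∀ a b c d -> a * b * (c * d) ≡ a * c * (b * d)
   e = solve-ℕ
  step : B ^ x ≤ 2 ^ (14 * x) * B ^ (suc i * E)
  step = *-cancelʳ-≤ (B ^ x) _ (A ^ x) {{m^n≢0 A x {{>-nonZero 1≤A}}}} (≡≤ℕ (sym (^-distribʳ-* x B A)) (≤-trans (n^n≤4^n*n! x) (≤≡ℕ (*-monoʳ-≤ (4 ^ x) fact) (trans (e (4 ^ x) (A ^ x) (16 ^ x) (x ^ E) (2 ^ (8 * x))) (cong₂ (\a b -> a * b * A ^ x) (trans (cong₂ (\a b -> a * b * 2 ^ (8 * x)) (^-*-assoc 2 2 x) (^-*-assoc 2 4 x)) (trans (cong (_* 2 ^ (8 * x)) (sym (^-distribˡ-+-* 2 (2 * x) (4 * x)))) (trans (sym (^-distribˡ-+-* 2 (2 * x + 4 * x) (8 * x))) (cong (2 ^_) (e2 x))))) (^-*-assoc B (suc i) E)))))) where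
   e : ∀ f a s x t -> f * ((a * s * x) * t) ≡ f * s * t * x * a
   e = solve-ℕ
   e2 : ∀ x -> 2 * x + 4 * x + 8 * x ≡ 14 * x
   e2 = solve-ℕ
  step^ : B ^ (x * c) ≤ B ^ (x + suc i * E * c)
  step^ = ≡≤ℕ (sym (^-*-assoc B x c)) (≤-trans (^-monoˡ-≤ c step) (≡≤ℕ (trans (^-distribʳ-* c (2 ^ (14 * x)) (B ^ (suc i * E))) (cong₂ _*_ (trans (^-*-assoc 2 (14 * x) c) (trans (cong (2 ^_) (e x c)) (sym (^-*-assoc 2 (14 * c) x)))) (^-*-assoc B (suc i * E) c)))
   (≤≡ℕ (*-monoˡ-≤ (B ^ (suc i * E * c)) (^-monoˡ-≤ x hB)) (sym (^-distribˡ-+-* B x (suc i * E * c)))))) where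
   e : ∀ x c -> 14 * x * c ≡ 14 * c * x
   e = solve-ℕ
  exps : x * c ≤ x + suc i * E * c
  exps with x * c ≤? x + suc i * E * c
  ... | yes y = y
  ... | no n = contradiction (≤-trans (^-monoʳ-< B 2≤B (≰⇒> n)) step^) (<-irrefl refl)
  ιE : ι E ℚ.≤ ι x ℚ.* S
  ιE = ≡≤ (ι-∑ℕ hi (D x)) (≤≡ (∑-mono∈ hi (\p m -> D-inv x p (1≤prime (proj₁ (∈-primes⁻ {suc A} {suc x} m))))) (∑-*ˡ hi (ι x) inv))
  final : ι x ℚ.* ι c ℚ.≤ ι x ℚ.+ ι (suc i) ℚ.* (ι x ℚ.* S) ℚ.* ι c
  final = ≡≤ (sym (ι-* x c)) (ℚ.≤-trans (ι-mono exps) (≡≤ (trans (ι-+ x (suc i * E * c)) (cong (ι x ℚ.+_) (trans (ι-* (suc i * E) c) (cong (ℚ._* ι c) (ι-* (suc i) E)))))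
   (ℚ.+-monoʳ-≤ (ι x) (*-monoʳ (ι c) (0≤ι c) (*-monoˡ (ι (suc i)) (0≤ι (suc i)) ιE)))))

module PBound where

 open Identities
 open Field
 open Sums
 open Forms
 open Sieve using (∏; ∏-nonneg; Fresh)
 open Smooth using (1≤prime)
 open Cheb
 open Rationals

 pow : ℚ -> ℕ -> ℚ
 pow x zero = 1ℚ
 pow x (suc n) = x * pow x n

 pow-nonneg : ∀ {x} n -> 0ℚ ≤ x -> 0ℚ ≤ pow x n
 pow-nonneg zero h = 0≤1
 pow-nonneg (suc n) h = 0≤* h (pow-nonneg n h)

 pow-mono : ∀ {x y} n -> 0ℚ ≤ x -> x ≤ y -> pow x n ≤ pow y n
 pow-mono zero h p = ≤-refl
 pow-mono (suc n) h p = *-mono h (≤-trans (pow-nonneg n h) (pow-mono n h p)) p (pow-mono n h p)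

 pow-* : ∀ x y n -> pow (x * y) n ≡ pow x n * pow y n
 pow-* x y zero = refl
 pow-* x y (suc n) = trans (cong (x * y *_) (pow-* x y n)) (id48 x y (pow x n) (pow y n))

 pow-+ : ∀ x m n -> pow x (m N.+ n) ≡ pow x m * pow x n
 pow-+ x zero n = sym (*-idˡ _)
 pow-+ x (suc m) n = trans (cong (x *_) (pow-+ x m n)) (sym (*-assoc x (pow x m) (pow x n)))

 pow-ι : ∀ m n -> pow (ι m) n ≡ ι (m ^ n)
 pow-ι m zero = sym (ι-def 1)
 pow-ι m (suc n) = trans (cong (ι m *_) (pow-ι m n)) (sym (ι-* m (m ^ n)))

 bernoulli : ∀ K x -> 0ℚ ≤ x -> 1ℚ + ι K * x ≤ pow (1ℚ + x) K
 bernoulli zero x h = ≡⇒≤ (trans (cong (\z -> 1ℚ + z * x) (ι-def 0)) (trans (cong (1ℚ +_) (*-zeroˡ x)) (+-idʳ 1ℚ)))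
 bernoulli (suc K) x h = ≤-trans (≤by (ι K * x * x) (0≤* (0≤* (0≤ι K) h) h) (trans (cong (\z -> 1ℚ + z * x + ι K * x * x) (trans (ι-+ 1 K) (cong (_+ ι K) (ι-def 1)))) (id49 (ι K) x))) (*-monoˡ (1ℚ + x) (0≤+ 0≤1 h) (bernoulli K x h))

 ∏-mono : ∀ P {f g : ℕ -> ℚ} -> (∀ p -> p ∈ P -> 0ℚ ≤ f p) -> (∀ p -> p ∈ P -> f p ≤ g p) -> ∏ P f ≤ ∏ P g
 ∏-mono [] hf h = ≤-refl
 ∏-mono (p ∷ P) {f} hf h = *-mono (hf p (here refl)) (≤-trans (nn P (\q m -> hf q (there m))) ih) (h p (here refl)) ih where
  nn : ∀ P -> (∀ q -> q ∈ P -> 0ℚ ≤ f q) -> 0ℚ ≤ ∏ P f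
  nn [] h = 0≤1
  nn (q ∷ P) h = 0≤* (h q (here refl)) (nn P (\r m -> h r (there m)))
  ih = ∏-mono P (\q m -> hf q (there m)) (\q m -> h q (there m))

 ∏-pow : ∀ P (f : ℕ -> ℚ) n -> ∏ P (\p -> pow (f p) n) ≡ pow (∏ P f) n
 ∏-pow [] f n = sym (one n) where
  one : ∀ n -> pow 1ℚ n ≡ 1ℚ
  one zero = refl
  one (suc n) = trans (*-idˡ _) (one n)
 ∏-pow (p ∷ P) f n = trans (cong (pow (f p) n *_) (∏-pow P f n)) (sym (pow-* (f p) (∏ P f) n))

 ∏-++ : ∀ P Q (f : ℕ -> ℚ) -> ∏ (P ++ Q) f ≡ ∏ P f * ∏ Q f
 ∏-++ [] Q f = sym (*-idˡ _)
 ∏-++ (p ∷ P) Q f = trans (cong (f p *_) (∏-++ P Q f)) (sym (*-assoc (f p) _ _))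

 ∏≥1 : ∀ P {f : ℕ -> ℚ} -> (∀ p -> 1ℚ ≤ f p) -> 1ℚ ≤ ∏ P f
 ∏≥1 [] h = ≤-refl
 ∏≥1 (p ∷ P) {f} h = ≤-trans (h p) (≡≤ (sym (*-idʳ (f p))) (*-monoˡ (f p) (≤-trans 0≤1 (h p)) (∏≥1 P h)))

 h1 : ℕ -> ℚ
 h1 p = 1ℚ + inv p

 1≤h1 : ∀ p -> 1ℚ ≤ h1 p
 1≤h1 p = ≤+ʳ (0≤inv p)

 0≤h1 : ∀ p -> 0ℚ ≤ h1 p
 0≤h1 p = ≤-trans 0≤1 (1≤h1 p)

 H : ℕ -> ℚ
 H k = ∏ (primes 1 (suc (2 ^ k))) h1

 0≤H : ∀ k -> 0ℚ ≤ H k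
 0≤H k = ∏-nonneg (primes 1 (suc (2 ^ k))) 0≤h1

 private
  ∏-short : ∀ n ps -> 1 ≦ n -> (∀ p -> p ∈ ps -> n ≦ p) -> length ps ≦ n -> ∏ ps h1 * (ι (suc n) - ι (length ps)) ≤ ι (suc n)
  ∏-short n [] hn h l = ≡⇒≤ (trans (cong (\z -> 1ℚ * (ι (suc n) - z)) (ι-def 0)) (id41 (ι (suc n))))
  ∏-short n (p ∷ ps) hn h l = ≡≤ (trans (cong₂ (\x y -> (1ℚ + inv p) * ∏ ps h1 * (x - y)) (ι-suc n) (ι-suc (length ps))) (id42 (inv p) (∏ ps h1) (ι n) L))
   (≤-trans (*-monoˡ (∏ ps h1) (∏-nonneg ps 0≤h1) (≤-trans (*-monoʳ (ι n - L) (diff L≤n) (+-monoʳ-≤ 1ℚ (inv-anti hn (h p (here refl)))))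
    (≤by (inv n * L) (0≤* (0≤inv n) (0≤ι (length ps))) (trans (id43 (ι n) (inv n) L) (cong (\b -> ι n - L + b) (*-inv n hn))))))
   (≡≤ (trans (cong (∏ ps h1 *_) (trans (id44 (ι n) L) (cong (_- L) (sym (ι-suc n))))) refl) (∏-short n ps hn (\q m -> h q (there m)) (<⇒≤ l)))) where
   L = ι (length ps)
   ι-suc : ∀ n -> ι (suc n) ≡ 1ℚ + ι n
   ι-suc n = trans (ι-+ 1 n) (cong (_+ ι n) (ι-def 1))
   L≤n : L ≤ ι n
   L≤n = ι-mono (<⇒≤ l)
  length-bound : ∀ n ps -> (∀ p -> p ∈ ps -> n ≦ p) -> n ^ length ps ≦ ∏ℕ ps (\p -> p)
  length-bound n [] h = N.≤-refl
  length-bound n (p ∷ ps) h = *-mono-≤ (h p (here refl)) (length-bound n ps (\q m -> h q (there m)))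

 H-step : ∀ j -> let k = 4 N.+ j in ι (k ^ 4) * H (suc k) ≤ H k * ι (suc k ^ 4)
 H-step j = ≡≤ (trans (cong (ι (k ^ 4) *_) Hs) (id50 (ι (k ^ 4)) (H k) Pr)) (*-monoˡ (H k) (0≤H k) step) where
  k = 4 N.+ j
  n = 2 ^ k
  ps = primes (suc n) (suc (n N.+ n))
  Pr = ∏ ps h1
  L = ι (length ps)
  Hs : H (suc k) ≡ H k * Pr
  Hs = trans (cong (\l -> ∏ l h1) (trans (cong (\z -> primes 1 (suc z)) (cong (n N.+_) (N.+-identityʳ n))) (primes-++ {1} {suc n} {suc (n N.+ n)} N.z<s (s≤s (m≤m+n n n))))) (∏-++ (primes 1 (suc n)) ps h1)
  big : ∀ p -> p ∈ ps -> n ≦ p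
  big p m = <⇒≤ (proj₁ (proj₂ (∈-primes⁻ {suc n} {suc (n N.+ n)} m)))
  kl : k · length ps ≦ 2 · n
  kl = ≮⇒≥ (\lt -> <-irrefl refl (<-≤-trans (^-monoʳ-< 2 (s≤s N.z<s) lt) (≡≤ℕ (sym (^-*-assoc 2 k (length ps))) (≦-trans (length-bound n ps big) (≤≡ℕ (chebyshev n) (^-*-assoc 2 2 n))))))
  l≤n : length ps ≦ n
  l≤n = *-cancelˡ-≤ 2 (≦-trans (*-monoˡ-≤ (length ps) (m≤m+n 2 (2 N.+ j))) kl)
  sh1 : Pr * (ι (suc n) - L) ≤ ι (suc n)
  sh1 = ∏-short n ps (m^n>0 2 k) big l≤n
  0≤Pr : 0ℚ ≤ Pr
  0≤Pr = ∏-nonneg ps 0≤h1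
  sh2 : ι (suc n) * (ι (2 N.+ j) * Pr) ≤ ι (suc n) * ι k
  sh2 = ≤-trans (≤by (Pr * ((2ℚ * ι (suc n) - ι k * L))) (0≤* 0≤Pr (diff (≡≤ (sym (ι-* k (length ps))) (≤≡ (ι-mono (≦-trans kl (*-monoʳ-≤ 2 (n≤1+n n)))) (trans (ι-* 2 (suc n)) (cong (_* ι (suc n)) (ι-def 2)))))))
    (trans (cong (\z -> ι (suc n) * (ι (2 N.+ j) * Pr) + Pr * (2ℚ * ι (suc n) - z * L)) ek) (trans (id45 (ι (suc n)) (ι (2 N.+ j)) Pr L) (cong (\z -> z * (Pr * (ι (suc n) - L))) (sym ek))))) (≤≡ (*-monoˡ (ι k) (0≤ι k) sh1) (ℚ.*-comm (ι k) (ι (suc n)))) where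
   ek : ι k ≡ 2ℚ + ι (2 N.+ j)
   ek = trans (ι-+ 2 (2 N.+ j)) (cong (_+ ι (2 N.+ j)) (ι-def 2))
  sh3 : ι (2 N.+ j) * Pr ≤ ι k
  sh3 = *-cancel (ι (suc n)) (0<ι N.z<s) sh2
  poly : k ^ 4 · k ≦ (2 N.+ j) · suc k ^ 4
  poly = ≤≡ℕ (m≤m+n (k ^ 4 · k) (226 N.+ 345 · j N.+ 160 · (j · j) N.+ 30 · (j · j · j) N.+ 2 · (j · j · j · j))) (id46 j)
  step : ι (k ^ 4) * Pr ≤ ι (suc k ^ 4)
  step = *-cancel (ι (2 N.+ j)) (0<ι N.z<s) (≡≤ (id50 (ι (2 N.+ j)) (ι (k ^ 4)) Pr) (≤-trans (*-monoˡ (ι (k ^ 4)) (0≤ι (k ^ 4)) sh3) (≡≤ (sym (ι-* (k ^ 4) k)) (≤≡ (ι-mono poly) (ι-* (2 N.+ j) (suc k ^ 4))))))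

 H-bound : ∀ j -> H (4 N.+ j) ≤ H 4 * ι ((4 N.+ j) ^ 4)
 H-bound zero = ≡≤ (sym (*-idʳ (H 4))) (*-monoˡ (H 4) (0≤H 4) (≡≤ (sym (ι-def 1)) (ι-mono {1} {4 ^ 4} N.z<s)))
 H-bound (suc j) = *-cancel (ι (k ^ 4)) (0<ι (m^n>0 k 4)) (≤-trans (subst (\z -> ι (k ^ 4) * H z ≤ H k * ι (z ^ 4)) (sym (+-suc 4 j)) (H-step j))
  (≤≡ (*-monoʳ (ι (k' ^ 4)) (0≤ι (k' ^ 4)) (H-bound j)) (id51 (H 4) (ι (k ^ 4)) (ι (k' ^ 4))))) where
  k = 4 N.+ j
  k' = 4 N.+ suc j

 ∏-primes≤H : ∀ k a b -> 1 ≦ a -> a ≦ b -> b ≦ suc (2 ^ k) -> ∏ (primes a b) h1 ≤ H k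
 ∏-primes≤H k a b ha hab hb = ≤≡ (le (∏ (primes a b) h1) (0≤∏ (primes a b)) (∏≥1 (primes 1 a) 1≤h1) (∏≥1 (primes b c) 1≤h1))
  (sym (trans (cong (\l -> ∏ l h1) (trans (primes-++ {1} {a} {c} ha (≦-trans hab hb)) (cong (primes 1 a ++_) (primes-++ {a} {b} {c} hab hb)))) (trans (∏-++ (primes 1 a) (primes a b ++ primes b c) h1) (cong (∏ (primes 1 a) h1 *_) (∏-++ (primes a b) (primes b c) h1))))) where
  c = suc (2 ^ k)
  0≤∏ : ∀ P -> 0ℚ ≤ ∏ P h1
  0≤∏ P = ∏-nonneg P 0≤h1
  le : ∀ x {y z} -> 0ℚ ≤ x -> 1ℚ ≤ y -> 1ℚ ≤ z -> x ≤ y * (x * z)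
  le x {y} {z} hx hy hz = ≡≤ (id47 x) (*-mono 0≤1 (0≤* hx (≤-trans 0≤1 hz)) hy (*-monoˡ x hx hz))

 wsum≤∏ : ∀ P K (b f : ℕ -> ℚ) q -> 0ℚ ≤ K -> (∀ p -> 0ℚ ≤ b p) -> (∀ m -> 0ℚ ≤ f m) -> Fresh P q -> (∀ p q -> p ∈ P -> Prime p -> p ∤ q -> f (p · q) ≤ b p * f q) ->
  wsum P (\_ -> K) (\d -> f (q · d)) ≤ f q * ∏ P (\p -> 1ℚ + K * b p)
 wsum≤∏ [] K b f q hK hb hf fr h = ≡⇒≤ (trans (cong f (N.*-identityʳ q)) (sym (*-idʳ (f q))))
 wsum≤∏ (p ∷ P) K b f q hK hb hf (pp , p∤q , fr , fr') h = ≤≡ (+-mono (wsum≤∏ P K b f q hK hb hf fr h')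
   (*-monoˡ K hK (≡≤ (wsum-cong P (\d -> cong f (id52 p q d))) (≤-trans (wsum≤∏ P K b f (p · q) hK hb hf fr' h') (*-monoʳ X (∏-nonneg P (\r -> 0≤+ 0≤1 (0≤* hK (hb r)))) (h p q (here refl) pp p∤q))))))
  (id53 (f q) X K (b p)) where
  X = ∏ P (\p -> 1ℚ + K * b p)
  h' : ∀ r q -> r ∈ P -> Prime r -> r ∤ q -> f (r · q) ≤ b r * f q
  h' r q m = h r q (there m)

module Phi where

 open Field
 open Sums
 open Smooth using (∑-multiples'; divides-true; divides-false; divides⇒∣; 1≤prime; cop; prime-∣-prime; cop-false)
 open Cheb using (∏ℕ)
 open import Defs using (range; count; coprimeᵇ; congᵇ; modℕ; φ; divides)
 open import Data.Bool using (T)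
 open import Data.Nat using (_+_; _*_; _≤_; _<_; _%_; _/_; NonZero)
 open import Data.Nat.Properties
 open import Data.Nat.DivMod
 open Rationals using (0ℚ; 1ℚ; ℚ)

 bool-ext : ∀ {a b} -> (a ≡ true -> b ≡ true) -> (b ≡ true -> a ≡ true) -> a ≡ b
 bool-ext {true} {true} f g = refl
 bool-ext {true} {false} f g = sym (f refl)
 bool-ext {false} {true} f g = g refl
 bool-ext {false} {false} f g = refl

 ≡ᵇ-true : ∀ {m n} -> m ≡ n -> (m N.≡ᵇ n) ≡ true
 ≡ᵇ-true {m} {n} e with m N.≡ᵇ n | ≡⇒≡ᵇ m n e
 ... | true | _ = refl

 ≡ᵇ-eq : ∀ {m n} -> (m N.≡ᵇ n) ≡ true -> m ≡ n
 ≡ᵇ-eq {m} {n} e = ≡ᵇ⇒≡ m n (subst T (sym e) _)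

 coprimeᵇ⇒ : ∀ a q -> coprimeᵇ a q ≡ true -> Coprime a q
 coprimeᵇ⇒ a q e = gcd≡1⇒coprime (≡ᵇ-eq e)

 ⇒coprimeᵇ : ∀ a q -> Coprime a q -> coprimeᵇ a q ≡ true
 ⇒coprimeᵇ a q c = ≡ᵇ-true (coprime⇒gcd≡1 c)

 coprimeᵇ-ext : ∀ a q a' q' -> (Coprime a q -> Coprime a' q') -> (Coprime a' q' -> Coprime a q) -> coprimeᵇ a q ≡ coprimeᵇ a' q'
 coprimeᵇ-ext a q a' q' f g = bool-ext (\e -> ⇒coprimeᵇ a' q' (f (coprimeᵇ⇒ a q e))) (\e -> ⇒coprimeᵇ a q (g (coprimeᵇ⇒ a' q' e)))

 coprime-+ : ∀ {a q} i -> Coprime a q -> Coprime (q * i + a) q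
 coprime-+ {a} {q} i c (d1 , d₂) = c (∣m+n∣m⇒∣n d1 (∣m⇒∣m*n i d₂) , d₂)

 coprime-+⁻ : ∀ {a q} i -> Coprime (q * i + a) q -> Coprime a q
 coprime-+⁻ {a} {q} i c (d1 , d₂) = c (∣m∣n⇒∣m+n (∣m⇒∣m*n i d₂) d1 , d₂)

 coprime-prime : ∀ {p a} -> Prime p -> p ∤ a -> Coprime a p
 coprime-prime {p} pp nd {i} (d1 , d₂) with prime⇒irreducible pp d₂
 ... | inj₁ e = e
 ... | inj₂ refl = contradiction d1 nd

 coprime-*ʳ : ∀ {a m n} -> Coprime a m -> Coprime a n -> Coprime a (m * n)
 coprime-*ʳ {a} {m} {n} c1 c2 {i} (d1 , d₂) = c2 (d1 , Data.Nat.Coprimality.coprime-divisor (λ { (x , y) -> c1 (∣-trans x d1 , y) }) d₂)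

 coprime-*ʳ⁻ : ∀ {a} m {n} -> Coprime a (m * n) -> Coprime a n
 coprime-*ʳ⁻ m c (d1 , d₂) = c (d1 , ∣n⇒∣m*n m d₂)

 coprime-*ˡ : ∀ {p a q} -> Prime p -> p ∤ q -> Coprime a q -> Coprime (p * a) q
 coprime-*ˡ {p} {a} {q} pp nd c = Data.Nat.Coprimality.sym (coprime-*ʳ (coprime-prime pp nd) (Data.Nat.Coprimality.sym c))

 coprime-*ˡ⁻ : ∀ p {a q} -> Coprime (p * a) q -> Coprime a q
 coprime-*ˡ⁻ p c (d1 , d₂) = c (∣n⇒∣m*n p d1 , d₂)

 Φ : ℕ -> ℚ
 Φ q = ∑ (range 0 q) (\a -> ind (coprimeᵇ a q))

 φ≡Φ : ∀ q -> ι (φ q) ≡ Φ q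
 φ≡Φ q = trans (count≡∑ (\a -> coprimeᵇ a q) (range 1 (suc q))) (shift q f eq) where
  f : ℕ -> ℚ
  f a = ind (coprimeᵇ a q)
  eq : f q ≡ f 0
  eq = cong ind (coprimeᵇ-ext q q 0 q (λ { c (_ , d) -> c (d , d) }) (λ { c (d , _) -> c (_ ∣0 , d) }))
  shift : ∀ q (f : ℕ -> ℚ) -> f q ≡ f 0 -> ∑ (range 1 (suc q)) f ≡ ∑ (range 0 q) f
  shift zero f eq = refl
  shift (suc q) f eq = trans (∑-range-last 1 (suc q) f N.z<s) (trans (cong (∑ (range 1 (suc q)) f ℚ.+_) eq) (trans (ℚ.+-comm (∑ (range 1 (suc q)) f) (f 0)) (sym (trans (∑-range-split 0 1 (suc q) f z≤n N.z<s) (cong (ℚ._+ ∑ (range 1 (suc q)) f) (ℚ.+-identityʳ (f 0)))))))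

 Φ-* : ∀ p q -> Prime p -> p ∤ q -> Φ (p * q) ≡ ι (p ∸ 1) ℚ.* Φ q
 Φ-* p q pp nd = trans (e1 _ _ (Φ q) (ι p) all mult sum≡) (cong (ℚ._* Φ q) (sym ι∸)) where
  f : ℕ -> ℚ
  f a = ind (coprimeᵇ a q)
  ι∸ : ι (p ∸ 1) ≡ ι p ℚ.- 1ℚ
  ι∸ = trans (e (ι (p ∸ 1))) (cong (ℚ._- 1ℚ) (trans (cong (ι (p ∸ 1) ℚ.+_) (sym (ι-def 1))) (trans (sym (ι-+ (p ∸ 1) 1)) (cong ι (m∸n+n≡m (1≤prime pp)))))) where
   e : ∀ a -> a ≡ (a ℚ.+ 1ℚ) ℚ.- 1ℚ
   e = ring Rℚ
  all : ∑ (range 0 (p * q)) f ≡ ι p ℚ.* Φ q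
  all = trans (cong₂ (\a b -> ∑ (range a b) f) (sym (*-zeroʳ q)) (*-comm p q)) (trans (∑-blocks q 0 p f) (trans (∑-cong (range 0 p) (\i -> ∑-cong (range 0 q) (\r -> cong ind (coprimeᵇ-ext (q * i + r) q r q (coprime-+⁻ i) (coprime-+ i)))))
   (trans (∑-const (range 0 p) (Φ q)) (cong (\z -> ι z ℚ.* Φ q) (length-range 0 p)))))
  mult : ∑ (range 0 (p * q)) (\a -> ind (divides p a) ℚ.* f a) ≡ Φ q
  mult = trans (∑-multiples' p q f (1≤prime pp)) (∑-cong (range 0 q) (\a -> cong ind (coprimeᵇ-ext (p * a) q a q (coprime-*ˡ⁻ p) (coprime-*ˡ pp nd))))
  pt : ∀ a -> f a ≡ ind (coprimeᵇ a (p * q)) ℚ.+ ind (divides p a) ℚ.* f a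
  pt a with p ∣? a
  ... | yes d = trans (e (f a)) (cong (\z -> z ℚ.+ 1ℚ ℚ.* f a) (cong ind (sym no1))) where
   e : ∀ x -> x ≡ 0ℚ ℚ.+ 1ℚ ℚ.* x
   e = ring Rℚ
   no1 : coprimeᵇ a (p * q) ≡ false
   no1 with coprimeᵇ a (p * q) in eq
   ... | false = refl
   ... | true = contradiction (subst Prime (coprimeᵇ⇒ a (p * q) eq (d , m∣m*n q)) pp) ¬prime[1]
  ... | no n = trans (e (f a)) (cong (\z -> z ℚ.+ 0ℚ ℚ.* f a) (cong ind (coprimeᵇ-ext a q a (p * q) (coprime-*ʳ (coprime-prime pp n)) (coprime-*ʳ⁻ p)))) where
   e : ∀ x -> x ≡ x ℚ.+ 0ℚ ℚ.* x
   e = ring Rℚ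
  sum≡ : ∑ (range 0 (p * q)) f ≡ Φ (p * q) ℚ.+ ∑ (range 0 (p * q)) (\a -> ind (divides p a) ℚ.* f a)
  sum≡ = trans (∑-cong (range 0 (p * q)) pt) (∑-+ (range 0 (p * q)) _ _)
  e1 : ∀ s m φ' p' -> s ≡ p' ℚ.* φ' -> m ≡ φ' -> s ≡ Φ (p * q) ℚ.+ m -> Φ (p * q) ≡ (p' ℚ.- 1ℚ) ℚ.* φ'
  e1 s m φ' p' refl refl h = trans (e (Φ (p * q)) m) (trans (cong (ℚ._- m) (sym h)) (e2 p' m)) where
   e : ∀ a m -> a ≡ (a ℚ.+ m) ℚ.- m
   e = ring Rℚ
   e2 : ∀ p m -> p ℚ.* m ℚ.- m ≡ (p ℚ.- 1ℚ) ℚ.* m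
   e2 = ring Rℚ

 φ-* : ∀ p q -> Prime p -> p ∤ q -> φ (p * q) ≡ (p ∸ 1) * φ q
 φ-* p q pp nd = ≤-antisym (ι-cancel (ℚ.≤-reflexive e)) (ι-cancel (ℚ.≤-reflexive (sym e))) where
  e : ι (φ (p * q)) ≡ ι ((p ∸ 1) * φ q)
  e = trans (φ≡Φ (p * q)) (trans (Φ-* p q pp nd) (trans (cong (ι (p ∸ 1) ℚ.*_) (sym (φ≡Φ q))) (sym (ι-* (p ∸ 1) (φ q)))))

 cop-coprime : ∀ Q a -> (∀ q -> q ∈ Q -> Prime q) -> cop Q a ≡ coprimeᵇ a (∏ℕ Q (\q -> q))
 cop-coprime Q a h = bool-ext (\e -> ⇒coprimeᵇ a (∏ℕ Q (\q -> q)) (to Q h e)) (\e -> from Q h (coprimeᵇ⇒ a (∏ℕ Q (\q -> q)) e)) where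
  to : ∀ Q -> (∀ q -> q ∈ Q -> Prime q) -> cop Q a ≡ true -> Coprime a (∏ℕ Q (\q -> q))
  to [] h e (_ , d) = ∣1⇒≡1 d
  to (q ∷ Q) h e with divides q a in eq
  ... | false = coprime-*ʳ (coprime-prime (h q (here refl)) (\d -> contradiction (trans (sym eq) (divides-true d)) λ ())) (to Q (\r m -> h r (there m)) e)
  from : ∀ Q -> (∀ q -> q ∈ Q -> Prime q) -> Coprime a (∏ℕ Q (\q -> q)) -> cop Q a ≡ true
  from [] h c = refl
  from (q ∷ Q) h c = cong₂ (\x y -> not x ∧ y) (divides-false {q} {a} (\d -> ¬prime[1] (subst Prime (c (d , m∣m*n _)) (h q (here refl))))) (from Q (\r m -> h r (there m)) (coprime-*ʳ⁻ q c))

 -- congruence modulo q, without subtraction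
 record Cong (q x y : ℕ) : Set where
  constructor cg
  field
   s t : ℕ
   eq : x + q * s ≡ y + q * t

 congᵇ⇒ : ∀ q n a -> congᵇ q n a ≡ true -> Cong q n a
 congᵇ⇒ zero n a e = cg 0 0 (cong (_+ 0) (≡ᵇ-eq e))
 congᵇ⇒ q@(suc _) n a e = cg (a / q) (n / q) (begin
  n + q * (a / q)                           ≡⟨ cong (_+ q * (a / q)) (m≡m%n+[m/n]*n n q) ⟩
  n % q + n / q * q + q * (a / q)           ≡⟨ e1 (n % q) (n / q) q (a / q) ⟩
  n % q + a / q * q + q * (n / q)           ≡⟨ cong (\z -> z + a / q * q + q * (n / q)) (≡ᵇ-eq {n % q} {a % q} e) ⟩
  a % q + a / q * q + q * (n / q)           ≡⟨ cong (_+ q * (n / q)) (m≡m%n+[m/n]*n a q) ⟨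
  a + q * (n / q) ∎) where
  open ≡-Reasoning
  e1 : ∀ r n q a -> r + n * q + q * a ≡ r + a * q + q * n
  e1 = solve-ℕ

 ⇒congᵇ : ∀ q n a -> Cong q n a -> congᵇ q n a ≡ true
 ⇒congᵇ zero n a (cg s t e) = ≡ᵇ-true (trans (sym (+-identityʳ n)) (trans e (+-identityʳ a)))
 ⇒congᵇ q@(suc _) n a (cg s t e) = ≡ᵇ-true (trans (sym (h n s)) (trans (cong (_% q) e) (h a t))) where
  h : ∀ x s -> (x + q * s) % q ≡ x % q
  h x s = trans (cong (\z -> (x + z) % q) (*-comm q s)) ([m+kn]%n≡m%n x s q)

 Cong-sym : ∀ {q x y} -> Cong q x y -> Cong q y x
 Cong-sym (cg s t e) = cg t s (sym e)

 Cong-trans : ∀ {q x y z} -> Cong q x y -> Cong q y z -> Cong q x z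
 Cong-trans {q} {x} {y} {z} (cg s t e) (cg s' t' e') = cg (s + s') (t + t') (trans (e1 x q s s') (trans (cong (_+ q * s') e) (trans (e2 y q t s') (trans (cong (_+ q * t) e') (e3 z q t t'))))) where
  e1 : ∀ x q s s' -> x + q * (s + s') ≡ x + q * s + q * s'
  e1 = solve-ℕ
  e2 : ∀ y q t s' -> y + q * t + q * s' ≡ y + q * s' + q * t
  e2 = solve-ℕ
  e3 : ∀ z q t t' -> z + q * t' + q * t ≡ z + q * (t + t')
  e3 = solve-ℕ

 Cong-+ : ∀ {q x y} k -> Cong q x y -> Cong q (x + k) (y + k)
 Cong-+ {q} {x} {y} k (cg s t e) = cg s t (trans (e1 x k (q * s)) (trans (cong (_+ k) e) (sym (e1 y k (q * t))))) where
  e1 : ∀ x k z -> x + k + z ≡ x + z + k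
  e1 = solve-ℕ

 Cong-+⁻ : ∀ {q x y} k -> Cong q (x + k) (y + k) -> Cong q x y
 Cong-+⁻ {q} {x} {y} k (cg s t e) = cg s t (+-cancelʳ-≡ k _ _ (trans (sym (e1 x k (q * s))) (trans e (e1 y k (q * t))))) where
  e1 : ∀ x k z -> x + k + z ≡ x + z + k
  e1 = solve-ℕ

 Cong-* : ∀ {q x y} k -> Cong q x y -> Cong q (k * x) (k * y)
 Cong-* {q} {x} {y} k (cg s t e) = cg (k * s) (k * t) (trans (e1 k x q s) (trans (cong (k *_) e) (sym (e1 k y q t)))) where
  e1 : ∀ k x q s -> k * x + q * (k * s) ≡ k * (x + q * s)
  e1 = solve-ℕ

 Cong-divisor : ∀ {p q x y} -> Cong (p * q) x y -> Cong q x y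
 Cong-divisor {p} {q} {x} {y} (cg s t e) = cg (p * s) (p * t) (trans (e1 x p q s) (trans e (sym (e1 y p q t)))) where
  e1 : ∀ x p q s -> x + q * (p * s) ≡ x + p * q * s
  e1 = solve-ℕ

 Cong-∣ : ∀ {q x y d} -> d ∣ q -> Cong q x y -> d ∣ x -> d ∣ y
 Cong-∣ {q} {x} {y} {d} dq (cg s t e) dx = ∣m+n∣m⇒∣n {d} {q * t} (subst (d ∣_) (trans e (+-comm y (q * t))) (∣m∣n⇒∣m+n dx (∣m⇒∣m*n s dq))) (∣m⇒∣m*n t dq)

 Cong-coprime : ∀ {q x y} -> Cong q x y -> Coprime x q -> Coprime y q
 Cong-coprime c h (d1 , d₂) = h (Cong-∣ d₂ (Cong-sym c) d1 , d₂)

 Cong-⇒∣ : ∀ {q x} d -> Cong q x (x + d) -> q ∣ d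
 Cong-⇒∣ {q} {x} d (cg s t e) = ∣m+n∣m⇒∣n {q} {q * t} (subst (q ∣_) (trans (+-cancelˡ-≡ x _ _ (trans e (+-assoc x d (q * t)))) (+-comm d (q * t))) (m∣m*n s)) (m∣m*n t)

 Cong-join-≤ : ∀ {p q x y} -> Prime p -> p ∤ q -> x ≤ y -> Cong p x y -> Cong q x y -> Cong (p * q) x y
 Cong-join-≤ {p} {q} {x} pp nd le cp cq with m≤n⇒∃[o]m+o≡n le
 ... | d , refl with Cong-⇒∣ d cq
 ... | ℕ∣.divides k refl with euclidsLemma k q pp (Cong-⇒∣ (k * q) cp)
 ... | inj₂ dq = contradiction dq nd
 ... | inj₁ (ℕ∣.divides j refl) = cg j 0 (trans (e1 x p q j) (sym (trans (cong (x + j * p * q +_) (*-zeroʳ (p * q))) (+-identityʳ _)))) where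
  e1 : ∀ x p q j -> x + p * q * j ≡ x + j * p * q
  e1 = solve-ℕ

 Cong-join : ∀ {p q x y} -> Prime p -> p ∤ q -> Cong p x y -> Cong q x y -> Cong (p * q) x y
 Cong-join {p} {q} {x} {y} pp nd cp cq with ≤-total x y
 ... | inj₁ le = Cong-join-≤ pp nd le cp cq
 ... | inj₂ le = Cong-sym (Cong-join-≤ pp nd le (Cong-sym cp) (Cong-sym cq))

 solve-cong : ∀ p q a c -> 1 ≤ p -> Coprime q p -> ∃[ i ] Cong p (q * i + a) c
 solve-cong p q a c 1≤p cop with coprime-Bézout cop
 ... | Bézout.+- u v e = u * t , cg 0 (a + v * t) (begin
  q * (u * t) + a + p * 0     ≡⟨ e1 q u t a p ⟩
  u * q * t + a               ≡⟨ cong (\z -> z * t + a) e ⟨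
  (1 + v * p) * t + a         ≡⟨ e2 v p t a ⟩
  a + t + p * (v * t)         ≡⟨ cong (_+ p * (v * t)) at ⟩
  c + a * p + p * (v * t)     ≡⟨ e3 c a p v t ⟩
  c + p * (a + v * t) ∎) where
  open ≡-Reasoning
  t = c + a * (p ∸ 1)
  at : a + t ≡ c + a * p
  at = trans (e0 a c (p ∸ 1)) (cong (\z -> c + a * z) (m+[n∸m]≡n 1≤p)) where
   e0 : ∀ a c r -> a + (c + a * r) ≡ c + a * (1 + r)
   e0 = solve-ℕ
  e1 : ∀ q u t a p -> q * (u * t) + a + p * 0 ≡ u * q * t + a
  e1 = solve-ℕ
  e2 : ∀ v p t a -> (1 + v * p) * t + a ≡ a + t + p * (v * t)
  e2 = solve-ℕ
  e3 : ∀ c a p v t -> c + a * p + p * (v * t) ≡ c + p * (a + v * t)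
  e3 = solve-ℕ
 ... | Bézout.-+ u v e = u * (r * t) , cg t (a + v * (r * t)) (begin
  q * (u * (r * t)) + a + p * t             ≡⟨ cong (\z -> q * (u * (r * t)) + a + z * t) pr ⟨
  q * (u * (r * t)) + a + (1 + r) * t       ≡⟨ e1 q u r t a ⟩
  (1 + u * q) * (r * t) + (a + t)           ≡⟨ cong₂ (\x y -> x * (r * t) + y) e at ⟩
  v * p * (r * t) + (c + a * p)             ≡⟨ e2 v p r t c a ⟩
  c + p * (a + v * (r * t)) ∎) where
  open ≡-Reasoning
  r = p ∸ 1
  t = c + a * r
  pr : 1 + r ≡ p
  pr = m+[n∸m]≡n 1≤p
  at : a + t ≡ c + a * p
  at = trans (e0 a c r) (cong (\z -> c + a * z) pr) where
   e0 : ∀ a c r -> a + (c + a * r) ≡ c + a * (1 + r)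
   e0 = solve-ℕ
  e1 : ∀ q u r t a -> q * (u * (r * t)) + a + (1 + r) * t ≡ (1 + u * q) * (r * t) + (a + t)
  e1 = solve-ℕ
  e2 : ∀ v p r t c a -> v * p * (r * t) + (c + a * p) ≡ c + p * (a + v * (r * t))
  e2 = solve-ℕ

 crt : ∀ p q a c -> Prime p -> p ∤ q -> 1 ≤ q -> ∃[ a' ] (a' < p * q × Cong q a' a × Cong p a' c × (∀ n -> ind (congᵇ q n a) ℚ.* ind (congᵇ p n c) ≡ ind (congᵇ (p * q) n a')))
 crt p q a c pp nd 1≤q with solve-cong p q a c (1≤prime pp) (coprime-prime pp nd)
 ... | i , ci = a' , m%n<n x (p * q) , ca , cc , \n -> trans (sym (ind-∧ (congᵇ q n a) (congᵇ p n c))) (cong ind (bool-ext (to n) (from n))) where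
  instance
   nz : NonZero (p * q)
   nz = >-nonZero (*-mono-≤ (1≤prime pp) 1≤q)
  x = q * i + a
  a' = x % (p * q)
  a'x : Cong (p * q) a' x
  a'x = cg (x / (p * q)) 0 (trans (trans (cong (a' +_) (*-comm (p * q) (x / (p * q)))) (sym (m≡m%n+[m/n]*n x (p * q)))) (sym (trans (cong (x +_) (*-zeroʳ (p * q))) (+-identityʳ x))))
  ca : Cong q a' a
  ca = Cong-trans (Cong-divisor {p} a'x) (cg 0 i (trans (cong (x +_) (*-zeroʳ q)) (trans (+-identityʳ x) (+-comm (q * i) a))))
  cc : Cong p a' c
  cc = Cong-trans (Cong-divisor {q} (subst (\z -> Cong z a' x) (*-comm p q) a'x)) ci
  to : ∀ n -> congᵇ q n a ∧ congᵇ p n c ≡ true -> congᵇ (p * q) n a' ≡ true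
  to n e with congᵇ q n a in e1 | congᵇ p n c in e2
  ... | true | true = ⇒congᵇ (p * q) n a' (Cong-join pp nd (Cong-trans (congᵇ⇒ p n c e2) (Cong-sym cc)) (Cong-trans (congᵇ⇒ q n a e1) (Cong-sym ca)))
  from : ∀ n -> congᵇ (p * q) n a' ≡ true -> congᵇ q n a ∧ congᵇ p n c ≡ true
  from n e = cong₂ _∧_ (⇒congᵇ q n a (Cong-trans (Cong-divisor {p} (congᵇ⇒ (p * q) n a' e)) ca))
   (⇒congᵇ p n c (Cong-trans (Cong-divisor {q} (subst (\z -> Cong z n a') (*-comm p q) (congᵇ⇒ (p * q) n a' e))) cc))

module Bins where

 open Identities
 open Field
 open Sums
 open Forms using (wsum; wsum-mono; wsum-cong; wsum-∑; wsum-*ˡ)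
 open Sieve using (below; below-true; below-anti; 0≤below)
 open Smooth
 open Cheb
 open Mertens using (∑inv²; ∃-prime; 2Q; 0≤2Q; inv1)
 open Phi using (Φ; cop-coprime; bool-ext; coprimeᵇ-ext; coprime-+; coprime-+⁻)
 open import Defs using (range; coprimeᵇ)
 open import Data.Bool using (T)
 open Rationals

 hsum : ℕ -> ℕ -> ℚ
 hsum a b = ∑ (range a b) inv

 hsum-nonneg : ∀ a b -> 0ℚ ≤ hsum a b
 hsum-nonneg a b = ∑-nonneg (range a b) 0≤inv

 hsum-mono : ∀ a {b c} -> a ≦ b -> b ≦ c -> hsum a b ≤ hsum a c
 hsum-mono a {b} {c} p q = ≤≡ (≤+ʳ (hsum-nonneg b c)) (sym (∑-range-split a b c inv p q))

 hsum-shift : ∀ a b -> ∑ (range a b) (\j -> inv (suc j)) ≡ hsum (suc a) (suc b)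
 hsum-shift a b = sym (∑-range-shift a b 1 inv)

 ∑-const-range : ∀ a b c -> ∑ (range a b) (\_ -> c) ≡ ι (b ∸ a) * c
 ∑-const-range a b c = trans (∑-const (range a b) c) (cong (\z -> ι z * c) (length-range a b))

 *-inv-* : ∀ a j -> 1 ≦ a -> ι a * inv (a · j) ≡ inv j
 *-inv-* a j h = trans (cong (ι a *_) (inv-* a j)) (trans (sym (*-assoc (ι a) (inv a) (inv j))) (trans (cong (_* inv j) (*-inv a h)) (*-idˡ (inv j))))

 private
  blocks : ∀ a m k (f : ℕ -> ℚ) -> m ≦ k -> ∑ (range (a · m) (a · k)) f ≡ ∑ (range m k) (\i -> ∑ (range 0 a) (\r -> f (a · i N.+ r)))
  blocks a m k f h = subst (\z -> ∑ (range (a · m) (a · z)) f ≡ ∑ (range m z) (\i -> ∑ (range 0 a) (\r -> f (a · i N.+ r)))) (m+[n∸m]≡n h) (∑-blocks a m (k ∸ m) f)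

 hsum-scale-≤ : ∀ a B -> 1 ≦ a -> 1 ≦ B -> hsum a (a · B) ≤ hsum 1 B
 hsum-scale-≤ a B ha hB = ≡≤ (trans (cong (\z -> hsum z (a · B)) (sym (N.*-identityʳ a))) (blocks a 1 B inv hB))
  (∑-mono∈ (range 1 B) (\j m -> ≤≡ (∑-mono (range 0 a) (\r -> inv-anti (*-mono-≤ ha (proj₁ (∈-range⁻ {1} {B} m))) (m≤m+n (a · j) r)))
   (trans (∑-const-range 0 a (inv (a · j))) (*-inv-* a j ha))))

 hsum-scale-≥ : ∀ a B -> 1 ≦ a -> 1 ≦ B -> hsum 1 B - 1ℚ ≤ hsum a (a · B)
 hsum-scale-≥ a B ha hB = ≤-trans lower (≤≡ (∑-mono∈ (range 1 B) (\j m -> ≡≤ (sym (trans (∑-const-range 0 a (inv (a · suc j))) (*-inv-* a (suc j) ha)))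
   (∑-mono∈ (range 0 a) (\r r∈ -> inv-anti (≦-trans (*-mono-≤ ha (proj₁ (∈-range⁻ {1} {B} m))) (m≤m+n (a · j) r)) (≤≡ℕ (N.+-monoʳ-≤ (a · j) (<⇒≤ (proj₂ (∈-range⁻ {0} {a} r∈)))) (trans (+-comm (a · j) a) (sym (*-suc a j))))))))
  (trans (sym (blocks a 1 B inv hB)) (cong (\z -> hsum z (a · B)) (N.*-identityʳ a)))) where
  lower : hsum 1 B - 1ℚ ≤ ∑ (range 1 B) (\j -> inv (suc j))
  lower = ≤≡ (≤by (inv B) (0≤inv B) (trans (id57 (hsum 1 B) (inv B)) (trans (cong (_- 1ℚ) (sym (∑-range-last 1 B inv hB))) (trans (cong (_- 1ℚ) (trans (∑-range-split 1 2 (suc B) inv N.z<s (s≤s hB)) (cong (_+ hsum 2 (suc B)) (trans (+-idʳ (inv 1)) inv1)))) (id58 (hsum 2 (suc B))))))) (sym (hsum-shift 1 B))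

 hsum-log : ∀ b -> inv 2 * ι b ≤ hsum 1 (2 ^ b)
 hsum-log zero = ≡⇒≤ (trans (cong (inv 2 *_) (ι-def 0)) (*-zeroʳ (inv 2)))
 hsum-log (suc b) = ≡≤ (trans (cong (inv 2 *_) (trans (cong ι (+-comm 1 b)) (ι-+ b 1))) (trans (*-distribˡ-+ (inv 2) (ι b) (ι 1)) (cong (inv 2 * ι b +_) (trans (cong (inv 2 *_) (ι-def 1)) (*-idʳ (inv 2))))))
  (≤≡ (+-mono (hsum-log b) half) (sym (∑-range-split 1 n (2 ^ suc b) inv 1≤n (m≤m+n n (n N.+ 0))))) where
  n = 2 ^ b
  1≤n : 1 ≦ n
  1≤n = m^n>0 2 b
  half : inv 2 ≤ hsum n (2 · n)
  half = ≡≤ (sym (trans (∑-const-range n (2 · n) (inv (2 · n))) (trans (cong (\z -> ι z * inv (2 · n)) (trans (m+n∸m≡n n (n N.+ 0)) (N.+-identityʳ n))) (trans (cong (\z -> ι n * inv z) (*-comm 2 n)) (*-inv-* n 2 1≤n)))))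
   (∑-mono∈ (range n (2 · n)) (\j m -> inv-anti (≦-trans 1≤n (proj₁ (∈-range⁻ {n} {2 · n} m))) (<⇒≤ (proj₂ (∈-range⁻ {n} {2 · n} m)))))

 module Coprime-sums (Qs : List ℕ) (prQ : ∀ q -> q ∈ Qs -> Prime q) (q0 : ℕ) (q0∈ : q0 ∈ Qs) where
  W = ∏ℕ Qs (\q -> q)
  1≤W : 1 ≦ W
  1≤W = ∏ℕ≥1 Qs (\q m -> 1≤prime (prQ q m))
  c = Φ W * inv W
  0≤Φ : 0ℚ ≤ Φ W
  0≤Φ = ∑-nonneg (range 0 W) (\a -> 0≤ind (coprimeᵇ a W))
  0≤c : 0ℚ ≤ c
  0≤c = 0≤* 0≤Φ (0≤inv W)
  g : ℕ -> ℚ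
  g m = ind (cop Qs m) * inv m
  0≤g : ∀ m -> 0ℚ ≤ g m
  0≤g m = 0≤* (0≤ind (cop Qs m)) (0≤inv m)
  cop-periodic : ∀ j r -> cop Qs (W · j N.+ r) ≡ coprimeᵇ r W
  cop-periodic j r = trans (cop-coprime Qs (W · j N.+ r) prQ) (coprimeᵇ-ext (W · j N.+ r) W r W (coprime-+⁻ j) (coprime-+ j))
  private
   blockΦ : ∀ j x -> ∑ (range 0 W) (\r -> ind (cop Qs (W · j N.+ r)) * x) ≡ Φ W * x
   blockΦ j x = trans (∑-*ʳ (range 0 W) x (\r -> ind (cop Qs (W · j N.+ r)))) (cong (_* x) (∑-cong (range 0 W) (\r -> cong ind (cop-periodic j r))))
  sum-≤ : ∀ a b -> 1 ≦ a -> a ≦ b -> ∑ (range (W · a) (W · b)) g ≤ c * hsum a b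
  sum-≤ a b ha hab = ≡≤ (blocks W a b g hab) (≤≡ (∑-mono∈ (range a b) (\j m -> ≤≡ (∑-mono (range 0 W) (\r ->
    *-monoˡ (ind (cop Qs (W · j N.+ r))) (0≤ind (cop Qs (W · j N.+ r))) (inv-anti (*-mono-≤ 1≤W (≦-trans ha (proj₁ (∈-range⁻ {a} {b} m)))) (m≤m+n (W · j) r))))
    (trans (blockΦ j (inv (W · j))) (trans (cong (Φ W *_) (inv-* W j)) (sym (*-assoc (Φ W) (inv W) (inv j)))))))
   (∑-*ˡ (range a b) c inv))
  sum-≥ : ∀ a b -> a ≦ b -> c * hsum (suc a) (suc b) ≤ ∑ (range (W · a) (W · b)) g
  sum-≥ a b hab = ≡≤ (trans (cong (c *_) (sym (hsum-shift a b))) (sym (∑-*ˡ (range a b) c (\j -> inv (suc j)))))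
   (≤≡ (∑-mono (range a b) (\j -> ≡≤ (sym (trans (blockΦ j (inv (W · suc j))) (trans (cong (Φ W *_) (inv-* W (suc j))) (sym (*-assoc (Φ W) (inv W) (inv (suc j)))))))
    (∑-mono∈ (range 0 W) (\r r∈ -> pt j r (proj₂ (∈-range⁻ {0} {W} r∈)))))) (sym (blocks W a b g hab))) where
   pt : ∀ j r -> r N.< W -> ind (cop Qs (W · j N.+ r)) * inv (W · suc j) ≤ g (W · j N.+ r)
   pt j r r<W with W · j N.+ r in eq
   ... | suc m = *-monoˡ (ind (cop Qs (suc m))) (0≤ind (cop Qs (suc m))) (inv-anti N.z<s (≡≤ℕ (sym eq) (≤≡ℕ (N.+-monoʳ-≤ (W · j) (<⇒≤ r<W)) (trans (+-comm (W · j) W) (sym (*-suc W j))))))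
   ... | zero = ≡≤ (trans (cong (\b -> ind b * inv (W · suc j)) (cop-false Qs q0 0 q0∈ (q0 ∣0))) (*-zeroˡ (inv (W · suc j)))) (0≤g 0)
  g0 : g 0 ≡ 0ℚ
  g0 = trans (cong (ind (cop Qs 0) *_) inv-0) (*-zeroʳ (ind (cop Qs 0)))
  module _ (B' : ℕ) (1≤B' : 1 ≦ B') where
   B = W · B'
   1≤B : 1 ≦ B
   1≤B = *-mono-≤ 1≤W 1≤B'
   ℓ = hsum 1 B
   private
    0≤W : 0ℚ ≤ ι W
    0≤W = 0≤ι W
    hsum≤ : ∀ n -> 1 ≦ n -> hsum 1 n ≤ ι n
    hsum≤ n h = ≤-trans (∑-mono∈ (range 1 n) (\j m -> ≤≡ (inv-anti N.≤-refl (proj₁ (∈-range⁻ {1} {n} m))) inv1)) (≡≤ (trans (∑-const-range 1 n 1ℚ) (*-idʳ (ι (n ∸ 1)))) (ι-mono (m∸n≤m n 1)))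
    a : ℕ -> ℕ
    a i = B' · B ^ i
    1≤a : ∀ i -> 1 ≦ a i
    1≤a i = *-mono-≤ 1≤B' (m^n>0 B {{>-nonZero 1≤B}} i)
    lo : ∀ i -> B ^ suc i ≡ W · a i
    lo i = N.*-assoc W B' (B ^ i)
    hi : ∀ i -> B ^ suc (suc i) ≡ W · (a i · B)
    hi i = trans (cong (B N.*_) (lo i)) (trans (*-comm B (W · a i)) (N.*-assoc W (a i) B))
    a≤aB : ∀ i -> a i ≦ a i · B
    a≤aB i = m≤m*n (a i) B {{>-nonZero 1≤B}}
   bin-≤ : ∀ i -> ∑ (range (B ^ i) (B ^ suc i)) g ≤ c * ℓ + ι W
   bin-≤ zero = ≤-trans (≤by (g 0) (0≤g 0) (trans (ℚ.+-comm _ (g 0)) (trans (cong (_+ ∑ (range 1 (B · 1)) g) (sym (+-idʳ (g 0)))) (sym (∑-range-split 0 1 (B · 1) g z≤n 1≤B1)))))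
     (≡≤ (trans (cong (\z -> ∑ (range 0 z) g) (N.*-identityʳ B)) (trans (∑-range-split 0 W B g z≤n W≤B) (ℚ.+-comm (∑ (range 0 W) g) (∑ (range W B) g))))
     (+-mono (≡≤ (cong (\z -> ∑ (range z B) g) (sym (N.*-identityʳ W))) (≤-trans (sum-≤ 1 B' N.≤-refl 1≤B') (*-monoˡ c 0≤c (hsum-mono 1 1≤B' (m≤n*m B' W {{>-nonZero 1≤W}})))))
      (≤≡ (∑-mono (range 0 W) {g = \_ -> 1ℚ} g≤1) (trans (∑-const-range 0 W 1ℚ) (*-idʳ (ι W)))))) where
    1≤B1 : 1 ≦ B · 1
    1≤B1 = ≤≡ℕ 1≤B (sym (N.*-identityʳ B))
    W≤B : W ≦ B
    W≤B = m≤m*n W B' {{>-nonZero 1≤B'}}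
    g≤1 : ∀ m -> g m ≤ 1ℚ
    g≤1 zero = ≡≤ g0 0≤1
    g≤1 (suc m) = ≤≡ (*-mono (0≤ind (cop Qs (suc m))) 0≤1 (ind≤1 (cop Qs (suc m))) (≤≡ (inv-anti N.≤-refl N.z<s) inv1)) (*-idˡ 1ℚ)
   bin-≤ (suc i) = ≡≤ (cong₂ (\x y -> ∑ (range x y) g) (lo i) (hi i)) (≤-trans (sum-≤ (a i) (a i · B) (1≤a i) (a≤aB i))
    (≤-trans (*-monoˡ c 0≤c (hsum-scale-≤ (a i) B (1≤a i) 1≤B)) (≤+ʳ 0≤W)))
   bin-≥ : ∀ i -> c * (ℓ - (1ℚ + 1ℚ) - ι W) ≤ ∑ (range (B ^ i) (B ^ suc i)) g
   bin-≥ zero = ≤-trans (*-monoˡ c 0≤c low) (≤≡ (sum-≥ 0 B' z≤n) (trans (cong₂ (\x y -> ∑ (range x y) g) (N.*-zeroʳ W) (sym (N.*-identityʳ B)))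
     (trans (∑-range-split 0 1 (B · 1) g z≤n (≤≡ℕ 1≤B (sym (N.*-identityʳ B)))) (trans (cong (_+ ∑ (range 1 (B · 1)) g) (trans (+-idʳ (g 0)) g0)) (+-idˡ _))))) where
    low : ℓ - (1ℚ + 1ℚ) - ι W ≤ hsum 1 (suc B')
    low = ≤-trans (≤by ((1ℚ + 1ℚ) + (ι W - hsum B' (B' · W))) (0≤+ (0≤+ 0≤1 0≤1) (diff (≤-trans (hsum-scale-≤ B' W 1≤B' 1≤W) (hsum≤ W 1≤W))))
     (trans (cong (\z -> z - (1ℚ + 1ℚ) - ι W + ((1ℚ + 1ℚ) + (ι W - hsum B' (B' · W)))) (trans (∑-range-split 1 B' B inv 1≤B' (m≤n*m B' W {{>-nonZero 1≤W}})) (cong (\z -> hsum 1 B' + hsum B' z) (*-comm W B')))) (id54 (hsum 1 B') (hsum B' (B' · W)) (ι W))))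
     (hsum-mono 1 1≤B' (n≤1+n B'))
   bin-≥ (suc i) = ≤-trans (*-monoˡ c 0≤c low) (≤≡ (sum-≥ (a i) (a i · B) (a≤aB i)) (cong₂ (\x y -> ∑ (range x y) g) (sym (lo i)) (sym (hi i)))) where
    A = a i
    shift : hsum A (A · B) + inv (A · B) ≡ inv A + hsum (suc A) (suc (A · B))
    shift = trans (sym (∑-range-last A (A · B) inv (a≤aB i))) (trans (∑-range-split A (suc A) (suc (A · B)) inv (n≤1+n A) (s≤s (a≤aB i))) (cong (_+ hsum (suc A) (suc (A · B))) (trans (cong (\l -> ∑ l inv) (range-suc A)) (+-idʳ (inv A)))))
    low : ℓ - (1ℚ + 1ℚ) - ι W ≤ hsum (suc A) (suc (A · B))
    low = ≤by ((hsum A (A · B) - (ℓ - 1ℚ)) + inv (A · B) + (1ℚ - inv A) + ι W)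
     (0≤+ (0≤+ (0≤+ (diff (hsum-scale-≥ A B (1≤a i) 1≤B)) (0≤inv (A · B))) (diff (≤≡ (inv-anti N.≤-refl (1≤a i)) inv1))) 0≤W)
     (trans (id55 ℓ (ι W) (hsum A (A · B)) (inv (A · B)) (inv A)) (trans (cong (_- inv A) shift) (id56 (inv A) (hsum (suc A) (suc (A · B))))))

module Setup where

 open Identities
 open Field
 open Sums
 open Forms
 open Sieve using (below; below-true; below-anti; 0≤below; Fresh)
 open Smooth
 open Cheb
 open Mertens using (∑inv²; ∃-prime; 2Q; 0≤2Q)
 open Bins
 open import Defs using (range; isPrimeᵇ)
 open import Data.Bool using (T)
 open Rationals

 distinct : ∀ P Q -> Unique P -> (∀ p -> p ∈ P -> Prime p) -> (∀ q -> q ∈ Q -> Prime q) -> (∀ p q -> p ∈ P -> q ∈ Q -> q ≢ p) -> Distinct P Q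
 distinct [] Q u hP hQ d = hQ
 distinct (p ∷ P) Q (np ∷ u) hP hQ d = hP p (here refl) , (\q m -> hQ q m , d p q (here refl) m) ,
  distinct P (p ∷ Q) u (\q m -> hP q (there m)) (λ { q (here refl) -> hP p (here refl) ; q (there m) -> hQ q m })
   (λ { r q m (here refl) e -> All.lookup np m e ; r q m (there k) -> d r q (there m) k })

 fresh : ∀ P q -> Unique P -> (∀ p -> p ∈ P -> Prime p × p ∤ q) -> Fresh P q
 fresh [] q u h = tt
 fresh (p ∷ P) q (np ∷ u) h = proj₁ (h p (here refl)) , proj₂ (h p (here refl)) , fresh P q u (\r m -> h r (there m)) ,
  fresh P (p · q) u (\r m -> proj₁ (h r (there m)) , \d -> [ (\d' -> All.lookup np m (sym (prime-∣-prime (proj₁ (h p (here refl))) (proj₁ (h r (there m))) d'))) , proj₂ (h r (there m)) ]′ (euclidsLemma p q (proj₁ (h r (there m))) d))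

 module _ (B n : ℕ) (2≤B : 2 ≦ B) where
  private instance
   nzB : N.NonZero B
   nzB = >-nonZero (<⇒≤ 2≤B)
  binK : ℕ -> ℕ -> ℕ
  binK zero m = 0
  binK (suc K) m = if B ^ suc K ≤ᵇ m then suc K else binK K m
  -- the index of the interval [B^i, B^(i+1)) containing m, capped at n; the value at 0 is n, so that step functions vanish there
  bin : ℕ -> ℕ
  bin zero = n
  bin m@(suc _) = binK n m
  private
   binK≤ : ∀ K m -> binK K m ≦ K
   binK≤ zero m = z≤n
   binK≤ (suc K) m with B ^ suc K ≤ᵇ m
   ... | true = N.≤-refl
   ... | false = m≤n⇒m≤1+n (binK≤ K m)
   binK-pow : ∀ K m -> 1 ≦ m -> B ^ binK K m ≦ m
   binK-pow zero m h = h
   binK-pow (suc K) m h with B ^ suc K ≤ᵇ m in e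
   ... | true = ≤ᵇ⇒≤ _ m (subst T (sym e) tt)
   ... | false = binK-pow K m h
   binK-lb : ∀ K i m -> i ≦ K -> B ^ i ≦ m -> i ≦ binK K m
   binK-lb zero i m h p = h
   binK-lb (suc K) i m h p with B ^ suc K ≤ᵇ m in e
   ... | true = h
   ... | false with m≤n⇒m<n∨m≡n h
   ... | inj₁ (s≤s lt) = binK-lb K i m lt p
   ... | inj₂ refl = contradiction (subst T e (≤⇒≤ᵇ p)) (λ ())
  bin≤n : ∀ m -> bin m ≦ n
  bin≤n zero = N.≤-refl
  bin≤n m@(suc _) = binK≤ n m
  bin-pow : ∀ m -> 1 ≦ m -> B ^ bin m ≦ m
  bin-pow m@(suc _) h = binK-pow n m h
  bin-lb : ∀ i m -> i ≦ n -> B ^ i ≦ m -> i ≦ bin m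
  bin-lb i zero h p = h
  bin-lb i m@(suc _) h p = binK-lb n i m h p
  bin-ub : ∀ i m -> 1 ≦ m -> m N.< B ^ suc i -> bin m ≦ i
  bin-ub i m h lt with bin m N.≤? i
  ... | yes y = y
  ... | no ny = contradiction (<-≤-trans lt (≦-trans (^-monoʳ-≤ B (≰⇒> ny)) (bin-pow m h))) (<-irrefl refl)
  bin-<pow : ∀ m -> bin m N.< n -> m N.< B ^ suc (bin m)
  bin-<pow m h = ≰⇒> (\le -> <-irrefl refl (bin-lb (suc (bin m)) m h le))
  bin-mono : ∀ {x y} -> 1 ≦ x -> x ≦ y -> bin x ≦ bin y
  bin-mono {x} {y} h p = bin-lb (bin x) y (bin≤n x) (≦-trans (bin-pow x h) p)
  bin-big : ∀ m -> B ^ n ≦ m -> bin m ≡ n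
  bin-big m h = ≤-antisym (bin≤n m) (bin-lb n m N.≤-refl h)
  bin<n : ∀ m -> 1 ≦ m -> m N.< B ^ n -> bin m N.< n
  bin<n m h lt = ≤∧≢⇒< (bin≤n m) (\e -> <-irrefl refl (<-≤-trans lt (subst (\z -> B ^ z ≦ m) e (bin-pow m h))))
  at : ℕ -> ℕ -> ℚ
  at i m = ind (bin m ≡ᵇ i)
  private
   true-≡ᵇ : ∀ k -> (k ≡ᵇ k) ≡ true
   true-≡ᵇ zero = refl
   true-≡ᵇ (suc k) = true-≡ᵇ k
   ≢-≡ᵇ : ∀ k i -> k ≢ i -> (k ≡ᵇ i) ≡ false
   ≢-≡ᵇ k i ne with k ≡ᵇ i in e
   ... | false = refl
   ... | true = contradiction (≡ᵇ⇒≡ k i (subst T (sym e) tt)) ne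
  at-yes : ∀ i m -> bin m ≡ i -> at i m ≡ 1ℚ
  at-yes i m refl = cong ind (true-≡ᵇ (bin m))
  at-no : ∀ i m -> bin m ≢ i -> at i m ≡ 0ℚ
  at-no i m ne = cong ind (≢-≡ᵇ (bin m) i ne)
  ∑-at : ∀ (h : ℕ -> ℚ) m -> h (bin m) ≡ ∑ (range 0 n) (\i -> h i * at i m) + h n * at n m
  ∑-at h m = sym (trans (sym (∑-range-last 0 n (\i -> h i * at i m) z≤n)) (sel (suc n) (s≤s (bin≤n m)))) where
   zero-sum : ∀ k -> k ≦ bin m -> ∑ (range 0 k) (\i -> h i * at i m) ≡ 0ℚ
   zero-sum k le = trans (∑-cong∈ (range 0 k) (\i i∈ -> trans (cong (h i *_) (at-no i m (\e -> <-irrefl (sym e) (<-≤-trans (proj₂ (∈-range⁻ {0} {k} i∈)) le)))) (*-zeroʳ (h i)))) (∑-0 (range 0 k))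
   sel : ∀ k -> bin m N.< k -> ∑ (range 0 k) (\i -> h i * at i m) ≡ h (bin m)
   sel (suc k) (s≤s lt) with m≤n⇒m<n∨m≡n lt
   ... | inj₁ lt' = trans (∑-range-last 0 k (\i -> h i * at i m) z≤n) (trans (cong₂ _+_ (sel k lt') (trans (cong (h k *_) (at-no k m (<⇒≢ lt'))) (*-zeroʳ (h k)))) (+-idʳ (h (bin m))))
   ... | inj₂ refl = trans (∑-range-last 0 (bin m) (\i -> h i * at i m) z≤n) (trans (cong₂ _+_ (zero-sum (bin m) N.≤-refl) (trans (cong (h (bin m) *_) (at-yes (bin m) m refl)) (*-idʳ (h (bin m))))) (+-idˡ (h (bin m))))
  0≤at : ∀ i m -> 0ℚ ≤ at i m
  0≤at i m = 0≤ind (bin m ≡ᵇ i)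
  module Sum (P : List ℕ) where
   V : ℕ -> ℚ
   V i = wsum P inv (at i)
   private
    S : (ℕ -> ℚ) -> ℕ -> ℚ
    S h m = ∑ (range 0 n) (\i -> h i * at i m)
    lin : ∀ h -> wsum P inv (S h) ≡ ∑ (range 0 n) (\i -> h i * V i)
    lin h = trans (wsum-∑ P inv (range 0 n) (\i m -> h i * at i m)) (∑-cong (range 0 n) (\i -> wsum-*ˡ P inv (h i) (at i)))
   binsum-≥ : ∀ (h : ℕ -> ℚ) v -> (∀ i -> 0ℚ ≤ h i) -> (∀ i -> i N.< n -> v ≤ V i) -> v * ∑ (range 0 n) h ≤ wsum P inv (\m -> h (bin m))
   binsum-≥ h v hh hv = ≡≤ (sym (∑-*ˡ (range 0 n) v h)) (≤-trans (∑-mono∈ (range 0 n) (\i i∈ -> ≤≡ (*-monoʳ (h i) (hh i) (hv i (proj₂ (∈-range⁻ {0} {n} i∈)))) (ℚ.*-comm (V i) (h i))))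
    (≡≤ (sym (lin h)) (wsum-mono P {f = S h} 0≤inv (\m -> ≤≡ (≤+ʳ {S h m} (0≤* (hh n) (0≤at n m))) (sym (∑-at h m))))))
   binsum-≤ : ∀ (h : ℕ -> ℚ) v -> (∀ i -> 0ℚ ≤ h i) -> h n ≡ 0ℚ -> (∀ i -> i N.< n -> V i ≤ v) -> wsum P inv (\m -> h (bin m)) ≤ v * ∑ (range 0 n) h
   binsum-≤ h v hh h0 hv = ≡≤ (trans (wsum-cong P {f' = S h} (\m -> trans (∑-at h m) (trans (cong (\z -> S h m + z * at n m) h0) (trans (cong (S h m +_) (*-zeroˡ (at n m))) (+-idʳ (S h m)))))) (lin h))
    (≤≡ (∑-mono∈ (range 0 n) (\i i∈ -> ≤≡ (*-monoˡ (h i) (hh i) (hv i (proj₂ (∈-range⁻ {0} {n} i∈)))) (ℚ.*-comm (h i) v))) (∑-*ˡ (range 0 n) v h))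

 prime2 : Prime 2
 prime2 = toWitness {a? = prime? 2} tt

 ∈⇒∣∏ : ∀ qs {q} -> q ∈ qs -> q ∣ ∏ℕ qs (\q -> q)
 ∈⇒∣∏ (q ∷ qs) (here refl) = m∣m*n (∏ℕ qs (\q -> q))
 ∈⇒∣∏ (q ∷ qs) (there m) = ∣n⇒∣m*n q (∈⇒∣∏ qs m)

 module Main-setup (D B' n : ℕ) (2≤D : 2 ≦ D) (1≤B' : 1 ≦ B') (1≤n : 1 ≦ n) where
  Qs = primes 1 (suc D)
  prQ : ∀ q -> q ∈ Qs -> Prime q
  prQ q m = proj₁ (∈-primes⁻ {1} {suc D} m)
  2∈Qs : 2 ∈ Qs
  2∈Qs = ∈-primes⁺ prime2 N.z<s (s≤s 2≤D)
  open Coprime-sums Qs prQ 2 2∈Qs public using (W; 1≤W; c; 0≤c; g; 0≤g; 0≤Φ)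
  B = W · B'
  2≤B : 2 ≦ B
  2≤B = *-mono-≤ {2} {W} {1} {B'} 2≤W 1≤B' where
   2≤W : 2 ≦ W
   2≤W = ∣⇒≤ {{>-nonZero 1≤W}} (∈⇒∣∏ Qs 2∈Qs)
  ℓ = hsum 1 B
  R = B ^ n
  1<R : 1 N.< R
  1<R = ≦-trans 2≤B (≡≤ℕ (sym (^-identityʳ B)) (^-monoʳ-≤ B {{>-nonZero (<⇒≤ 2≤B)}} 1≤n))
  P = primes (suc D) R
  prP : ∀ p -> p ∈ P -> Prime p
  prP p m = proj₁ (∈-primes⁻ {suc D} {R} m)
  D<P : ∀ p -> p ∈ P -> D N.< p
  D<P p m = proj₁ (proj₂ (∈-primes⁻ {suc D} {R} m))
  P<R : ∀ p -> p ∈ P -> p N.< R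
  P<R p m = proj₂ (proj₂ (∈-primes⁻ {suc D} {R} m))
  uniqueP : Unique P
  uniqueP = primes-unique (suc D) R
  dist : Distinct P Qs
  dist = distinct P Qs uniqueP prP prQ (\p q m k e -> <-irrefl e (≤-<-trans (≤-pred (proj₂ (proj₂ (∈-primes⁻ {1} {suc D} k)))) (D<P p m)))
  cov : ∀ m -> 1 N.< m -> m N.< R -> ∃[ q ] (q ∣ m × (q ∈ P ⊎ q ∈ Qs))
  cov m h lt with ∃-prime m h
  ... | q , pq , d with q N.≤? D
  ... | yes le = q , d , inj₂ (∈-primes⁺ pq (1≤prime pq) (s≤s le))
  ... | no gt = q , d , inj₁ (∈-primes⁺ pq (≰⇒> gt) (≤-<-trans (∣⇒≤ {{>-nonZero (<⇒≤ h)}} d) lt))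
  bin' : ℕ -> ℕ
  bin' = bin B n 2≤B
  at' : ℕ -> ℕ -> ℚ
  at' = at B n 2≤B
  open Sum B n 2≤B P public
  private
   instance
    nzB : N.NonZero B
    nzB = >-nonZero (<⇒≤ 2≤B)
   Nb : ℕ -> ℚ
   Nb i = ∑ (range (B ^ i) (B ^ suc i)) g
   N≡ : ∀ i -> i N.< n -> N R 1<R Qs (at' i) ≡ Nb i
   N≡ i i<n = trans (∑-range-split 0 lo R f z≤n (≦-trans lo≤hi hi≤R)) (trans (cong₂ _+_ z1 (trans (∑-range-split lo hi R f lo≤hi hi≤R) (cong₂ _+_ mid z2))) (id60 (Nb i))) where
    lo = B ^ i
    hi = B ^ suc i
    f : ℕ -> ℚ
    f m = ind (cop Qs m) * (inv m * at' i m)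
    lo≤hi : lo ≦ hi
    lo≤hi = ^-monoʳ-≤ B (n≤1+n i)
    hi≤R : hi ≦ R
    hi≤R = ^-monoʳ-≤ B i<n
    nul : ∀ m -> bin' m ≢ i -> f m ≡ 0ℚ
    nul m ne = trans (cong (\z -> ind (cop Qs m) * (inv m * z)) (at-no B n 2≤B i m ne)) (id37 (ind (cop Qs m)) (inv m))
    lo≤⇒ : ∀ m -> 1 ≦ m -> bin' m ≡ i -> lo ≦ m
    lo≤⇒ m h refl = bin-pow B n 2≤B m h
    z1 : ∑ (range 0 lo) f ≡ 0ℚ
    z1 = trans (∑-cong∈ (range 0 lo) (\m m∈ -> nul m (\id60 -> case m id60 (proj₂ (∈-range⁻ {0} {lo} m∈))))) (∑-0 (range 0 lo)) where
     case : ∀ m -> bin' m ≡ i -> m N.< lo -> ⊥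
     case zero id60 lt = <-irrefl (sym id60) i<n
     case m@(suc _) id60 lt = <-irrefl refl (<-≤-trans lt (lo≤⇒ m N.z<s id60))
    z2 : ∑ (range hi R) f ≡ 0ℚ
    z2 = trans (∑-cong∈ (range hi R) (\m m∈ -> nul m (\id60 -> <-irrefl refl (<-≤-trans (s≤s (N.≤-reflexive id60)) (bin-lb B n 2≤B (suc i) m i<n (proj₁ (∈-range⁻ {hi} {R} m∈))))))) (∑-0 (range hi R))
    mid : ∑ (range lo hi) f ≡ Nb i
    mid = ∑-cong∈ (range lo hi) (\m m∈ -> cong (ind (cop Qs m) *_) (trans (cong (inv m *_) (at-yes B n 2≤B i m (≤-antisym (bin-ub B n 2≤B i m (≦-trans (m^n>0 B i) (proj₁ (∈-range⁻ {lo} {hi} m∈))) (proj₂ (∈-range⁻ {lo} {hi} m∈))) (bin-lb B n 2≤B i m (<⇒≤ i<n) (proj₁ (∈-range⁻ {lo} {hi} m∈)))))) (*-idʳ (inv m))))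
   supp : ∀ i -> i N.< n -> Supp R 1<R (at' i)
   supp i i<n m h = at-no B n 2≤B i m (\e -> <-irrefl (trans (sym e) (bin-big B n 2≤B m h)) i<n)
  binMax = c * ℓ + ι W
  V≤ : ∀ i -> i N.< n -> V i ≤ binMax
  V≤ i i<n = ≤-trans (wsum≤N R 1<R P Qs (at' i) dist (supp i i<n) (0≤at B n 2≤B i)) (≡≤ (N≡ i i<n) (Coprime-sums.bin-≤ Qs prQ 2 2∈Qs B' 1≤B' i))
  private
   supR : Supp R 1<R (below R)
   supR m h with m <ᵇ R in e
   ... | false = refl
   ... | true = contradiction (<ᵇ⇒< m R (subst T (sym e) tt)) (≤⇒≯ h)
   total-≤ : N R 1<R Qs (below R) ≤ ι n * binMax
   total-≤ = ≤-trans (≤≡ (∑-mono (range 0 R) pt) (trans (∑-cong (range 0 R) (\m -> e (ind (cop Qs m)) (inv m) (range 0 n) (\i -> at' i m))) (∑-swap (range 0 R) (range 0 n) (\m i -> ind (cop Qs m) * (inv m * at' i m)))))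
    (≤≡ (∑-mono∈ (range 0 n) (\i i∈ -> ≡≤ (N≡ i (proj₂ (∈-range⁻ {0} {n} i∈))) (Coprime-sums.bin-≤ Qs prQ 2 2∈Qs B' 1≤B' i))) (∑-const-range 0 n binMax)) where
    e : ∀ a b (xs : List ℕ) (f : ℕ -> ℚ) -> a * (b * ∑ xs f) ≡ ∑ xs (\x -> a * (b * f x))
    e a b xs f = trans (cong (a *_) (sym (∑-*ˡ xs b f))) (sym (∑-*ˡ xs a (\x -> b * f x)))
    pt : ∀ m -> ind (cop Qs m) * (inv m * below R m) ≤ ind (cop Qs m) * (inv m * ∑ (range 0 n) (\i -> at' i m))
    pt zero = ≡⇒≤ (trans (cong (\z -> ind (cop Qs 0) * (z * below R 0)) inv-0) (trans (id59 (ind (cop Qs 0)) (below R 0) (∑ (range 0 n) (\i -> at' i 0))) (cong (\z -> ind (cop Qs 0) * (z * ∑ (range 0 n) (\i -> at' i 0))) (sym inv-0))))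
    pt m@(suc _) = *-monoˡ (ind (cop Qs m)) (0≤ind (cop Qs m)) (*-monoˡ (inv m) (0≤inv m) le) where
     le : below R m ≤ ∑ (range 0 n) (\i -> at' i m)
     le with m <ᵇ R in e
     ... | false = ∑-nonneg (range 0 n) (\i -> 0≤at B n 2≤B i m)
     ... | true = ≡≤ (sym (at-yes B n 2≤B (bin' m) m refl)) (∑-≥-term {xs = range 0 n} {f = \i -> at' i m} (\i _ -> 0≤at B n 2≤B i m) (∈-range⁺ {0} {n} z≤n (bin<n B n 2≤B m N.z<s (<ᵇ⇒< m R (subst T (sym e) tt)))))
  wsum-below : wsum P inv (below R) ≤ ι n * binMax
  wsum-below = ≤-trans (wsum≤N R 1<R P Qs (below R) dist supR (0≤below R)) total-≤
  εP = ∑ P (\p -> inv p * inv p)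
  εP≤ : εP ≤ 2Q * inv D
  εP≤ = ≡≤ (∑-filter isPrimeᵇ (range (suc D) R) (\p -> inv p * inv p)) (≤-trans (∑-mono (range (suc D) R) (\p -> ≤≡ (*-monoʳ (inv p * inv p) (0≤* (0≤inv p) (0≤inv p)) (ind≤1 (isPrimeᵇ p))) (*-idˡ (inv p * inv p))))
   (sq (suc D) R N.z<s (inv-anti (<⇒≤ 2≤D) (n≤1+n D)))) where
   sq : ∀ d Y -> 1 ≦ d -> inv d ≤ inv D -> ∑ (range d Y) (\p -> inv p * inv p) ≤ 2Q * inv D
   sq d Y h le with ≤-total d Y
   ... | inj₁ d≤Y = ≤-trans (subst (\z -> ∑ (range d z) (\p -> inv p * inv p) ≤ 2Q * inv d - 2Q * inv z) (m+[n∸m]≡n d≤Y) (∑inv² d (Y ∸ d) h)) (≤-trans (-≤ (0≤* 0≤2Q (0≤inv Y))) (*-monoˡ 2Q 0≤2Q le))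
   ... | inj₂ Y≤d = ≡≤ (trans (cong (\l -> ∑ (Data.List.map (d N.+_) (Data.List.upTo l)) (\p -> inv p * inv p)) (m≤n⇒m∸n≡0 Y≤d)) refl) (0≤* 0≤2Q (0≤inv D))
  V≥ : ∀ i -> i N.< n -> c * (ℓ - 2ℚ - ι W) - εP * (ι n * binMax) ≤ V i
  V≥ i i<n = ≤by (N' - (c * (ℓ - 2ℚ - ι W)) + (V i + 1ℚ * εP * NA - N') + εP * (ι n * binMax - NA))
   (0≤+ (0≤+ (diff (≤≡ (Coprime-sums.bin-≥ Qs prQ 2 2∈Qs B' 1≤B' i) (sym (N≡ i i<n)))) (diff low))
    (0≤* (∑-nonneg P (\p -> 0≤* (0≤inv p) (0≤inv p))) (diff total-≤))) (id61 (c * (ℓ - 2ℚ - ι W)) εP (ι n * binMax) N' (V i) NA) where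
   N' = N R 1<R Qs (at' i)
   NA = N R 1<R Qs (\m -> below R m)
   low : N' ≤ V i + 1ℚ * εP * NA
   low = N≤wsum R 1<R P Qs (at' i) (below R) 1ℚ dist cov (supp i i<n) supR (0≤at B n 2≤B i) (0≤below R) 0≤1
    (\p m p∈ -> below-anti R (m≤n*m m p {{>-nonZero (1≤prime (prP p p∈))}})) le where
    le : ∀ m -> at' i m ≤ 1ℚ * below R m
    le m with m <ᵇ R in id61
    ... | true = ≤≡ (ind≤1 (bin' m ≡ᵇ i)) (sym (*-idˡ 1ℚ))
    ... | false = ≡⇒≤ (trans (supp i i<n m (≮⇒≥ (\lt -> contradiction (subst T id61 (<⇒<ᵇ lt)) (λ ())))) (sym (*-zeroʳ 1ℚ)))

module Lower where

 open Identities
 open Field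
 open Sums
 open Forms
 open Trip
 open Sieve using (below; below-true; below-anti; 0≤below)
 open Smooth using (1≤prime)
 open Setup
 open import Defs using (range)
 open import Data.Bool using (T)
 open Rationals

 module Step (B n : ℕ) (2≤B : 2 ≦ B) (F : ℕ -> ℕ) (F-anti : ∀ {i j} -> i ≦ j -> F j ≦ F i) (F-0 : ∀ {i} -> n ≦ i -> F i ≡ 0) where
  private
   β : ℕ -> ℕ
   β = bin B n 2≤B
  bin-* : ∀ a b -> (β a N.+ β b ≦ β (a · b)) ⊎ (β (a · b) ≡ n)
  bin-* zero b = inj₂ refl
  bin-* a@(suc _) zero = inj₂ (cong β (N.*-zeroʳ a))
  bin-* a@(suc _) b@(suc _) with β a N.+ β b N.≤? n
  ... | yes le = inj₁ (bin-lb B n 2≤B (β a N.+ β b) (a · b) le (≡≤ℕ (^-distribˡ-+-* B (β a) (β b)) pw)) where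
   pw : B ^ β a · B ^ β b ≦ a · b
   pw = *-mono-≤ (bin-pow B n 2≤B a N.z<s) (bin-pow B n 2≤B b N.z<s)
  ... | no gt = inj₂ (bin-big B n 2≤B (a · b) (≦-trans (^-monoʳ-≤ B {{>-nonZero (<⇒≤ 2≤B)}} (<⇒≤ (≰⇒> gt))) (≡≤ℕ (^-distribˡ-+-* B (β a) (β b))
   (*-mono-≤ (bin-pow B n 2≤B a N.z<s) (bin-pow B n 2≤B b N.z<s)))))
  F-up : ∀ k a b -> F (k N.+ β (a · b)) ≦ F (k N.+ (β a N.+ β b))
  F-up k a b with bin-* a b
  ... | inj₁ le = F-anti (N.+-monoʳ-≤ k le)
  ... | inj₂ e = ≡≤ℕ (F-0 (≡≤ℕ (sym e) (m≤n+m _ k))) z≤n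
  F-up3 : ∀ k a b c -> F (k N.+ β (a · (b · c))) ≦ F (k N.+ (β a N.+ (β b N.+ β c)))
  F-up3 k a b c = ≦-trans (F-up k a (b · c)) (≡≤ℕ (cong F (sym (+-assoc k (β a) (β (b · c)))))
   (≤≡ℕ (F-up (k N.+ β a) b c) (cong F (+-assoc k (β a) _))))
  F-down3 : ∀ a b c -> F (β a N.+ (β b N.+ β c) N.+ 2) ≦ F (β (a · (b · c)))
  F-down3 a b c with β a N.<? n | β b N.<? n | β c N.<? n
  ... | no h | _ | _ = ≡≤ℕ (F-0 (≦-trans (≮⇒≥ h) (≦-trans (m≤m+n (β a) _) (m≤m+n _ 2)))) z≤n
  ... | yes _ | no h | _ = ≡≤ℕ (F-0 (≦-trans (≮⇒≥ h) (≦-trans (m≤m+n (β b) _) (≦-trans (m≤n+m _ (β a)) (m≤m+n _ 2))))) z≤n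
  ... | yes _ | yes _ | no h = ≡≤ℕ (F-0 (≦-trans (≮⇒≥ h) (≦-trans (m≤n+m (β c) (β b)) (≦-trans (m≤n+m _ (β a)) (m≤m+n _ 2))))) z≤n
  ... | yes ha | yes hb | yes hc = F-anti (bin-ub B n 2≤B _ (a · (b · c)) (pos a b c ha hb hc) (<-≤-trans (*-mono-< (bin-<pow B n 2≤B a ha) (*-mono-< (bin-<pow B n 2≤B b hb) (bin-<pow B n 2≤B c hc)))
    (N.≤-reflexive (trans (cong (B ^ suc (β a) N.*_) (sym (^-distribˡ-+-* B (suc (β b)) (suc (β c))))) (trans (sym (^-distribˡ-+-* B (suc (β a)) _)) (cong (B N.^_) (id66 (β a) (β b) (β c)))))))) where
   pos : ∀ a b c -> β a N.< n -> β b N.< n -> β c N.< n -> 1 ≦ a · (b · c)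
   pos zero b c h _ _ = contradiction h (<-irrefl refl)
   pos (suc _) zero c _ h _ = contradiction h (<-irrefl refl)
   pos (suc _) (suc _) zero _ _ h = contradiction h (<-irrefl refl)
   pos (suc _) (suc _) (suc _) _ _ _ = s≤s z≤n
  y : ℕ -> ℚ
  y m = ι (F (β m))
  0≤y : ∀ m -> 0ℚ ≤ y m
  0≤y m = 0≤ι (F (β m))
  y-anti : ∀ p m -> 1 ≦ p -> y (p · m) ≤ y m
  y-anti p zero h = ≡⇒≤ (cong y (N.*-zeroʳ p))
  y-anti p m@(suc _) h = ι-mono (F-anti (bin-mono B n 2≤B N.z<s (m≤n*m m p {{>-nonZero h}})))
  y≤ : ∀ m -> y m ≤ ι (F 0) * below (B ^ n) m
  y≤ m with m <ᵇ B ^ n in e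
  ... | true = ≤≡ (ι-mono (F-anti z≤n)) (sym (*-idʳ (ι (F 0))))
  ... | false = ≡⇒≤ (trans (cong ι (F-0 (N.≤-reflexive (sym (bin-big B n 2≤B m (≮⇒≥ (\lt -> subst T e (<⇒<ᵇ lt)))))))) (trans (ι-def 0) (sym (*-zeroʳ (ι (F 0))))))
  module Bounds (P : List ℕ) (v v̄ : ℚ) (0≤v : 0ℚ ≤ v) (0≤v̄ : 0ℚ ≤ v̄)
   (v≤ : ∀ i -> i N.< n -> v ≤ Sum.V B n 2≤B P i) (≤v̄ : ∀ i -> i N.< n -> Sum.V B n 2≤B P i ≤ v̄) where
   ∑2 : (ℕ -> ℕ -> ℚ) -> ℚ
   ∑2 g = ∑ (range 0 n) (\j -> ∑ (range 0 n) (g j))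
   ∑3 : (ℕ -> ℕ -> ℕ -> ℚ) -> ℚ
   ∑3 g = ∑ (range 0 n) (\i -> ∑2 (g i))
   private
    open Sum B n 2≤B P
    nn : ∀ {g : ℕ -> ℚ} -> (∀ i -> 0ℚ ≤ g i) -> 0ℚ ≤ ∑ (range 0 n) g
    nn = ∑-nonneg (range 0 n)
    low : ∀ h -> (∀ i -> 0ℚ ≤ h i) -> v * ∑ (range 0 n) h ≤ wsum P inv (\m -> h (β m))
    low h hh = binsum-≥ h v hh v≤
    high : ∀ h -> (∀ i -> 0ℚ ≤ h i) -> h n ≡ 0ℚ -> wsum P inv (\m -> h (β m)) ≤ v̄ * ∑ (range 0 n) h
    high h hh h0 = binsum-≤ h v̄ hh h0 ≤v̄
   W2-high : ∀ (g : ℕ -> ℕ -> ℚ) -> (∀ j k -> 0ℚ ≤ g j k) -> (∀ j k -> n ≦ j ⊎ n ≦ k -> g j k ≡ 0ℚ) -> W2 P inv (\b c -> g (β b) (β c)) ≤ v̄ * (v̄ * ∑2 g)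
   W2-high g hg g0 = ≤-trans (wsum-mono P 0≤inv (\b -> high (g (β b)) (hg (β b)) (g0 (β b) n (inj₂ N.≤-refl))))
    (≡≤ (wsum-*ˡ P inv v̄ (\b -> ∑ (range 0 n) (g (β b)))) (*-monoˡ v̄ 0≤v̄ (high (\j -> ∑ (range 0 n) (g j)) (\j -> nn (hg j)) (trans (∑-cong (range 0 n) (\k -> g0 n k (inj₁ N.≤-refl))) (∑-0 (range 0 n))))))
   W3-high : ∀ (g : ℕ -> ℕ -> ℕ -> ℚ) -> (∀ i j k -> 0ℚ ≤ g i j k) -> (∀ i j k -> n ≦ i ⊎ (n ≦ j ⊎ n ≦ k) -> g i j k ≡ 0ℚ) -> W3 P inv (\a b c -> g (β a) (β b) (β c)) ≤ v̄ * (v̄ * (v̄ * ∑3 g))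
   W3-high g hg g0 = ≤-trans (wsum-mono P 0≤inv (\a -> W2-high (g (β a)) (hg (β a)) (\j k h -> g0 (β a) j k (inj₂ h))))
    (≡≤ (trans (wsum-*ˡ P inv v̄ (\a -> v̄ * ∑2 (g (β a)))) (cong (v̄ *_) (wsum-*ˡ P inv v̄ (\a -> ∑2 (g (β a))))))
    (*-monoˡ v̄ 0≤v̄ (*-monoˡ v̄ 0≤v̄ (high (\i -> ∑2 (g i)) (\i -> nn (\j -> nn (hg i j))) (trans (∑-cong (range 0 n) (\j -> trans (∑-cong (range 0 n) (\k -> g0 n j k (inj₁ N.≤-refl))) (∑-0 (range 0 n)))) (∑-0 (range 0 n)))))))
   W3-low : ∀ (g : ℕ -> ℕ -> ℕ -> ℚ) -> (∀ i j k -> 0ℚ ≤ g i j k) -> v * (v * (v * ∑3 g)) ≤ W3 P inv (\a b c -> g (β a) (β b) (β c))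
   W3-low g hg = ≤-trans (*-monoˡ v 0≤v (*-monoˡ v 0≤v (low (\i -> ∑2 (g i)) (\i -> nn (\j -> nn (hg i j))))))
    (≡≤ (sym (trans (wsum-*ˡ P inv v (\a -> v * ∑2 (g (β a)))) (cong (v *_) (wsum-*ˡ P inv v (\a -> ∑2 (g (β a)))))))
    (wsum-mono P 0≤inv (\a -> ≤-trans (*-monoˡ v 0≤v (low (\j -> ∑ (range 0 n) (g (β a) j)) (\j -> nn (hg (β a) j))))
     (≡≤ (sym (wsum-*ˡ P inv v (\b -> ∑ (range 0 n) (g (β a) (β b))))) (wsum-mono P 0≤inv (\b -> low (g (β a) (β b)) (hg (β a) (β b))))))))
   γ3 = ∑3 (\i j k -> ι (F (i N.+ (j N.+ k))) * ι (F (i N.+ (j N.+ k))))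
   diagonal-≤ : wsum P (\p -> 3ℚ * inv p) (\m -> y m * y m) ≤ v̄ * (v̄ * (v̄ * γ3))
   diagonal-≤ = ≤-trans (wsum≤W3 P 0≤inv (\m -> 0≤* (0≤y m) (0≤y m))) (≤-trans (W3-mono P 0≤inv (\a b c -> *-mono (0≤y (a · (b · c))) (0≤ι (F (β a N.+ (β b N.+ β c)))) (ι-mono (F-up3 0 a b c)) (ι-mono (F-up3 0 a b c))))
    (W3-high (\i j k -> ι (F (i N.+ (j N.+ k))) * ι (F (i N.+ (j N.+ k)))) (\i j k -> 0≤* (0≤ι _) (0≤ι _)) z)) where
    z : ∀ i j k -> n ≦ i ⊎ (n ≦ j ⊎ n ≦ k) -> ι (F (i N.+ (j N.+ k))) * ι (F (i N.+ (j N.+ k))) ≡ 0ℚ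
    z i j k h = trans (cong (\x -> ι x * ι x) (F-0 (le h))) (trans (cong (_* ι 0) (ι-def 0)) (*-zeroˡ (ι 0))) where
     le : n ≦ i ⊎ (n ≦ j ⊎ n ≦ k) -> n ≦ i N.+ (j N.+ k)
     le (inj₁ h) = ≦-trans h (m≤m+n i _)
     le (inj₂ (inj₁ h)) = ≦-trans h (≦-trans (m≤m+n j k) (m≤n+m _ i))
     le (inj₂ (inj₂ h)) = ≦-trans h (≦-trans (m≤n+m k j) (m≤n+m _ i))
   module Tangent (Δ : ℕ -> ℕ) (Δ≤ : ∀ u -> Δ u ≦ F 0) (Δ-0 : ∀ {u} -> n ≦ u -> Δ u ≡ 0) where
    Tᵟ : ℕ -> ℚ
    Tᵟ s = ∑ (range 0 n) (\i -> ι (Δ (i N.+ s)))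
    α = ∑2 (\j k -> Tᵟ (j N.+ k) * Tᵟ (j N.+ k))
    0≤T : ∀ s -> 0ℚ ≤ Tᵟ s
    0≤T s = nn (\i -> 0≤ι _)
    0≤α : 0ℚ ≤ α
    0≤α = nn (\j -> nn (\k -> 0≤* (0≤T _) (0≤T _)))
    private
     ι0 : ∀ {k} -> k ≡ 0 -> ι k ≡ 0ℚ
     ι0 refl = ι-def 0
     T-0 : ∀ s -> n ≦ s -> Tᵟ s ≡ 0ℚ
     T-0 s h = trans (∑-cong (range 0 n) (\i -> ι0 (Δ-0 (≦-trans h (m≤n+m s i))))) (∑-0 (range 0 n))
     T≤ : ∀ s -> Tᵟ s ≤ ι n * ι (F 0)
     T≤ s = ≤≡ (∑-mono (range 0 n) (\i -> ι-mono (Δ≤ (i N.+ s)))) (trans (∑-const (range 0 n) (ι (F 0))) (cong (\z -> ι z * ι (F 0)) (length-range 0 n)))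
     T0 : ∀ j k -> n ≦ j ⊎ n ≦ k -> Tᵟ (j N.+ k) ≡ 0ℚ
     T0 j k (inj₁ h) = T-0 (j N.+ k) (≦-trans h (m≤m+n j k))
     T0 j k (inj₂ h) = T-0 (j N.+ k) (≦-trans h (m≤n+m k j))
    Form-≥ : ∀ (τ σ κ e : ℕ -> ℚ) (f : ℕ -> ℚ) L E Z -> (∀ p -> 0ℚ ≤ κ p) -> (∀ p -> 0ℚ ≤ e p) -> (∀ p -> κ p ≤ inv p) -> (∀ p -> inv p ≤ κ p + e p) ->
     (∀ p -> p ∈ P -> 1 ≦ p) -> (∀ p -> p ∈ P -> κ p ≤ τ p) -> (∀ p -> p ∈ P -> 2ℚ * κ p ≤ σ p - τ p * τ p) ->
     (∀ m -> 0ℚ ≤ f m) -> (∀ a b c -> ι (Δ (β a N.+ (β b N.+ β c))) ≤ f (a · (b · c))) -> 0ℚ ≤ L ->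
     ∑ P (\p -> 3ℚ * e p + 3ℚ * (inv p * inv p) + inv p * inv p * inv p) ≤ E -> 0ℚ ≤ Z -> wsum P inv (below (B ^ n)) ≤ Z ->
     2ℚ * (v * (v * (v * (L * α))) - L * (ι n * ι (F 0)) * ι (F 0) * E * (Z * (Z * Z))) - v̄ * (v̄ * (L * L * α)) ≤ Form P τ σ f f
    Form-≥ τ σ κ e f L E Z hκ he κ≤ ≤κ 1≤P κτ κσ hf Δf hL hE hZ hZ' = ≤-trans (+-mono (*-monoˡ 2ℚ 0≤2 d3) (neg-antimono-≤ d2)) (Form-lower P τ σ κ f t hκ κτ κσ hf ht) where
     t : ℕ -> ℕ -> ℚ
     t b c = L * Tᵟ (β b N.+ β c)
     ht : ∀ b c -> 0ℚ ≤ t b c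
     ht b c = 0≤* hL (0≤T _)
     d2 : D2 P κ (\b c -> t b c * t b c) ≤ v̄ * (v̄ * (L * L * α))
     d2 = ≤-trans (D2≤W2 P hκ κ≤ (\b c -> 0≤* (ht b c) (ht b c))) (≤≡ (W2-high (\j k -> L * Tᵟ (j N.+ k) * (L * Tᵟ (j N.+ k))) (\j k -> 0≤* (0≤* hL (0≤T _)) (0≤* hL (0≤T _))) (\j k h -> trans (cong (\z -> L * z * (L * z)) (T0 j k h)) (id62 L)))
      (cong (\z -> v̄ * (v̄ * z)) (trans (∑-cong (range 0 n) (\j -> trans (∑-cong (range 0 n) (\k -> id63 L (Tᵟ (j N.+ k)))) (∑-*ˡ (range 0 n) (L * L) (\k -> Tᵟ (j N.+ k) * Tᵟ (j N.+ k))))) (∑-*ˡ (range 0 n) (L * L) (\j -> ∑ (range 0 n) (\k -> Tᵟ (j N.+ k) * Tᵟ (j N.+ k)))))))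
     g : ℕ -> ℕ -> ℕ -> ℚ
     g i j k = L * Tᵟ (j N.+ k) * ι (Δ (i N.+ (j N.+ k)))
     G : ℕ -> ℕ -> ℕ -> ℚ
     G a b c = g (β a) (β b) (β c)
     M = L * (ι n * ι (F 0)) * ι (F 0)
     hM : 0ℚ ≤ M
     hM = 0≤* (0≤* hL (0≤* (0≤ι n) (0≤ι (F 0)))) (0≤ι (F 0))
     A : ℕ -> ℚ
     A = below (B ^ n)
     g≤M : ∀ i j k -> g i j k ≤ M
     g≤M i j k = *-mono (0≤* hL (0≤T _)) (0≤ι (F 0)) (*-monoˡ L hL (T≤ (j N.+ k))) (ι-mono (Δ≤ _))
     big : ∀ m -> (m <ᵇ B ^ n) ≡ false -> n ≦ β m
     big m e = N.≤-reflexive (sym (bin-big B n 2≤B m (≮⇒≥ (\lt -> subst T e (<⇒<ᵇ lt)))))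
     G≤ : ∀ a b c -> G a b c ≤ M * (A a * (A b * A c))
     G≤ a b c with a <ᵇ B ^ n in ea | b <ᵇ B ^ n in eb | c <ᵇ B ^ n in ec
     ... | true | true | true = ≤≡ (g≤M (β a) (β b) (β c)) (sym (*-idʳ M))
     ... | false | b' | c' = ≡≤ (trans (cong (L * Tᵟ (β b N.+ β c) *_) (ι0 (Δ-0 (≦-trans (big a ea) (m≤m+n (β a) _))))) (*-zeroʳ (L * Tᵟ (β b N.+ β c)))) (0≤* hM (0≤* ≤-refl (0≤* (0≤ind b') (0≤ind c'))))
     ... | true | false | c' = ≡≤ (trans (cong (\z -> L * z * ι (Δ (β a N.+ (β b N.+ β c)))) (T0 (β b) (β c) (inj₁ (big b eb)))) (id64 L (ι (Δ (β a N.+ (β b N.+ β c)))))) (0≤* hM (0≤* 0≤1 (0≤* ≤-refl (0≤ind c'))))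
     ... | true | true | false = ≡≤ (trans (cong (\z -> L * z * ι (Δ (β a N.+ (β b N.+ β c)))) (T0 (β b) (β c) (inj₂ (big c ec)))) (id64 L (ι (Δ (β a N.+ (β b N.+ β c)))))) (0≤* hM (0≤* 0≤1 (0≤* 0≤1 ≤-refl)))
     dA : ∀ p m -> p ∈ P -> A (p · m) ≤ A m
     dA p m p∈ = below-anti (B ^ n) (m≤n*m m p {{>-nonZero (1≤P p p∈)}})
     0≤A : ∀ m -> 0ℚ ≤ A m
     0≤A = 0≤below (B ^ n)
     wA = wsum P inv A
     0≤wA : 0ℚ ≤ wA
     0≤wA = wsum-nonneg P 0≤inv 0≤A
     e∑ = ∑ P (\p -> 3ℚ * e p + 3ℚ * (inv p * inv p) + inv p * inv p * inv p)
     0≤e∑ : 0ℚ ≤ e∑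
     0≤e∑ = ∑-nonneg P (\p -> 0≤+ (0≤+ (0≤* 0≤3 (he p)) (0≤* 0≤3 (0≤* (0≤inv p) (0≤inv p)))) (0≤* (0≤* (0≤inv p) (0≤inv p)) (0≤inv p)))
     w3 : v * (v * (v * (L * α))) ≤ W3 P inv G
     w3 = ≡≤ (cong (\z -> v * (v * (v * z))) eqα) (W3-low g (\i j k -> 0≤* (0≤* hL (0≤T _)) (0≤ι _))) where
      eqα : L * α ≡ ∑3 g
      eqα = sym (trans (∑-swap (range 0 n) (range 0 n) (\i j -> ∑ (range 0 n) (g i j))) (trans (∑-cong (range 0 n) (\j -> trans (∑-swap (range 0 n) (range 0 n) (\i k -> g i j k)) (trans (∑-cong (range 0 n) (\k -> trans (∑-*ˡ (range 0 n) (L * Tᵟ (j N.+ k)) (\i -> ι (Δ (i N.+ (j N.+ k))))) (*-assoc L (Tᵟ (j N.+ k)) (Tᵟ (j N.+ k))))) (∑-*ˡ (range 0 n) L (\k -> Tᵟ (j N.+ k) * Tᵟ (j N.+ k))))))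
       (∑-*ˡ (range 0 n) L (\j -> ∑ (range 0 n) (\k -> Tᵟ (j N.+ k) * Tᵟ (j N.+ k))))))
     err : M * e∑ * (wA * (wA * wA)) ≤ M * E * (Z * (Z * Z))
     err = *-mono (0≤* hM 0≤e∑) (0≤* hZ (0≤* hZ hZ)) (*-monoˡ M hM hE) (*-mono 0≤wA (0≤* hZ hZ) hZ' (*-mono 0≤wA hZ hZ' hZ'))
     d3 : v * (v * (v * (L * α))) - M * E * (Z * (Z * Z)) ≤ D3 P κ (\a b c -> t b c * f (a · (b · c)))
     d3 = ≤by ((W3 P inv G - v * (v * (v * (L * α)))) + (D3 P κ G + M * e∑ * (wA * (wA * wA)) - W3 P inv G) + (M * E * (Z * (Z * Z)) - M * e∑ * (wA * (wA * wA))) + (D3 P κ (\a b c -> t b c * f (a · (b · c))) - D3 P κ G))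
      (0≤+ (0≤+ (0≤+ (diff w3) (diff (W3≤D3 P inv κ e M G A A A 0≤inv hκ he κ≤ ≤κ hM 0≤A 0≤A 0≤A dA dA dA G≤))) (diff err)) (diff (D3-mono P hκ (\a b c -> *-monoˡ (t b c) (ht b c) (Δf a b c)))))
      (id65 (v * (v * (v * (L * α)))) (M * E * (Z * (Z * Z))) (W3 P inv G) (D3 P κ G) (M * e∑ * (wA * (wA * wA))) (D3 P κ (\a b c -> t b c * f (a · (b · c)))))

module BVErr where

 open Identities
 open Field
 open Sums
 open Forms
 open Sieve using (∏; ∏-nonneg; Fresh; below; below-true; below-anti; 0≤below; 9ℚ)
 open Smooth
 open Cheb
 open Mertens using (∃-prime; inv1)
 open PBound
 open Phi using (φ-*; φ≡Φ; Φ; bool-ext)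
 open Setup
 open import Defs as D' using (range; squarefreeᵇ; moduli; φ; LogPowerSaving; toℚ)
 open import Data.Bool using (T)
 open import Data.Bool.ListAction using (all)
 open import Data.Nat.Divisibility using (divides)
 open Rationals

 private
  ^-distribʳ-* : ∀ n a b -> (a · b) ^ n ≡ a ^ n · b ^ n
  ^-distribʳ-* zero a b = refl
  ^-distribʳ-* (suc n) a b = trans (cong (a · b N.*_) (^-distribʳ-* n a b)) (id81 a b (a ^ n) (b ^ n))

 n<2^n : ∀ n -> suc n ≦ 2 ^ n
 n<2^n zero = s≤s z≤n
 n<2^n (suc n) = ≤≡ℕ (+-mono-≤ (m^n>0 2 n) (n<2^n n)) (cong (2 ^ n N.+_) (sym (N.+-identityʳ _)))

 ^≤2^ : ∀ e -> ∃[ C ] (∀ b -> b ^ e ≦ C · 2 ^ b)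
 ^≤2^ zero = 1 , \b -> ≤≡ℕ (m^n>0 2 b) (sym (N.+-identityʳ _))
 ^≤2^ e@(suc _) = e ^ e , \b -> ≦-trans (^-monoˡ-≤ e (ub b)) (≡≤ℕ (^-distribʳ-* e e (suc (b N./ e))) (*-monoʳ-≤ (e ^ e)
   (≦-trans (^-monoˡ-≤ e (n<2^n (b N./ e))) (≡≤ℕ (^-*-assoc 2 (b N./ e) e) (^-monoʳ-≤ 2 (≤≡ℕ (m≤n+m _ (b N.% e)) (sym (m≡m%n+[m/n]*n b e))))))))
  where
  ub : ∀ b -> b ≦ e · suc (b N./ e)
  ub b = ≡≤ℕ (m≡m%n+[m/n]*n b e) (≤≡ℕ (N.+-monoˡ-≤ (b N./ e · e) (<⇒≤ (m%n<n b e))) (*-comm (suc (b N./ e)) e))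

 0≤9 : 0ℚ ≤ 9ℚ
 0≤9 = 0≤* 0≤3 0≤3

 -- 2 · 9^ω ≤ s + 81^ω / s, summed
 am-gm : ∀ P f s t -> 0ℚ ≤ s -> 0ℚ ≤ t -> s * t ≡ 1ℚ -> (∀ m -> 0ℚ ≤ f m) -> wsum P (\_ -> 9ℚ) f ≤ s * wsum P (\_ -> 1ℚ) f + t * wsum P (\_ -> 9ℚ * 9ℚ) f
 am-gm [] f s t hs ht e hf = ≤by (t * (s - 1ℚ) * (s - 1ℚ) * f 1 + f 1) (0≤+ (0≤* (≤≡ (0≤* ht (0≤sq (s - 1ℚ))) (sym (*-assoc t (s - 1ℚ) (s - 1ℚ)))) (hf 1)) (hf 1))
  (trans (id84 s t (f 1)) (trans (cong (\z -> f 1 + (z * s - z - z + t) * f 1 + f 1) e) (id85 s t (f 1))))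
 am-gm (p ∷ P) f s t hs ht e hf = ≤≡ (+-mono (am-gm P f s t hs ht e hf) (*-monoˡ 9ℚ 0≤9 (am-gm P (sh p f) (s * inv 9) (9ℚ * t) (0≤* hs (0≤inv 9)) (0≤* {9ℚ} 0≤9 ht) e' (\m -> hf (p · m)))))
  (trans (cong (\z -> s * w₁ + t * w81 + z) (r s t (inv 9) (wsum P (\_ -> 1ℚ) (sh p f)) (wsum P (\_ -> 9ℚ * 9ℚ) (sh p f)))) (trans (cong (\z -> s * w₁ + t * w81 + (s * z * u1 + t * (9ℚ * 9ℚ * u81))) 9i) (id86 s t w₁ w81 u1 u81 (9ℚ * 9ℚ)))) where
  w₁ = wsum P (\_ -> 1ℚ) f
  w81 = wsum P (\_ -> 9ℚ * 9ℚ) f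
  u1 = wsum P (\_ -> 1ℚ) (sh p f)
  u81 = wsum P (\_ -> 9ℚ * 9ℚ) (sh p f)
  9i : 9ℚ * inv 9 ≡ 1ℚ
  9i = trans (cong (_* inv 9) (sym (ι-def 9))) (*-inv 9 N.z<s)
  e' : s * inv 9 * (9ℚ * t) ≡ 1ℚ
  e' = trans (id82 s t (inv 9) 9ℚ) (trans (cong₂ _*_ e 9i) refl)
  r : ∀ s t i u v -> 9ℚ * (s * i * u + 9ℚ * t * v) ≡ s * (9ℚ * i) * u + t * (9ℚ * 9ℚ * v)
  r s t i u v = id83 s t i u v 9ℚ

 wsum-good : ∀ (Good : ℕ -> Set) -> (∀ p q -> Prime p -> p ∤ q -> Good q -> Good (p · q)) -> ∀ P q K f g -> 0ℚ ≤ K -> Fresh P q -> Good q ->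
  (∀ d -> Good (q · d) -> f d ≤ g d) -> wsum P (\_ -> K) f ≤ wsum P (\_ -> K) g
 wsum-good Good st [] q K f g hK fr gq h = h 1 (subst Good (sym (N.*-identityʳ q)) gq)
 wsum-good Good st (p ∷ P) q K f g hK (pp , nd , fr , fr') gq h = +-mono (wsum-good Good st P q K f g hK fr gq h)
  (*-monoˡ K hK (wsum-good Good st P (p · q) K (sh p f) (sh p g) hK fr' (st p q pp nd gq) (\d gd -> h (p · d) (subst Good (id24 p q d) gd))))

 wsum-1 : ∀ P (g : ℕ -> ℚ) -> (∀ p -> p ∈ P -> 1 ≦ p) -> wsum P (\_ -> 1ℚ) g ≡ wsum P inv (\m -> ι m * g m)
 wsum-1 [] g h = sym (trans (cong (_* g 1) (ι-def 1)) (*-idˡ (g 1)))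
 wsum-1 (p ∷ P) g h = cong₂ _+_ (wsum-1 P g (\q m -> h q (there m))) (trans (*-idˡ _) (trans (wsum-1 P (sh p g) (\q m -> h q (there m)))
  (trans (sym (trans (cong (_* wsum P inv (\m -> ι m * sh p g m)) (trans (ℚ.*-comm (inv p) (ι p)) (*-inv p (h p (here refl))))) (*-idˡ _)))
  (trans (*-assoc (inv p) (ι p) _) (cong (inv p *_) (trans (sym (wsum-*ˡ P inv (ι p) (\m -> ι m * sh p g m))) (wsum-cong P (\m -> trans (sym (*-assoc (ι p) (ι m) (sh p g m))) (cong (_* sh p g m) (sym (ι-* p m)))))))))))

 private
  all-true : ∀ (f : ℕ -> Bool) xs -> (∀ x -> x ∈ xs -> f x ≡ true) -> all f xs ≡ true
  all-true f [] h = refl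
  all-true f (x ∷ xs) h rewrite h x (here refl) = all-true f xs (\y m -> h y (there m))
  all-elim : ∀ (f : ℕ -> Bool) xs -> all f xs ≡ true -> ∀ x -> x ∈ xs -> f x ≡ true
  all-elim f (x ∷ xs) e y m with f x in eq
  all-elim f (x ∷ xs) e y (here refl) | true = eq
  all-elim f (x ∷ xs) e y (there m) | true = all-elim f xs e y m

 Squarefree : ℕ -> Set
 Squarefree q = 1 ≦ q × (∀ d -> 2 ≦ d -> d · d ∤ q)

 squarefreeᵇ-true : ∀ q -> Squarefree q -> squarefreeᵇ q ≡ true
 squarefreeᵇ-true q (_ , h) = all-true _ (range 2 (suc q)) (\d m -> cong not (divides-false (h d (proj₁ (∈-range⁻ {2} {suc q} m)))))

 squarefree-1 : Squarefree 1
 squarefree-1 = N.≤-refl , \d h dd -> contradiction (subst (2 N.≤_) (∣1⇒≡1 (∣-trans (m∣m*n d) dd)) h) λ { (s≤s ()) }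

 squarefree-* : ∀ p q -> Prime p -> p ∤ q -> Squarefree q -> Squarefree (p · q)
 squarefree-* p q pp nd (1≤q , sf) = *-mono-≤ (1≤prime pp) 1≤q , \d h dd -> case d h dd where
  case : ∀ d -> 2 ≦ d -> d · d ∤ p · q
  case d h dd with ∃-prime d h
  ... | r , pr , r∣d = go (∣-trans (∣-trans (*-monoʳ-∣ r r∣d) (*-monoˡ-∣ d r∣d)) dd) where
   go : r · r ∤ p · q
   go rr with r N.≟ p
   ... | yes refl = nd (*-cancelˡ-∣ r {{>-nonZero (1≤prime pr)}} rr)
   ... | no ne with euclidsLemma p q pr (∣-trans (m∣m*n r) rr)
   ... | inj₁ d' = ne (prime-∣-prime pp pr d')
   ... | inj₂ (divides k refl) with euclidsLemma p k pr (*-cancelˡ-∣ r {{>-nonZero (1≤prime pr)}} (subst (r · r ∣_) (id79 p k r) rr))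
   ... | inj₁ d' = ne (prime-∣-prime pp pr d')
   ... | inj₂ d' = sf r (nonTrivial⇒n>1 r {{prime⇒nonTrivial pr}}) (*-monoˡ-∣ r d')

 -- Opaque, so that powers with these exponents are never expanded.
 opaque
  κ6 κ9 κ162 : ℕ
  κ6 = 6
  κ9 = 9
  κ162 = 162
  κ6≡ : κ6 ≡ 6
  κ6≡ = refl
  κ9≡ : κ9 ≡ 9
  κ9≡ = refl
  κ162≡ : κ162 ≡ 162
  κ162≡ = refl

 inv-pred : ∀ p -> 2 ≦ p -> inv (p ∸ 1) ≤ 2ℚ * inv p
 inv-pred (suc (suc r)) (s≤s (s≤s _)) = ≡≤ (trans (sym (*-idˡ (inv (suc r)))) (trans (cong (_* inv (suc r)) (trans (sym (*-inv 2 N.z<s)) (cong (_* inv 2) (ι-def 2)))) (trans (*-assoc 2ℚ (inv 2) (inv (suc r))) (cong (2ℚ *_) (sym (inv-* 2 (suc r)))))))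
  (*-monoˡ 2ℚ 0≤2 (inv-anti N.z<s (s≤s (≡≤ℕ (sym (+-comm r 1)) (N.+-monoʳ-≤ r N.z<s)))))

 module Regime (D n k : ℕ) (2≤D : 2 ≦ D) (1≤n : 1 ≦ n) (b : ℕ) where
  open Main-setup D (2 ^ b) n 2≤D (m^n>0 2 b) 1≤n public
  private instance
   nzB : N.NonZero B
   nzB = >-nonZero (<⇒≤ 2≤B)
  M = 2 · n N.+ 1 N.+ k
  private
   W∤ : ∀ p -> p ∈ P -> p ∤ W
   W∤ p p∈ d = go Qs (\q m -> proj₁ (∈-primes⁻ {1} {suc D} m) , ≤-pred (proj₂ (proj₂ (∈-primes⁻ {1} {suc D} m)))) d where
    go : ∀ qs -> (∀ q -> q ∈ qs -> Prime q × q ≦ D) -> p ∤ ∏ℕ qs (\q -> q)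
    go [] h d = ¬prime[1] (subst Prime (∣1⇒≡1 d) (prP p p∈))
    go (q ∷ qs) h d = [ (\d' -> <-irrefl (sym (prime-∣-prime (proj₁ (h q (here refl))) (prP p p∈) d')) (≤-<-trans (proj₂ (h q (here refl))) (D<P p p∈))) , go qs (\r m -> h r (there m)) ]′ (euclidsLemma q _ (prP p p∈) d)
  freshW : Fresh P W
  freshW = fresh P W uniqueP (\p m -> prP p m , W∤ p m)
  Wsf : Squarefree W
  Wsf = go Qs (primes-unique 1 (suc D)) prQ where
   go : ∀ qs -> Unique qs -> (∀ q -> q ∈ qs -> Prime q) -> Squarefree (∏ℕ qs (\q -> q))
   go [] u h = squarefree-1
   go (q ∷ qs) (nq ∷ u) h = squarefree-* q _ (h q (here refl)) (nd qs nq (\r m -> h r (there m))) (go qs u (\r m -> h r (there m))) where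
    nd : ∀ qs -> All.All (q ≢_) qs -> (∀ r -> r ∈ qs -> Prime r) -> q ∤ ∏ℕ qs (\q -> q)
    nd [] _ _ d = ¬prime[1] (subst Prime (∣1⇒≡1 d) (h q (here refl)))
    nd (r ∷ rs) (q≢r All.∷ a) hr d = [ (\d' -> q≢r (prime-∣-prime (hr r (here refl)) (h q (here refl)) d')) , nd rs a (\x m -> hr x (there m)) ]′ (euclidsLemma r _ (h q (here refl)) d)
  -- admissible lengths for the modulus cutoff W R² / s
  record Range (N' s : ℕ) : Set where
   field
    1≤s : 1 ≦ s
    large : B · (R · R) ≦ N' · s
    upper : N' ≦ B ^ M
    log : 2 ^ b ≦ N'
  module _ (b≥W : W ≦ 2 ^ b) {N' s : ℕ} (rg : Range N' s) where
   open Range rg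
   private
    WW≤B : W · W ≦ B
    WW≤B = *-monoʳ-≤ W b≥W
   cut⇒≤ : ∀ q -> q · s N.< W · (R · R) -> q ≦ N'
   cut⇒≤ q h = *-cancelʳ-≤ q N' s {{>-nonZero 1≤s}} (≦-trans (<⇒≤ h) (≦-trans (*-monoˡ-≤ (R · R) (m≤m*n W (2 ^ b) {{m^n≢0 2 b}})) large))
   level : ∀ q -> q · s N.< W · (R · R) -> q ^ (2 · M) · N' ^ 1 ≦ N' ^ (2 · M)
   level q h = *-cancelʳ-≤ _ _ (s ^ K) {{m^n≢0 s K {{>-nonZero 1≤s}}}} (begin
    q ^ K · N' ^ 1 · s ^ K       ≡⟨ trans (id80 (q ^ K) (N' ^ 1) (s ^ K)) (cong₂ _·_ (sym (^-distribʳ-* K q s)) (N.*-identityʳ N')) ⟩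
    (q · s) ^ K · N'                 ≤⟨ *-mono-≤ (^-monoˡ-≤ K (<⇒≤ h)) upper ⟩
    (W · RR) ^ K · B ^ M           ≡⟨ trans (cong (N._* B ^ M) (^-distribʳ-* K W RR)) (id80 (W ^ K) (RR ^ K) (B ^ M)) ⟩
    W ^ K · B ^ M · RR ^ K       ≤⟨ *-monoˡ-≤ (RR ^ K) WB ⟩
    B ^ K · RR ^ K                   ≡⟨ ^-distribʳ-* K B RR ⟨
    (B · RR) ^ K                       ≤⟨ ^-monoˡ-≤ K large ⟩
    (N' · s) ^ K                       ≡⟨ ^-distribʳ-* K N' s ⟩
    N' ^ K · s ^ K ∎) where
    open N.≤-Reasoning
    K = 2 · M
    RR = R · R
    WB : W ^ K · B ^ M ≦ B ^ K
    WB = ≡≤ℕ (trans (cong (\z -> W ^ z · B ^ M) (cong (M N.+_) (N.+-identityʳ M))) (cong (N._* B ^ M) (trans (^-distribˡ-+-* W M M) (sym (^-distribʳ-* M W W)))))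
     (≤≡ℕ (*-monoˡ-≤ (B ^ M) (^-monoˡ-≤ M WW≤B)) (trans (sym (^-distribˡ-+-* B M M)) (cong (B N.^_) (cong (M N.+_) (sym (N.+-identityʳ M))))))
   private
    cut : ℕ -> ℚ
    cut d = below (W · (R · R)) (W · d · s)
    cut-case : ∀ d (x y : ℚ) -> 0ℚ ≤ y -> (W · d · s N.< W · (R · R) -> x ≤ y) -> cut d * x ≤ y
    cut-case d x y hy h with W · d · s <ᵇ W · (R · R) in e
    ... | true = ≡≤ (*-idˡ x) (h (<ᵇ⇒< _ _ (subst T (sym e) tt)))
    ... | false = ≡≤ (*-zeroˡ x) hy
    d<RR : ∀ d -> W · d · s N.< W · (R · R) -> d · s N.< R · R
    d<RR d h = *-cancelˡ-< W _ _ (subst (N._< W · (R · R)) (N.*-assoc W d s) h)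
   module _ (E : ℕ -> ℚ) (0≤E : ∀ q -> 0ℚ ≤ E q) where
    -- d ↦ W d is injective into the list of moduli
    sum-moduli : wsum P (\_ -> 1ℚ) (\d -> cut d * E (W · d)) ≤ ∑ (moduli 1 (2 · M) N') E
    sum-moduli = ≤-trans (wsum-good Squarefree squarefree-* P W 1ℚ (\d -> cut d * E (W · d)) g₀ 0≤1 freshW Wsf pt)
     (≡≤ (wsum-1 P g₀ (\p m -> 1≤prime (prP p m))) (≤-trans (wsum≤N X 1<X P Qs (\m -> ι m * g₀ m) dist supp (\m -> 0≤* (0≤ι m) (0≤g0 m)))
     (≤-trans (∑-mono (range 0 X) pt2) (≡≤ (sym (∑-multiples' W X G 1≤W)) (≤-trans (∑-mono (range 0 (W · X)) (\m -> ≤≡ (*-monoʳ (G m) (0≤G m) (ind≤1 (D'.divides W m))) (*-idˡ (G m)))) fin))))) where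
     X = R · R
     1<X : 1 N.< X
     1<X = <-≤-trans 1<R (m≤m*n R R {{>-nonZero (<⇒≤ 1<R)}})
     cond : ℕ -> Bool
     cond q = squarefreeᵇ q ∧ (q ^ (2 · M) · N' ^ 1 ≤ᵇ N' ^ (2 · M))
     G : ℕ -> ℚ
     G zero = 0ℚ
     G q@(suc _) = ind (cond q) * E q
     0≤G : ∀ q -> 0ℚ ≤ G q
     0≤G zero = ≤-refl
     0≤G q@(suc _) = 0≤* (0≤ind (cond q)) (0≤E q)
     g₀ : ℕ -> ℚ
     g₀ d = below X d * G (W · d)
     0≤g0 : ∀ d -> 0ℚ ≤ g₀ d
     0≤g0 d = 0≤* (0≤below X d) (0≤G (W · d))
     Gpos : ∀ q -> 1 ≦ q -> cond q ≡ true -> E q ≤ G q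
     Gpos q@(suc _) h e = ≡⇒≤ (trans (sym (*-idˡ (E q))) (cong (\z -> ind z * E q) (sym e)))
     pt : ∀ d -> Squarefree (W · d) -> cut d * E (W · d) ≤ g₀ d
     pt d sf = cut-case d (E (W · d)) (g₀ d) (0≤g0 d) (\h -> ≤-trans (Gpos (W · d) (proj₁ sf) (cong₂ _∧_ (squarefreeᵇ-true (W · d) sf) (≤ᵇ-true (level (W · d) h))))
      (≡≤ (sym (*-idˡ (G (W · d)))) (≡⇒≤ (cong (_* G (W · d)) (sym (below-true (≤-<-trans (m≤m*n d s {{>-nonZero 1≤s}}) (d<RR d h)))))))) where
      ≤ᵇ-true : ∀ {x y} -> x ≦ y -> (x ≤ᵇ y) ≡ true
      ≤ᵇ-true {x} {y} h with x ≤ᵇ y | ≤⇒≤ᵇ h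
      ... | true | _ = refl
     supp : Supp X 1<X (\m -> ι m * g₀ m)
     supp m h with m <ᵇ X in e
     ... | true = contradiction (<ᵇ⇒< m X (subst T (sym e) tt)) (≤⇒≯ h)
     ... | false = trans (cong (ι m *_) (*-zeroˡ (G (W · m)))) (*-zeroʳ (ι m))
     pt2 : ∀ m -> ind (cop Qs m) * (inv m * (ι m * g₀ m)) ≤ G (W · m)
     pt2 zero = ≡≤ (trans (cong (\z -> ind (cop Qs 0) * (z * (ι 0 * g₀ 0))) inv-0) (id34 (ind (cop Qs 0)) (ι 0 * g₀ 0))) (0≤G (W · 0))
     pt2 m@(suc _) = ≤-trans (*-mono (0≤ind (cop Qs m)) (0≤g0 m) (ind≤1 (cop Qs m)) (≡⇒≤ (trans (sym (*-assoc (inv m) (ι m) (g₀ m))) (trans (cong (_* g₀ m) (trans (ℚ.*-comm (inv m) (ι m)) (*-inv m N.z<s))) (*-idˡ (g₀ m))))))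
      (≡≤ (*-idˡ (g₀ m)) (≤≡ (*-monoʳ (G (W · m)) (0≤G (W · m)) (ind≤1 (m <ᵇ X))) (*-idˡ (G (W · m)))))
     G-big : ∀ q -> N' N.< q -> G q ≡ 0ℚ
     G-big q@(suc _) lt = trans (cong (\z -> ind z * E q) (no-cond (squarefreeᵇ q))) (*-zeroˡ (E q)) where
      bad : (q ^ (2 · M) · N' ^ 1 ≤ᵇ N' ^ (2 · M)) ≡ false
      bad with q ^ (2 · M) · N' ^ 1 ≤ᵇ N' ^ (2 · M) in e
      ... | false = refl
      ... | true = contradiction (≤ᵇ⇒≤ _ _ (subst T (sym e) tt)) (<⇒≱ (<-≤-trans (^-monoˡ-< (2 · M) {{2M≢0}} lt) (m≤m*n (q ^ (2 · M)) (N' ^ 1) {{m^n≢0 N' 1 {{>-nonZero 1≤N'}}}}))) where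
       1≤N' : 1 ≦ N'
       1≤N' = ≦-trans (m^n>0 2 b) log
       2M≢0 : N.NonZero (2 · M)
       2M≢0 = >-nonZero (*-mono-≤ {1} {2} N.z<s (≦-trans (≦-trans (m≤n+m 1 (2 · n)) N.≤-refl) (m≤m+n _ k)))
      no-cond : ∀ a -> (a ∧ (q ^ (2 · M) · N' ^ 1 ≤ᵇ N' ^ (2 · M))) ≡ false
      no-cond true = bad
      no-cond false = refl
     filt : ∑ (moduli 1 (2 · M) N') E ≡ ∑ (range 1 (suc N')) G
     filt = trans (∑-filter cond (range 1 (suc N')) E) (∑-cong∈ (range 1 (suc N')) (λ { zero m -> contradiction (proj₁ (∈-range⁻ {1} {suc N'} m)) λ () ; (suc _) m -> refl }))
     fin : ∑ (range 0 (W · X)) G ≤ ∑ (moduli 1 (2 · M) N') E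
     fin with ≤-total (W · X) (suc N')
     ... | inj₁ le = ≤≡ (≤≡ (≤+ʳ (∑-nonneg (range (W · X) (suc N')) 0≤G)) (sym (∑-range-split 0 (W · X) (suc N') G z≤n le)))
       (trans (∑-range-split 0 1 (suc N') G z≤n N.z<s) (trans (+-idˡ _) (sym filt)))
     ... | inj₂ ge = ≡⇒≤ (trans (∑-range-split 0 (suc N') (W · X) G z≤n ge) (trans (cong₂ _+_ (trans (∑-range-split 0 1 (suc N') G z≤n N.z<s) (trans (+-idˡ _) (sym filt)))
       (trans (∑-cong∈ (range (suc N') (W · X)) (\q m -> G-big q (proj₁ (∈-range⁻ {suc N'} {W · X} m)))) (∑-0 (range (suc N') (W · X))))) (+-idʳ _)))
  h = ∏ P h1
  0≤h : 0ℚ ≤ h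
  0≤h = ∏-nonneg P 0≤h1
  G0 = H 4 * ι ((2 · n) ^ 4)
  0≤G0 : 0ℚ ≤ G0
  0≤G0 = 0≤* (0≤H 4) (0≤ι ((2 · n) ^ 4))
  Γ = ∏ P (\p -> (1ℚ + 3ℚ * inv p) * (1ℚ + 3ℚ * inv p))
  inv≤1 : ∀ m -> inv m ≤ 1ℚ
  inv≤1 zero = ≡≤ inv-0 0≤1
  inv≤1 (suc m) = ≤≡ (inv-anti N.≤-refl N.z<s) inv1
  ∏-lin : ∀ k (f : ℕ -> ℚ) -> (∀ p -> 0ℚ ≤ f p) -> (∀ p -> p ∈ P -> f p ≤ ι k * inv p) -> ∏ P (\p -> 1ℚ + f p) ≤ pow h k
  ∏-lin k f hf le = ≤≡ (∏-mono P (\p _ -> 0≤+ 0≤1 (hf p)) (\p m -> ≤-trans (+-monoʳ-≤ 1ℚ (le p m)) (bernoulli k (inv p) (0≤inv p)))) (∏-pow P h1 k)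
  Γ≤ : Γ ≤ pow h κ6
  Γ≤ = subst (\k -> Γ ≤ pow h k) (sym κ6≡) (≤≡ (∏-mono P (\p _ -> 0≤* (nn p) (nn p)) (\p _ -> ≤≡ (*-mono (nn p) (pow-nonneg 3 (0≤h1 p)) (bn p) (bn p)) (sym (pow-+ (h1 p) 3 3)))) (∏-pow P h1 6)) where
   nn : ∀ p -> 0ℚ ≤ 1ℚ + 3ℚ * inv p
   nn p = 0≤+ 0≤1 (0≤* 0≤3 (0≤inv p))
   bn : ∀ p -> 1ℚ + 3ℚ * inv p ≤ pow (h1 p) 3
   bn p = ≡≤ (cong (\z -> 1ℚ + z * inv p) (sym (ι-def 3))) (bernoulli 3 (inv p) (0≤inv p))
  module _ (b≥W : W ≦ 2 ^ b) (b≥D : D ≦ 2 ^ b) (2≤b : 2 ≦ b) where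
   h≤ : ∀ k -> pow h k ≤ pow G0 k * ι (b ^ (4 · k))
   h≤ k = ≤≡ (pow-mono k 0≤h (≤-trans (∏-primes≤H k' (suc D) R N.z<s D≤R R≤) (≤≡ (subst (\z -> H z ≤ H 4 * ι (z ^ 4)) (m+[n∸m]≡n 4≤k') (H-bound (k' ∸ 4))) eq)))
    (trans (pow-* G0 (ι (b ^ 4)) k) (cong (pow G0 k *_) (trans (pow-ι (b ^ 4) k) (cong ι (^-*-assoc b 4 k))))) where
    k' = (2 · n) · b
    4≤k' : 4 ≦ k'
    4≤k' = *-mono-≤ (*-monoʳ-≤ 2 1≤n) 2≤b
    eq : H 4 * ι (k' ^ 4) ≡ G0 * ι (b ^ 4)
    eq = trans (cong (\z -> H 4 * ι z) (^-distribʳ-* 4 (2 · n) b)) (trans (cong (H 4 *_) (ι-* ((2 · n) ^ 4) (b ^ 4))) (sym (*-assoc (H 4) (ι ((2 · n) ^ 4)) (ι (b ^ 4)))))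
    R≤2 : R ≦ 2 ^ k'
    R≤2 = ≤≡ℕ (^-monoˡ-≤ n (*-monoˡ-≤ (2 ^ b) b≥W)) (trans (cong (N._^ n) (sym (^-distribˡ-+-* 2 b b))) (trans (^-*-assoc 2 (b N.+ b) n) (cong (2 N.^_) (id76 b n))))
    R≤ : R ≦ suc (2 ^ k')
    R≤ = m≤n⇒m≤1+n R≤2
    D≤R : suc D ≦ R
    D≤R = ≦-trans (+-mono-≤ (m^n>0 2 b) b≥D) (≡≤ℕ (cong (2 ^ b N.+_) (sym (N.+-identityʳ (2 ^ b)))) (≦-trans (*-monoˡ-≤ (2 ^ b) 2≤W)
     (≡≤ℕ (sym (^-identityʳ B)) (^-monoʳ-≤ B 1≤n)))) where
     2≤W : 2 ≦ W
     2≤W = ∣⇒≤ {{>-nonZero 1≤W}} (∈⇒∣∏ Qs 2∈Qs)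
   module _ {N' s : ℕ} (rg : Range N' s) where
    open Range rg
    private
     cut : ℕ -> ℚ
     cut d = below (W · (R · R)) (W · d · s)
     0≤cut : ∀ d -> 0ℚ ≤ cut d
     0≤cut d = 0≤below (W · (R · R)) (W · d · s)
     cut-≤ : ∀ d (x y : ℚ) -> 0ℚ ≤ y -> (W · d · s N.< W · (R · R) -> x ≤ y) -> cut d * x ≤ y
     cut-≤ d x y hy h with W · d · s <ᵇ W · (R · R) in e
     ... | true = ≡≤ (*-idˡ x) (h (<ᵇ⇒< _ _ (subst T (sym e) tt)))
     ... | false = ≡≤ (*-zeroˡ x) hy
    trivial : ∀ (E : ℕ -> ℚ) -> (∀ q -> 1 ≦ q -> q ≦ N' -> E q ≤ 3ℚ * ι N' * inv (φ q)) ->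
     wsum P (\_ -> 9ℚ * 9ℚ) (\d -> cut d * E (W · d)) ≤ 3ℚ * ι N' * pow h κ162
    trivial E hE = ≤-trans (wsum-good Squarefree squarefree-* P W (9ℚ * 9ℚ) _ (\d -> 3ℚ * ι N' * f (W · d)) 0≤81 freshW Wsf
      (\d sf -> cut-≤ d (E (W · d)) _ (0≤* 0≤3N (0≤inv _)) (\h -> hE (W · d) (proj₁ sf) (cut⇒≤ b≥W rg (W · d) h))))
     (≡≤ (wsum-*ˡ P (\_ -> 9ℚ * 9ℚ) (3ℚ * ι N') (\d -> f (W · d))) (*-monoˡ (3ℚ * ι N') 0≤3N
     (≤-trans (wsum≤∏ P (9ℚ * 9ℚ) (\p -> inv (p ∸ 1)) f W 0≤81 (\p -> 0≤inv (p ∸ 1)) (\m -> 0≤inv (φ m)) freshW (\p q _ pp nd -> ≡⇒≤ (trans (cong inv (φ-* p q pp nd)) (inv-* (p ∸ 1) (φ q)))))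
     (≤≡ (*-mono (0≤inv (φ W)) (pow-nonneg κ162 0≤h) (inv≤1 (φ W)) (∏-lin κ162 (\p -> 9ℚ * 9ℚ * inv (p ∸ 1)) (\p -> 0≤* 0≤81 (0≤inv (p ∸ 1))) (\p m -> le p (prP p m)))) (*-idˡ (pow h κ162)))))) where
     f : ℕ -> ℚ
     f q = inv (φ q)
     0≤81 : 0ℚ ≤ 9ℚ * 9ℚ
     0≤81 = 0≤* 0≤9 0≤9
     0≤3N : 0ℚ ≤ 3ℚ * ι N'
     0≤3N = 0≤* 0≤3 (0≤ι N')
     le : ∀ p -> Prime p -> 9ℚ * 9ℚ * inv (p ∸ 1) ≤ ι κ162 * inv p
     le p pp = ≤≡ (*-monoˡ (9ℚ * 9ℚ) 0≤81 half) (trans (sym (*-assoc (9ℚ * 9ℚ) 2ℚ (inv p))) (cong (_* inv p) (trans (sym (ι-def 162)) (cong ι (sym κ162≡))))) where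
      half : inv (p ∸ 1) ≤ 2ℚ * inv p
      half = inv-pred p (nonTrivial⇒n>1 p {{prime⇒nonTrivial pp}})
    const-part : wsum P (\_ -> 9ℚ) (\d -> cut d * 2ℚ) ≤ 2ℚ * ι N' * inv (2 ^ b) * pow h κ9
    const-part = ≤-trans (wsum-good Squarefree squarefree-* P W 9ℚ _ (\d -> X * inv (W · d)) 0≤9 freshW Wsf
      (\d sf -> cut-≤ d 2ℚ (X * inv (W · d)) (0≤* 0≤X (0≤inv (W · d))) (\h -> pt (W · d) (proj₁ sf) h)))
     (≡≤ (wsum-*ˡ P (\_ -> 9ℚ) X (\d -> inv (W · d))) (*-mono 0≤X (pow-nonneg κ9 0≤h) ≤-refl
     (≤-trans (wsum≤∏ P 9ℚ inv inv W 0≤9 0≤inv 0≤inv freshW (\p q _ _ _ -> ≡⇒≤ (inv-* p q)))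
     (≤≡ (*-mono (0≤inv W) (pow-nonneg κ9 0≤h) (inv≤1 W) (∏-lin κ9 (\p -> 9ℚ * inv p) (\p -> 0≤* 0≤9 (0≤inv p)) (\p _ -> ≡⇒≤ (cong (_* inv p) (trans (sym (ι-def 9)) (cong ι (sym κ9≡))))))) (*-idˡ (pow h κ9)))))) where
     X = 2ℚ * ι N' * inv (2 ^ b)
     0≤X : 0ℚ ≤ X
     0≤X = 0≤* (0≤* 0≤2 (0≤ι N')) (0≤inv (2 ^ b))
     pt : ∀ q -> 1 ≦ q -> q · s N.< W · (R · R) -> 2ℚ ≤ X * inv q
     pt q 1≤q h = ≡≤ (sym (*-idʳ 2ℚ)) (≤≡ (*-monoˡ 2ℚ 0≤2 (≡≤ (sym (*-inv (q · 2 ^ b) 1≤z)) (*-monoʳ (inv (q · 2 ^ b)) (0≤inv (q · 2 ^ b)) (ι-mono qN)))) (trans (cong (\z -> 2ℚ * (ι N' * z)) (inv-* q (2 ^ b))) (id68 (ι N') (inv q) (inv (2 ^ b))))) where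
      1≤z : 1 ≦ q · 2 ^ b
      1≤z = *-mono-≤ 1≤q (m^n>0 2 b)
      qN : q · 2 ^ b ≦ N'
      qN = *-cancelʳ-≤ _ N' s {{>-nonZero 1≤s}} (≡≤ℕ (id24 q (2 ^ b) s) (≦-trans (*-monoʳ-≤ (2 ^ b) (<⇒≤ h)) (≡≤ℕ (id20 (2 ^ b) W (R · R)) large)))
    cancel-pow : ∀ x e -> ι (b ^ x) * inv (b ^ (x N.+ e)) ≡ inv (b ^ e)
    cancel-pow x e = trans (cong (\z -> ι (b ^ x) * z) (trans (cong inv (^-distribˡ-+-* b x e)) (inv-* (b ^ x) (b ^ e)))) (trans (sym (*-assoc (ι (b ^ x)) (inv (b ^ x)) (inv (b ^ e)))) (trans (cong (_* inv (b ^ e)) (*-inv (b ^ x) (m^n>0 b {{>-nonZero (<⇒≤ 2≤b)}} x))) (*-idˡ (inv (b ^ e)))))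
    -- Of the exponent of log N, Γ consumes the first summand, the weight in am-gm the second, and e is left over.
    estimate : ∀ (E : ℕ -> ℚ) e C -> (∀ q -> 0ℚ ≤ E q) -> (∀ q -> 1 ≦ q -> q ≦ N' -> E q ≤ 3ℚ * ι N' * inv (φ q)) ->
     ∑ (moduli 1 (2 · M) N') E ≤ ι C * ι N' * inv (b ^ (4 · κ6 N.+ ((4 · (κ6 N.+ κ162)) N.+ e) N.+ e)) ->
     Γ * wsum P (\_ -> 9ℚ) (\d -> cut d * (E (W · d) + 2ℚ)) ≤ (pow G0 κ6 * ι C + 3ℚ * pow G0 (κ6 N.+ κ162) + 2ℚ * pow G0 (κ6 N.+ κ9) * ι (proj₁ (^≤2^ (4 · (κ6 N.+ κ9) N.+ e)))) * ι N' * inv (b ^ e)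
    estimate E e C hE triv bv = ≤-trans (*-monoˡ Γ 0≤Γ w≤) (≡≤ (id77 Γ _ _ _) (≤≡ (+-mono (+-mono t₁ t₂) t₃) (id78 (pow G0 κ6 * ι C) (3ℚ * pow G0 (κ6 N.+ κ162)) (2ℚ * pow G0 (κ6 N.+ κ9) * ι C2) (ι N') (inv (b ^ e))))) where
     C2 = proj₁ (^≤2^ (4 · (κ6 N.+ κ9) N.+ e))
     e1 = (4 · (κ6 N.+ κ162)) N.+ e
     s₁ = ι (b ^ e1)
     t1' = inv (b ^ e1)
     instance
      nzb : N.NonZero b
      nzb = >-nonZero (<⇒≤ 2≤b)
     0≤Γ : 0ℚ ≤ Γ
     0≤Γ = ∏-nonneg P (\p -> 0≤* (0≤+ 0≤1 (0≤* 0≤3 (0≤inv p))) (0≤+ 0≤1 (0≤* 0≤3 (0≤inv p))))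
     wE : ℚ -> ℚ
     wE K = wsum P (\_ -> K) (\d -> cut d * E (W · d))
     BV = ι C * ι N' * inv (b ^ (4 · κ6 N.+ e1 N.+ e))
     w≤ : wsum P (\_ -> 9ℚ) (\d -> cut d * (E (W · d) + 2ℚ)) ≤ s₁ * BV + t1' * (3ℚ * ι N' * pow h κ162) + 2ℚ * ι N' * inv (2 ^ b) * pow h κ9
     w≤ = ≡≤ (trans (wsum-cong P (\d -> id69 (cut d) (E (W · d)))) (trans (wsum-lin P (\_ -> 9ℚ) 1ℚ (\d -> cut d * E (W · d)) (\d -> cut d * 2ℚ)) (cong (wE 9ℚ +_) (*-idˡ _))))
      (+-mono (≤-trans (am-gm P (\d -> cut d * E (W · d)) s₁ t1' (0≤ι _) (0≤inv _) (*-inv (b ^ e1) (m^n>0 b e1)) (\d -> 0≤* (0≤cut d) (hE _)))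
       (+-mono (*-monoˡ s₁ (0≤ι _) (≤-trans (sum-moduli b≥W rg E hE) bv)) (*-monoˡ t1' (0≤inv _) (trivial E triv)))) const-part)
     0≤N : 0ℚ ≤ ι N'
     0≤N = 0≤ι N'
     t₁ : Γ * (s₁ * BV) ≤ pow G0 κ6 * ι C * (ι N' * inv (b ^ e))
     t₁ = ≤≡ (*-monoʳ (s₁ * BV) (0≤* (0≤ι _) (0≤* (0≤* (0≤ι C) 0≤N) (0≤inv _))) (≤-trans Γ≤ (h≤ κ6))) (trans (id70 (pow G0 κ6) (ι (b ^ (4 · κ6))) s₁ (ι C) (ι N') (inv (b ^ (4 · κ6 N.+ e1 N.+ e))))
      (cong (\z -> pow G0 κ6 * ι C * (ι N' * z)) (trans (cong (_* inv (b ^ (4 · κ6 N.+ e1 N.+ e))) (trans (sym (ι-* (b ^ (4 · κ6)) (b ^ e1))) (cong ι (sym (^-distribˡ-+-* b (4 · κ6) e1))))) (cancel-pow (4 · κ6 N.+ e1) e))))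
     t₂ : Γ * (t1' * (3ℚ * ι N' * pow h κ162)) ≤ 3ℚ * pow G0 (κ6 N.+ κ162) * (ι N' * inv (b ^ e))
     t₂ = ≤-trans (*-monoʳ _ (0≤* (0≤inv _) (0≤* (0≤* 0≤3 0≤N) (pow-nonneg κ162 0≤h))) Γ≤) (≡≤ (id71 (pow h κ6) t1' (ι N') (pow h κ162)) (≤≡ (*-monoˡ (3ℚ * ι N' * t1') (0≤* (0≤* 0≤3 0≤N) (0≤inv _)) (≡≤ (sym (pow-+ h κ6 κ162)) (h≤ (κ6 N.+ κ162))))
      (trans (id72 (ι N') t1' (pow G0 (κ6 N.+ κ162)) (ι (b ^ (4 · (κ6 N.+ κ162))))) (cong (\z -> 3ℚ * pow G0 (κ6 N.+ κ162) * (ι N' * z)) (cancel-pow (4 · (κ6 N.+ κ162)) e)))))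
     t₃ : Γ * (2ℚ * ι N' * inv (2 ^ b) * pow h κ9) ≤ 2ℚ * pow G0 (κ6 N.+ κ9) * ι C2 * (ι N' * inv (b ^ e))
     t₃ = ≤-trans (*-monoʳ _ (0≤* (0≤* (0≤* 0≤2 0≤N) (0≤inv _)) (pow-nonneg κ9 0≤h)) Γ≤) (≡≤ (id73 (pow h κ6) (ι N') (inv (2 ^ b)) (pow h κ9))
      (≤-trans (*-monoˡ (2ℚ * ι N' * inv (2 ^ b)) (0≤* (0≤* 0≤2 0≤N) (0≤inv _)) (≡≤ (sym (pow-+ h κ6 κ9)) (h≤ (κ6 N.+ κ9)))) (≡≤ (id74 (ι N') (inv (2 ^ b)) (pow G0 (κ6 N.+ κ9)) (ι (b ^ (4 · (κ6 N.+ κ9)))))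
      (≤≡ (*-monoˡ (2ℚ * pow G0 (κ6 N.+ κ9) * ι N') (0≤* (0≤* 0≤2 (pow-nonneg (κ6 N.+ κ9) 0≤G0)) 0≤N) exp) (id75 (pow G0 (κ6 N.+ κ9)) (ι N') (ι C2) (inv (b ^ e))))))) where
      exp : ι (b ^ (4 · (κ6 N.+ κ9))) * inv (2 ^ b) ≤ ι C2 * inv (b ^ e)
      exp = ≡≤ (trans (cong (_* inv (2 ^ b)) (cancel60)) (id67 (inv (b ^ e)) (ι (b ^ (4 · (κ6 N.+ κ9) N.+ e))) (inv (2 ^ b)))) (≤≡ (*-monoˡ (inv (b ^ e)) (0≤inv _) le) (ℚ.*-comm (inv (b ^ e)) (ι C2))) where
       cancel60 : ι (b ^ (4 · (κ6 N.+ κ9))) ≡ ι (b ^ (4 · (κ6 N.+ κ9) N.+ e)) * inv (b ^ e)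
       cancel60 = sym (trans (cong (_* inv (b ^ e)) (trans (cong ι (^-distribˡ-+-* b (4 · (κ6 N.+ κ9)) e)) (ι-* (b ^ (4 · (κ6 N.+ κ9))) (b ^ e)))) (trans (*-assoc (ι (b ^ (4 · (κ6 N.+ κ9)))) (ι (b ^ e)) (inv (b ^ e))) (trans (cong (ι (b ^ (4 · (κ6 N.+ κ9))) *_) (*-inv (b ^ e) (m^n>0 b e))) (*-idʳ (ι (b ^ (4 · (κ6 N.+ κ9))))))))
       le : ι (b ^ (4 · (κ6 N.+ κ9) N.+ e)) * inv (2 ^ b) ≤ ι C2
       le = ≤≡ (*-monoʳ (inv (2 ^ b)) (0≤inv _) (≤≡ (ι-mono (proj₂ (^≤2^ (4 · (κ6 N.+ κ9) N.+ e)) b)) (ι-* C2 (2 ^ b)))) (trans (*-assoc (ι C2) (ι (2 ^ b)) (inv (2 ^ b))) (trans (cong (ι C2 *_) (*-inv (2 ^ b) (m^n>0 2 b))) (*-idʳ (ι C2))))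
    saving⇒ : ∀ (S : ℕ -> ℚ) A C -> S N' * toℚ (⌊log₂ N' ⌋ ^ A) ≤ toℚ (C · N') -> 0ℚ ≤ S N' -> S N' ≤ ι C * ι N' * inv (b ^ A)
    saving⇒ S A C h hS = ≤≡ (≤inv (b ^ A) (m^n>0 b {{>-nonZero (<⇒≤ 2≤b)}} A) (≡≤ (ℚ.*-comm (ι (b ^ A)) (S N'))
     (≤-trans (*-monoˡ (S N') hS (ι-mono (^-monoˡ-≤ A (≡≤ℕ (sym (⌊log₂[2^n]⌋≡n b)) (⌊log₂⌋-mono-≤ log))))) (≡≤ (cong (S N' *_) (ι-def (⌊log₂ N' ⌋ ^ A))) (≤≡ h (trans (sym (ι-def (C · N'))) (ι-* C N')))))))
     (ℚ.*-comm (inv (b ^ A)) (ι C * ι N'))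

module Shift where

 open Identities
 open Field
 open Sums
 open Forms using (sh)
 open Sieve using (Λ; Λ-lin)
 open Smooth using (divides-true; divides-false; divides⇒∣; prime-∣-prime; 1≤prime; cop)
 open Phi
 open import Defs using (congᵇ; divides; coprimeᵇ)
 open Rationals

 -- With m = n + h, the condition p ∣ n + k for some k in hs is that m lies in one of these classes.
 res : ℕ -> List ℕ -> ℕ -> List ℕ
 res h hs p = map (\k -> h N.+ (p ∸ k)) hs

 hits : (ℕ -> List ℕ) -> ℕ -> ℕ -> ℚ
 hits r p n = ∑ (r p) (\c -> ind (congᵇ p n c))

 hits-01 : ∀ (r : ℕ -> List ℕ) p n -> AllPairs (\c c' -> ¬ Cong p c c') (r p) -> hits r p n * hits r p n ≡ hits r p n
 hits-01 r p n ap = go (r p) ap where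
  S : List ℕ -> ℚ
  S cs = ∑ cs (\c -> ind (congᵇ p n c))
  none : ∀ c cs -> congᵇ p n c ≡ true -> All (\c' -> ¬ Cong p c c') cs -> S cs ≡ 0ℚ
  none c [] e a = refl
  none c (c' ∷ cs) e (h ∷ a) with congᵇ p n c' in e'
  ... | true = contradiction (Cong-trans (Cong-sym (congᵇ⇒ p n c e)) (congᵇ⇒ p n c' e')) h
  ... | false = trans (+-idˡ _) (none c cs e a)
  go : ∀ cs -> AllPairs (\c c' -> ¬ Cong p c c') cs -> S cs * S cs ≡ S cs
  go [] _ = refl
  go (c ∷ cs) (a ∷ ap) with congᵇ p n c in e
  ... | true = trans (cong (\z -> (1ℚ + z) * (1ℚ + z)) (none c cs e a)) (sym (cong (1ℚ +_) (none c cs e a)))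
  ... | false = trans (cong₂ _*_ (+-idˡ (S cs)) (+-idˡ (S cs))) (trans (go cs ap) (sym (+-idˡ (S cs))))

 congᵇ-ext : ∀ p n a q m c -> (Cong p n a -> Cong q m c) -> (Cong q m c -> Cong p n a) -> congᵇ p n a ≡ congᵇ q m c
 congᵇ-ext p n a q m c f g = bool-ext (\e -> ⇒congᵇ q m c (f (congᵇ⇒ p n a e))) (\e -> ⇒congᵇ p n a (g (congᵇ⇒ q m c e)))

 shift-class : ∀ p n h k -> congᵇ p (n N.+ h) (h N.+ (p ∸ k)) ≡ congᵇ p n (p ∸ k)
 shift-class p n h k = congᵇ-ext p (n N.+ h) (h N.+ (p ∸ k)) p n (p ∸ k) (\c -> Cong-+⁻ h (subst (Cong p (n N.+ h)) (+-comm h (p ∸ k)) c)) (\c -> subst (Cong p (n N.+ h)) (+-comm (p ∸ k) h) (Cong-+ h c))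

 divides-class : ∀ p n h -> h ≦ p -> congᵇ p n (p ∸ h) ≡ divides p (n N.+ h)
 divides-class p n h le = bool-ext (\e -> divides-true (Cong-∣ ∣-refl (Cong-sym (subst (Cong p (n N.+ h)) (m∸n+n≡m le) (Cong-+ h (congᵇ⇒ p n (p ∸ h) e)))) ∣-refl))
  (\e -> ⇒congᵇ p n (p ∸ h) (Cong-+⁻ h (subst (Cong p (n N.+ h)) (sym (m∸n+n≡m le)) (to (divides⇒∣ p (n N.+ h) e))))) where
  to : ∀ {x} -> p ∣ x -> Cong p x p
  to {x} (Data.Nat.Divisibility.divides q refl) = cg 1 q (id87 p q)

 hits-none : ∀ (r : ℕ -> List ℕ) p n -> (∀ c -> c ∈ r p -> p ∤ c) -> p ∣ n -> hits r p n ≡ 0ℚ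
 hits-none r p n h d = go (r p) h where
  go : ∀ cs -> (∀ c -> c ∈ cs -> p ∤ c) -> ∑ cs (\c -> ind (congᵇ p n c)) ≡ 0ℚ
  go [] h = refl
  go (c ∷ cs) h with congᵇ p n c in e
  ... | false = trans (+-idˡ _) (go cs (\c m -> h c (there m)))
  ... | true = contradiction (Cong-∣ ∣-refl (congᵇ⇒ p n c e) d) (h c (here refl))

 class-≢ : ∀ p h k k' -> k N.< k' -> k' N.< p -> ¬ Cong p (h N.+ (p ∸ k)) (h N.+ (p ∸ k'))
 class-≢ p h k k' lt lt' c = >⇒∤ {{>-nonZero (m<n⇒0<n∸m lt)}} (≤-<-trans (m∸n≤m k' k) lt') (Cong-⇒∣ (k' ∸ k) (subst (Cong p (h N.+ (p ∸ k'))) e (Cong-sym c))) where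
  e : h N.+ (p ∸ k) ≡ h N.+ (p ∸ k') N.+ (k' ∸ k)
  e = trans (cong (h N.+_) (trans (cong (_∸ k) (sym (m∸n+n≡m (<⇒≤ lt')))) (+-∸-assoc (p ∸ k') (<⇒≤ lt)))) (sym (+-assoc h (p ∸ k') (k' ∸ k)))

 class-unit : ∀ p h k -> h ≢ k -> h N.< p -> k N.< p -> p ∤ h N.+ (p ∸ k)
 class-unit p h k ne hp kp d with <-cmp h k
 ... | tri≈ _ e _ = ne e
 ... | tri< lt _ _ = >⇒∤ {{>-nonZero (≦-trans (m<n⇒0<n∸m kp) (m≤n+m (p ∸ k) h))}} (<-≤-trans (+-monoˡ-< (p ∸ k) lt) (N.≤-reflexive (m+[n∸m]≡n (<⇒≤ kp)))) d
 ... | tri> _ _ gt = >⇒∤ {{>-nonZero (m<n⇒0<n∸m gt)}} (≤-<-trans (m∸n≤m h k) hp) (∣m+n∣m⇒∣n {p} {p} (subst (p ∣_) e d) ∣-refl) where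
  e : h N.+ (p ∸ k) ≡ p N.+ (h ∸ k)
  e = trans (cong (N._+ (p ∸ k)) (sym (m+[n∸m]≡n (<⇒≤ gt)))) (trans (id88 k (h ∸ k) (p ∸ k)) (cong (N._+ (h ∸ k)) (m+[n∸m]≡n (<⇒≤ kp))))

 Λ-cong : ∀ γ (χ χ' : ℕ -> ℕ -> ℚ) P y n n' -> (∀ p -> p ∈ P -> χ p n ≡ χ' p n') -> Λ γ χ P y n ≡ Λ γ χ' P y n'
 Λ-cong γ χ χ' [] y n n' h = refl
 Λ-cong γ χ χ' (p ∷ P) y n n' h = cong₂ _+_ (Λ-cong γ χ χ' P y n n' h') (cong₂ (\a b -> (γ p - a) * b) (h p (here refl)) (Λ-cong γ χ χ' P (sh p y) n n' h')) where
  h' : ∀ q -> q ∈ P -> χ q n ≡ χ' q n'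
  h' q m = h q (there m)

 Λ-ext : ∀ p1 -> Prime p1 -> ∀ γ χ P u v n -> (∀ p -> p ∈ P -> Prime p × p ≢ p1) -> (∀ m -> p1 ∤ m -> u m ≡ v m) -> Λ γ χ P u n ≡ Λ γ χ P v n
 Λ-ext p1 pr γ χ [] u v n hP h = h 1 (\d -> ¬prime[1] (subst Prime (∣1⇒≡1 d) pr))
 Λ-ext p1 pr γ χ (p ∷ P) u v n hP h = cong₂ (\a b -> a + (γ p - χ p n) * b) (Λ-ext p1 pr γ χ P u v n (\q m -> hP q (there m)) h)
  (Λ-ext p1 pr γ χ P (sh p u) (sh p v) n (\q m -> hP q (there m)) (\m nd -> h (p · m) (\d -> [ (\d' -> proj₂ (hP p (here refl)) (sym (prime-∣-prime (proj₁ (hP p (here refl))) pr d'))) , nd ]′ (euclidsLemma p m pr d))))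

 punct : ℕ -> (ℕ -> ℚ) -> ℕ -> ℚ
 punct p u m = ind (not (divides p m)) * u (p · m)

 0≤punct : ∀ p u m -> 0ℚ ≤ u (p · m) -> 0ℚ ≤ punct p u m
 0≤punct p u m h = 0≤* (0≤ind (not (divides p m))) h

 punct≤ : ∀ p u m -> 0ℚ ≤ u (p · m) -> punct p u m ≤ u (p · m)
 punct≤ p u m h = ≤≡ (*-monoʳ (u (p · m)) h (ind≤1 (not (divides p m)))) (*-idˡ (u (p · m)))

 punct-∤ : ∀ p u m -> p ∤ m -> punct p u m ≡ u (p · m)
 punct-∤ p u m nd = trans (cong (\z -> ind (not z) * u (p · m)) (divides-false nd)) (*-idˡ (u (p · m)))

 punct-∣ : ∀ p u m -> p ∣ m -> punct p u m ≡ 0ℚ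
 punct-∣ p u m d = trans (cong (\z -> ind (not z) * u (p · m)) (divides-true d)) (*-zeroˡ (u (p · m)))

 punct-sh : ∀ p q u m -> Prime p -> Prime q -> q ≢ p -> punct p u (q · m) ≡ punct p (sh q u) m
 punct-sh p q u m pp pq ne = cong₂ (\a b -> ind (not a) * u b) (bool-ext (\e -> divides-true ([ (\d -> contradiction (sym (prime-∣-prime pq pp d)) ne) , (\d -> d) ]′ (euclidsLemma q m pp (divides⇒∣ p (q · m) e)))) (\e -> divides-true (∣n⇒∣m*n q (divides⇒∣ p m e)))) (id18 p q m)

 -- A factor with χ p1 = 1 can be traded for one with χ' p1 = 0 by replacing u(m) with u(m) - u(p1 m) for m prime to p1.
 Λ-remove : ∀ γ (χ χ' : ℕ -> ℕ -> ℚ) P p1 u n n' -> Prime p1 -> p1 ∈ P -> Unique P -> (∀ p -> p ∈ P -> Prime p) ->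
  (∀ p -> p ∈ P -> p ≢ p1 -> χ p n ≡ χ' p n') -> χ p1 n ≡ 1ℚ -> χ' p1 n' ≡ 0ℚ ->
  Λ γ χ P u n ≡ Λ γ χ' P (\m -> u m + - 1ℚ * punct p1 u m) n'
 Λ-remove γ χ χ' (p ∷ P) p1 u n n' pr (here refl) (np ∷ uq) hP h e1 e0 = trans (cong (\b -> Λ γ χ P u n + (γ p - b) * Λ γ χ P u1 n) e1)
  (trans (cong₂ (\a b -> a + (γ p - 1ℚ) * b) (eqχ u) (eqχ u1)) (trans (id90 (γ p) (Λ γ χ' P u n') (Λ γ χ' P u1 n'))
  (cong₂ _+_ (trans (sym (Λ-lin' u u1)) (Λ-ext p pr γ χ' P (\m -> u m + - 1ℚ * u1 m) v n' hP' (\m nd -> cong (\z -> u m + - 1ℚ * z) (sym (punct-∤ p u m nd)))))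
   (cong₂ (\a b -> (γ p - a) * b) (sym e0) (sym shv))))) where
  u1 v : ℕ -> ℚ
  u1 = sh p u
  v m = u m + - 1ℚ * punct p u m
  hP' : ∀ q -> q ∈ P -> Prime q × q ≢ p
  hP' q m = hP q (there m) , \e -> All.lookup np m (sym e)
  eqχ : ∀ u -> Λ γ χ P u n ≡ Λ γ χ' P u n'
  eqχ u = Λ-cong γ χ χ' P u n n' (\q m -> h q (there m) (proj₂ (hP' q m)))
  Λ-lin' : ∀ a b -> Λ γ χ' P (\m -> a m + - 1ℚ * b m) n' ≡ Λ γ χ' P a n' + - 1ℚ * Λ γ χ' P b n'
  Λ-lin' a b = Λ-lin γ χ' P (- 1ℚ) a b n'
  shv : Λ γ χ' P (sh p v) n' ≡ Λ γ χ' P u1 n'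
  shv = Λ-ext p pr γ χ' P (sh p v) u1 n' hP' (\m _ -> trans (cong (\z -> u (p · m) + - 1ℚ * z) (punct-∣ p u (p · m) (m∣m*n m))) (id89 (u (p · m))))
 Λ-remove γ χ χ' (p ∷ P) p1 u n n' pr (there m∈) (np ∷ uq) hP h e1 e0 = cong₂ _+_ (ih u) (cong₂ (\a b -> (γ p - a) * b) (h p (here refl) ne)
   (trans (ih (sh p u)) (ext P (\m -> cong (\z -> u (p · m) + - 1ℚ * z) (sym (punct-sh p1 p u m pr (hP p (here refl)) ne)))))) where
  ne : p ≢ p1
  ne e = All.lookup np m∈ e
  ih : ∀ u -> Λ γ χ P u n ≡ Λ γ χ' P (\m -> u m + - 1ℚ * punct p1 u m) n'
  ih u = Λ-remove γ χ χ' P p1 u n n' pr m∈ uq (\q m -> hP q (there m)) (\q m -> h q (there m)) e1 e0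
  ext : ∀ P {a b : ℕ -> ℚ} -> (∀ m -> a m ≡ b m) -> Λ γ χ' P a n' ≡ Λ γ χ' P b n'
  ext [] h = h 1
  ext (q ∷ P) h = cong₂ (\x y -> x + (γ q - χ' q n') * y) (ext P h) (ext P (\m -> h (q · m)))

 -- W / 2 + 2 and its shifts by 2 and 6 are prime to the squarefree even number W.
 base-residue : ∀ Q W W' h -> (∀ q -> q ∈ Q -> Prime q) -> (∀ q -> q ∈ Q -> q ∣ W) -> W ≡ 2 · W' -> 2 ∤ W' -> Prime 2 -> (h ≡ 0 ⊎ (h ≡ 2 ⊎ h ≡ 6)) -> cop Q (2 N.+ W' N.+ h) ≡ true
 base-residue [] W W' h hQ hW e odd p2 hh = refl
 base-residue (q ∷ Q) W W' h hQ hW e odd p2 hh = cong₂ (\a b -> not a Data.Bool.∧ b) (divides-false {q} (nd hh)) (base-residue Q W W' h (\id91 m -> hQ id91 (there m)) (\id91 m -> hW id91 (there m)) e odd p2 hh) where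
  pq : Prime q
  pq = hQ q (here refl)
  two : ∀ {a b} -> ¬ q ∣ a -> ¬ q ∣ b -> ¬ q ∣ a · b
  two {a} {b} x y d = [ x , y ]′ (euclidsLemma a b pq d)
  nd : (h ≡ 0 ⊎ (h ≡ 2 ⊎ h ≡ 6)) -> ¬ q ∣ 2 N.+ W' N.+ h
  nd hh d with q N.≟ 2
  ... | yes refl = odd (∣m+n∣m⇒∣n {2} {2 N.+ h} (subst (2 ∣_) (trans (id91 W' h) (+-comm W' (2 N.+ h))) d) (even hh)) where
   even : (h ≡ 0 ⊎ (h ≡ 2 ⊎ h ≡ 6)) -> 2 ∣ 2 N.+ h
   even (inj₁ refl) = m∣m*n 1
   even (inj₂ (inj₁ refl)) = m∣m*n 2
   even (inj₂ (inj₂ refl)) = m∣m*n 4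
  ... | no ne with euclidsLemma 2 W' pq (subst (q ∣_) e (hW q (here refl)))
  ... | inj₁ d2 = ne (prime-∣-prime p2 pq d2)
  ... | inj₂ dW = pow2 hh (∣m+n∣m⇒∣n {q} {W'} (subst (q ∣_) (id91 W' h) d) dW) where
   n2 : ¬ q ∣ 2
   n2 d = ne (prime-∣-prime p2 pq d)
   pow2 : (h ≡ 0 ⊎ (h ≡ 2 ⊎ h ≡ 6)) -> ¬ q ∣ 2 N.+ h
   pow2 (inj₁ refl) = n2
   pow2 (inj₂ (inj₁ refl)) = two {2} {2} n2 n2
   pow2 (inj₂ (inj₂ refl)) = two {2} {4} n2 (two {2} {2} n2 n2)

module Counts where

 open Identities
 open Field
 open Sums
 open Forms
 open Sieve
 open MainForm
 open Smooth using (divides-true; divides-false; divides⇒∣; prime-∣-prime; 1≤prime; ∑-multiples'; cop)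
 open Cheb using (isPrime-true; isPrime⇒; ∈-primes⁺; ∈-primes⁻)
 open Phi
 open Shift
 open BVErr
 open Lower
 open Setup
 open import Defs
 open import Data.Bool using (T)
 open Rationals

 ∈-filterᵇ⁻ : ∀ (f : ℕ -> Bool) xs {m} -> m ∈ filterᵇ f xs -> m ∈ xs × f m ≡ true
 ∈-filterᵇ⁻ f xs {m} m∈ with ∈-filter⁻ (T? ∘ f) {xs = xs} m∈
 ... | r , t = r , T⇒ (f m) t where
  T⇒ : ∀ b -> T b -> b ≡ true
  T⇒ true _ = refl

 any-elim : ∀ (f : ℕ -> Bool) xs -> any f xs ≡ true -> ∃[ x ] (x ∈ xs × f x ≡ true)
 any-elim f (x ∷ xs) e with f x in eq
 ... | true = x , here refl , eq
 ... | false with any-elim f xs e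
 ... | z , m , h = z , there m , h

 any-intro : ∀ (f : ℕ -> Bool) xs x -> x ∈ xs -> f x ≡ true -> any f xs ≡ true
 any-intro f (y ∷ xs) x (here refl) e rewrite e = refl
 any-intro f (y ∷ xs) x (there m) e with f y
 ... | true = refl
 ... | false = any-intro f xs x m e

 ∑-single : ∀ (P : List ℕ) d (g : ℕ -> ℚ) -> Unique P -> d ∈ P -> (∀ p -> p ∈ P -> p ≢ d -> g p ≡ 0ℚ) -> ∑ P g ≡ g d
 ∑-single (p ∷ P) d g (np ∷ u) (here refl) h = trans (cong (g p +_) (trans (∑-cong∈ P (\q m -> h q (there m) (\e -> All.lookup np m (sym e)))) (∑-0 P))) (+-idʳ (g p))
 ∑-single (p ∷ P) d g (np ∷ u) (there m) h = trans (cong₂ _+_ (h p (here refl) (\e -> All.lookup np m e)) (∑-single P d g u m (\q k -> h q (there k)))) (+-idˡ (g d))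

 ∑-cong-class : ∀ (f : ℕ -> Bool) xs q a -> ∑ (filterᵇ f xs) (\m -> ind (congᵇ q m a)) ≡ toℚ (count (\m -> f m ∧ congᵇ q m a) xs)
 ∑-cong-class f xs q a = trans (∑-filter f xs (\m -> ind (congᵇ q m a))) (trans (∑-cong xs (\m -> sym (ind-∧ (f m) (congᵇ q m a)))) (trans (sym (count≡∑ (\m -> f m ∧ congᵇ q m a) xs)) (ι-def _)))

 ≤maxRes : ∀ q a (f : ℕ -> ℚ) -> a N.< q -> Coprime a q -> f a ≤ maxRes q f
 ≤maxRes q a f h c = ≤maxQ {f = f} (∈-filter⁺ (T? ∘ (\a -> coprimeᵇ a q)) (∈-upTo⁺ h) (subst T (sym (⇒coprimeᵇ a q c)) tt))

 0≤maxRes : ∀ q (f : ℕ -> ℚ) -> 0ℚ ≤ maxRes q f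
 0≤maxRes q f = 0≤maxQ (map f (filterᵇ (\a -> coprimeᵇ a q) (upTo q)))

 ∑-interval-multiples : ∀ p b c (G : ℕ -> ℚ) {{_ : N.NonZero p}} -> b ≦ c ->
  ∑ (range (suc b) (suc c)) (\m -> ind (divides p m) * G m) ≡ ∑ (range (suc (b N./ p)) (suc (c N./ p))) (\i -> G (p · i))
 ∑-interval-multiples p b c G le = cancel (∑ (range 0 (suc b)) g) (trans (sym (∑-range-split 0 (suc b) (suc c) g z≤n (s≤s le))) (trans (prefix c) (trans (∑-range-split 0 (suc (b N./ p)) (suc (c N./ p)) (\i -> G (p · i)) z≤n (s≤s (/-monoˡ-≤ p le)))
   (cong (_+ ∑ (range (suc (b N./ p)) (suc (c N./ p))) (\i -> G (p · i))) (sym (prefix b)))))) where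
  g : ℕ -> ℚ
  g m = ind (divides p m) * G m
  cancel : ∀ x {y z} -> x + y ≡ x + z -> y ≡ z
  cancel x {y} {z} e = trans (id104 x y) (trans (cong (_- x) e) (sym (id104 x z)))
  prefix : ∀ b -> ∑ (range 0 (suc b)) g ≡ ∑ (range 0 (suc (b N./ p))) (\i -> G (p · i))
  prefix b = trans (sym (trans (∑-range-split 0 (suc b) top g z≤n b<top) (trans (cong (∑ (range 0 (suc b)) g +_) tail) (+-idʳ _)))) (∑-multiples' p (suc (b N./ p)) G (>-nonZero⁻¹ p)) where
   top = p · suc (b N./ p)
   b<top : b N.< top
   b<top = ≦-trans (s≤s (N.≤-reflexive (m≡m%n+[m/n]*n b p))) (≤≡ℕ (+-monoˡ-< (b N./ p · p) (m%n<n b p)) (*-comm (suc (b N./ p)) p))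
   tail : ∑ (range (suc b) top) g ≡ 0ℚ
   tail = trans (∑-cong∈ (range (suc b) top) (\m m∈ -> trans (cong (\z -> ind z * G m) (divides-false (nd m (∈-range⁻ {suc b} {top} m∈)))) (*-zeroˡ (G m)))) (∑-0 (range (suc b) top)) where
    nd : ∀ m -> suc b ≦ m × m N.< top -> ¬ p ∣ m
    nd m (h1 , h2) (Data.Nat.Divisibility.divides i refl) = <-irrefl refl (<-≤-trans (*-cancelˡ-< p i (suc (b N./ p)) (subst (N._< top) (*-comm i p) h2))
     (≦-trans (*-cancelʳ-< p (b N./ p) i (≤-<-trans (m/n*n≤m b p) h1)) N.≤-refl))

 divℕ-≤ : ∀ N p -> 1 ≦ p -> p · divℕ N p ≦ N
 divℕ-≤ N p@(suc _) _ = ≡≤ℕ (*-comm p (N N./ p)) (m/n*n≤m N p)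

 divℕ-< : ∀ N p -> 1 ≦ p -> N N.< p · suc (divℕ N p)
 divℕ-< N p@(suc _) _ = ≦-trans (s≤s (N.≤-reflexive (m≡m%n+[m/n]*n N p))) (≤≡ℕ (+-monoˡ-< (N N./ p · p) (m%n<n N p)) (*-comm (suc (N N./ p)) p))

 divℕ-* : ∀ d e -> 1 ≦ d -> divℕ (d · e) d ≡ e
 divℕ-* d@(suc _) e _ = trans (cong (N._/ d) (*-comm d e)) (m*n/n≡m e d)

 divℕ-mono : ∀ {M N} p -> M ≦ N -> divℕ M p ≦ divℕ N p
 divℕ-mono zero h = z≤n
 divℕ-mono (suc k) h = /-monoˡ-≤ (suc k) h

 ∑-multiples-div : ∀ p b c (G : ℕ -> ℚ) -> 1 ≦ p -> b ≦ c ->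
  ∑ (range (suc b) (suc c)) (\m -> ind (divides p m) * G m) ≡ ∑ (range (suc (divℕ b p)) (suc (divℕ c p))) (\i -> G (p · i))
 ∑-multiples-div p@(suc _) b c G _ le = ∑-interval-multiples p b c G le

 ∧-elim : ∀ a {b} -> a ∧ b ≡ true -> a ≡ true × b ≡ true
 ∧-elim true e = refl , e

 ≤ᵇ-true : ∀ {x y} -> x ≦ y -> (x ≤ᵇ y) ≡ true
 ≤ᵇ-true {x} {y} h with x ≤ᵇ y | ≤⇒≤ᵇ h
 ... | true | _ = refl

 <ᵇ-true : ∀ {x y} -> x N.< y -> (x <ᵇ y) ≡ true
 <ᵇ-true {x} {y} h with x <ᵇ y | <⇒<ᵇ h
 ... | true | _ = refl

 ≤ᵇ-elim : ∀ x y -> (x ≤ᵇ y) ≡ true -> x ≦ y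
 ≤ᵇ-elim x y e = ≤ᵇ⇒≤ x y (subst T (sym e) tt)

 <ᵇ-elim : ∀ x y -> (x <ᵇ y) ≡ true -> x N.< y
 <ᵇ-elim x y e = <ᵇ⇒< x y (subst T (sym e) tt)

 record Semiprime (v N m : ℕ) : Set where
  constructor semi
  field
   d e : ℕ
   pd : Prime d
   pe : Prime e
   m≡ : m ≡ d · e
   N<d : N ^ 1 N.< d ^ v
   dd≤N : d · d ≦ N
   N<ee : N N.< e · e

 β⇒ : ∀ v N m -> βᵇ 1 v N m ≡ true -> Semiprime v N m
 β⇒ v N m e = from (any-elim _ (range 1 (suc m)) e) where
  from : ∃[ d ] (d ∈ range 1 (suc m) × (isPrimeᵇ d ∧ divides d m ∧ isPrimeᵇ (divℕ m d) ∧ (N ^ 1 <ᵇ d ^ v) ∧ (d · d ≤ᵇ N) ∧ (N <ᵇ divℕ m d · divℕ m d)) ≡ true) -> Semiprime v N m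
  from (d , _ , e0) = let (e1 , f1) = ∧-elim (isPrimeᵇ d) e0; (e2 , f2) = ∧-elim (divides d m) f1; (e3 , f3) = ∧-elim (isPrimeᵇ (divℕ m d)) f2; (e4 , f4) = ∧-elim (N ^ 1 <ᵇ d ^ v) f3; (e5 , e6) = ∧-elim (d · d ≤ᵇ N) f4
   in semi d (divℕ m d) (isPrime⇒ d e1) (isPrime⇒ _ e3) (m≡ d (divides⇒∣ d m e2) (1≤prime (isPrime⇒ d e1))) (<ᵇ-elim _ _ e4) (≤ᵇ-elim _ _ e5) (<ᵇ-elim _ _ e6) where
   m≡ : ∀ d -> d ∣ m -> 1 ≦ d -> m ≡ d · divℕ m d
   m≡ d (Data.Nat.Divisibility.divides q refl) h = trans (*-comm q d) (cong (d N.*_) (sym (trans (cong (\z -> divℕ z d) (*-comm q d)) (divℕ-* d q h))))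

 ⇒β : ∀ v N d e -> Prime d -> Prime e -> N ^ 1 N.< d ^ v -> d · d ≦ N -> N N.< e · e -> βᵇ 1 v N (d · e) ≡ true
 ⇒β v N d e pd pe h1 h2 h3 = any-intro _ (range 1 (suc (d · e))) d (∈-range⁺ {1} {suc (d · e)} (1≤prime pd) (s≤s (m≤m*n d e {{>-nonZero (1≤prime pe)}})))
  (cong₂ _∧_ (isPrime-true pd) (cong₂ _∧_ (divides-true {d} {d · e} (m∣m*n e)) (cong₂ _∧_ (subst (\z -> isPrimeᵇ z ≡ true) (sym q) (isPrime-true pe)) (cong₂ _∧_ (<ᵇ-true h1) (cong₂ _∧_ (≤ᵇ-true h2) (<ᵇ-true (subst (\z -> N N.< z · z) (sym q) h3)))))))
  where
  q : divℕ (d · e) d ≡ e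
  q = divℕ-* d e (1≤prime pd)

 Adm : ℕ -> ℕ -> Set
 Adm q a = 1 ≦ q × Coprime a q × a N.< q

 crt-unit : ∀ (ns : List ℕ) p q a c -> Prime p -> p ∤ q -> p ∤ c -> Adm q a ->
  ∃[ a' ] (Adm (p · q) a' × (∀ n -> n ∈ ns -> ind (congᵇ q n a) * ind (congᵇ p n c) ≡ ind (congᵇ (p · q) n a')))
 crt-unit ns p q a c pp nd nc (1≤q , cop , a<q) = join (crt p q a c pp nd 1≤q) where
  join : ∃[ a' ] (a' N.< p · q × Cong q a' a × Cong p a' c × (∀ n -> ind (congᵇ q n a) * ind (congᵇ p n c) ≡ ind (congᵇ (p · q) n a'))) ->
   ∃[ a' ] (Adm (p · q) a' × (∀ n -> n ∈ ns -> ind (congᵇ q n a) * ind (congᵇ p n c) ≡ ind (congᵇ (p · q) n a')))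
  join (a' , lt , cq , cp , eq) = a' , (*-mono-≤ (1≤prime pp) 1≤q , coprime-*ʳ (coprime-prime pp (\d -> nc (Cong-∣ ∣-refl cp d))) (Cong-coprime (Cong-sym cq) cop) , lt) , \n _ -> eq n

 cop-true : ∀ Q a -> (∀ q -> q ∈ Q -> q ∤ a) -> cop Q a ≡ true
 cop-true [] a h = refl
 cop-true (q ∷ Q) a h = cong₂ (\x y -> not x ∧ y) (divides-false {q} {a} (h q (here refl))) (cop-true Q a (\r m -> h r (there m)))

 module Level (D n k : ℕ) (7≤D : 7 ≦ D) (1≤n : 1 ≦ n) (b : ℕ) (F : ℕ -> ℕ) (F-anti : ∀ {i j} -> i ≦ j -> F j ≦ F i) (F-0 : ∀ {i} -> n ≦ i -> F i ≡ 0) where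
  2≤D : 2 ≦ D
  2≤D = ≦-trans (m≤m+n 2 5) 7≤D
  open Regime D n k 2≤D 1≤n b public
  open Step B n 2≤B F F-anti F-0 public
  γ : ℕ -> ℚ
  γ p = 3ℚ * inv p
  0≤γ : ∀ p -> 0ℚ ≤ γ p
  0≤γ p = 0≤* 0≤3 (0≤inv p)
  γ≤1 : ∀ p -> 6 N.< p -> γ p ≤ 1ℚ
  γ≤1 p h = ≤≡ (*-monoʳ (inv p) (0≤inv p) (≡≤ (sym (ι-def 3)) (ι-mono (≦-trans (m≤m+n 3 4) h)))) (*-inv p (≦-trans N.z<s h))
  6<P : ∀ p -> p ∈ P -> 6 N.< p
  6<P p m = <-trans 7≤D (D<P p m)
  U = ι (F 0)
  0≤U : 0ℚ ≤ U
  0≤U = 0≤ι (F 0)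
  cut : ℕ -> ℕ -> ℚ
  cut s d = below (W · (R · R)) (W · d · s)
  weight : (ℕ -> ℚ) -> ℕ -> ℚ
  weight e s = wsum P (\_ -> 9ℚ) (\d -> cut s d * (e (W · d) + 2ℚ))
  abs-y : ∀ m -> ∣ y m ∣ ≤ U * below R (1 · m)
  abs-y m = ≡≤ (0≤p⇒∣p∣≡p (0≤y m)) (≤≡ (y≤ m) (cong (\z -> U * below R z) (sym (N.*-identityˡ m))))
  abs-punct : ∀ p m -> ∣ punct p y m ∣ ≤ U * below R (p · m)
  abs-punct p m = ≡≤ (0≤p⇒∣p∣≡p {punct p y m} (0≤punct p y m (0≤y (p · m)))) (≤-trans (punct≤ p y m (0≤y (p · m))) (y≤ (p · m)))
  module At (h k1 k2 : ℕ) (h≤6 : h ≦ 6) (k1<k2 : k1 N.< k2) (k2≤6 : k2 ≦ 6) (h≢k1 : h ≢ k1) (h≢k2 : h ≢ k2) where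
   r2 : ℕ -> List ℕ
   r2 = res h (k1 ∷ k2 ∷ [])
   χʰ χ⁺ : ℕ -> ℕ -> ℚ
   χʰ = hits r2
   -- with m = n + h, the event p ∣ m as well
   χ⁺ p m = χʰ p m + ind (divides p m)
   Λʰ Λ⁺ : (ℕ -> ℚ) -> ℕ -> ℚ
   Λʰ = Λ γ χʰ P
   Λ⁺ = Λ γ χ⁺ P
   units : ∀ p -> 6 N.< p -> ∀ c -> c ∈ r2 p -> p ∤ c
   units p h6 c (here refl) = class-unit p h k1 h≢k1 (≤-<-trans h≤6 h6) (<-trans (<-≤-trans k1<k2 k2≤6) h6)
   units p h6 c (there (here refl)) = class-unit p h k2 h≢k2 (≤-<-trans h≤6 h6) (≤-<-trans k2≤6 h6)
   χ² : ∀ p m -> p ∈ P -> χʰ p m * χʰ p m ≡ χʰ p m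
   χ² p m p∈ = hits-01 r2 p m ((class-≢ p h k1 k2 k1<k2 (≤-<-trans k2≤6 (6<P p p∈)) ∷ []) ∷ [] ∷ [])
   χʰ-∣ : ∀ p m -> 6 N.< p -> p ∣ m -> χʰ p m ≡ 0ℚ
   χʰ-∣ p m h6 d = hits-none r2 p m (units p h6) d
   αU : ℕ -> ℚ
   αU p = ι 2 * inv (p ∸ 1)
   module _ (a : ℕ) (adm : Adm W a) where
    f : ℕ -> ℚ
    f m = ind (congᵇ W m a)
    EP : ℕ -> ℕ -> ℚ
    EP N q = maxRes q (\a -> ∣ toℚ (πflatAP N q a) - divQ (toℚ (πflat N)) (φ q) ∣)
    EB : ℕ -> ℕ -> ℚ
    EB N q = maxRes q (\a -> ∣ toℚ (πβAP 1 M N q a) - divQ (toℚ (πβq 1 M N q)) (φ q) ∣)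
    0≤EP : ∀ N q -> 0ℚ ≤ EP N q
    0≤EP N q = 0≤maxRes q (\a -> ∣ toℚ (πflatAP N q a) - divQ (toℚ (πflat N)) (φ q) ∣)
    0≤EB : ∀ N q -> 0ℚ ≤ EB N q
    0≤EB N q = 0≤maxRes q (\a -> ∣ toℚ (πβAP 1 M N q a) - divQ (toℚ (πβq 1 M N q)) (φ q) ∣)
    prime-sum : ∀ N -> R ≦ N -> ι (πflat N) * inv (φ W) * Form P (mean γ αU) (moment γ αU) y y - U * U * Γ * weight (EP N) 1
     ≤ ∑ (filterᵇ isPrimeᵇ (range N (2 · N))) (\m -> f m * (Λ⁺ y m * Λ⁺ y m))
    prime-sum N R≤N = ≡≤ (cong (_- U * U * Γ * weight (EP N) 1) (sym (main-Form γ r M0 (\p -> inv (p ∸ 1)) P y y W freshW mult)))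
     (≤≡ (abs≤⇒lb (error U U 0≤U 0≤U P y y 1 1 W a freshW (\p m p∈ _ -> χ² p m p∈) 6<P adm abs-y abs-y (N.≤-reflexive refl))) (∑-cong∈ ns (\m m∈ -> cong (\z -> f m * (z * z)) (sym (same m m∈))))) where
     ns = filterᵇ isPrimeᵇ (range N (2 · N))
     M0 : ℕ -> ℚ
     M0 q = ι (πflat N) * inv (φ q)
     cnt : ∀ q a -> Adm q a -> ∣ ∑ ns (\m -> ind (congᵇ q m a)) - M0 q ∣ ≤ EP N q + 2ℚ
     cnt q a (_ , cop , a<q) = ≡≤ (cong ∣_∣ (cong₂ _-_ (∑-cong-class isPrimeᵇ (range N (2 · N)) q a) (trans (cong (_* inv (φ q)) (ι-def (πflat N))) (sym (divQ≡ (toℚ (πflat N)) (φ q))))))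
      (≤-trans (≤maxRes q a (\a -> ∣ toℚ (πflatAP N q a) - divQ (toℚ (πflat N)) (φ q) ∣) a<q cop) (≤+ʳ 0≤2))
     open Error γ 0≤γ (6 N.<_) γ≤1 ns r2 (\p -> s≤s N.z<s) M0 (\q -> EP N q + 2ℚ) (\q -> 0≤+ (0≤EP N q) 0≤2) W R 1 1≤W Adm
      (\p q a c h6 pp nd ad c∈ -> crt-unit ns p q a c pp nd (units p h6 c c∈) ad) cnt using (error; r)
     mult : ∀ p q -> p ∈ P -> Prime p -> p ∤ q -> M0 (p · q) ≡ inv (p ∸ 1) * M0 q
     mult p q _ pp nd = trans (cong (ι (πflat N) *_) (trans (cong inv (φ-* p q pp nd)) (inv-* (p ∸ 1) (φ q)))) (id50 (ι (πflat N)) (inv (p ∸ 1)) (inv (φ q)))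
     same : ∀ m -> m ∈ ns -> Λ⁺ y m ≡ Λʰ y m
     same m m∈ = Λ-cong γ χ⁺ χʰ P y m m (\p p∈ -> trans (cong (\z -> χʰ p m + ind z) (divides-false (nd p p∈))) (+-idʳ (χʰ p m))) where
      mm : m ∈ range N (2 · N) × isPrimeᵇ m ≡ true
      mm = ∈-filterᵇ⁻ isPrimeᵇ (range N (2 · N)) m∈
      nd : ∀ p -> p ∈ P -> ¬ p ∣ m
      nd p p∈ d = <-irrefl (prime-∣-prime (isPrime⇒ m (proj₂ mm)) (prP p p∈) d) (<-≤-trans (P<R p p∈) (≦-trans R≤N (proj₁ (∈-range⁻ {N} {2 · N} (proj₁ mm)))))
    module _ (N : ℕ) (RR≤N : R · R ≦ N) where
     βs = filterᵇ (βᵇ 1 M N) (range (suc N) (suc (2 · N)))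
     β∈ : ∀ {m} -> m ∈ βs -> Semiprime M N m
     β∈ {m} m∈ = β⇒ M N m (proj₂ (∈-filterᵇ⁻ (βᵇ 1 M N) (range (suc N) (suc (2 · N))) m∈))
     only : ∀ p m -> p ∈ P -> (sp : Semiprime M N m) -> p ∣ m -> p ≡ Semiprime.d sp
     only p m p∈ (semi d e pd pe refl _ _ N<ee) dv = [ (\dv -> prime-∣-prime pd (prP p p∈) dv) , (\dv -> contradiction (bad (prime-∣-prime pe (prP p p∈) dv)) (<-irrefl refl)) ]′ (euclidsLemma d e (prP p p∈) dv) where
      bad : p ≡ e -> N N.< N
      bad refl = <-≤-trans N<ee (≦-trans (*-mono-≤ (<⇒≤ (P<R p p∈)) (<⇒≤ (P<R p p∈))) RR≤N)
     -- p exceeds the lower cutoff Y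
     big : ℕ -> Bool
     big p = N ^ 1 <ᵇ p ^ M
     N1 : ℕ -> ℕ
     N1 p = suc (divℕ N p)
     cofactors : ℕ -> List ℕ
     cofactors p = filterᵇ isPrimeᵇ (range (N1 p) (suc (divℕ (2 · N) p)))
     private
      1≤P : ∀ p -> p ∈ P -> 1 ≦ p
      1≤P p p∈ = 1≤prime (prP p p∈)
      R<cof : ∀ p i -> p ∈ P -> N1 p ≦ i -> R N.< i × N N.< p · i
      R<cof p i p∈ h = *-cancelˡ-< R R i (≤-<-trans RR≤N (<-≤-trans N<pi (*-monoˡ-≤ i (<⇒≤ (P<R p p∈))))) , N<pi where
       N<pi : N N.< p · i
       N<pi = <-≤-trans (divℕ-< N p (1≤P p p∈)) (*-monoʳ-≤ p h)
     cof∈ : ∀ p i -> p ∈ P -> i ∈ cofactors p -> Prime i × R N.< i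
     cof∈ p i p∈ i∈ = isPrime⇒ i (proj₂ z) , proj₁ (R<cof p i p∈ (proj₁ (∈-range⁻ {N1 p} {suc (divℕ (2 · N) p)} (proj₁ z)))) where
      z : i ∈ range (N1 p) (suc (divℕ (2 · N) p)) × isPrimeᵇ i ≡ true
      z = ∈-filterᵇ⁻ isPrimeᵇ (range (N1 p) (suc (divℕ (2 · N) p))) i∈
     ∑-by-factor : ∀ p (G : ℕ -> ℚ) -> p ∈ P -> ∑ βs (\m -> ind (divides p m) * G m) ≡ ind (big p) * ∑ (cofactors p) (\i -> G (p · i))
     ∑-by-factor p G p∈ = trans (∑-filter (βᵇ 1 M N) (range (suc N) (suc (2 · N))) (\m -> ind (divides p m) * G m)) (trans (∑-cong (range (suc N) (suc (2 · N))) (\m -> id50 (ind (βᵇ 1 M N m)) (ind (divides p m)) (G m)))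
      (trans (∑-multiples-div p N (2 · N) (\m -> ind (βᵇ 1 M N m) * G m) (1≤P p p∈) (m≤m+n N (N N.+ 0))) (trans (∑-cong∈ rg (\i i∈ -> trans (cong (\z -> ind z * G (p · i)) (β≡ i (proj₁ (∈-range⁻ {N1 p} {suc (divℕ (2 · N) p)} i∈)))) (trans (cong (_* G (p · i)) (ind-∧ (big p) (isPrimeᵇ i))) (*-assoc (ind (big p)) (ind (isPrimeᵇ i)) (G (p · i))))))
       (trans (∑-*ˡ rg (ind (big p)) (\i -> ind (isPrimeᵇ i) * G (p · i))) (cong (ind (big p) *_) (sym (∑-filter isPrimeᵇ rg (\i -> G (p · i))))))))) where
      rg = range (N1 p) (suc (divℕ (2 · N) p))
      β≡ : ∀ i -> N1 p ≦ i -> βᵇ 1 M N (p · i) ≡ big p ∧ isPrimeᵇ i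
      β≡ i h = bool-ext (\e -> to (β⇒ M N (p · i) e)) from where
       to : Semiprime M N (p · i) -> big p ∧ isPrimeᵇ i ≡ true
       to sp@(semi d e pd pe m≡ h1 h2 h3) = cong₂ _∧_ (subst (\z -> (N ^ 1 <ᵇ z ^ M) ≡ true) (sym p≡d) (<ᵇ-true h1)) (subst (\z -> isPrimeᵇ z ≡ true) (sym i≡e) (isPrime-true pe)) where
        p≡d : p ≡ d
        p≡d = only p (p · i) p∈ sp (m∣m*n i)
        i≡e : i ≡ e
        i≡e = *-cancelˡ-≡ i e p {{>-nonZero (1≤P p p∈)}} (trans m≡ (cong (N._* e) (sym p≡d)))
       from : big p ∧ isPrimeᵇ i ≡ true -> βᵇ 1 M N (p · i) ≡ true
       from e = ⇒β M N p i (prP p p∈) (isPrime⇒ i (proj₂ (∧-elim (big p) e))) (<ᵇ-elim _ _ (proj₁ (∧-elim (big p) e))) (≦-trans (*-mono-≤ (<⇒≤ (P<R p p∈)) (<⇒≤ (P<R p p∈))) RR≤N)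
        (<-trans (proj₂ (R<cof p i p∈ h)) (*-monoˡ-< i {{>-nonZero (≦-trans N.z<s h)}} (<-trans (P<R p p∈) (proj₁ (R<cof p i p∈ h)))))
     z : ℕ -> ℕ -> ℚ
     z p = punct p y
     A0 : ℕ -> ℚ
     A0 m = Λʰ y m
     B0 : ℕ -> ℕ -> ℚ
     B0 p m = Λʰ (z p) m
     -- Λ⁺ equals A0 unless m has a prime factor p in P, and A0 - B0 p if it does.
     square-split : ∀ m -> m ∈ βs -> Λ⁺ y m * Λ⁺ y m ≡ A0 m * A0 m + ∑ P (\p -> ind (divides p m) * (B0 p m * B0 p m - 2ℚ * (A0 m * B0 p m)))
     square-split m m∈ = case (D N.<? d) (d N.<? R) where
      sp : Semiprime M N m
      sp = β∈ m∈
      open Semiprime sp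
      t : ℕ -> ℚ
      t p = ind (divides p m) * (B0 p m * B0 p m - 2ℚ * (A0 m * B0 p m))
      t0 : ∀ p -> p ∈ P -> p ≢ d -> t p ≡ 0ℚ
      t0 p p∈ ne = trans (cong (\z -> ind z * (B0 p m * B0 p m - 2ℚ * (A0 m * B0 p m))) (divides-false (\dv -> ne (only p m p∈ sp dv)))) (*-zeroˡ (B0 p m * B0 p m - 2ℚ * (A0 m * B0 p m)))
      none : (∀ p -> p ∈ P -> p ≢ d) -> Λ⁺ y m * Λ⁺ y m ≡ A0 m * A0 m + ∑ P t
      none nd = trans (cong (\z -> z * z) (Λ-cong γ χ⁺ χʰ P y m m (\p p∈ -> trans (cong (\z -> χʰ p m + ind z) (divides-false (\dv -> nd p p∈ (only p m p∈ sp dv)))) (+-idʳ (χʰ p m)))))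
       (sym (trans (cong (A0 m * A0 m +_) (trans (∑-cong∈ P (\p p∈ -> t0 p p∈ (nd p p∈))) (∑-0 P))) (+-idʳ (A0 m * A0 m))))
      case : Dec (D N.< d) -> Dec (d N.< R) -> Λ⁺ y m * Λ⁺ y m ≡ A0 m * A0 m + ∑ P t
      case (no h) _ = none (\p p∈ eq -> h (subst (D N.<_) eq (D<P p p∈)))
      case _ (no h) = none (\p p∈ eq -> h (subst (N._< R) eq (P<R p p∈)))
      case (yes h1) (yes h2) = trans (cong (\z -> z * z) (trans (Λ-remove γ χ⁺ χʰ P d y m m pd d∈ uniqueP prP off on1 on0) (Λ-lin γ χʰ P (- 1ℚ) y (z d) m)))
        (trans (id96 (A0 m) (B0 d m)) (cong (A0 m * A0 m +_) (sym (trans (∑-single P d t uniqueP d∈ t0) (trans (cong (\z -> ind z * (B0 d m * B0 d m - 2ℚ * (A0 m * B0 d m))) (divides-true d∣m)) (*-idˡ (B0 d m * B0 d m - 2ℚ * (A0 m * B0 d m)))))))) where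
       d∈ : d ∈ P
       d∈ = ∈-primes⁺ pd h1 h2
       d∣m : d ∣ m
       d∣m = subst (d ∣_) (sym m≡) (m∣m*n e)
       off : ∀ p -> p ∈ P -> p ≢ d -> χ⁺ p m ≡ χʰ p m
       off p p∈ ne = trans (cong (\z -> χʰ p m + ind z) (divides-false (\dv -> ne (only p m p∈ sp dv)))) (+-idʳ (χʰ p m))
       on0 : χʰ d m ≡ 0ℚ
       on0 = χʰ-∣ d m (6<P d d∈) d∣m
       on1 : χ⁺ d m ≡ 1ℚ
       on1 = trans (cong₂ (\a b -> a + ind b) on0 (divides-true d∣m)) (+-idˡ 1ℚ)
     factor-≤1 : ∀ m x -> m ∈ βs -> 0ℚ ≤ x -> ∑ P (\p -> ind (divides p m) * x) ≤ x
     factor-≤1 m x m∈ hx = case (D N.<? d) (d N.<? R) where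
      sp : Semiprime M N m
      sp = β∈ m∈
      open Semiprime sp
      zero' : ∀ p -> p ∈ P -> p ≢ d -> ind (divides p m) * x ≡ 0ℚ
      zero' p p∈ ne = trans (cong (\z -> ind z * x) (divides-false (\dv -> ne (only p m p∈ sp dv)))) (*-zeroˡ x)
      none : (∀ p -> p ∈ P -> p ≢ d) -> ∑ P (\p -> ind (divides p m) * x) ≤ x
      none nd = ≡≤ (trans (∑-cong∈ P (\p p∈ -> zero' p p∈ (nd p p∈))) (∑-0 P)) hx
      case : Dec (D N.< d) -> Dec (d N.< R) -> ∑ P (\p -> ind (divides p m) * x) ≤ x
      case (no h) _ = none (\p p∈ eq -> h (subst (D N.<_) eq (D<P p p∈)))
      case _ (no h) = none (\p p∈ eq -> h (subst (N._< R) eq (P<R p p∈)))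
      case (yes h1) (yes h2) = ≡≤ (∑-single P d (\p -> ind (divides p m) * x) uniqueP (∈-primes⁺ pd h1 h2) zero') (≤≡ (*-monoʳ x hx (ind≤1 (divides d m))) (*-idˡ x))
     Mₘ : ℕ -> ℕ -> ℚ
     Mₘ m q = ind (coprimeᵇ m q) * inv (φ q)
     αₘ : ℕ -> ℕ -> ℚ
     αₘ m p = ι 2 * (ind (not (divides p m)) * inv (p ∸ 1))
     K : ℕ -> ℚ
     K m = Mₘ m W * Form P (mean γ (αₘ m)) (moment γ (αₘ m)) y y
     0≤K : ∀ m -> 0ℚ ≤ K m
     0≤K m = 0≤* (0≤* (0≤ind (coprimeᵇ m W)) (0≤inv (φ W))) (Form-nonneg P (mean γ (αₘ m)) (moment γ (αₘ m)) y (\p p∈ -> ≤≡ (0≤* (0≤α p) (diff (α≤1 p (6<P p p∈)))) (sym (variance γ (αₘ m) p)))) where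
      0≤α : ∀ p -> 0ℚ ≤ αₘ m p
      0≤α p = 0≤* (0≤ι 2) (0≤* (0≤ind (not (divides p m))) (0≤inv (p ∸ 1)))
      α≤1 : ∀ p -> 6 N.< p -> αₘ m p ≤ 1ℚ
      α≤1 p h6 = ≤≡ (*-monoˡ (ι 2) (0≤ι 2) (≤-trans (*-monoʳ (inv (p ∸ 1)) (0≤inv (p ∸ 1)) (ind≤1 (not (divides p m)))) (≡≤ (*-idˡ (inv (p ∸ 1))) (inv-anti {2} {p ∸ 1} N.z<s (≦-trans (m≤m+n 2 4) (∸-monoˡ-≤ 1 h6)))))) (*-inv 2 N.z<s)
     A-sum : ∑ βs K - U * U * Γ * weight (EB N) 1 ≤ ∑ βs (\m -> f m * (A0 m * A0 m))
     A-sum = ≡≤ (cong (_- U * U * Γ * weight (EB N) 1) (sym (trans (main-∑ γ r βs Mₘ P y y W) (∑-cong βs (\m -> main-Form γ r (Mₘ m) (\p -> ind (not (divides p m)) * inv (p ∸ 1)) P y y W freshW (mult m))))))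
      (abs≤⇒lb (error U U 0≤U 0≤U P y y 1 1 W a freshW (\p m p∈ _ -> χ² p m p∈) 6<P adm abs-y abs-y (N.≤-reflexive refl))) where
      cnt : ∀ q a -> Adm q a -> ∣ ∑ βs (\m -> ind (congᵇ q m a)) - ∑ βs (\m -> Mₘ m q) ∣ ≤ EB N q + 2ℚ
      cnt q a (_ , cop' , a<q) = ≡≤ (cong ∣_∣ (cong₂ _-_ (∑-cong-class (βᵇ 1 M N) (range (suc N) (suc (2 · N))) q a) tot))
       (≤-trans (≤maxRes q a (\a -> ∣ toℚ (πβAP 1 M N q a) - divQ (toℚ (πβq 1 M N q)) (φ q) ∣) a<q cop') (≤+ʳ 0≤2)) where
       tot : ∑ βs (\m -> Mₘ m q) ≡ divQ (toℚ (πβq 1 M N q)) (φ q)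
       tot = trans (∑-*ʳ βs (inv (φ q)) (\m -> ind (coprimeᵇ m q))) (trans (cong (_* inv (φ q)) (trans (∑-filter (βᵇ 1 M N) (range (suc N) (suc (2 · N))) (\m -> ind (coprimeᵇ m q))) (trans (∑-cong (range (suc N) (suc (2 · N))) (\m -> sym (ind-∧ (βᵇ 1 M N m) (coprimeᵇ m q))))
        (trans (sym (count≡∑ (\m -> βᵇ 1 M N m ∧ coprimeᵇ m q) (range (suc N) (suc (2 · N))))) (ι-def (πβq 1 M N q)))))) (sym (divQ≡ (toℚ (πβq 1 M N q)) (φ q))))
      open Error γ 0≤γ (6 N.<_) γ≤1 βs r2 (\p -> s≤s N.z<s) (\q -> ∑ βs (\m -> Mₘ m q)) (\q -> EB N q + 2ℚ) (\q -> 0≤+ (0≤EB N q) 0≤2) W R 1 1≤W Adm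
       (\p q a c h6 pp nd ad c∈ -> crt-unit βs p q a c pp nd (units p h6 c c∈) ad) cnt using (error; r)
      mult : ∀ m p q -> p ∈ P -> Prime p -> p ∤ q -> Mₘ m (p · q) ≡ ind (not (divides p m)) * inv (p ∸ 1) * Mₘ m q
      mult m p q _ pp nd = trans (cong₂ _*_ (trans (cong ind cp) (ind-∧ (not (divides p m)) (coprimeᵇ m q))) (trans (cong inv (φ-* p q pp nd)) (inv-* (p ∸ 1) (φ q)))) (id48 (ind (not (divides p m))) (ind (coprimeᵇ m q)) (inv (p ∸ 1)) (inv (φ q))) where
       cp : coprimeᵇ m (p · q) ≡ not (divides p m) ∧ coprimeᵇ m q
       cp = bool-ext (\id48 -> let c = coprimeᵇ⇒ m (p · q) id48 in cong₂ (\x y -> not x ∧ y) (divides-false {p} {m} (\d -> ¬prime[1] (subst Prime (c (d , m∣m*n q)) pp))) (⇒coprimeᵇ m q (coprime-*ʳ⁻ p c)))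
        (\id48 -> ⇒coprimeᵇ m (p · q) (coprime-*ʳ (coprime-prime pp (\d -> contradiction (trans (cong not (sym (divides-true d))) (proj₁ (∧-elim (not (divides p m)) id48))) λ ())) (coprimeᵇ⇒ m q (proj₂ (∧-elim (not (divides p m)) id48)))))
     r' : ℕ -> ℕ -> List ℕ
     r' p p' = if Dec.does (p' N.≟ p) then [] else r2 p'
     αₚ : ℕ -> ℕ -> ℚ
     αₚ p p' = ι (length (r' p p')) * inv (p' ∸ 1)
     Fₚ : ℕ -> (u v : ℕ -> ℚ) -> ℚ
     Fₚ p = Form P (mean γ (αₚ p)) (moment γ (αₚ p))
     r'-case : ∀ p p' (Q : List ℕ -> Set) -> (p' ≡ p -> Q []) -> (p' ≢ p -> Q (r2 p')) -> Q (r' p p')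
     r'-case p p' Q f g = go (p' N.≟ p) where
      go : (d : Dec (p' ≡ p)) -> Q (if Dec.does d then [] else r2 p')
      go (yes e) = f e
      go (no ne) = g ne
     X : ℕ -> ℚ
     X p = ι (length (cofactors p)) * inv (φ W)
     K-cofactor : ∀ p i -> p ∈ P -> i ∈ cofactors p -> K (p · i) ≡ inv (φ W) * Fₚ p y y
     K-cofactor p i p∈ i∈ = cong₂ _*_ (trans (cong (\z -> ind z * inv (φ W)) cpW) (*-idˡ (inv (φ W)))) (Form-cong P y y (\q q∈ -> cong (\z -> γ q - z) (α≡ q q∈)) (\q q∈ -> cong (\z -> γ q * γ q + (1ℚ - 2ℚ * γ q) * z) (α≡ q q∈))) where
      pi : Prime i
      pi = proj₁ (cof∈ p i p∈ i∈)
      R<i : R N.< i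
      R<i = proj₂ (cof∈ p i p∈ i∈)
      cpW : coprimeᵇ (p · i) W ≡ true
      cpW = trans (sym (cop-coprime Qs (p · i) prQ)) (cop-true Qs (p · i) (\q q∈ d -> [ (\d -> <-irrefl (prime-∣-prime (prP p p∈) (prQ q q∈) d) (≤-<-trans (q≤D q q∈) (D<P p p∈))) ,
        (\d -> <-irrefl (prime-∣-prime pi (prQ q q∈) d) (≤-<-trans (q≤D q q∈) (<-trans (D<P p p∈) (<-trans (P<R p p∈) R<i)))) ]′ (euclidsLemma p i (prQ q q∈) d))) where
       q≤D : ∀ q -> q ∈ Qs -> q ≦ D
       q≤D q q∈ = ≤-pred (proj₂ (proj₂ (∈-primes⁻ {1} {suc D} q∈)))
      α≡ : ∀ q -> q ∈ P -> αₘ (p · i) q ≡ αₚ p q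
      α≡ q q∈ = r'-case p q (\l -> αₘ (p · i) q ≡ ι (length l) * inv (q ∸ 1))
       (λ { refl -> trans (cong (\z -> ι 2 * (ind (not z) * inv (q ∸ 1))) (divides-true {q} {q · i} (m∣m*n i))) (trans (id34 (ι 2) (inv (q ∸ 1))) (trans (sym (*-zeroˡ (inv (q ∸ 1)))) (cong (_* inv (q ∸ 1)) (sym (ι-def 0))))) })
       (\ne -> trans (cong (\z -> ι 2 * (ind (not z) * inv (q ∸ 1))) (divides-false {q} {p · i} (\d -> [ (\d -> ne (prime-∣-prime (prP p p∈) (prP q q∈) d)) , (\d -> <-irrefl (prime-∣-prime pi (prP q q∈) d) (<-trans (P<R q q∈) R<i)) ]′ (euclidsLemma p i (prP q q∈) d)))) (cong (ι 2 *_) (*-idˡ (inv (q ∸ 1)))))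
     cross : ∀ p -> p ∈ P -> ∀ u v k l -> (∀ m -> ∣ u m ∣ ≤ U * below R (k · m)) -> (∀ m -> ∣ v m ∣ ≤ U * below R (l · m)) -> p ≦ k · l ->
      ∣ ∑ (cofactors p) (\i -> f (p · i) * (Λʰ u (p · i) * Λʰ v (p · i))) - X p * Fₚ p u v ∣ ≤ U * U * Γ * weight (EP (N1 p)) p
     cross p p∈ u v k l hu hv pkl = ≡≤ (cong ∣_∣ (cong₂ _-_ (trans (∑-cong∈ cs (\i i∈ -> cong₂ (\a b -> f (p · i) * (a * b)) (same i u) (same i v))) (sym (∑-map (p N.*_) cs (\m -> f m * (Λ γ (hits (r' p)) P u m * Λ γ (hits (r' p)) P v m)))))
       (sym (main-Form γ r M0 (\p -> inv (p ∸ 1)) P u v W freshW mult))))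
      (error U U 0≤U 0≤U P u v k l W a freshW χ²' 6<P (adm , p∤W) hu hv (*-monoʳ-≤ W pkl)) where
      cs = cofactors p
      ns = map (p N.*_) cs
      pp : Prime p
      pp = prP p p∈
      p∤W : p ∤ W
      p∤W = fresh-∤ P W p freshW p∈ where
       fresh-∤ : ∀ P q p -> Fresh P q -> p ∈ P -> p ∤ q
       fresh-∤ (_ ∷ P) q p (_ , nd , _) (here refl) = nd
       fresh-∤ (_ ∷ P) q p (_ , _ , fr , _) (there m) = fresh-∤ P q p fr m
      same : ∀ i u -> Λʰ u (p · i) ≡ Λ γ (hits (r' p)) P u (p · i)
      same i u = Λ-cong γ χʰ (hits (r' p)) P u (p · i) (p · i) (\q q∈ -> r'-case p q (\l -> χʰ q (p · i) ≡ ∑ l (\c -> ind (congᵇ q (p · i) c))) (λ { refl -> χʰ-∣ q (q · i) (6<P q q∈) (m∣m*n i) }) (\_ -> refl))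
      χ²' : ∀ q m -> q ∈ P -> m ∈ ns -> hits (r' p) q m * hits (r' p) q m ≡ hits (r' p) q m
      χ²' q m q∈ _ = r'-case p q (\l -> ∑ l (\c -> ind (congᵇ q m c)) * ∑ l (\c -> ind (congᵇ q m c)) ≡ ∑ l (\c -> ind (congᵇ q m c))) (\_ -> refl) (\_ -> χ² q m q∈)
      M0 : ℕ -> ℚ
      M0 q = ι (length cs) * inv (φ q)
      mult : ∀ p q -> p ∈ P -> Prime p -> p ∤ q -> M0 (p · q) ≡ inv (p ∸ 1) * M0 q
      mult p q _ pp nd = trans (cong (ι (length cs) *_) (trans (cong inv (φ-* p q pp nd)) (inv-* (p ∸ 1) (φ q)))) (id50 (ι (length cs)) (inv (p ∸ 1)) (inv (φ q)))
      Adm' : ℕ -> ℕ -> Set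
      Adm' q a = Adm q a × p ∤ q
      E' : ℕ -> ℚ
      E' q = EP (N1 p) q + 2ℚ
      hi = suc (divℕ (2 · N) p)
      hi≤ : hi ≦ 2 · N1 p
      hi≤ = *-cancelˡ-< p (divℕ (2 · N) p) (2 · N1 p) (≤-<-trans (divℕ-≤ (2 · N) p (1≤P p p∈)) (<-≤-trans (*-monoʳ-< 2 (divℕ-< N p (1≤P p p∈))) (N.≤-reflexive (id97 p (N1 p)))))
      ≤hi : 2 · N1 p ≦ suc hi
      ≤hi = ≡≤ℕ (id98 (divℕ N p)) (s≤s (s≤s (≮⇒≥ (\lt -> <-irrefl refl (≤-<-trans (≦-trans (*-monoʳ-≤ p lt) (≡≤ℕ (id99 p (divℕ N p)) (*-monoʳ-≤ 2 (divℕ-≤ N p (1≤P p p∈))))) (divℕ-< (2 · N) p (1≤P p p∈)))))))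
      -- [N1, 2 N1) has at most one element more than the range of the cofactors
      extra : ∀ (w : ℕ -> ℚ) -> (∀ i -> 0ℚ ≤ w i) -> (∀ i -> w i ≤ 1ℚ) -> ∣ ∑ (range (N1 p) hi) w - ∑ (range (N1 p) (2 · N1 p)) w ∣ ≤ 1ℚ
      extra w hw w1 = ≡≤ (trans (cong (\x -> ∣ s₁ - x ∣) (∑-range-split (N1 p) hi (2 · N1 p) w (s≤s (divℕ-mono p (m≤m+n N (N N.+ 0)))) hi≤)) (trans (cong ∣_∣ (id100 s₁ s₂)) (trans (∣-p∣≡∣p∣ s₂) (0≤p⇒∣p∣≡p (∑-nonneg (range hi (2 · N1 p)) hw)))))
       (≤-trans (∑-mono (range hi (2 · N1 p)) {g = \_ -> 1ℚ} w1) (≡≤ (trans (∑-const (range hi (2 · N1 p)) 1ℚ) (trans (*-idʳ _) (cong ι (length-range hi (2 · N1 p))))) (≤≡ (ι-mono (≤≡ℕ (∸-monoˡ-≤ hi ≤hi) (m+n∸n≡m 1 hi))) (ι-def 1)))) where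
       s₁ = ∑ (range (N1 p) hi) w
       s₂ = ∑ (range hi (2 · N1 p)) w
      cnt : ∀ q a -> Adm' q a -> ∣ ∑ ns (\m -> ind (congᵇ q m a)) - M0 q ∣ ≤ E' q
      cnt q@(suc _) a ((_ , cop' , a<q) , p∤q) = from (solve-cong q p 0 a N.z<s (λ { (d1 , d₂) -> coprime-prime pp p∤q (d₂ , d1) })) where
       from : ∃[ i ] Cong q (p · i N.+ 0) a -> ∣ ∑ ns (\m -> ind (congᵇ q m a)) - M0 q ∣ ≤ E' q
       from (i , ci) = ≡≤ (cong ∣_∣ (trans (cong₂ _-_ eq1 eq2) (id94 sI sA sP sL (inv (φ q))))) (≤≡ (abs+ (abs+ (extra _ (\i -> 0≤* (0≤ind (isPrimeᵇ i)) (0≤ind (congᵇ q i a″))) (\i -> ≡≤ (sym (ind-∧ (isPrimeᵇ i) (congᵇ q i a″))) (ind≤1 (isPrimeᵇ i ∧ congᵇ q i a″))))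
         (≡≤ (cong ∣_∣ (cong₂ _-_ eq3 eq4)) (≤maxRes q a″ (\a -> ∣ toℚ (πflatAP (N1 p) q a) - divQ (toℚ (πflat (N1 p))) (φ q) ∣) a″<q cop″)))
         (≤-trans (abs** (absneg (extra _ (\i -> 0≤ind (isPrimeᵇ i)) (\i -> ind≤1 (isPrimeᵇ i)))) (≡⇒≤ (0≤p⇒∣p∣≡p (0≤inv (φ q))))) (*-monoˡ 1ℚ 0≤1 (inv≤1 (φ q))))) (id93 (EP (N1 p) q))) where
        a″ = i N.% q
        a″<q : a″ N.< q
        a″<q = m%n<n i q
        ia : Cong q a″ i
        ia = cg (i N./ q) 0 (trans (trans (cong (a″ N.+_) (*-comm q (i N./ q))) (sym (m≡m%n+[m/n]*n i q))) (sym (trans (cong (i N.+_) (N.*-zeroʳ q)) (N.+-identityʳ i))))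
        pa : Cong q (p · a″) a
        pa = Cong-trans (Cong-* p ia) (subst (\z -> Cong q z a) (N.+-identityʳ (p · i)) ci)
        cop″ : Coprime a″ q
        cop″ = coprime-*ˡ⁻ p (Cong-coprime (Cong-sym pa) cop')
        class : ∀ j -> congᵇ q (p · j) a ≡ congᵇ q j a″
        class j = congᵇ-ext q (p · j) a q j a″ (\c -> Cong-divide (Cong-trans c (Cong-sym pa))) (\c -> Cong-trans (Cong-* p c) pa) where
         Cong-divide : Cong q (p · j) (p · a″) -> Cong q j a″
         Cong-divide c = from' (solve-cong q p 0 1 N.z<s (λ { (d1 , d₂) -> coprime-prime pp p∤q (d₂ , d1) })) where
          from' : ∃[ t ] Cong q (p · t N.+ 0) 1 -> Cong q j a″
          from' (t , ct) = Cong-trans (Cong-sym (one j)) (Cong-trans (Cong-* t c) (one a″)) where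
           one : ∀ x -> Cong q (t · (p · x)) x
           one x = subst₂ (Cong q) (id92 x p t) (N.*-identityʳ x) (Cong-* x ct)
        rg = range (N1 p) hi
        rg2 = range (N1 p) (2 · N1 p)
        sI = ∑ rg (\i -> ind (isPrimeᵇ i) * ind (congᵇ q i a″))
        sA = ∑ rg2 (\i -> ind (isPrimeᵇ i) * ind (congᵇ q i a″))
        sP = ∑ rg2 (\i -> ind (isPrimeᵇ i))
        sL = ∑ rg (\i -> ind (isPrimeᵇ i))
        eq1 : ∑ ns (\m -> ind (congᵇ q m a)) ≡ sI
        eq1 = trans (∑-map (p N.*_) cs (\m -> ind (congᵇ q m a))) (trans (∑-cong cs (\i -> cong ind (class i))) (∑-filter isPrimeᵇ rg (\i -> ind (congᵇ q i a″))))
        eq2 : M0 q ≡ sL * inv (φ q)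
        eq2 = cong (_* inv (φ q)) (count≡∑ isPrimeᵇ rg)
        eq3 : sA ≡ toℚ (πflatAP (N1 p) q a″)
        eq3 = trans (sym (∑-filter isPrimeᵇ rg2 (\i -> ind (congᵇ q i a″)))) (∑-cong-class isPrimeᵇ rg2 q a″)
        eq4 : sP * inv (φ q) ≡ divQ (toℚ (πflat (N1 p))) (φ q)
        eq4 = trans (cong (_* inv (φ q)) (trans (sym (count≡∑ isPrimeᵇ rg2)) (ι-def (πflat (N1 p))))) (sym (divQ≡ (toℚ (πflat (N1 p))) (φ q)))
      crt' : ∀ q m a c -> 6 N.< q -> Prime q -> q ∤ m -> Adm' m a -> c ∈ r' p q -> ∃[ a' ] (Adm' (q · m) a' × (∀ n -> n ∈ ns -> ind (congᵇ m n a) * ind (congᵇ q n c) ≡ ind (congᵇ (q · m) n a')))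
      crt' q m a c h6 pq nd ad c∈ = r'-case p q (\l -> c ∈ l -> ∃[ a' ] (Adm' (q · m) a' × (∀ n -> n ∈ ns -> ind (congᵇ m n a) * ind (congᵇ q n c) ≡ ind (congᵇ (q · m) n a')))) (λ _ ())
       (\ne c∈ -> let (a' , ad' , eq) = crt-unit ns q m a c pq nd (units q h6 c c∈) (proj₁ ad) in a' , (ad' , \d -> [ (\d -> ne (sym (prime-∣-prime pq pp d))) , proj₂ ad ]′ (euclidsLemma q m pp d)) , eq) c∈
      open Error γ 0≤γ (6 N.<_) γ≤1 ns (r' p) (\q -> r'-case p q (\l -> length l ≦ 3) (\_ -> z≤n) (\_ -> s≤s N.z<s)) M0 E' (\q -> 0≤+ (0≤EP (N1 p) q) 0≤2) W R p 1≤W Adm' crt' cnt using (error; r)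
     E2-sum : ∑ P (\p -> ind (big p) * (X p * Fₚ p (\m -> y m + - 1ℚ * z p m) (\m -> y m + - 1ℚ * z p m)))
      - (U * U * Γ * weight (EB N) 1 + ∑ P (\p -> ind (big p) * (3ℚ * (U * U * Γ * weight (EP (N1 p)) p)))) ≤ ∑ βs (\m -> f m * (Λ⁺ y m * Λ⁺ y m))
     E2-sum = ≤by ((∑ βs (\m -> f m * (A0 m * A0 m)) - (∑ βs K - εA)) + (∑ βs K - ∑ P (\p -> ind (big p) * (X p * Fₚ p y y))) + (∑ P (\p -> ind (big p) * C p) - ∑ P (\p -> ind (big p) * L p)))
       (0≤+ (0≤+ (diff A-sum) (diff K-lower)) (diff (∑-mono∈ P (\p p∈ -> *-monoˡ (ind (big p)) (0≤ind (big p)) (lower p p∈)))))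
       (trans (id103 (∑ P (\p -> ind (big p) * Q p)) εA (∑ P (\p -> ind (big p) * (3ℚ * ε p))) (∑ βs (\m -> f m * (A0 m * A0 m))) (∑ βs K) (∑ P (\p -> ind (big p) * (X p * Fₚ p y y))) (∑ P (\p -> ind (big p) * C p)) (∑ P (\p -> ind (big p) * L p)))
       (trans (cong (\x -> x + (∑ βs (\m -> f m * (A0 m * A0 m)) + ∑ P (\p -> ind (big p) * C p))) zero″) (trans (+-idˡ _) (sym total)))) where
      εA = U * U * Γ * weight (EB N) 1
      ε Q C L : ℕ -> ℚ
      ε p = U * U * Γ * weight (EP (N1 p)) p
      Q p = X p * Fₚ p (\m -> y m + - 1ℚ * z p m) (\m -> y m + - 1ℚ * z p m)
      C p = ∑ (cofactors p) (\i -> f (p · i) * (B0 p (p · i) * B0 p (p · i) - 2ℚ * (A0 (p · i) * B0 p (p · i))))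
      L p = X p * Fₚ p (z p) (z p) - 2ℚ * (X p * Fₚ p y (z p)) - 3ℚ * ε p
      zero″ : ∑ P (\p -> ind (big p) * Q p) - ∑ P (\p -> ind (big p) * (X p * Fₚ p y y)) - ∑ P (\p -> ind (big p) * (3ℚ * ε p)) - ∑ P (\p -> ind (big p) * L p) ≡ 0ℚ
      zero″ = trans (cong (\x -> x - ∑ P (\p -> ind (big p) * L p)) (trans (cong (_- ∑ P (\p -> ind (big p) * (3ℚ * ε p))) (sym (∑-- P (\p -> ind (big p) * Q p) (\p -> ind (big p) * (X p * Fₚ p y y))))) (sym (∑-- P (\p -> ind (big p) * Q p - ind (big p) * (X p * Fₚ p y y)) (\p -> ind (big p) * (3ℚ * ε p))))))
       (trans (sym (∑-- P (\p -> ind (big p) * Q p - ind (big p) * (X p * Fₚ p y y) - ind (big p) * (3ℚ * ε p)) (\p -> ind (big p) * L p))) (trans (∑-cong P pt) (∑-0 P))) where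
       pt : ∀ p -> ind (big p) * Q p - ind (big p) * (X p * Fₚ p y y) - ind (big p) * (3ℚ * ε p) - ind (big p) * L p ≡ 0ℚ
       pt p = trans (cong (\x -> ind (big p) * (X p * x) - ind (big p) * (X p * Fₚ p y y) - ind (big p) * (3ℚ * ε p) - ind (big p) * L p) (Form-square P (mean γ (αₚ p)) (moment γ (αₚ p)) (- 1ℚ) y (z p)))
        (id95 (ind (big p)) (X p) (Fₚ p y y) (Fₚ p y (z p)) (Fₚ p (z p) (z p)) (ε p))
      total : ∑ βs (\m -> f m * (Λ⁺ y m * Λ⁺ y m)) ≡ ∑ βs (\m -> f m * (A0 m * A0 m)) + ∑ P (\p -> ind (big p) * C p)
      total = trans (∑-cong∈ βs (\m m∈ -> trans (cong (f m *_) (square-split m m∈)) (trans (*-distribˡ-+ (f m) (A0 m * A0 m) _) (cong (f m * (A0 m * A0 m) +_) (trans (sym (∑-*ˡ P (f m) (\p -> ind (divides p m) * G p m))) (∑-cong P (\p -> id50 (f m) (ind (divides p m)) (G p m))))))))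
       (trans (∑-+ βs (\m -> f m * (A0 m * A0 m)) (\m -> ∑ P (\p -> ind (divides p m) * (f m * G p m)))) (cong (∑ βs (\m -> f m * (A0 m * A0 m)) +_) (trans (∑-swap βs P (\m p -> ind (divides p m) * (f m * G p m))) (∑-cong∈ P (\p p∈ -> ∑-by-factor p (\m -> f m * G p m) p∈))))) where
       G : ℕ -> ℕ -> ℚ
       G p m = B0 p m * B0 p m - 2ℚ * (A0 m * B0 p m)
      K-lower : ∑ P (\p -> ind (big p) * (X p * Fₚ p y y)) ≤ ∑ βs K
      K-lower = ≡≤ (trans (∑-cong∈ P (\p p∈ -> trans (cong (ind (big p) *_) (sym (trans (∑-cong∈ (cofactors p) (\i i∈ -> K-cofactor p i p∈ i∈)) (trans (∑-const (cofactors p) (inv (φ W) * Fₚ p y y)) (sym (*-assoc (ι (length (cofactors p))) (inv (φ W)) (Fₚ p y y))))))) (sym (∑-by-factor p K p∈)))) (∑-swap P βs (\p m -> ind (divides p m) * K m)))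
       (∑-mono∈ βs (\m m∈ -> factor-≤1 m (K m) m∈ (0≤K m)))
      lower : ∀ p -> p ∈ P -> L p ≤ C p
      lower p p∈ = ≤by ((∑ cs zz - (X p * Fₚ p (z p) (z p) - ε p)) + 2ℚ * ((X p * Fₚ p y (z p) + ε p) - ∑ cs yz))
        (0≤+ (diff (abs≤⇒lb {∑ cs zz} {X p * Fₚ p (z p) (z p)} {ε p} (cross p p∈ (z p) (z p) p p (abs-punct p) (abs-punct p) (m≤m*n p p {{>-nonZero (1≤P p p∈)}})))) (0≤* 0≤2 (diff (abs≤⇒ub {∑ cs yz} {X p * Fₚ p y (z p)} {ε p} (cross p p∈ y (z p) 1 p abs-y (abs-punct p) (N.≤-reflexive (sym (N.*-identityˡ p))))))))
        (trans (id101 (X p * Fₚ p (z p) (z p)) (X p * Fₚ p y (z p)) (ε p) (∑ cs zz) (∑ cs yz)) (sym (trans (∑-cong cs (\i -> id102 (f (p · i)) (B0 p (p · i)) (A0 (p · i)))) (trans (∑-- cs zz (\i -> 2ℚ * yz i)) (cong (\x -> ∑ cs zz - x) (∑-*ˡ cs 2ℚ yz)))))) where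
       cs = cofactors p
       zz yz : ℕ -> ℚ
       zz i = f (p · i) * (B0 p (p · i) * B0 p (p · i))
       yz i = f (p · i) * (A0 (p · i) * B0 p (p · i))

module Sift where

 open Identities
 open Field
 open Sums
 open Forms
 open Sieve
 open MainForm
 open Smooth using (divides-false; divides-true; 1≤prime)
 open Cheb using (isPrime⇒; range-unique)
 open Phi
 open Shift
 open Counts
 open import Defs
 open Rationals

 ∑-subrange : ∀ a b a' b' (G : ℕ -> ℚ) -> (∀ i -> 0ℚ ≤ G i) -> a' ≦ a -> a ≦ b -> b ≦ b' -> ∑ (range a b) G ≤ ∑ (range a' b') G
 ∑-subrange a b a' b' G hG h1 h2 h3 = ≤-trans (≤+ʳ (∑-nonneg (range b b') hG)) (≡≤ (sym (∑-range-split a b b' G h2 h3)) (≤≡ (≤+ˡ (∑-nonneg (range a' a) hG)) (sym (∑-range-split a' a b' G h1 (≦-trans h2 h3)))))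

 module _ (q a : ℕ) (1≤q : 1 ≦ q) where
  private
   g : ℕ -> ℚ
   g n = ind (congᵇ q n a)
   periodic : ∀ x -> g (x N.+ q) ≡ g x
   periodic x = cong ind (congᵇ-ext q (x N.+ q) a q x a (Cong-trans (Cong-sym st)) (Cong-trans st)) where
    st : Cong q (x N.+ q) x
    st = cg 0 1 (id105 x q)
   window : ∀ x -> ∑ (range x (x N.+ q)) g ≡ 1ℚ
   window zero = first q a 1≤q where
    first : ∀ q a -> 1 ≦ q -> ∑ (range 0 q) (\n -> ind (congᵇ q n a)) ≡ 1ℚ
    first q@(suc _) a _ = trans (∑-single (range 0 q) d (\n -> ind (congᵇ q n a)) (range-unique 0 q) (∈-range⁺ {0} {q} z≤n (m%n<n a q)) (\r r∈ ne -> cong ind (no-hit r (proj₂ (∈-range⁻ {0} {q} r∈)) ne)))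
      (cong ind (≡ᵇ-true {d N.% q} {d} (m<n⇒m%n≡m (m%n<n a q)))) where
     d = a N.% q
     no-hit : ∀ r -> r N.< q -> r ≢ d -> congᵇ q r a ≡ false
     no-hit r lt ne with congᵇ q r a in e
     ... | false = refl
     ... | true = contradiction (trans (sym (m<n⇒m%n≡m lt)) (≡ᵇ-eq {r N.% q} {d} e)) ne
   window (suc x) = trans (cancel (g x) (trans (cong (_+ ∑ (range (suc x) (suc x N.+ q)) g) (sym (trans (cong (\l -> ∑ l g) (range-suc x)) (+-idʳ (g x))))) (trans (sym (∑-range-split x (suc x) (suc (x N.+ q)) g (n≤1+n x) (s≤s (m≤m+n x q))))
     (trans (∑-range-last x (x N.+ q) g (m≤m+n x q)) (trans (cong (∑ (range x (x N.+ q)) g +_) (periodic x)) (ℚ.+-comm (∑ (range x (x N.+ q)) g) (g x))))))) (window x) where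
    cancel : ∀ u {v w} -> u + v ≡ u + w -> v ≡ w
    cancel u {v} {w} e = trans (id104 u v) (trans (cong (_- u) e) (sym (id104 u w)))
   windows : ∀ lo j -> ∑ (range lo (lo N.+ q · j)) g ≡ ι j
   windows lo zero = trans (cong (\z -> ∑ (range lo z) g) (trans (cong (lo N.+_) (N.*-zeroʳ q)) (N.+-identityʳ lo))) (trans (cong (\l -> ∑ l g) (range-[] lo)) (sym (ι-def 0)))
   windows lo (suc j) = trans (cong (\z -> ∑ (range lo z) g) (trans (cong (lo N.+_) (trans (*-suc q j) (+-comm q (q · j)))) (sym (+-assoc lo (q · j) q))))
    (trans (∑-range-split lo (lo N.+ q · j) (lo N.+ q · j N.+ q) g (m≤m+n lo _) (m≤m+n _ q)) (trans (cong₂ _+_ (windows lo j) (window (lo N.+ q · j))) (trans (cong (ι j +_) (sym (ι-def 1))) (trans (sym (ι-+ j 1)) (cong ι (+-comm j 1))))))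
  class-count : ∀ lo L -> ∣ ∑ (range lo (lo N.+ L)) g - ι L * inv q ∣ ≤ 1ℚ
  class-count lo L = abs≤ (undiff (≤≡ (0≤+ (diff low1) (diff high2)) (id108 S Lq (ι j)))) (undiff (≤≡ (0≤+ (diff high1) (diff low2)) (id109 S Lq (ι j)))) where
   instance
    nzq : N.NonZero q
    nzq = >-nonZero 1≤q
   j = L N./ q
   S = ∑ (range lo (lo N.+ L)) g
   Lq = ι L * inv q
   jq≤L : q · j ≦ L
   jq≤L = ≤≡ℕ (≡≤ℕ (*-comm q j) (m≤n+m (j · q) (L N.% q))) (sym (m≡m%n+[m/n]*n L q))
   L≤jq : L ≦ q · suc j
   L≤jq = ≡≤ℕ (m≡m%n+[m/n]*n L q) (≤≡ℕ (N.+-monoˡ-≤ (j · q) (<⇒≤ (m%n<n L q))) (*-comm (suc j) q))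
   0≤g : ∀ n -> 0ℚ ≤ g n
   0≤g n = 0≤ind (congᵇ q n a)
   ι1+ : ι (suc j) ≡ 1ℚ + ι j
   ι1+ = trans (ι-+ 1 j) (cong (_+ ι j) (ι-def 1))
   low1 : ι j ≤ S
   low1 = ≡≤ (sym (windows lo j)) (∑-subrange lo (lo N.+ q · j) lo (lo N.+ L) g 0≤g N.≤-refl (m≤m+n lo _) (N.+-monoʳ-≤ lo jq≤L))
   high1 : S ≤ 1ℚ + ι j
   high1 = ≤≡ (∑-subrange lo (lo N.+ L) lo (lo N.+ q · suc j) g 0≤g N.≤-refl (m≤m+n lo _) (N.+-monoʳ-≤ lo L≤jq)) (trans (windows lo (suc j)) ι1+)
   q-cancel : ∀ i -> ι (q · i) * inv q ≡ ι i
   q-cancel i = trans (cong (_* inv q) (ι-* q i)) (trans (id51 (ι q) (ι i) (inv q)) (trans (cong (ι i *_) (*-inv q 1≤q)) (*-idʳ (ι i))))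
   low2 : ι j ≤ Lq
   low2 = ≡≤ (sym (q-cancel j)) (*-monoʳ (inv q) (0≤inv q) (ι-mono jq≤L))
   high2 : Lq ≤ 1ℚ + ι j
   high2 = ≤≡ (*-monoʳ (inv q) (0≤inv q) (ι-mono L≤jq)) (trans (q-cancel (suc j)) ι1+)

 module Full (D n k : ℕ) (7≤D : 7 ≦ D) (1≤n : 1 ≦ n) (b : ℕ) (F : ℕ -> ℕ) (F-anti : ∀ {i j} -> i ≦ j -> F j ≦ F i) (F-0 : ∀ {i} -> n ≦ i -> F i ≡ 0) where
  open Level D n k 7≤D 1≤n b F F-anti F-0 public
  r3 : ℕ -> List ℕ
  r3 = res 0 (0 ∷ 2 ∷ 6 ∷ [])
  Λ⁰ : (ℕ -> ℚ) -> ℕ -> ℚ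
  Λ⁰ = Λ γ (hits r3) P
  all-sum : ∀ a lo L -> ∑ (range lo (lo N.+ L)) (\m -> ind (congᵇ W m a) * (Λ⁰ y m * Λ⁰ y m)) ≤ ι L * inv W * wsum P (\p -> 3ℚ * inv p) (\m -> y m * y m) + U * U * Γ * weight (\_ -> 0ℚ) 1
  all-sum a lo L = ≤-trans (abs≤⇒ub (error U U 0≤U 0≤U P y y 1 1 W a freshW (\p m p∈ _ -> χ² p m (6<P p p∈)) 6<P 1≤W abs-y abs-y (N.≤-reflexive refl)))
    (+-monoˡ-≤ (U * U * Γ * weight (\_ -> 0ℚ) 1) (≡≤ (main-Form γ r M0 inv P y y W freshW (\p q _ _ _ -> trans (cong (ι L *_) (inv-* p q)) (id50 (ι L) (inv p) (inv q)))) (*-monoˡ (ι L * inv W) (0≤* (0≤ι L) (0≤inv W)) form))) where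
   ns = range lo (lo N.+ L)
   M0 : ℕ -> ℚ
   M0 q = ι L * inv q
   χ² : ∀ p m -> 6 N.< p -> hits r3 p m * hits r3 p m ≡ hits r3 p m
   χ² p m h6 = hits-01 r3 p m ((class-≢ p 0 0 2 N.z<s (≦-trans (m≤m+n 3 4) h6) ∷ class-≢ p 0 0 6 N.z<s h6 ∷ []) ∷ (class-≢ p 0 2 6 (m≤m+n 3 3) h6 ∷ []) ∷ [] ∷ [])
   crt' : ∀ p q a c -> 6 N.< p -> Prime p -> p ∤ q -> 1 ≦ q -> c ∈ r3 p -> ∃[ a' ] (1 ≦ p · q × (∀ n -> n ∈ ns -> ind (congᵇ q n a) * ind (congᵇ p n c) ≡ ind (congᵇ (p · q) n a')))
   crt' p q a c h6 pp nd 1≤q c∈ = let (a' , _ , _ , _ , eq) = crt p q a c pp nd 1≤q in a' , *-mono-≤ (1≤prime pp) 1≤q , \n _ -> eq n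
   open Error γ 0≤γ (6 N.<_) γ≤1 ns r3 (\p -> N.≤-refl) M0 (\q -> 0ℚ + 2ℚ) (\q -> 0≤+ (≤-refl {0ℚ}) 0≤2) W R 1 1≤W (\q a -> 1 ≦ q)
    crt'
    (\q a 1≤q -> ≤-trans (class-count q a 1≤q lo L) (≤by 1ℚ 0≤1 refl)) using (error; r)
   α : ℕ -> ℚ
   α p = ι 3 * inv p
   α≡ : ∀ p -> α p ≡ γ p
   α≡ p = cong (_* inv p) (ι-def 3)
   σ : ℕ -> ℚ
   σ = moment γ α
   form : Form P (mean γ α) σ y y ≤ wsum P (\p -> 3ℚ * inv p) (\m -> y m * y m)
   form = ≡≤ (trans (Form-cong P y y (\p _ -> trans (cong (\z -> γ p - z) (α≡ p)) (+-inverseʳ (γ p))) (\p p∈ -> sym (0≤p⇒∣p∣≡p (0≤σ p p∈)))) (Form-diag P (\p -> ∣ σ p ∣) y))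
    (wsum-g-mono P (\p -> 0≤∣p∣ (σ p)) (\p p∈ -> ≡≤ (trans (0≤p⇒∣p∣≡p (0≤σ p p∈)) (σ≡ p)) (-≤ (0≤sq (γ p)))) (\m -> 0≤* (0≤y m) (0≤y m))) where
    σ≡ : ∀ p -> σ p ≡ γ p - γ p * γ p
    σ≡ p = trans (cong (\z -> γ p * γ p + (1ℚ - 2ℚ * γ p) * z) (α≡ p)) (id106 (γ p))
    0≤σ : ∀ p -> p ∈ P -> 0ℚ ≤ σ p
    0≤σ p p∈ = ≤≡ (0≤* (0≤γ p) (diff (γ≤1 p (6<P p p∈)))) (sym (trans (σ≡ p) (id107 (γ p))))

module Combine where

 open Identities
 open Field
 open Sums
 open Forms
 open Sieve
 open MainForm
 open Smooth using (divides-false; divides-true; 1≤prime; prime-∣-prime; cop)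
 open Cheb using (isPrime⇒; isPrime-true; ∏ℕ)
 open Mertens using (2Q; 0≤2Q)
 open BVErr using (inv-pred)
 open Phi
 open Shift
 open Counts
 open Sift
 open Setup
 open Lower
 open import Defs
 open Rationals
 open import Data.List.Membership.DecPropositional N._≟_ using (_∈?_)

 private
  3inv : ∀ p -> 1 ≦ p -> inv p - 3ℚ * (inv p * inv p) ≤ ι (p ∸ 3) * (inv p * inv p)
  3inv p h = undiff (≤≡ (0≤* (diff le) (0≤* (0≤inv p) (0≤inv p))) (trans (id127 (ι p) (ι (p ∸ 3)) (inv p)) (trans (cong (\z -> (ι (p ∸ 3) * (inv p * inv p)) - (z * inv p - 3ℚ * (inv p * inv p))) (*-inv p h)) (cong (\z -> ι (p ∸ 3) * (inv p * inv p) - (z - 3ℚ * (inv p * inv p))) (*-idˡ (inv p)))))) where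
   le : ι p - 3ℚ ≤ ι (p ∸ 3)
   le = ≤≡ (+-monoˡ-≤ (- 3ℚ) (≤≡ (ι-mono (m≤n+m∸n p 3)) (trans (ι-+ 3 (p ∸ 3)) (cong (_+ ι (p ∸ 3)) (ι-def 3))))) (id124 (ι (p ∸ 3)))

 κ0 : ℕ -> ℚ
 κ0 p = ι (p ∸ 3) * (inv p * inv p)

 κ0≤inv : ∀ p -> κ0 p ≤ inv p
 κ0≤inv zero = ≡⇒≤ (trans (cong (\z -> ι 0 * (z * z)) inv-0) (trans (*-zeroʳ (ι 0)) (sym inv-0)))
 κ0≤inv p@(suc _) = ≤≡ (*-monoʳ (inv p * inv p) (0≤* (0≤inv p) (0≤inv p)) (ι-mono (m∸n≤m p 3))) (trans (sym (*-assoc (ι p) (inv p) (inv p))) (trans (cong (_* inv p) (*-inv p N.z<s)) (*-idˡ (inv p))))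

 inv≤κ0 : ∀ p -> inv p ≤ κ0 p + 3ℚ * (inv p * inv p)
 inv≤κ0 zero = ≡≤ inv-0 (0≤+ (0≤* (0≤ι _) (0≤* (0≤inv 0) (0≤inv 0))) (0≤* 0≤3 (0≤* (0≤inv 0) (0≤inv 0))))
 inv≤κ0 p@(suc _) = undiff (≤≡ (diff (3inv p N.z<s)) (id131 (κ0 p) (inv p) (3ℚ * (inv p * inv p))))

 -- τ = 3/p - 2/(p-1) and α(1-α) for α = 2/(p-1)
 local-bounds : ∀ p -> 6 N.< p -> κ0 p ≤ 3ℚ * inv p - ι 2 * inv (p ∸ 1) × 2ℚ * κ0 p ≤ ι 2 * inv (p ∸ 1) * (1ℚ - ι 2 * inv (p ∸ 1))
 local-bounds p@(suc (suc (suc r))) (s≤s (s≤s (s≤s _))) = t₁ , t₂ where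
  i = inv p
  j = inv (suc (suc r))
  x = ι r
  pe : (3ℚ + x) * i ≡ 1ℚ
  pe = trans (cong (_* i) (sym (trans (ι-+ 3 r) (cong (_+ x) (ι-def 3))))) (*-inv p N.z<s)
  je : (2ℚ + x) * j ≡ 1ℚ
  je = trans (cong (_* j) (sym (trans (ι-+ 2 r) (cong (_+ x) (ι-def 2))))) (*-inv (suc (suc r)) N.z<s)
  0≤x : 0ℚ ≤ x
  0≤x = 0≤ι r
  0≤i : 0ℚ ≤ i
  0≤i = 0≤inv p
  0≤j : 0ℚ ≤ j
  0≤j = 0≤inv (suc (suc r))
  i≤j : i ≤ j
  i≤j = inv-anti N.z<s (n≤1+n _)
  t₁ : x * (i * i) ≤ 3ℚ * i - ι 2 * j
  t₁ = ≤≡ (*-monoˡ x 0≤x (*-monoˡ i 0≤i i≤j)) (trans (id128 x i j) (trans (cong₂ (\a b -> 3ℚ * i * a - 2ℚ * j * b) je pe) (trans (id129 i j) (cong (\z -> 3ℚ * i - z * j) (sym (ι-def 2))))))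
  t₂ : 2ℚ * (x * (i * i)) ≤ ι 2 * j * (1ℚ - ι 2 * j)
  t₂ = ≤≡ (*-monoˡ 2ℚ 0≤2 (*-monoˡ x 0≤x (*-mono 0≤i 0≤j i≤j i≤j))) (trans (id130 x j) (trans (cong (\a -> 2ℚ * j * (a - 2ℚ * j)) je) (cong (\z -> z * j * (1ℚ - z * j)) (sym (ι-def 2)))))

 module Local (D n k : ℕ) (7≤D : 7 ≦ D) (1≤n : 1 ≦ n) (b : ℕ) (F : ℕ -> ℕ) (F-anti : ∀ {i j} -> i ≦ j -> F j ≦ F i) (F-0 : ∀ {i} -> n ≦ i -> F i ≡ 0) where
  open Full D n k 7≤D 1≤n b F F-anti F-0 public
  -- the step function of y(m) - y(p m) for p in the l-th interval
  Δ : ℕ -> ℕ -> ℕ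
  Δ l u = F (u N.+ 2) ∸ F (u N.+ l)
  private
   Δ≤ : ∀ l u -> Δ l u ≦ F 0
   Δ≤ l u = ≦-trans (m∸n≤m (F (u N.+ 2)) (F (u N.+ l))) (F-anti z≤n)
   Δ-0 : ∀ l {u} -> n ≦ u -> Δ l u ≡ 0
   Δ-0 l {u} h = trans (cong (_∸ F (u N.+ l)) (F-0 (≦-trans h (m≤m+n u 2)))) (0∸n≡0 (F (u N.+ l)))
  module Numbers (v v̄ : ℚ) (0≤v : 0ℚ ≤ v) (0≤v̄ : 0ℚ ≤ v̄) (v≤ : ∀ i -> i N.< n -> v ≤ V i) (≤v̄ : ∀ i -> i N.< n -> V i ≤ v̄) (L : ℚ) (0≤L : 0ℚ ≤ L) (Z : ℚ) (0≤Z : 0ℚ ≤ Z) (≤Z : wsum P inv (below R) ≤ Z) where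
   open Bounds P v v̄ 0≤v 0≤v̄ v≤ ≤v̄ public
   module Ta (l : ℕ) = Tangent (Δ l) (Δ≤ l) (Δ-0 l)
   αl : ℕ -> ℚ
   αl = Ta.α
   loss = L * (ι n * ι (F 0)) * ι (F 0) * (ι 29 * inv D) * (Z * (Z * Z))
   Q : ℕ -> ℚ
   Q l = 2ℚ * (v * (v * (v * (L * αl l))) - loss) - v̄ * (v̄ * (L * L * αl l))
   -- x is the prime whose event is excluded, or 0
   Form-Q : ∀ x l (α : ℕ -> ℚ) (f : ℕ -> ℚ) -> x ≡ 0 ⊎ x ∈ P -> (∀ p -> p ∈ P -> (p ≡ x -> α p ≡ 0ℚ) × (p ≢ x -> α p ≡ ι 2 * inv (p ∸ 1))) -> (∀ m -> 0ℚ ≤ f m) ->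
    (∀ a b c -> ι (Δ l (bin' a N.+ (bin' b N.+ bin' c))) ≤ f (a · (b · c))) -> Q l ≤ Form P (mean γ α) (moment γ α) f f
   Form-Q x l α f hx hα hf hΔ = Ta.Form-≥ l (mean γ α) (moment γ α) κ e f L (ι 29 * inv D) Z 0≤κ 0≤e κ≤inv ≤κe (\p p∈ -> 1≤prime (prP p p∈)) κ≤τ κ≤σ hf hΔ 0≤L e≤ 0≤Z ≤Z where
    κ e : ℕ -> ℚ
    κ p = if Dec.does (p N.≟ x) then 0ℚ else κ0 p
    e p = 3ℚ * (inv p * inv p) + (if Dec.does (p N.≟ x) then inv p else 0ℚ)
    0≤κ0 : ∀ p -> 0ℚ ≤ κ0 p
    0≤κ0 p = 0≤* (0≤ι (p ∸ 3)) (0≤* (0≤inv p) (0≤inv p))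
    0≤sq3 : ∀ p -> 0ℚ ≤ 3ℚ * (inv p * inv p)
    0≤sq3 p = 0≤* 0≤3 (0≤* (0≤inv p) (0≤inv p))
    case : ∀ p (S : ℚ -> ℚ -> Set) -> (p ≡ x -> S 0ℚ (inv p)) -> (p ≢ x -> S (κ0 p) 0ℚ) -> S (κ p) (if Dec.does (p N.≟ x) then inv p else 0ℚ)
    case p S f g = go (p N.≟ x) where
     go : (d : Dec (p ≡ x)) -> S (if Dec.does d then 0ℚ else κ0 p) (if Dec.does d then inv p else 0ℚ)
     go (yes h) = f h
     go (no h) = g h
    0≤κ : ∀ p -> 0ℚ ≤ κ p
    0≤κ p = case p (\a _ -> 0ℚ ≤ a) (\_ -> ≤-refl) (\_ -> 0≤κ0 p)
    0≤e : ∀ p -> 0ℚ ≤ e p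
    0≤e p = 0≤+ (0≤sq3 p) (case p (λ _ a -> 0ℚ ≤ a) (\_ -> 0≤inv p) (\_ -> ≤-refl))
    κ≤inv : ∀ p -> κ p ≤ inv p
    κ≤inv p = case p (\a _ -> a ≤ inv p) (\_ -> 0≤inv p) (\_ -> κ0≤inv p)
    ≤κe : ∀ p -> inv p ≤ κ p + e p
    ≤κe p = case p (\a i -> inv p ≤ a + (3ℚ * (inv p * inv p) + i)) (\_ -> ≤by (3ℚ * (inv p * inv p)) (0≤sq3 p) (id119 (inv p) (3ℚ * (inv p * inv p)))) (\_ -> ≤≡ (inv≤κ0 p) (cong (κ0 p +_) (sym (+-idʳ (3ℚ * (inv p * inv p))))))
    κ≤τ : ∀ p -> p ∈ P -> κ p ≤ mean γ α p
    κ≤τ p p∈ = case p (\a _ -> a ≤ mean γ α p) (\h -> ≤≡ (0≤γ p) (trans (sym (+-idʳ (γ p))) (cong (\z -> γ p - z) (sym (proj₁ (hα p p∈) h)))))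
     (\h -> ≤≡ (proj₁ (local-bounds p (6<P p p∈))) (cong (\z -> γ p - z) (sym (proj₂ (hα p p∈) h))))
    κ≤σ : ∀ p -> p ∈ P -> 2ℚ * κ p ≤ moment γ α p - mean γ α p * mean γ α p
    κ≤σ p p∈ = case p (\a _ -> 2ℚ * a ≤ moment γ α p - mean γ α p * mean γ α p) (\h -> ≡⇒≤ (trans (*-zeroʳ 2ℚ) (sym (trans (variance γ α p) (trans (cong (\z -> z * (1ℚ - z)) (proj₁ (hα p p∈) h)) refl)))))
     (\h -> ≤≡ (proj₂ (local-bounds p (6<P p p∈))) (sym (trans (variance γ α p) (cong (\z -> z * (1ℚ - z)) (proj₂ (hα p p∈) h)))))
    excl : ∑ P (\p -> if Dec.does (p N.≟ x) then inv p else 0ℚ) ≤ inv D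
    excl = go hx where
     off : ∀ p -> p ≢ x -> (if Dec.does (p N.≟ x) then inv p else 0ℚ) ≡ 0ℚ
     off p ne = case p (λ _ a -> a ≡ 0ℚ) (\h -> contradiction h ne) (\_ -> refl)
     go : x ≡ 0 ⊎ x ∈ P -> ∑ P (\p -> if Dec.does (p N.≟ x) then inv p else 0ℚ) ≤ inv D
     go (inj₁ refl) = ≡≤ (trans (∑-cong∈ P (\p p∈ -> off p (\h -> <-irrefl (sym h) (1≤prime (prP p p∈))))) (∑-0 P)) (0≤inv D)
     go (inj₂ x∈) = ≡≤ (∑-single P x (\p -> if Dec.does (p N.≟ x) then inv p else 0ℚ) uniqueP x∈ (\p _ ne -> off p ne)) (≤-trans (case x (λ _ a -> a ≤ inv x) (\_ -> ≤-refl) (\_ -> 0≤inv x)) (inv-anti (≦-trans N.z<s 7≤D) (<⇒≤ (D<P x x∈))))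
    e≤ : ∑ P (\p -> 3ℚ * e p + 3ℚ * (inv p * inv p) + inv p * inv p * inv p) ≤ ι 29 * inv D
    e≤ = ≤-trans (∑-mono P (\p -> ≤≡ (+-monoʳ-≤ (3ℚ * e p + 3ℚ * (inv p * inv p)) (≤≡ (*-monoˡ (inv p * inv p) (0≤* (0≤inv p) (0≤inv p)) (inv≤1 p)) (*-idʳ (inv p * inv p)))) (id120 (inv p * inv p) (if Dec.does (p N.≟ x) then inv p else 0ℚ))))
     (≡≤ (trans (∑-+ P (\p -> 13ℚ * (inv p * inv p)) (\p -> 3ℚ * (if Dec.does (p N.≟ x) then inv p else 0ℚ))) (cong₂ _+_ (∑-*ˡ P 13ℚ (\p -> inv p * inv p)) (∑-*ˡ P 3ℚ (\p -> if Dec.does (p N.≟ x) then inv p else 0ℚ))))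
     (≤≡ (+-mono (*-monoˡ 13ℚ (ℚ.≤ᵇ⇒≤ _) εP≤) (*-monoˡ 3ℚ 0≤3 excl)) (trans (id121 (inv D)) (cong (_* inv D) (sym (ι-def 29)))))) where
     13ℚ = toℚ 13
   θ : ℕ -> ℚ
   θ l = Q l ⊔ 0ℚ
   0≤θ : ∀ l -> 0ℚ ≤ θ l
   0≤θ l = ℚ.p≤q⊔p (Q l) 0ℚ
   Form-θ : ∀ x l (α : ℕ -> ℚ) (f : ℕ -> ℚ) -> x ≡ 0 ⊎ x ∈ P -> (∀ p -> p ∈ P -> (p ≡ x -> α p ≡ 0ℚ) × (p ≢ x -> α p ≡ ι 2 * inv (p ∸ 1))) -> (∀ m -> 0ℚ ≤ f m) ->
    (∀ a b c -> ι (Δ l (bin' a N.+ (bin' b N.+ bin' c))) ≤ f (a · (b · c))) -> θ l ≤ Form P (mean γ α) (moment γ α) f f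
   Form-θ x l α f hx hα hf hΔ = ℚ.⊔-lub (Form-Q x l α f hx hα hf hΔ) (Form-nonneg P (mean γ α) (moment γ α) f (\p p∈ -> ≤≡ (var p p∈ (p N.≟ x)) (sym (variance γ α p)))) where
    var : ∀ p -> p ∈ P -> Dec (p ≡ x) -> 0ℚ ≤ α p * (1ℚ - α p)
    var p p∈ (yes h) = ≡⇒≤ (sym (cong (\z -> z * (1ℚ - z)) (proj₁ (hα p p∈) h)))
    var p p∈ (no h) = ≤≡ (≤-trans (0≤* 0≤2 (0≤* (0≤ι (p ∸ 3)) (0≤* (0≤inv p) (0≤inv p)))) (proj₂ (local-bounds p (6<P p p∈)))) (cong (\z -> z * (1ℚ - z)) (sym (proj₂ (hα p p∈) h)))
   y-Δ : ∀ a b c -> ι (Δ n (bin' a N.+ (bin' b N.+ bin' c))) ≤ y (a · (b · c))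
   y-Δ a b c = ι-mono (≦-trans (m∸n≤m (F (bin' a N.+ (bin' b N.+ bin' c) N.+ 2)) (F (bin' a N.+ (bin' b N.+ bin' c) N.+ n))) (F-down3 a b c))
   punct-Δ : ∀ p -> p ∈ P -> ∀ a b c -> ι (Δ (bin' p) (bin' a N.+ (bin' b N.+ bin' c))) ≤ y (a · (b · c)) + - 1ℚ * punct p y (a · (b · c))
   punct-Δ p p∈ a b c = ≤-trans (go (≤-total F2 F1)) (≤-trans (≤by (y (p · m) - punct p y m) (diff (punct≤ p y m (0≤y (p · m)))) (id125 (y m) (y (p · m)) (punct p y m))) ≤-refl) where
    m = a · (b · c)
    s = bin' a N.+ (bin' b N.+ bin' c)
    F1 = F (s N.+ 2)
    F2 = F (s N.+ bin' p)
    yp : y (p · m) ≤ ι F2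
    yp = ι-mono (≦-trans (F-up 0 p m) (≤≡ℕ (F-up3 (bin' p) a b c) (cong F (+-comm (bin' p) s))))
    go : F2 ≦ F1 ⊎ F1 ≦ F2 -> ι (F1 ∸ F2) ≤ y m - y (p · m)
    go (inj₁ h) = ≤-trans (undiff (≡⇒≤ (sym (trans (cong (\z -> (ι F1 - ι F2) - z) ι∸) (+-inverseʳ (ι F1 - ι F2)))))) (undiff (≤≡ (0≤+ (diff (ι-mono (F-down3 a b c))) (diff yp)) (id122 (y m) (y (p · m)) (ι F1) (ι F2)))) where
     ι∸ : ι (F1 ∸ F2) ≡ ι F1 - ι F2
     ι∸ = trans (id113 (ι (F1 ∸ F2)) (ι F2)) (cong (_- ι F2) (trans (sym (ι-+ (F1 ∸ F2) F2)) (cong ι (m∸n+n≡m h))))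
    go (inj₂ h) = ≡≤ (trans (cong ι (m≤n⇒m∸n≡0 h)) (ι-def 0)) (diff (y-anti p m (1≤prime (prP p p∈))))
   0≤punct-diff : ∀ p -> p ∈ P -> ∀ m -> 0ℚ ≤ y m + - 1ℚ * punct p y m
   0≤punct-diff p p∈ m = ≤≡ (diff (≤-trans (punct≤ p y m (0≤y (p · m))) (y-anti p m (1≤prime (prP p p∈))))) (id126 (y m) (punct p y m))
   prime-factor : ∀ N p -> Bool
   prime-factor N p = N ^ 1 <ᵇ p ^ M
   cof : ℕ -> ℕ -> List ℕ
   cof N p = filterᵇ isPrimeᵇ (range (suc (divℕ N p)) (suc (divℕ (2 · N) p)))
   main-count : ℕ -> ℚ
   main-count N = ι (πflat N) * θ n + ∑ P (\p -> ind (prime-factor N p) * (ι (length (cof N p)) * θ (bin' p)))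
   P-error β-error : ℕ -> ℕ -> ℚ
   P-error N q = maxRes q (\a -> ∣ toℚ (πflatAP N q a) - divQ (toℚ (πflat N)) (φ q) ∣)
   β-error N q = maxRes q (\a -> ∣ toℚ (πβAP 1 M N q a) - divQ (toℚ (πβq 1 M N q)) (φ q) ∣)
   errors : ℕ -> ℚ
   errors N = U * U * Γ * weight (P-error N) 1 + (U * U * Γ * weight (β-error N) 1 + ∑ P (\p -> ind (prime-factor N p) * (3ℚ * (U * U * Γ * weight (P-error (suc (divℕ N p))) p))))
   module Residue (W' : ℕ) (W≡ : W ≡ 2 · W') (odd : 2 ∤ W') where
    n0 = 2 N.+ W'
    private
     instance
      nzW : N.NonZero W
      nzW = >-nonZero 1≤W
    w : ℕ -> ℚ
    w m = ind (congᵇ W m n0) * (Λ⁰ y m * Λ⁰ y m)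
    0≤w : ∀ m -> 0ℚ ≤ w m
    0≤w m = 0≤* (0≤ind (congᵇ W m n0)) (0≤sq (Λ⁰ y m))
    lo : ℕ -> ℕ
    lo N = N ∸ 6
    hit : ℕ -> ℕ -> ℚ
    hit N m = ind (isPrimeᵇ m) + ind (βᵇ 1 M N m)
    module Shifted (h k1 k2 : ℕ) (h≤6 : h ≦ 6) (k1<k2 : k1 N.< k2) (k2≤6 : k2 ≦ 6) (h≢k1 : h ≢ k1) (h≢k2 : h ≢ k2) (hh : h ≡ 0 ⊎ (h ≡ 2 ⊎ h ≡ 6))
     (perm : ∀ (x : ℕ -> ℚ) -> x k1 + (x k2 + 0ℚ) + x h ≡ x 0 + (x 2 + (x 6 + 0ℚ))) where
     open At h k1 k2 h≤6 k1<k2 k2≤6 h≢k1 h≢k2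
     a = (n0 N.+ h) N.% W
     a≡ : Cong W a (n0 N.+ h)
     a≡ = cg ((n0 N.+ h) N./ W) 0 (trans (trans (cong (a N.+_) (*-comm W ((n0 N.+ h) N./ W))) (sym (m≡m%n+[m/n]*n (n0 N.+ h) W))) (sym (trans (cong (n0 N.+ h N.+_) (N.*-zeroʳ W)) (N.+-identityʳ (n0 N.+ h)))))
     adm : Adm W a
     adm = 1≤W , Cong-coprime (Cong-sym a≡) (coprimeᵇ⇒ (n0 N.+ h) W (trans (sym (cop-coprime Qs (n0 N.+ h) prQ)) (base-residue Qs W W' h prQ (\q -> ∈⇒∣∏ Qs) W≡ odd prime2 hh))) , m%n<n (n0 N.+ h) W
     f-shift : ∀ m -> f a adm (h N.+ m) ≡ ind (congᵇ W m n0)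
     f-shift m = cong ind (congᵇ-ext W (h N.+ m) a W m n0 (\c -> Cong-+⁻ h (subst (\z -> Cong W z (n0 N.+ h)) (+-comm h m) (Cong-trans c a≡))) (\c -> Cong-trans (subst (\z -> Cong W z (n0 N.+ h)) (+-comm m h) (Cong-+ h c)) (Cong-sym a≡)))
     Λ-shift : ∀ m -> Λ⁺ y (h N.+ m) ≡ Λ⁰ y m
     Λ-shift m = Λ-cong γ χ⁺ (hits r3) P y (h N.+ m) m (\p p∈ -> trans (cong (χ⁺ p) (+-comm h m)) (trans (cong₂ _+_ (cong₂ (\u v -> ind u + (ind v + 0ℚ)) (shift-class p m h k1) (shift-class p m h k2)) (cong ind (sym (divides-class p m h (≦-trans h≤6 (<⇒≤ (6<P p p∈)))))))
      (perm (\k -> ind (congᵇ p m (p ∸ k))))))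
     w-shift : ∀ m -> f a adm (h N.+ m) * (Λ⁺ y (h N.+ m) * Λ⁺ y (h N.+ m)) ≡ w m
     w-shift m = cong₂ (\u v -> u * (v * v)) (f-shift m) (Λ-shift m)
     transfer : ∀ (t : ℕ -> Bool) a1 b1 lo1 hi1 -> lo1 N.+ h ≦ a1 -> a1 ≦ b1 -> b1 ≦ hi1 N.+ h ->
      ∑ (filterᵇ t (range a1 b1)) (\m -> f a adm m * (Λ⁺ y m * Λ⁺ y m)) ≤ ∑ (range lo1 hi1) (\m -> ind (t (m N.+ h)) * w m)
     transfer t a1 b1 lo1 hi1 h1 h2 h3 = ≡≤ (∑-filter t (range a1 b1) (\m -> f a adm m * (Λ⁺ y m * Λ⁺ y m))) (≤≡ (∑-subrange a1 b1 (h N.+ lo1) (h N.+ hi1) G 0≤G (≡≤ℕ (+-comm h lo1) h1) h2 (≤≡ℕ h3 (+-comm hi1 h)))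
      (trans (∑-range-shift lo1 hi1 h G) (∑-cong (range lo1 hi1) (\m -> cong₂ (\u v -> ind (t u) * v) (+-comm h m) (w-shift m))))) where
      G : ℕ -> ℚ
      G m = ind (t m) * (f a adm m * (Λ⁺ y m * Λ⁺ y m))
      0≤G : ∀ m -> 0ℚ ≤ G m
      0≤G m = 0≤* (0≤ind (t m)) (0≤* (0≤ind (congᵇ W m a)) (0≤sq (Λ⁺ y m)))
     bound : ∀ N -> R · R ≦ N -> R ≦ N -> 6 ≦ N -> inv (φ W) * main-count N - errors N ≤ ∑ (range (lo N) (lo N N.+ (N N.+ 7))) (\m -> hit N (m N.+ h) * w m)
     bound N RR≤N R≤N 6≤N = ≤-trans (≤by ((iφ * ι (πflat N) * F∞ - iφ * ι (πflat N) * θ n) + (E2m - E2θ)) (0≤+ (diff (*-monoˡ (iφ * ι (πflat N)) (0≤* (0≤inv (φ W)) (0≤ι (πflat N))) f∞)) (diff e2)) (trans (id114 iφ (ι (πflat N)) (θ n) Tθ F∞ E2m E2θ eP (errors2)) (cong (\z -> (ι (πflat N) * iφ * F∞ - eP) + (E2m - errors2) + z) (trans (cong (\z -> iφ * Tθ - z) E2θ≡) (+-inverseʳ (iφ * Tθ))))))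
       (≡≤ (+-idʳ _) (≤-trans (+-mono (prime-sum a adm N R≤N) (E2-sum a adm N RR≤N)) (≤≡ (+-mono (transfer isPrimeᵇ N (2 · N) (lo N) hi lo≤N N≤2N (≦-trans (n≤1+n _) 2N≤hi)) (transfer (βᵇ 1 M N) (suc N) (suc (2 · N)) (lo N) hi (≦-trans lo≤N (n≤1+n N)) (s≤s N≤2N) 2N≤hi))
       (trans (sym (∑-+ (range (lo N) hi) (\m -> ind (isPrimeᵇ (m N.+ h)) * w m) (\m -> ind (βᵇ 1 M N (m N.+ h)) * w m))) (∑-cong (range (lo N) hi) (\m -> sym (*-distribʳ-+ (w m) (ind (isPrimeᵇ (m N.+ h))) (ind (βᵇ 1 M N (m N.+ h))))))))))
      where
      hi = lo N N.+ (N N.+ 7)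
      hi≡ : hi ≡ suc (2 · N)
      hi≡ = trans (id110 (N ∸ 6) N) (trans (cong (\z -> z N.+ suc N) (m∸n+n≡m 6≤N)) (id111 N))
      N≤2N : N ≦ 2 · N
      N≤2N = m≤m+n N (N N.+ 0)
      lo≤N : lo N N.+ h ≦ N
      lo≤N = ≤≡ℕ (N.+-monoʳ-≤ (lo N) h≤6) (m∸n+n≡m 6≤N)
      2N≤hi : suc (2 · N) ≦ hi N.+ h
      2N≤hi = ≡≤ℕ (sym hi≡) (m≤m+n hi h)
      iφ eP errors2 F∞ E2m E2θ Tθ : ℚ
      iφ = inv (φ W)
      eP = U * U * Γ * weight (P-error N) 1
      errors2 = U * U * Γ * weight (β-error N) 1 + ∑ P (\p -> ind (prime-factor N p) * (3ℚ * (U * U * Γ * weight (P-error (suc (divℕ N p))) p)))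
      F∞ = Form P (mean γ αU) (moment γ αU) y y
      g2 : ℕ -> ℕ -> ℚ
      g2 p m = y m + - 1ℚ * punct p y m
      E2m = ∑ P (\p -> ind (prime-factor N p) * (X a adm N RR≤N p * Fₚ a adm N RR≤N p (g2 p) (g2 p)))
      E2θ = ∑ P (\p -> ind (prime-factor N p) * (X a adm N RR≤N p * θ (bin' p)))
      Tθ = ∑ P (\p -> ind (prime-factor N p) * (ι (length (cof N p)) * θ (bin' p)))
      E2θ≡ : E2θ ≡ iφ * Tθ
      E2θ≡ = trans (∑-cong P (\p -> id112 (ind (prime-factor N p)) (ι (length (cof N p))) iφ (θ (bin' p)))) (∑-*ˡ P iφ (\p -> ind (prime-factor N p) * (ι (length (cof N p)) * θ (bin' p))))
      f∞ : θ n ≤ F∞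
      f∞ = Form-θ 0 n αU y (inj₁ refl) (\p p∈ -> (\e -> ⊥-elim (<-irrefl (sym e) (1≤prime (prP p p∈)))) , (\_ -> refl)) 0≤y y-Δ
      e2 : E2θ ≤ E2m
      e2 = ∑-mono∈ P (\p p∈ -> *-monoˡ (ind (prime-factor N p)) (0≤ind (prime-factor N p)) (*-monoˡ (X a adm N RR≤N p) (0≤* (0≤ι (length (cof N p))) (0≤inv (φ W)))
       (Form-θ p (bin' p) (αₚ a adm N RR≤N p) (g2 p) (inj₂ p∈) (\q q∈ -> (\e -> r'-case a adm N RR≤N p q (\l -> ι (length l) * inv (q ∸ 1) ≡ 0ℚ) (\_ -> trans (cong (_* inv (q ∸ 1)) (ι-def 0)) (*-zeroˡ (inv (q ∸ 1)))) (\ne -> contradiction e ne)) , (\ne -> r'-case a adm N RR≤N p q (\l -> ι (length l) * inv (q ∸ 1) ≡ ι 2 * inv (q ∸ 1)) (\e -> contradiction e ne) (\_ -> refl)))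
        (0≤punct-diff p p∈) (punct-Δ p p∈))))
    private
     small : ℕ -> ℕ -> Set
     small N m = hit N m ≡ 0ℚ ⊎ (P₂ m × hit N m ≡ 1ℚ)
     hit-small : ∀ N m -> small N m
     hit-small N m with isPrimeᵇ m in e1 | βᵇ 1 M N m in e2
     ... | false | false = inj₁ refl
     ... | true | false = inj₂ (inj₁ (isPrime⇒ m e1) , refl)
     ... | false | true = inj₂ (inj₂ (d , e , pd , pe , d<e , m≡) , refl) where
      open Semiprime (β⇒ M N m e2)
      d<e : d N.< e
      d<e = ≰⇒> (\le -> <-irrefl refl (<-≤-trans N<ee (≦-trans (*-mono-≤ le le) dd≤N)))
     ... | true | true = contradiction (isPrime⇒ m e1) (composite (β⇒ M N m e2)) where
      composite : Semiprime M N m -> ¬ Prime m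
      composite (semi d e pd pe refl _ _ _) pm with prime⇒irreducible pm (m∣m*n {d} e)
      ... | inj₁ refl = ¬prime[1] pd
      ... | inj₂ eq = ¬prime[1] (subst Prime (*-cancelˡ-≡ e 1 d {{>-nonZero (1≤prime pd)}} (trans (sym eq) (sym (N.*-identityʳ d)))) pe)
     at-most-two : ∀ N m -> ¬ (P₂ m × P₂ (m N.+ 2) × P₂ (m N.+ 6)) -> hit N (m N.+ 0) + hit N (m N.+ 2) + hit N (m N.+ 6) ≤ 2ℚ
     at-most-two N m ntp = go (hit-small N (m N.+ 0)) (hit-small N (m N.+ 2)) (hit-small N (m N.+ 6)) where
      le1 : ∀ m -> small N m -> hit N m ≤ 1ℚ
      le1 m (inj₁ e) = ≡≤ e 0≤1
      le1 m (inj₂ (_ , e)) = ≡⇒≤ e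
      go : small N (m N.+ 0) -> small N (m N.+ 2) -> small N (m N.+ 6) -> hit N (m N.+ 0) + hit N (m N.+ 2) + hit N (m N.+ 6) ≤ 2ℚ
      go (inj₁ e) b c = ≤-trans (+-mono (+-mono (≡⇒≤ e) (le1 (m N.+ 2) b)) (le1 (m N.+ 6) c)) ≤-refl
      go a@(inj₂ _) (inj₁ e) c = ≤-trans (+-mono (+-mono (le1 (m N.+ 0) a) (≡⇒≤ e)) (le1 (m N.+ 6) c)) ≤-refl
      go a@(inj₂ _) b@(inj₂ _) (inj₁ e) = ≤-trans (+-mono (+-mono (le1 (m N.+ 0) a) (le1 (m N.+ 2) b)) (≡⇒≤ e)) ≤-refl
      go (inj₂ (p , _)) (inj₂ (q , _)) (inj₂ (r , _)) = contradiction (subst P₂ (N.+-identityʳ m) p , q , r) ntp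
    all-errors : ℕ -> ℚ
    all-errors N = 3ℚ * errors N + 2ℚ * (U * U * Γ * weight (\_ -> 0ℚ) 1)
    per-N : ∀ N M1 M2 -> (∀ m -> M1 ≦ m -> m N.< M2 -> ¬ (P₂ m × P₂ (m N.+ 2) × P₂ (m N.+ 6))) -> R · R ≦ N -> M1 N.+ 6 ≦ N -> N N.+ (N N.+ 7) ≦ M2 ->
     3ℚ * (inv (φ W) * main-count N) ≤ 2ℚ * (ι (N N.+ 7) * inv W * (v̄ * (v̄ * (v̄ * γ3)))) + all-errors N
    per-N N M1 M2 none RR≤N M1≤N ≤M2 = ≤by ((s0 - (c0 - errors N)) + (s₂ - (c0 - errors N)) + (s6 - (c0 - errors N)) + (2ℚ * S - (s0 + s₂ + s6)) + 2ℚ * (ιL * wd + ε0 - S) + 2ℚ * (ιL * G - ιL * wd))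
      (0≤+ (0≤+ (0≤+ (0≤+ (0≤+ (diff b0) (diff b2)) (diff b6)) (diff two)) (0≤* 0≤2 (diff (all-sum n0 (lo N) (N N.+ 7))))) (0≤* 0≤2 (diff (*-monoˡ ιL (0≤* (0≤ι (N N.+ 7)) (0≤inv W)) diagonal-≤))))
      (id123 c0 (errors N) s0 s₂ s6 S ιL wd ε0 G) where
     6≤N : 6 ≦ N
     6≤N = ≦-trans (m≤n+m 6 M1) M1≤N
     R≤N : R ≦ N
     R≤N = ≦-trans (m≤m*n R R {{>-nonZero (<⇒≤ 1<R)}}) RR≤N
     rg = range (lo N) (lo N N.+ (N N.+ 7))
     c0 = inv (φ W) * main-count N
     ιL = ι (N N.+ 7) * inv W
     wd = wsum P (\p -> 3ℚ * inv p) (\m -> y m * y m)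
     ε0 = U * U * Γ * weight (\_ -> 0ℚ) 1
     G = v̄ * (v̄ * (v̄ * γ3))
     S = ∑ rg w
     s0 = ∑ rg (\m -> hit N (m N.+ 0) * w m)
     s₂ = ∑ rg (\m -> hit N (m N.+ 2) * w m)
     s6 = ∑ rg (\m -> hit N (m N.+ 6) * w m)
     b0 : c0 - errors N ≤ s0
     b0 = Shifted.bound 0 2 6 z≤n (m≤m+n 3 3) N.≤-refl (λ ()) (λ ()) (inj₁ refl) (\x -> id115 (x 0) (x 2) (x 6)) N RR≤N R≤N 6≤N
     b2 : c0 - errors N ≤ s₂
     b2 = Shifted.bound 2 0 6 (m≤m+n 2 4) N.z<s N.≤-refl (λ ()) (λ ()) (inj₂ (inj₁ refl)) (\x -> id116 (x 0) (x 2) (x 6)) N RR≤N R≤N 6≤N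
     b6 : c0 - errors N ≤ s6
     b6 = Shifted.bound 6 0 2 N.≤-refl N.z<s (m≤m+n 2 4) (λ ()) (λ ()) (inj₂ (inj₂ refl)) (\x -> id117 (x 0) (x 2) (x 6)) N RR≤N R≤N 6≤N
     two : s0 + s₂ + s6 ≤ 2ℚ * S
     two = ≡≤ (trans (cong (_+ s6) (sym (∑-+ rg (\m -> hit N (m N.+ 0) * w m) (\m -> hit N (m N.+ 2) * w m)))) (sym (∑-+ rg (\m -> hit N (m N.+ 0) * w m + hit N (m N.+ 2) * w m) (\m -> hit N (m N.+ 6) * w m))))
      (≤≡ (∑-mono∈ rg (\m m∈ -> ≡≤ (id118 (hit N (m N.+ 0)) (hit N (m N.+ 2)) (hit N (m N.+ 6)) (w m)) (*-monoʳ (w m) (0≤w m) (at-most-two N m (none m (≦-trans (≡≤ℕ (sym (m+n∸n≡m M1 6)) (∸-monoˡ-≤ 6 M1≤N)) (proj₁ (∈-range⁻ {lo N} {lo N N.+ (N N.+ 7)} m∈))) (<-≤-trans (proj₂ (∈-range⁻ {lo N} {lo N N.+ (N N.+ 7)} m∈)) (≦-trans (N.+-monoˡ-≤ (N N.+ 7) (m∸n≤m N 6)) ≤M2)))))))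
      (∑-*ˡ rg 2ℚ w))

module Average where

 open Identities
 open Field
 open Sums
 open Cheb using (primes; isPrime⇒; isPrime-true)
 open Mertens using (mertens; inv1)
 open Smooth using (1≤prime)
 open Setup using (bin; bin-lb; bin-ub)
 open Counts using (divℕ-≤; divℕ-<)
 open Sift using (∑-subrange)
 open import Defs using (range; isPrimeᵇ; πflat; divℕ)
 open import Data.Bool using (T)
 open Rationals

 inv-pred-sq : ∀ a -> 1 ≦ a -> inv a - inv (suc a) ≤ inv a * inv a
 inv-pred-sq a h = ≡≤ (trans (trans (id138 (inv a) (inv (suc a))) (cong₂ (\u v -> u * inv a - v * inv (suc a)) (sym (*-inv (suc a) N.z<s)) (sym (*-inv a h)))) (trans (cong (\z -> z * inv (suc a) * inv a - ι a * inv a * inv (suc a)) (trans (ι-+ 1 a) (cong (_+ ι a) (ι-def 1)))) (id139 (ι a) (inv a) (inv (suc a)))))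
  (*-monoˡ (inv a) (0≤inv a) (inv-anti h (n≤1+n a)))

 ∑-inv²-≥ : ∀ a k -> 1 ≦ a -> inv a - inv (a N.+ k) ≤ ∑ (range a (a N.+ k)) (\N -> inv N * inv N)
 ∑-inv²-≥ a zero h = ≡≤ (trans (cong (\z -> inv a - inv z) (N.+-identityʳ a)) (+-inverseʳ (inv a))) (∑-nonneg (range a (a N.+ 0)) (\N -> 0≤sq (inv N)))
 ∑-inv²-≥ a (suc k) h = ≡≤ (trans (cong (\z -> inv a - inv z) (+-suc a k)) (id140 (inv a) (inv (a N.+ k)) (inv (suc (a N.+ k)))))
  (≤≡ (+-mono (∑-inv²-≥ a k h) (inv-pred-sq (a N.+ k) (≦-trans h (m≤m+n a k)))) (sym (trans (cong (\z -> ∑ (range a z) (\N -> inv N * inv N)) (+-suc a k)) (∑-range-last a (a N.+ k) (\N -> inv N * inv N) (m≤m+n a k)))))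

 ∑-support : ∀ c d a b (f : ℕ -> ℚ) -> (∀ m -> 0ℚ ≤ f m) -> a ≦ b -> (∀ m -> m N.< a ⊎ b ≦ m -> f m ≡ 0ℚ) -> ∑ (range c d) f ≤ ∑ (range a b) f
 ∑-support c d a b f hf a≤b h0 = ≤≡ le (trans (∑-range-split 0 a (d N.+ b) f z≤n (≦-trans a≤b (m≤n+m b d))) (trans (cong₂ _+_ z1 (trans (∑-range-split a b (d N.+ b) f a≤b (m≤n+m b d)) (cong (∑ (range a b) f +_) z2))) (id60 (∑ (range a b) f)))) where
  z1 : ∑ (range 0 a) f ≡ 0ℚ
  z1 = trans (∑-cong∈ (range 0 a) (\m m∈ -> h0 m (inj₁ (proj₂ (∈-range⁻ {0} {a} m∈))))) (∑-0 (range 0 a))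
  z2 : ∑ (range b (d N.+ b)) f ≡ 0ℚ
  z2 = trans (∑-cong∈ (range b (d N.+ b)) (\m m∈ -> h0 m (inj₂ (proj₁ (∈-range⁻ {b} {d N.+ b} m∈))))) (∑-0 (range b (d N.+ b)))
  le : ∑ (range c d) f ≤ ∑ (range 0 (d N.+ b)) f
  le with ≤-total c d
  ... | inj₁ c≤d = ∑-subrange c d 0 (d N.+ b) f hf z≤n c≤d (m≤m+n d b)
  ... | inj₂ d≤c = ≡≤ (cong (\l -> ∑ (Data.List.map (c N.+_) (Data.List.upTo l)) f) (m≤n⇒m∸n≡0 d≤c)) (∑-nonneg (range 0 (d N.+ b)) hf)

 between : ℕ -> ℕ -> Bool
 between N m = (N <ᵇ m) ∧ (m <ᵇ 2 · N)

 between-true : ∀ {N m} -> N N.< m -> m N.< 2 · N -> between N m ≡ true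
 between-true {N} {m} h1 h2 = cong₂ _∧_ (tr N m h1) (tr m (2 · N) h2) where
  tr : ∀ x y -> x N.< y -> (x <ᵇ y) ≡ true
  tr x y h with x <ᵇ y | <⇒<ᵇ h
  ... | true | _ = refl

 between-⇒ : ∀ N m -> between N m ≡ true -> N N.< m × m N.< 2 · N
 between-⇒ N m h with N <ᵇ m in e1 | m <ᵇ 2 · N in e2
 ... | true | true = <ᵇ⇒< N m (subst T (sym e1) tt) , <ᵇ⇒< m (2 · N) (subst T (sym e2) tt)

 ρ : ℕ -> ℚ
 ρ c = 1ℚ - inv c

 0≤ρ : ∀ c -> 1 ≦ c -> 0ℚ ≤ ρ c
 0≤ρ c h = diff (≤≡ (inv-anti {1} {c} N.z<s h) inv1)

 window : ∀ X0 X1 m c -> 1 ≦ c -> 4 · c ≦ X0 -> 2 · X0 ≦ m -> m ≦ X1 -> ρ c * inv m ≤ ∑ (range X0 X1) (\N -> inv N * inv N * ind (between N m))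
 window X0 X1 m c 1≤c hX hm hX1 = ≤-trans key (≤-trans (subst (\z -> inv a - inv z ≤ ∑ (range a z) (\N -> inv N * inv N)) (m+[n∸m]≡n a≤m) (∑-inv²-≥ a (m ∸ a) N.z<s))
  (≡≤ (∑-cong∈ (range a m) one) (∑-subrange a m X0 X1 G (\N -> 0≤* (0≤sq (inv N)) (0≤ind (between N m))) X0≤a a≤m hX1))) where
  a = suc (m N./ 2)
  G : ℕ -> ℚ
  G N = inv N * inv N * ind (between N m)
  m<2a : m N.< 2 · a
  m<2a = divℕ-< m 2 N.z<s
  2a≤ : 2 · a ≦ m N.+ 2
  2a≤ = ≡≤ℕ (trans (*-suc 2 (m N./ 2)) (+-comm 2 (2 · (m N./ 2)))) (N.+-monoˡ-≤ 2 (divℕ-≤ m 2 N.z<s))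
  X0≤a : X0 ≦ a
  X0≤a = <⇒≤ (*-cancelˡ-< 2 X0 a (≤-<-trans hm m<2a))
  4≤X0 : 4 ≦ X0
  4≤X0 = ≦-trans (*-monoʳ-≤ 4 1≤c) hX
  X0≤m : X0 ≦ m
  X0≤m = ≦-trans (m≤m+n X0 (X0 N.+ 0)) hm
  a≤m : a ≦ m
  a≤m = *-cancelˡ-≤ 2 (≦-trans 2a≤ (≤≡ℕ (N.+-monoʳ-≤ m (≦-trans (≦-trans (s≤s N.z<s) 4≤X0) X0≤m)) (cong (m N.+_) (sym (N.+-identityʳ m)))))
  1≤m : 1 ≦ m
  1≤m = ≦-trans N.z<s a≤m
  one : ∀ N -> N ∈ range a m -> inv N * inv N ≡ G N
  one N N∈ = sym (trans (cong (\t -> inv N * inv N * ind t) (between-true (proj₂ (∈-range⁻ {a} {m} N∈)) (<-≤-trans m<2a (*-monoʳ-≤ 2 (proj₁ (∈-range⁻ {a} {m} N∈)))))) (*-idʳ (inv N * inv N)))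
  x = inv m
  y = inv (m N.+ 2)
  z = inv c
  4ℚ = (1ℚ + 1ℚ) + (1ℚ + 1ℚ)
  y≤ : 4ℚ * y ≤ z
  y≤ = ≤≡ (*-monoˡ 4ℚ (0≤+ (0≤+ 0≤1 0≤1) (0≤+ 0≤1 0≤1)) (≤≡ (inv-anti (≦-trans 1≤c (m≤n*m c 4)) (≦-trans hX (≦-trans X0≤m (m≤m+n m 2)))) (inv-* 4 c)))
   (trans (sym (*-assoc 4ℚ (inv 4) z)) (trans (cong (_* z) (trans (cong (_* inv 4) (sym (ι-def 4))) (*-inv 4 N.z<s))) (*-idˡ z)))
  2y≤ : (1ℚ + 1ℚ) * y ≤ inv a
  2y≤ = ≤≡ (*-monoˡ (1ℚ + 1ℚ) (0≤+ 0≤1 0≤1) (inv-anti N.z<s 2a≤)) (trans (cong ((1ℚ + 1ℚ) *_) (inv-* 2 a)) (trans (sym (*-assoc (1ℚ + 1ℚ) (inv 2) (inv a))) (trans (cong (_* inv a) (trans (cong (_* inv 2) (sym (ι-def 2))) (*-inv 2 N.z<s))) (*-idˡ (inv a)))))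
  y≡ : x - (1ℚ + 1ℚ) * (x * y) ≡ y
  y≡ = trans (cong (_- (1ℚ + 1ℚ) * (x * y)) (trans (sym (*-idʳ x)) (cong (x *_) (sym (*-inv (m N.+ 2) (m≤n⇒m≤n+o 2 1≤m)))))) (trans (cong (\s -> x * (s * y) - (1ℚ + 1ℚ) * (x * y)) (trans (ι-+ m 2) (cong (ι m +_) (ι-def 2)))) (trans (id134 (ι m) x y) (trans (cong (_* y) (*-inv m 1≤m)) (*-idˡ y))))
  key : ρ c * x ≤ inv a - x
  key = ≤by (x * (z - 4ℚ * y) + (inv a - (1ℚ + 1ℚ) * y)) (0≤+ (0≤* (0≤inv m) (diff y≤)) (diff 2y≤)) (trans (id135 z x y (inv a)) (trans (cong (\s -> inv a + (1ℚ + 1ℚ) * s - (1ℚ + 1ℚ) * y - x) y≡) (id136 (inv a) x y)))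

 module Harmonic (B c : ℕ) (2≤B : 2 ≦ B) (1≤c : 1 ≦ c) (c-B : 2 ^ (14 · c) ≦ B) where
  private
   instance
    nzB : N.NonZero B
    nzB = >-nonZero (<⇒≤ 2≤B)
   up : ∀ {i j} -> i ≦ j -> suc (B ^ i) ≦ suc (B ^ j)
   up h = s≤s (^-monoʳ-≤ B h)
  pow-blocks : ∀ i k f -> ∑ (range i (i N.+ k)) (\l -> ∑ (range (suc (B ^ l)) (suc (B ^ suc l))) f) ≡ ∑ (range (suc (B ^ i)) (suc (B ^ (i N.+ k)))) f
  pow-blocks i zero f = subst (\z -> ∑ (range i z) (\l -> ∑ (range (suc (B ^ l)) (suc (B ^ suc l))) f) ≡ ∑ (range (suc (B ^ i)) (suc (B ^ z))) f) (sym (N.+-identityʳ i))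
   (trans (cong (\l -> ∑ l (\l -> ∑ (range (suc (B ^ l)) (suc (B ^ suc l))) f)) (range-[] i)) (sym (cong (\l -> ∑ l f) (range-[] (suc (B ^ i))))))
  pow-blocks i (suc k) f = subst (\z -> ∑ (range i z) (\l -> ∑ (range (suc (B ^ l)) (suc (B ^ suc l))) f) ≡ ∑ (range (suc (B ^ i)) (suc (B ^ z))) f) (sym (+-suc i k))
   (trans (∑-range-last i (i N.+ k) (\l -> ∑ (range (suc (B ^ l)) (suc (B ^ suc l))) f) (m≤m+n i k)) (trans (cong (_+ ∑ (range (suc (B ^ (i N.+ k))) (suc (B ^ suc (i N.+ k)))) f) (pow-blocks i k f))
    (sym (∑-range-split (suc (B ^ i)) (suc (B ^ (i N.+ k))) (suc (B ^ suc (i N.+ k))) f (up (m≤m+n i k)) (up (n≤1+n (i N.+ k)))))))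
  block : ∀ i -> ρ c * inv (suc i) ≤ ∑ (range (suc (B ^ i)) (suc (B ^ suc i))) (\m -> ind (isPrimeᵇ m) * inv m)
  block i = *-cancel (ι (suc i) * ι c) (subst (0ℚ ℚ.<_) (ι-* (suc i) c) (0<ι (*-mono-≤ {1} {suc i} N.z<s 1≤c)))
   (≡≤ (trans (id137 (ι (suc i)) (ι c) (inv (suc i)) (inv c)) (trans (cong₂ (\u v -> u * (ι c - v)) (*-inv (suc i) N.z<s) (*-inv c 1≤c)) (*-idˡ (ι c - 1ℚ))))
   (≤≡ (mertens B c i 1≤c c-B) (cong (ι (suc i) * ι c *_) (∑-filter isPrimeᵇ (range (suc (B ^ i)) (suc (B ^ suc i))) inv))))
  prime-harmonic : ∀ i k -> ρ c * ∑ (range i (i N.+ k)) (\l -> inv (suc l)) ≤ ∑ (range (suc (B ^ i)) (suc (B ^ (i N.+ k)))) (\m -> ind (isPrimeᵇ m) * inv m)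
  prime-harmonic i k = ≡≤ (sym (∑-*ˡ (range i (i N.+ k)) (ρ c) (\l -> inv (suc l)))) (≤≡ (∑-mono (range i (i N.+ k)) block) (pow-blocks i k (\m -> ind (isPrimeᵇ m) * inv m)))
  module _ (X0 X1 : ℕ) (hX : 4 · c ≦ X0) where
   count-average : ∀ (C : ℕ -> ℚ) s i k -> 1 ≦ s -> (∀ q -> q ∈ range (suc (B ^ i)) (suc (B ^ (i N.+ k))) -> 2 · X0 ≦ s · q × s · q ≦ X1) ->
    (∀ N -> N ∈ range X0 X1 -> ∑ (range (suc (B ^ i)) (suc (B ^ (i N.+ k)))) (\q -> ind (isPrimeᵇ q) * ind (between N (s · q))) ≤ C N) ->
    ρ c * ρ c * inv s * ∑ (range i (i N.+ k)) (\l -> inv (suc l)) ≤ ∑ (range X0 X1) (\N -> inv N * inv N * C N)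
   count-average C s i k 1≤s hq hC = ≤-trans (≡≤ (id132 (ρ c) (inv s) (∑ (range i (i N.+ k)) (\l -> inv (suc l)))) (*-monoˡ (ρ c * inv s) (0≤* (0≤ρ c 1≤c) (0≤inv s)) (prime-harmonic i k)))
    (≡≤ (sym (∑-*ˡ qs (ρ c * inv s) (\q -> ind (isPrimeᵇ q) * inv q))) (≤-trans (∑-mono∈ qs (\q q∈ -> ≡≤ (trans (id133 (ρ c) (inv s) (ind (isPrimeᵇ q)) (inv q)) (cong (\z -> ind (isPrimeᵇ q) * (ρ c * z)) (sym (inv-* s q))))
     (*-monoˡ (ind (isPrimeᵇ q)) (0≤ind (isPrimeᵇ q)) (window X0 X1 (s · q) c 1≤c hX (proj₁ (hq q q∈)) (proj₂ (hq q q∈))))))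
    (≡≤ (trans (∑-cong qs (\q -> trans (sym (∑-*ˡ Ns (ind (isPrimeᵇ q)) (\N -> inv N * inv N * ind (between N (s · q))))) (∑-cong Ns (\N -> id50 (ind (isPrimeᵇ q)) (inv N * inv N) (ind (between N (s · q)))))))
     (trans (∑-swap qs Ns (\q N -> inv N * inv N * (ind (isPrimeᵇ q) * ind (between N (s · q))))) (∑-cong Ns (\N -> ∑-*ˡ qs (inv N * inv N) (\q -> ind (isPrimeᵇ q) * ind (between N (s · q)))))))
    (∑-mono∈ Ns (\N N∈ -> *-monoˡ (inv N * inv N) (0≤sq (inv N)) (hC N N∈)))))) where
    qs = range (suc (B ^ i)) (suc (B ^ (i N.+ k)))
    Ns = range X0 X1

 count-between : ∀ N s a b qs qe -> a ≦ b -> (∀ q -> N N.< s · q -> s · q N.< 2 · N -> a ≦ q × q N.< b) ->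
  ∑ (range qs qe) (\q -> ind (isPrimeᵇ q) * ind (between N (s · q))) ≤ ι (length (filterᵇ isPrimeᵇ (range a b)))
 count-between N s a b qs qe a≤b h = ≤-trans (∑-support qs qe a b f (\q -> 0≤* (0≤ind (isPrimeᵇ q)) (0≤ind (between N (s · q)))) a≤b out)
  (≤≡ (∑-mono (range a b) (\q -> ≤≡ (*-monoˡ (ind (isPrimeᵇ q)) (0≤ind (isPrimeᵇ q)) (ind≤1 (between N (s · q)))) (*-idʳ (ind (isPrimeᵇ q))))) (sym (count≡∑ isPrimeᵇ (range a b)))) where
  f : ℕ -> ℚ
  f q = ind (isPrimeᵇ q) * ind (between N (s · q))
  out : ∀ q -> q N.< a ⊎ b ≦ q -> f q ≡ 0ℚ
  out q o with between N (s · q) in e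
  ... | false = *-zeroʳ (ind (isPrimeᵇ q))
  ... | true with h q (proj₁ (between-⇒ N (s · q) e)) (proj₂ (between-⇒ N (s · q) e)) | o
  ... | lo , hi | inj₁ lt = contradiction (<-≤-trans lt lo) (<-irrefl refl)
  ... | lo , hi | inj₂ le = contradiction (<-≤-trans hi le) (<-irrefl refl)

module Averages where

 open Identities
 open Field
 open Sums
 open Cheb using (primes; isPrime⇒; ∈-primes⁻)
 open Smooth using (1≤prime)
 open Setup using (bin; bin-lb; bin-ub)
 open Counts using (divℕ-≤; divℕ-<; divℕ-mono)
 open Sift using (∑-subrange)
 open Average
 open import Defs using (range; isPrimeᵇ; πflat; divℕ)
 open Rationals

 module Averaged (D B n k c : ℕ) (2≤B : 2 ≦ B) (D≤B : D ≦ B) (2≤n : 2 ≦ n) (1≤c : 1 ≦ c) (c-B : 2 ^ (14 · c) ≦ B) (θ : ℕ -> ℚ) (0≤θ : ∀ l -> 0ℚ ≤ θ l) where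
  open Harmonic B c 2≤B 1≤c c-B
  private
   instance
    nzB : N.NonZero B
    nzB = >-nonZero (<⇒≤ 2≤B)
   R = B ^ n
   M = 2 · n N.+ 1 N.+ k
   X0 = B ^ (2 · n N.+ 1)
   X1 = B ^ M
   P = primes (suc D) R
   Ns = range X0 X1
  factor : ℕ -> ℕ -> Bool
  factor N p = N ^ 1 <ᵇ p ^ M
  cofs : ℕ -> ℕ -> List ℕ
  cofs N p = filterᵇ isPrimeᵇ (range (suc (divℕ N p)) (suc (divℕ (2 · N) p)))
  count-main : ℕ -> ℚ
  count-main N = ι (πflat N) * θ n + ∑ P (\p -> ind (factor N p) * (ι (length (cofs N p)) * θ (bin B n 2≤B p)))
  recip : ℕ -> ℕ -> ℚ
  recip i k = ∑ (range i (i N.+ k)) (\l -> inv (suc l))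
  Θ = recip (2 · n N.+ 2) (k ∸ 1) * θ n + ∑ (range 1 n) (\l -> θ l * (inv (suc l) * recip (2 · n N.+ 2 ∸ l) (k ∸ 2)))
  module _ (2≤k : 2 ≦ k) (4c≤X0 : 4 · c ≦ X0) where
   private
    ρ0 = ρ c
    0≤ρ0 : 0ℚ ≤ ρ0
    0≤ρ0 = 0≤ρ c 1≤c
    2X0≤ : ∀ i m -> suc (B ^ i) ≦ m -> 2 · n N.+ 2 ≦ i -> 2 · X0 ≦ m
    2X0≤ i m h h2 = ≦-trans (*-monoˡ-≤ X0 2≤B) (≡≤ℕ (cong (B N.^_) (sym (+-suc (2 · n) 1))) (≦-trans (^-monoʳ-≤ B h2) (<⇒≤ h)))
    prime-part : ρ0 * ρ0 * recip (2 · n N.+ 2) (k ∸ 1) ≤ ∑ Ns (\N -> inv N * inv N * ι (πflat N))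
    prime-part = ≡≤ (cong (_* recip i (k ∸ 1)) (trans (sym (*-idʳ (ρ0 * ρ0))) (cong (ρ0 * ρ0 *_) (trans (trans (sym (*-inv 1 N.z<s)) (cong (_* inv 1) (ι-def 1))) (*-idˡ (inv 1))))))
     (count-average X0 X1 4c≤X0 (\N -> ι (πflat N)) 1 i (k ∸ 1) N.z<s
      (\q q∈ -> subst (\z -> 2 · X0 ≦ z × z ≦ X1) (sym (N.*-identityˡ q)) (2X0≤ i q (proj₁ (∈-range⁻ {suc (B ^ i)} {suc (B ^ (i N.+ (k ∸ 1)))} q∈)) N.≤-refl ,
       ≤≡ℕ (≤-pred (proj₂ (∈-range⁻ {suc (B ^ i)} {suc (B ^ (i N.+ (k ∸ 1)))} q∈))) (cong (B N.^_) exp)))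
      (\N _ -> count-between N 1 N (2 · N) (suc (B ^ i)) (suc (B ^ (i N.+ (k ∸ 1)))) (m≤m+n N (N N.+ 0)) (\q lo hi -> <⇒≤ (<-≤-trans lo (N.≤-reflexive (N.*-identityˡ q))) , ≤-<-trans (N.≤-reflexive (sym (N.*-identityˡ q))) hi))) where
     i = 2 · n N.+ 2
     exp : i N.+ (k ∸ 1) ≡ M
     exp = trans (id142 (2 · n) (k ∸ 1)) (cong (\z -> 2 · n N.+ 1 N.+ z) (m+[n∸m]≡n (<⇒≤ 2≤k)))
    -- the prime p contributes in the l-th interval
    module Block (l : ℕ) (1≤l : 1 ≦ l) (l<n : l N.< n) where
     i = 2 · n N.+ 2 ∸ l
     l≤ : l ≦ 2 · n N.+ 2
     l≤ = ≦-trans (<⇒≤ l<n) (≦-trans (m≤m+n n (n N.+ 0)) (m≤m+n (2 · n) 2))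
     part : ∀ p -> B ^ l N.< p -> p ≦ B ^ suc l -> ρ0 * ρ0 * inv p * recip i (k ∸ 2) ≤ ∑ Ns (\N -> inv N * inv N * (ind (factor N p) * ι (length (cofs N p))))
     part p lo hi = count-average X0 X1 4c≤X0 (\N -> ind (factor N p) * ι (length (cofs N p))) p i (k ∸ 2) 1≤p
      (\q q∈ -> 2X0≤ (l N.+ i) (p · q) (≦-trans (s≤s (N.≤-reflexive (^-distribˡ-+-* B l i))) (*-mono-< lo (lo' q q∈))) (N.≤-reflexive (sym (m+[n∸m]≡n l≤))) ,
       ≤≡ℕ (*-mono-≤ hi (≤-pred (proj₂ (∈-range⁻ {suc (B ^ i)} {suc (B ^ (i N.+ (k ∸ 2)))} q∈)))) (trans (sym (^-distribˡ-+-* B (suc l) (i N.+ (k ∸ 2)))) (cong (B N.^_) exp)))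
      (\N N∈ -> ≤≡ (count-between N p (suc (divℕ N p)) (suc (divℕ (2 · N) p)) (suc (B ^ i)) (suc (B ^ (i N.+ (k ∸ 2)))) (s≤s (divℕ-mono p (m≤m+n N (N N.+ 0)))) (\q lo hi ->
        *-cancelˡ-< p (divℕ N p) q (≤-<-trans (divℕ-≤ N p 1≤p) lo) , *-cancelˡ-< p q (suc (divℕ (2 · N) p)) (<-trans hi (divℕ-< (2 · N) p 1≤p))))
       (trans (sym (*-idˡ (ι (length (cofs N p))))) (cong (\t -> ind t * ι (length (cofs N p))) (sym (big N (proj₂ (∈-range⁻ {X0} {X1} N∈))))))) where
      lo' : ∀ q -> q ∈ range (suc (B ^ i)) (suc (B ^ (i N.+ (k ∸ 2)))) -> B ^ i N.< q
      lo' q q∈ = proj₁ (∈-range⁻ {suc (B ^ i)} {suc (B ^ (i N.+ (k ∸ 2)))} q∈)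
      1≤p : 1 ≦ p
      1≤p = ≦-trans N.z<s lo
      B≤p : B ≦ p
      B≤p = ≡≤ℕ (sym (^-identityʳ B)) (≦-trans (^-monoʳ-≤ B 1≤l) (<⇒≤ lo))
      big : ∀ N -> N N.< X1 -> factor N p ≡ true
      big N lt with N ^ 1 <ᵇ p ^ M | <⇒<ᵇ (≤-<-trans (N.≤-reflexive (^-identityʳ N)) (<-≤-trans lt (^-monoˡ-≤ M B≤p)))
      ... | true | _ = refl
      exp : suc l N.+ (i N.+ (k ∸ 2)) ≡ M
      exp = trans (cong suc (sym (+-assoc l i (k ∸ 2)))) (trans (cong (\z -> suc (z N.+ (k ∸ 2))) (m+[n∸m]≡n l≤)) (trans (id141 (2 · n) (k ∸ 2)) (cong (\z -> 2 · n N.+ 1 N.+ z) (m+[n∸m]≡n 2≤k))))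
    f : ℕ -> ℚ
    f p = θ (bin B n 2≤B p) * ∑ Ns (\N -> inv N * inv N * (ind (factor N p) * ι (length (cofs N p))))
    0≤f : ∀ p -> 0ℚ ≤ f p
    0≤f p = 0≤* (0≤θ (bin B n 2≤B p)) (∑-nonneg Ns (\N -> 0≤* (0≤sq (inv N)) (0≤* (0≤ind (factor N p)) (0≤ι (length (cofs N p))))))
    composite : ∀ l -> 1 ≦ l -> isPrimeᵇ (B ^ suc l) ≡ false
    composite l 1≤l with isPrimeᵇ (B ^ suc l) in e
    ... | false = refl
    ... | true with prime⇒irreducible (isPrime⇒ (B ^ suc l) e) (m∣m*n {B} (B ^ l))
    ... | inj₁ h = contradiction (subst (2 N.≤_) h 2≤B) (λ { (s≤s ()) })
    ... | inj₂ h = contradiction (≤≡ℕ (subst (_≦ B ^ l) (^-identityʳ B) (^-monoʳ-≤ B 1≤l)) (*-cancelˡ-≡ (B ^ l) 1 B (trans (sym h) (sym (N.*-identityʳ B))))) (\h -> <-irrefl refl (<-≤-trans 2≤B h))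
    G : ℕ -> ℚ
    G p = ind (isPrimeᵇ p) * f p
    0≤G : ∀ p -> 0ℚ ≤ G p
    0≤G p = 0≤* (0≤ind (isPrimeᵇ p)) (0≤f p)
    block-sum : ∀ l -> l ∈ range 1 n -> ρ0 * ρ0 * ρ0 * (θ l * (inv (suc l) * recip (2 · n N.+ 2 ∸ l) (k ∸ 2))) ≤ ∑ (range (suc (B ^ l)) (suc (B ^ suc l))) G
    block-sum l l∈ = ≡≤ (id144 ρ0 (θ l) (inv (suc l)) hs) (≤-trans (*-monoˡ K 0≤K (block l)) (≡≤ (sym (∑-*ˡ rg K (\m -> ind (isPrimeᵇ m) * inv m))) (∑-mono∈ rg pt))) where
     1≤l : 1 ≦ l
     1≤l = proj₁ (∈-range⁻ {1} {n} l∈)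
     l<n : l N.< n
     l<n = proj₂ (∈-range⁻ {1} {n} l∈)
     hs = recip (2 · n N.+ 2 ∸ l) (k ∸ 2)
     K = θ l * (ρ0 * ρ0 * hs)
     rg = range (suc (B ^ l)) (suc (B ^ suc l))
     0≤K : 0ℚ ≤ K
     0≤K = 0≤* (0≤θ l) (0≤* (0≤* 0≤ρ0 0≤ρ0) (∑-nonneg (range (2 · n N.+ 2 ∸ l) (2 · n N.+ 2 ∸ l N.+ (k ∸ 2))) (\i -> 0≤inv (suc i))))
     pt : ∀ p -> p ∈ rg -> K * (ind (isPrimeᵇ p) * inv p) ≤ G p
     pt p p∈ with isPrimeᵇ p in e
     ... | false = ≡⇒≤ (id143 K (inv p) (f p))
     ... | true = ≡≤ (id145 (θ l) ρ0 hs (inv p)) (*-monoˡ 1ℚ 0≤1 (≤≡ (*-monoˡ (θ l) (0≤θ l) (Block.part l 1≤l l<n p lo hi)) (cong (\z -> θ z * ∑ Ns (\N -> inv N * inv N * (ind (factor N p) * ι (length (cofs N p))))) (sym binp)))) where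
      lo : B ^ l N.< p
      lo = proj₁ (∈-range⁻ {suc (B ^ l)} {suc (B ^ suc l)} p∈)
      hi : p ≦ B ^ suc l
      hi = ≤-pred (proj₂ (∈-range⁻ {suc (B ^ l)} {suc (B ^ suc l)} p∈))
      hi' : p N.< B ^ suc l
      hi' = ≤∧≢⇒< hi (\eq -> contradiction (trans (sym e) (trans (cong isPrimeᵇ eq) (composite l 1≤l))) (λ ()))
      binp : bin B n 2≤B p ≡ l
      binp = ≤-antisym (bin-ub B n 2≤B l p (≦-trans N.z<s lo) hi') (bin-lb B n 2≤B l p (<⇒≤ l<n) (<⇒≤ lo))
    n' = n ∸ 1
    n≡ : 1 N.+ n' ≡ n
    n≡ = m+[n∸m]≡n (<⇒≤ 2≤n)
    last : G R ≡ 0ℚ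
    last = trans (cong (\t -> ind t * f R) (subst (\z -> isPrimeᵇ (B ^ z) ≡ false) n≡ (composite n' (≤-pred (subst (2 N.≤_) (sym n≡) 2≤n))))) (*-zeroˡ (f R))
    factor-part : ρ0 * ρ0 * ρ0 * ∑ (range 1 n) (\l -> θ l * (inv (suc l) * recip (2 · n N.+ 2 ∸ l) (k ∸ 2))) ≤ ∑ P f
    factor-part = ≡≤ (sym (∑-*ˡ (range 1 n) (ρ0 * ρ0 * ρ0) (\l -> θ l * (inv (suc l) * recip (2 · n N.+ 2 ∸ l) (k ∸ 2))))) (≤-trans (∑-mono∈ (range 1 n) block-sum)
     (≡≤ (trans (subst (\z -> ∑ (range 1 z) (\l -> ∑ (range (suc (B ^ l)) (suc (B ^ suc l))) G) ≡ ∑ (range (suc (B ^ 1)) (suc (B ^ z))) G) n≡ (pow-blocks 1 n' G))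
      (trans (∑-range-last (suc (B ^ 1)) R G B<R) (trans (cong (∑ (range (suc (B ^ 1)) R) G +_) last) (+-idʳ (∑ (range (suc (B ^ 1)) R) G)))))
     (≤≡ (∑-subrange (suc (B ^ 1)) R (suc D) R G 0≤G (s≤s (≤≡ℕ D≤B (sym (^-identityʳ B)))) B<R N.≤-refl) (sym (∑-filter isPrimeᵇ (range (suc D) R) f))))) where
     B<R : B ^ 1 N.< R
     B<R = <-≤-trans (^-monoʳ-< B 2≤B (N.≤-refl {2})) (^-monoʳ-≤ B 2≤n)
    total : ∑ Ns (\N -> inv N * inv N * count-main N) ≡ θ n * ∑ Ns (\N -> inv N * inv N * ι (πflat N)) + ∑ P f
    total = trans (∑-cong Ns (\N -> trans (*-distribˡ-+ (inv N * inv N) (ι (πflat N) * θ n) (inner N)) (cong₂ _+_ (id146 (inv N * inv N) (ι (πflat N)) (θ n)) (trans (sym (∑-*ˡ P (inv N * inv N) (\p -> ind (factor N p) * (ι (length (cofs N p)) * θ (bin B n 2≤B p)))))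
      (∑-cong P (\p -> id147 (inv N * inv N) (ind (factor N p)) (ι (length (cofs N p))) (θ (bin B n 2≤B p))))))))
     (trans (∑-+ Ns (\N -> θ n * (inv N * inv N * ι (πflat N))) (\N -> ∑ P (\p -> θ (bin B n 2≤B p) * (inv N * inv N * (ind (factor N p) * ι (length (cofs N p)))))))
     (cong₂ _+_ (∑-*ˡ Ns (θ n) (\N -> inv N * inv N * ι (πflat N))) (trans (∑-swap Ns P (\N p -> θ (bin B n 2≤B p) * (inv N * inv N * (ind (factor N p) * ι (length (cofs N p))))))
      (∑-cong P (\p -> ∑-*ˡ Ns (θ (bin B n 2≤B p)) (\N -> inv N * inv N * (ind (factor N p) * ι (length (cofs N p))))))))) where
     inner : ℕ -> ℚ
     inner N = ∑ P (\p -> ind (factor N p) * (ι (length (cofs N p)) * θ (bin B n 2≤B p)))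
   average-≥ : ρ c * ρ c * ρ c * Θ ≤ ∑ (range X0 X1) (\N -> inv N * inv N * count-main N)
   average-≥ = ≤-trans (≤by (θ n * (inv c * (ρ0 * ρ0 * h₀))) (0≤* (0≤θ n) (0≤* (0≤inv c) (0≤* (0≤* 0≤ρ0 0≤ρ0) (∑-nonneg (range (2 · n N.+ 2) (2 · n N.+ 2 N.+ (k ∸ 1))) (\i -> 0≤inv (suc i)))))) (id148 (inv c) h₀ (θ n) s0))
    (≤≡ (+-mono (*-monoˡ (θ n) (0≤θ n) prime-part) factor-part) (sym total)) where
    h₀ = recip (2 · n N.+ 2) (k ∸ 1)
    s0 = ∑ (range 1 n) (\l -> θ l * (inv (suc l) * recip (2 · n N.+ 2 ∸ l) (k ∸ 2)))

module Errors where

 open Identities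
 open Field
 open Sums
 open Forms
 open Sieve using (∏)
 open Smooth using (1≤prime)
 open PBound
 open Phi
 open Mertens using (2Q; 0≤2Q)
 open BVErr
 open Counts
 open Sift using (class-count)
 open import Defs as D' using (range; isPrimeᵇ; count; coprimeᵇ; congᵇ; φ; toℚ; divQ; divℕ; moduli; maxRes; πflat; πflatAP; βᵇ; πβq; πβAP; BVsumP; BVsumE₂)
 open Rationals

 1≤φ : ∀ q -> 1 ≦ q -> 1 ≦ φ q
 1≤φ q h = ι-cancel (≤≡ (≡≤ (trans (ι-def 1) (cong ind (sym (⇒coprimeᵇ 1 q (λ { (d , _) -> ℕ∣.∣1⇒≡1 d }))))) (∑-≥-term {xs = range 1 (suc q)} {f = \a -> ind (coprimeᵇ a q)} (\a _ -> 0≤ind (coprimeᵇ a q)) (∈-range⁺ {1} {suc q} N.≤-refl (s≤s h)))) (sym (count≡∑ (\a -> coprimeᵇ a q) (range 1 (suc q)))))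

 count-≤ : ∀ (t : ℕ -> Bool) a b -> count t (range a b) ≦ b ∸ a
 count-≤ t a b = ι-cancel (≡≤ (count≡∑ t (range a b)) (≤≡ (∑-mono (range a b) (\x -> ind≤1 (t x))) (trans (∑-const (range a b) 1ℚ) (trans (*-idʳ (ι (length (range a b)))) (cong ι (length-range a b))))))

 φ≤ : ∀ q -> φ q ≦ q
 φ≤ q = count-≤ (\a -> coprimeᵇ a q) 1 (suc q)

 module Trivial (N q a : ℕ) (1≤q : 1 ≦ q) (q≤N : q ≦ N) where
  private
   iφ = inv (φ q)
  class-≤ : ∀ (t : ℕ -> Bool) lo -> ι (count (\m -> t m ∧ congᵇ q m a) (range lo (lo N.+ N))) ≤ 2ℚ * ι N * iφ
  class-≤ t lo = ≡≤ (count≡∑ (\m -> t m ∧ congᵇ q m a) (range lo (lo N.+ N))) (≤-trans (∑-mono (range lo (lo N.+ N)) (\m -> le m (t m)))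
   (≤-trans (abs≤⇒ub (class-count q a 1≤q lo N)) (≤-trans (+-monoʳ-≤ (ι N * inv q) one) (≡≤ (id156 (ι N) (inv q)) (*-monoˡ (2ℚ * ι N) (0≤* 0≤2 (0≤ι N)) (inv-anti (1≤φ q 1≤q) (φ≤ q))))))) where
   le : ∀ m b -> ind (b ∧ congᵇ q m a) ≤ ind (congᵇ q m a)
   le m true = ≤-refl
   le m false = 0≤ind (congᵇ q m a)
   one : 1ℚ ≤ ι N * inv q
   one = ≡≤ (sym (*-inv q 1≤q)) (*-monoʳ (inv q) (0≤inv q) (ι-mono q≤N))
  bound : ∀ x y -> ι x ≤ 2ℚ * ι N * iφ -> y ≦ N -> ∣ toℚ x - divQ (toℚ y) (φ q) ∣ ≤ 3ℚ * ι N * iφ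
  bound x y hx hy = subst (\z -> ∣ z ∣ ≤ 3ℚ * ι N * iφ) (sym (cong₂ _-_ (sym (ι-def x)) (trans (divQ≡ (toℚ y) (φ q)) (cong (_* iφ) (sym (ι-def y))))))
   (abs≤ (≤by (ι x + (ι N * iφ - ι y * iφ) + 2ℚ * ι N * iφ) (0≤+ (0≤+ (0≤ι x) (diff le)) (0≤* (0≤* 0≤2 (0≤ι N)) (0≤inv (φ q)))) (id157 (ι x) (ι N) iφ (ι y * iφ)))
    (≤by ((2ℚ * ι N * iφ - ι x) + ι y * iφ + ι N * iφ) (0≤+ (0≤+ (diff hx) (0≤* (0≤ι y) (0≤inv (φ q)))) (0≤* (0≤ι N) (0≤inv (φ q)))) (id158 (ι x) (ι N) iφ (ι y * iφ)))) where
   le : ι y * iφ ≤ ι N * iφ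
   le = *-monoʳ iφ (0≤inv (φ q)) (ι-mono hy)

 maxRes≤ : ∀ q (f : ℕ -> ℚ) c -> 0ℚ ≤ c -> (∀ a -> f a ≤ c) -> maxRes q f ≤ c
 maxRes≤ q f c hc h = maxQ≤ (filterᵇ (\a -> coprimeᵇ a q) (upTo q)) {f} {c} hc (\a _ -> h a)

 ∑inv≤∏ : ∀ P -> 1ℚ + ∑ P inv ≤ ∏ P h1
 ∑inv≤∏ [] = ≡⇒≤ (+-idʳ 1ℚ)
 ∑inv≤∏ (p ∷ P) = ≤-trans (≤by (inv p * ∑ P inv) (0≤* (0≤inv p) (∑-nonneg P 0≤inv)) (id159 (inv p) (∑ P inv))) (*-monoˡ (h1 p) (0≤+ 0≤1 (0≤inv p)) (∑inv≤∏ P))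

 module Bound (D n k : ℕ) (7≤D : 7 ≦ D) (1≤n : 1 ≦ n) (b : ℕ) (F : ℕ -> ℕ) (F-anti : ∀ {i j} -> i ≦ j -> F j ≦ F i) (F-0 : ∀ {i} -> n ≦ i -> F i ≡ 0) where
  open Level D n k 7≤D 1≤n b F F-anti F-0
  δᴾ δᵝ : ℕ -> ℕ -> ℕ -> ℚ
  δᴾ N q a = ∣ toℚ (πflatAP N q a) - divQ (toℚ (πflat N)) (φ q) ∣
  δᵝ N q a = ∣ toℚ (πβAP 1 M N q a) - divQ (toℚ (πβq 1 M N q)) (φ q) ∣
  Eᴾ Eᵝ : ℕ -> ℕ -> ℚ
  Eᴾ N q = maxRes q (δᴾ N q)
  Eᵝ N q = maxRes q (δᵝ N q)
  errorSum : ℕ -> ℚ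
  errorSum N = 3ℚ * (U * U * Γ * weight (Eᴾ N) 1 + (U * U * Γ * weight (Eᵝ N) 1 + ∑ P (\p -> ind (N ^ 1 <ᵇ p ^ M) * (3ℚ * (U * U * Γ * weight (Eᴾ (suc (divℕ N p))) p))))) + 2ℚ * (U * U * Γ * weight (\_ -> 0ℚ) 1)
  A = 4 · κ6 N.+ ((4 · (κ6 N.+ κ162)) N.+ 5) N.+ 5
  K : ℕ -> ℚ
  K C = pow G0 κ6 * ι C + 3ℚ * pow G0 (κ6 N.+ κ162) + 2ℚ * pow G0 (κ6 N.+ κ9) * ι (proj₁ (^≤2^ (4 · (κ6 N.+ κ9) N.+ 5)))
  0≤K : ∀ C -> 0ℚ ≤ K C
  0≤K C = 0≤+ (0≤+ (0≤* (pow-nonneg κ6 0≤G0) (0≤ι C)) (0≤* 0≤3 (pow-nonneg (κ6 N.+ κ162) 0≤G0))) (0≤* (0≤* 0≤2 (pow-nonneg (κ6 N.+ κ9) 0≤G0)) (0≤ι _))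
  K∞ : ℕ -> ℕ -> ℚ
  K∞ C C' = 3ℚ * (U * U * K C + (U * U * K C' + 2ℚ * 3ℚ * (U * U * K C) * G0)) + 2ℚ * (U * U * K 0)
  module _ (b≥W : W ≦ 2 ^ b) (b≥D : D ≦ 2 ^ b) (2≤b : 2 ≦ b) (C C' : ℕ)
   (hP : ∀ N -> 2 ^ b ≦ N -> BVsumP 1 (2 · M) N * toℚ (⌊log₂ N ⌋ ^ A) ≤ toℚ (C · N))
   (hβ : ∀ N -> 2 ^ b ≦ N -> BVsumE₂ 1 M 1 (2 · M) N * toℚ (⌊log₂ N ⌋ ^ A) ≤ toℚ (C' · N)) where
   private
    instance
     nzB : N.NonZero B
     nzB = >-nonZero (<⇒≤ 2≤B)
    i5 = inv (b ^ 5)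
    i1 = inv (b ^ 1)
    P-weight : ∀ {N s} -> Range N s -> Γ * weight (Eᴾ N) s ≤ K C * ι N * i5
    P-weight {N} {s} rg = estimate b≥W b≥D 2≤b rg (Eᴾ N) 5 C (\q -> 0≤maxRes q (δᴾ N q))
     (\q 1≤q q≤N -> maxRes≤ q (δᴾ N q) (3ℚ * ι N * inv (φ q)) (0≤* (0≤* 0≤3 (0≤ι N)) (0≤inv (φ q))) (\a -> Trivial.bound N q a 1≤q q≤N (πflatAP N q a) (πflat N)
      (subst (\z -> ι (count (\p -> isPrimeᵇ p ∧ congᵇ q p a) (range N z)) ≤ 2ℚ * ι N * inv (φ q)) (id153 N) (Trivial.class-≤ N q a 1≤q q≤N isPrimeᵇ N))
      (≤≡ℕ (count-≤ isPrimeᵇ N (2 · N)) (trans (cong (_∸ N) (sym (id153 N))) (m+n∸m≡n N N)))))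
     (≡≤ (sym (sumQ≡∑ (moduli 1 (2 · M) N) (Eᴾ N))) (saving⇒ b≥W b≥D 2≤b rg (BVsumP 1 (2 · M)) A C (hP N (Range.log rg)) (≤≡ (∑-nonneg (moduli 1 (2 · M) N) (\q -> 0≤maxRes q (δᴾ N q))) (sym (sumQ≡∑ (moduli 1 (2 · M) N) (Eᴾ N))))))
    β-weight : ∀ {N s} -> Range N s -> Γ * weight (Eᵝ N) s ≤ K C' * ι N * i5
    β-weight {N} {s} rg = estimate b≥W b≥D 2≤b rg (Eᵝ N) 5 C' (\q -> 0≤maxRes q (δᵝ N q))
     (\q 1≤q q≤N -> maxRes≤ q (δᵝ N q) (3ℚ * ι N * inv (φ q)) (0≤* (0≤* 0≤3 (0≤ι N)) (0≤inv (φ q))) (\a -> Trivial.bound N q a 1≤q q≤N (πβAP 1 M N q a) (πβq 1 M N q)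
      (subst (\z -> ι (count (\m -> βᵇ 1 M N m ∧ congᵇ q m a) (range (suc N) z)) ≤ 2ℚ * ι N * inv (φ q)) (id154 N) (Trivial.class-≤ N q a 1≤q q≤N (βᵇ 1 M N) (suc N)))
      (≤≡ℕ (count-≤ (\m -> βᵇ 1 M N m ∧ coprimeᵇ m q) (suc N) (suc (2 · N))) (trans (cong (_∸ suc N) (sym (id154 N))) (m+n∸m≡n (suc N) N)))))
     (≡≤ (sym (sumQ≡∑ (moduli 1 (2 · M) N) (Eᵝ N))) (saving⇒ b≥W b≥D 2≤b rg (BVsumE₂ 1 M 1 (2 · M)) A C' (hβ N (Range.log rg)) (≤≡ (∑-nonneg (moduli 1 (2 · M) N) (\q -> 0≤maxRes q (δᵝ N q))) (sym (sumQ≡∑ (moduli 1 (2 · M) N) (Eᵝ N))))))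
    0-weight : ∀ {N s} -> Range N s -> Γ * weight (\_ -> 0ℚ) s ≤ K 0 * ι N * i5
    0-weight {N} {s} rg = estimate b≥W b≥D 2≤b rg (\_ -> 0ℚ) 5 0 (\_ -> ≤-refl) (\q _ _ -> 0≤* (0≤* 0≤3 (0≤ι N)) (0≤inv (φ q)))
     (≡≤ (∑-0 (moduli 1 (2 · M) N)) (0≤* (0≤* (0≤ι 0) (0≤ι N)) (0≤inv (b ^ A))))
    2^b≤B : 2 ^ b ≦ B
    2^b≤B = m≤n*m (2 ^ b) W {{>-nonZero 1≤W}}
   module At-N (N : ℕ) (lo : B · (R · R) ≦ N) (hi : N N.< B ^ M) where
    private
     1≤R : 1 ≦ R
     1≤R = <⇒≤ 1<R
     BR≤N : B · R ≦ N
     BR≤N = ≦-trans (*-monoʳ-≤ B (m≤m*n R R {{>-nonZero 1≤R}})) lo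
     B≤N : B ≦ N
     B≤N = ≦-trans (m≤m*n B R {{>-nonZero 1≤R}}) BR≤N
     R≤N : R ≦ N
     R≤N = ≦-trans (m≤n*m R B) BR≤N
     rg1 : Range N 1
     rg1 = record { 1≤s = N.≤-refl ; large = ≤≡ℕ lo (sym (N.*-identityʳ N)) ; upper = <⇒≤ hi ; log = ≦-trans 2^b≤B B≤N }
     N1 : ℕ -> ℕ
     N1 p = suc (divℕ N p)
     rgₚ : ∀ p -> p ∈ P -> Range (N1 p) p
     rgₚ p p∈ = record { 1≤s = 1≤p ; large = ≦-trans lo (≤≡ℕ (<⇒≤ big) (*-comm p (N1 p))) ; upper = ≦-trans (s≤s (≦-trans (m≤n*m (divℕ N p) p {{>-nonZero 1≤p}}) (divℕ-≤ N p 1≤p))) hi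
      ; log = ≦-trans 2^b≤B (*-cancelʳ-≤ B (N1 p) R {{>-nonZero 1≤R}} (≦-trans BR≤N (≦-trans (<⇒≤ big) (≤≡ℕ (*-monoˡ-≤ (N1 p) (<⇒≤ (P<R p p∈))) (*-comm R (N1 p)))))) } where
      1≤p : 1 ≦ p
      1≤p = 1≤prime (prP p p∈)
      big : N N.< p · N1 p
      big = divℕ-< N p 1≤p
     N1≤ : ∀ p -> p ∈ P -> ι (N1 p) ≤ 2ℚ * ι N * inv p
     N1≤ p p∈ = ≤≡ (≤inv p 1≤p (≡≤ (sym (ι-* p (N1 p))) (≤≡ (ι-mono (≡≤ℕ (*-suc p (divℕ N p)) (+-mono-≤ (≦-trans (<⇒≤ (P<R p p∈)) R≤N) (divℕ-≤ N p 1≤p)))) (ι-+ N N)))) (id149 (inv p) (ι N)) where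
      1≤p : 1 ≦ p
      1≤p = 1≤prime (prP p p∈)
     u = U * U
     0≤u : 0ℚ ≤ u
     0≤u = 0≤* 0≤U 0≤U
     scale : ∀ {w x} -> Γ * w ≤ x -> u * Γ * w ≤ u * x
     scale {w} {x} h = ≡≤ (*-assoc u Γ w) (*-monoˡ u 0≤u h)
     i5≤i1 : i5 ≤ i1
     i5≤i1 = inv-anti (m^n>0 b {{>-nonZero (<⇒≤ 2≤b)}} 1) (^-monoʳ-≤ b {{>-nonZero (<⇒≤ 2≤b)}} {1} {5} N.z<s)
     ∑inv≤ : ∑ P inv ≤ G0 * ι (b ^ 4)
     ∑inv≤ = ≤-trans (≤by 1ℚ 0≤1 (ℚ.+-comm (∑ P inv) 1ℚ)) (≤-trans (∑inv≤∏ P) (≡≤ (sym (*-idʳ h)) (≤≡ (h≤ b≥W b≥D 2≤b 1) (cong (_* ι (b ^ 4)) (*-idʳ G0)))))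
     single : ∀ {w} C -> Γ * w ≤ K C * ι N * i5 -> u * Γ * w ≤ u * K C * ι N * i1
     single {w} C h = ≤-trans (scale h) (≡≤ (id150 u (K C) (ι N) i5) (*-monoˡ (u * K C * ι N) (0≤* (0≤* 0≤u (0≤K C)) (0≤ι N)) i5≤i1))
     T = 2ℚ * 3ℚ * (u * K C)
     0≤T : 0ℚ ≤ T
     0≤T = 0≤* (0≤* (0≤+ 0≤1 0≤1) 0≤3) (0≤* 0≤u (0≤K C))
     term : ∀ p -> p ∈ P -> ind (N ^ 1 <ᵇ p ^ M) * (3ℚ * (u * Γ * weight (Eᴾ (N1 p)) p)) ≤ T * ι N * i5 * inv p
     term p p∈ = ≤-trans (*-monoˡ (ind (N ^ 1 <ᵇ p ^ M)) (0≤ind (N ^ 1 <ᵇ p ^ M)) (≤≡ (*-monoˡ 3ℚ 0≤3 (≤-trans (scale (P-weight (rgₚ p p∈))) (*-monoˡ u 0≤u (*-monoʳ i5 (0≤inv (b ^ 5)) (*-monoˡ (K C) (0≤K C) (N1≤ p p∈)))))) (id151 u (K C) (ι N) (inv p) i5)))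
      (≤≡ (*-monoʳ (T * ι N * i5 * inv p) (0≤* (0≤* (0≤* 0≤T (0≤ι N)) (0≤inv (b ^ 5))) (0≤inv p)) (ind≤1 (N ^ 1 <ᵇ p ^ M))) (*-idˡ (T * ι N * i5 * inv p)))
     factors : ∑ P (\p -> ind (N ^ 1 <ᵇ p ^ M) * (3ℚ * (u * Γ * weight (Eᴾ (N1 p)) p))) ≤ T * G0 * ι N * i1
     factors = ≤-trans (∑-mono∈ P term) (≡≤ (∑-*ˡ P (T * ι N * i5) inv) (≤≡ (*-monoˡ (T * ι N * i5) (0≤* (0≤* 0≤T (0≤ι N)) (0≤inv (b ^ 5))) ∑inv≤)
      (trans (id152 T (ι N) i5 G0 (ι (b ^ 4))) (cong (T * G0 * ι N *_) (cancel-pow b≥W b≥D 2≤b rg1 4 1)))))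
    errorSum-≤ : errorSum N ≤ K∞ C C' * ι N * inv (b ^ 1)
    errorSum-≤ = ≤≡ (+-mono (*-monoˡ 3ℚ 0≤3 (+-mono (single C (P-weight rg1)) (+-mono (single C' (β-weight rg1)) factors))) (*-monoˡ 2ℚ 0≤2 (single 0 (0-weight rg1))))
     (id155 (u * K C) (u * K C') (T * G0) (u * K 0) (ι N) i1)

module Endgame where

 open Identities
 open Field
 open Sums
 open Forms using (0≤2; 0≤3; 2ℚ; 3ℚ)
 open Phi
 open Mertens using (2Q; 0≤2Q)
 open Bins using (hsum; hsum-nonneg; hsum-mono; hsum-scale-≤)
 open Average using (ρ; 0≤ρ)
 open Averages
 open Errors
 open Combine
 open BVErr
 open import Defs using (range; φ; toℚ; BVsumP; BVsumE₂; P₂)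
 open Rationals

 module Limits (n k : ℕ) (F : ℕ -> ℕ) where
  tail : ℕ -> ℕ -> ℚ
  tail l s = ∑ (range 0 n) (\i -> ι (F (i N.+ s N.+ 2) ∸ F (i N.+ s N.+ l)))
  α∞ : ℕ -> ℚ
  α∞ l = ∑ (range 0 n) (\i -> ∑ (range 0 n) (\j -> tail l (i N.+ j) * tail l (i N.+ j)))
  γ∞ = ∑ (range 0 n) (\h -> ∑ (range 0 n) (\i -> ∑ (range 0 n) (\j -> ι (F (h N.+ (i N.+ j))) * ι (F (h N.+ (i N.+ j))))))
  top = ∑ (range (2 · n N.+ 2) (2 · n N.+ 2 N.+ (k ∸ 1))) (\l -> inv (suc l))
  coef : ℕ -> ℚ
  coef l = inv (suc l) * ∑ (range (2 · n N.+ 2 ∸ l) (2 · n N.+ 2 ∸ l N.+ (k ∸ 2))) (\j -> inv (suc j))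
  mix : (ℕ -> ℚ) -> ℚ
  mix θ = top * θ n + ∑ (range 1 n) (\l -> θ l * coef l)
  0≤coef : ∀ l -> 0ℚ ≤ coef l
  0≤coef l = 0≤* (0≤inv (suc l)) (∑-nonneg (range (2 · n N.+ 2 ∸ l) (2 · n N.+ 2 ∸ l N.+ (k ∸ 2))) (\j -> 0≤inv (suc j)))
  mix-mono : ∀ {θ η : ℕ -> ℚ} -> (∀ l -> θ l ≤ η l) -> mix θ ≤ mix η
  mix-mono h = +-mono (*-monoˡ top (∑-nonneg (range (2 · n N.+ 2) (2 · n N.+ 2 N.+ (k ∸ 1))) (\l -> 0≤inv (suc l))) (h n)) (∑-mono (range 1 n) (\l -> *-monoʳ (coef l) (0≤coef l) (h l)))
  mix-* : ∀ x (θ : ℕ -> ℚ) -> mix (\l -> x * θ l) ≡ x * mix θ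
  mix-* x θ = trans (cong₂ _+_ (id50 top x (θ n)) (trans (∑-cong (range 1 n) (\l -> *-assoc x (θ l) (coef l))) (∑-*ˡ (range 1 n) x (\l -> θ l * coef l)))) (sym (*-distribˡ-+ x (top * θ n) (∑ (range 1 n) (\l -> θ l * coef l))))
  mix-- : ∀ (θ η : ℕ -> ℚ) -> mix (\l -> θ l - η l) ≡ mix θ - mix η
  mix-- θ η = trans (cong (top * (θ n - η n) +_) (trans (∑-cong (range 1 n) (\l -> id178 (θ l) (η l) (coef l))) (∑-- (range 1 n) (\l -> θ l * coef l) (\l -> η l * coef l)))) (id179 top (θ n) (η n) (∑ (range 1 n) (\l -> θ l * coef l)) (∑ (range 1 n) (\l -> η l * coef l)))
  -- δ = 1/c is the relative error of all asymptotic statements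
  module Tolerance (c : ℕ) where
   σ = 1ℚ + inv c
   ω = 2ℚ * (ρ c * ρ c * ρ c) - σ * σ
   gain = 3ℚ * (ρ c * ρ c * ρ c * mix (\l -> ω * α∞ l - 2ℚ))
   cost = ι k * (2ℚ * (σ * σ * σ * σ) * γ∞ + 1ℚ)

 module Contradiction (D n k c m : ℕ) (7≤D : 7 ≦ D) (2≤n : 2 ≦ n) (2≤k : 2 ≦ k) (1≤c : 1 ≦ c) (F : ℕ -> ℕ) (F-anti : ∀ {i j} -> i ≦ j -> F j ≦ F i) (F-0 : ∀ {i} -> n ≦ i -> F i ≡ 0)
  (D≥1 : 8 · n · c ≦ D) (D≥2 : 232 · (n · n · n · n · (F 0 · F 0)) ≦ D)
  (win : Limits.Tolerance.cost n k F c ℚ.< Limits.Tolerance.gain n k F c) (b : ℕ) where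
  private
   1≤n : 1 ≦ n
   1≤n = <⇒≤ 2≤n
  open Local D n k 7≤D 1≤n b F F-anti F-0 renaming (c to cW)
  open Limits n k F
  open Tolerance c
  private module Er = Bound D n k 7≤D 1≤n b F F-anti F-0
  module _ (C C' : ℕ) (K≤ : Er.K∞ C C' ≤ ι m) (b≥W : W ≦ 2 ^ b) (b≥D : D ≦ 2 ^ b) (b≥m : m · W ≦ b) (b≥c : 14 · c ≦ b) (hℓ : ι (2 · c · (W N.+ 2) · W) ≤ ℓ)
   (hP : ∀ N -> 2 ^ b ≦ N -> BVsumP 1 (2 · M) N * toℚ (⌊log₂ N ⌋ ^ Er.A) ≤ toℚ (C · N))
   (hβ : ∀ N -> 2 ^ b ≦ N -> BVsumE₂ 1 M 1 (2 · M) N * toℚ (⌊log₂ N ⌋ ^ Er.A) ≤ toℚ (C' · N))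
   (W' : ℕ) (W≡ : W ≡ 2 · W') (odd : 2 ∤ W') where
   private
    instance
     nzB : N.NonZero B
     nzB = >-nonZero (<⇒≤ 2≤B)
    δ = inv c
    L = cW * ℓ
    v = ρ c * L
    v̄ = σ * L
    Z = ι n * v̄
    iφ = inv (φ W)
    iW = inv W
    0≤δ : 0ℚ ≤ δ
    0≤δ = 0≤inv c
    δ≤1 : δ ≤ 1ℚ
    δ≤1 = undiff (0≤ρ c 1≤c)
    0≤σ : 0ℚ ≤ σ
    0≤σ = 0≤+ 0≤1 0≤δ
    σ≤2 : σ ≤ 2ℚ
    σ≤2 = +-monoʳ-≤ 1ℚ δ≤1
    0≤ℓ : 0ℚ ≤ ℓ
    0≤ℓ = hsum-nonneg 1 B
    0≤L : 0ℚ ≤ L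
    0≤L = 0≤* 0≤c 0≤ℓ
    0≤v̄ : 0ℚ ≤ v̄
    0≤v̄ = 0≤* 0≤σ 0≤L
    c≡ : cW ≡ ι (φ W) * iW
    c≡ = cong (_* iW) (sym (φ≡Φ W))
    ιcδ : ι c * δ ≡ 1ℚ
    ιcδ = *-inv c 1≤c
    ℓ-lb : 2ℚ * ι c * (ι W + 2ℚ) * ι W ≤ ℓ
    ℓ-lb = ≡≤ (sym (trans (ι-* (2 · c · (W N.+ 2)) W) (cong (_* ι W) (trans (ι-* (2 · c) (W N.+ 2)) (cong₂ _*_ (trans (ι-* 2 c) (cong (_* ι c) (ι-def 2))) (trans (ι-+ W 2) (cong (ι W +_) (ι-def 2)))))))) hℓ
    ιW≥1 : 1ℚ ≤ ι W
    ιW≥1 = ≡≤ (sym (ι-def 1)) (ι-mono 1≤W)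
    iW≤c : iW ≤ cW
    iW≤c = ≡≤ (sym (*-idˡ iW)) (≤≡ (*-monoʳ iW (0≤inv W) (≡≤ (sym (ι-def 1)) (ι-mono (1≤φ W 1≤W)))) (sym c≡))
    L-lb : 2ℚ * ι c * (ι W + 2ℚ) ≤ L
    L-lb = ≡≤ (trans (sym (*-idˡ x)) (trans (cong (_* x) (sym (*-inv W 1≤W))) (id161 (ι W) iW x))) (*-mono (0≤inv W) 0≤ℓ iW≤c ℓ-lb) where
     x = 2ℚ * ι c * (ι W + 2ℚ)
    δL-lb : 2ℚ * (ι W + 2ℚ) ≤ δ * L
    δL-lb = ≡≤ (trans (sym (*-idˡ _)) (trans (cong (_* (2ℚ * (ι W + 2ℚ))) (sym ιcδ)) (id162 (ι c) δ (ι W + 2ℚ)))) (*-monoˡ δ 0≤δ L-lb)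
    δℓ-lb : 2ℚ * (ι W + 2ℚ) ≤ δ * ℓ
    δℓ-lb = ≤-trans (≤by (x * (ι W - 1ℚ)) (0≤* 0≤x (diff ιW≥1)) (id163 x (ι W))) (≡≤ (trans (sym (*-idˡ _)) (trans (cong (_* (x * ι W)) (sym ιcδ)) (id164 (ι c) δ (ι W + 2ℚ) (ι W)))) (*-monoˡ δ 0≤δ ℓ-lb)) where
     x = 2ℚ * (ι W + 2ℚ)
     0≤x : 0ℚ ≤ x
     0≤x = 0≤* 0≤2 (0≤+ (0≤ι W) 0≤2)
    max≤ : binMax ≤ v̄
    max≤ = ≤by ((δ * L - 2ℚ * (ι W + 2ℚ)) + (ι W + 2ℚ * 2ℚ)) (0≤+ (diff δL-lb) (0≤+ (0≤ι W) (0≤* 0≤2 0≤2))) (id165 δ L (ι W))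
    ≤v̄ : ∀ i -> i N.< n -> V i ≤ v̄
    ≤v̄ i lt = ≤-trans (V≤ i lt) max≤
    εn : εP * (ι n * 2ℚ) ≤ inv 2 * δ
    εn = ≤-trans (*-monoʳ (ι n * 2ℚ) (0≤* (0≤ι n) 0≤2) εP≤) (≡≤ (id166 (inv D) (ι n)) (≤≡ (*-monoˡ (2ℚ * 2ℚ * ι n) (0≤* (0≤* (0≤+ 0≤1 0≤1) (0≤+ 0≤1 0≤1)) (0≤ι n)) (inv-anti 1≤8nc D≥1))
     (trans (cong (\z -> 2ℚ * 2ℚ * ι n * z) (trans (inv-* (8 · n) c) (cong (_* δ) (trans (inv-* 8 n) (cong (_* inv n) (trans (inv-* 2 4) (cong (inv 2 *_) (inv-* 2 2))))))))
      (trans (id167 (ι n) (inv n) (inv 2) δ) (trans (cong₂ (\x y -> x * x * y * (inv 2 * δ)) (trans (cong (_* inv 2) (sym (ι-def 2))) (*-inv 2 N.z<s)) (*-inv n 1≤n)) (*-idˡ (inv 2 * δ))))))) where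
     1≤8nc : 1 ≦ 8 · n · c
     1≤8nc = *-mono-≤ {1} {8 · n} {1} {c} (≦-trans 1≤n (m≤n*m n 8)) 1≤c
    8ℚ = toℚ 8
    half : inv 2 + inv 2 ≡ 1ℚ
    half = trans (id168 (inv 2)) (trans (cong (_* inv 2) (sym (ι-def 2))) (*-inv 2 N.z<s))
    v≤ : ∀ i -> i N.< n -> v ≤ V i
    v≤ i lt = ≤-trans (≤by (e1 * L + (cW * (inv 2 * e2) + εP * ι n * e3)) (0≤+ (0≤* (diff εn) 0≤L) (0≤+ (0≤* 0≤c (0≤* (0≤inv 2) (diff δℓ-lb))) (0≤* (0≤* 0≤ε (0≤ι n)) (diff (≤-trans max≤ (*-monoʳ L 0≤L σ≤2))))))
      (trans (id169 (inv 2) δ cW ℓ (ι W) εP (ι n) binMax) (trans (cong (\h -> (1ℚ - δ) * (cW * ℓ) + (h * δ * (cW * ℓ) - cW * (h * (ι W + 2ℚ)) - εP * (ι n * binMax))) half) (id170 δ cW ℓ (ι W) (εP * (ι n * binMax)))))) (V≥ i lt) where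
     e1 = inv 2 * δ - εP * (ι n * 2ℚ)
     e2 = δ * ℓ - 2ℚ * (ι W + 2ℚ)
     e3 = 2ℚ * L - binMax
     0≤ε : 0ℚ ≤ εP
     0≤ε = ∑-nonneg P (\p -> 0≤sq (inv p))
    wsum≤ : ι n * binMax ≤ Z
    wsum≤ = *-monoˡ (ι n) (0≤ι n) max≤
   open Numbers v v̄ (0≤* (0≤ρ c 1≤c) 0≤L) 0≤v̄ v≤ ≤v̄ L 0≤L Z (0≤* (0≤ι n) 0≤v̄) (≤-trans wsum-below wsum≤)
   open Residue W' W≡ odd
   private
    L² = L * L
    L³ = L * L²
    L⁴ = L * L³
    0≤L³ : 0ℚ ≤ L³
    0≤L³ = 0≤* 0≤L (0≤* 0≤L 0≤L)
    0≤L⁴ : 0ℚ ≤ L⁴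
    0≤L⁴ = 0≤* 0≤L 0≤L³
    F₀ = ι (F 0)
    nn = ι n * ι n * ι n * ι n * (F₀ * F₀)
    big : 8ℚ * (ι 29 * nn) ≤ ι D
    big = ≡≤ (sym (trans (ι-* 232 (n · n · n · n · (F 0 · F 0))) (trans (cong₂ _*_ (ι-* 8 29) (trans (ι-* (n · n · n · n) (F 0 · F 0)) (cong₂ _*_ (trans (ι-* (n · n · n) n) (cong (_* ι n) (trans (ι-* (n · n) n) (cong (_* ι n) (ι-* n n))))) (ι-* (F 0) (F 0))))) (trans (*-assoc (ι 8) (ι 29) nn) (cong (_* (ι 29 * nn)) (ι-def 8)))))) (ι-mono D≥2)
    loss≤ : loss ≤ L⁴
    loss≤ = ≤-trans (≤by (pre * (8ℚ - σ * (σ * σ))) (0≤* 0≤pre (diff (*-mono 0≤σ (0≤* 0≤2 0≤2) σ≤2 (*-mono 0≤σ 0≤2 σ≤2 σ≤2)))) (id171 L (ι n) F₀ (ι 29) (inv D) σ))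
     (≤≡ (*-monoˡ L⁴ 0≤L⁴ (≤≡ (*-monoʳ (inv D) (0≤inv D) big) (*-inv D (≦-trans N.z<s 7≤D)))) (*-idʳ L⁴)) where
     pre = L⁴ * (ι 29 * nn * inv D)
     0≤pre : 0ℚ ≤ pre
     0≤pre = 0≤* 0≤L⁴ (0≤* (0≤* (0≤ι 29) (0≤* (0≤* (0≤* (0≤* (0≤ι n) (0≤ι n)) (0≤ι n)) (0≤ι n)) (0≤* (0≤ι (F 0)) (0≤ι (F 0))))) (0≤inv D))
    Q-lb : ∀ l -> L⁴ * (ω * α∞ l - 2ℚ) ≤ θ l
    Q-lb l = ≤-trans (≤by (2ℚ * (L⁴ - loss)) (0≤* 0≤2 (diff loss≤)) (id172 (ρ c) σ L (α∞ l) loss)) (ℚ.p≤p⊔q (Q l) 0ℚ)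
    D≤B : D ≦ B
    D≤B = ≦-trans b≥D (m≤n*m (2 ^ b) W {{>-nonZero 1≤W}})
    b≤B : b ≦ B
    b≤B = ≦-trans (<⇒≤ (n<2^n b)) (m≤n*m (2 ^ b) W {{>-nonZero 1≤W}})
    c-B : 2 ^ (14 · c) ≦ B
    c-B = ≦-trans (^-monoʳ-≤ 2 b≥c) (m≤n*m (2 ^ b) W {{>-nonZero 1≤W}})
    2≤b : 2 ≦ b
    2≤b = ≦-trans (≦-trans (m≤m+n 2 12) (m≤m*n 14 c {{>-nonZero 1≤c}})) b≥c
    open Averaged D B n k c 2≤B D≤B 2≤n 1≤c c-B θ 0≤θ
    X0 = B ^ (2 · n N.+ 1)
    X1 = B ^ M
    X0≡ : X0 ≡ B · (R · R)
    X0≡ = trans (cong (B N.^_) (+-comm (2 · n) 1)) (cong (B N.*_) (trans (cong (\z -> B ^ (n N.+ z)) (N.+-identityʳ n)) (^-distribˡ-+-* B n n)))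
    B≤X0 : B ≦ X0
    B≤X0 = ≡≤ℕ (sym (^-identityʳ B)) (^-monoʳ-≤ B (m≤n+m 1 (2 · n)))
    7c≤X0 : 7 · c ≦ X0
    7c≤X0 = ≦-trans (*-monoˡ-≤ c (m≤m+n 7 7)) (≦-trans b≥c (≦-trans b≤B B≤X0))
    harmonic-≤ : ∀ e j -> ∑ (range (B ^ e) (B ^ (e N.+ j))) inv ≤ ι j * ℓ
    harmonic-≤ e zero = ≡≤ (cong (\l -> ∑ l inv) (trans (cong (\z -> range (B ^ e) (B ^ z)) (N.+-identityʳ e)) (range-[] (B ^ e)))) (0≤* (0≤ι 0) 0≤ℓ)
    harmonic-≤ e (suc j) = ≡≤ (trans (cong (\z -> ∑ (range (B ^ e) (B ^ z)) inv) (+-suc e j)) (∑-range-split (B ^ e) a (B ^ suc (e N.+ j)) inv (^-monoʳ-≤ B (m≤m+n e j)) (^-monoʳ-≤ B (n≤1+n (e N.+ j)))))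
     (≤≡ (+-mono (harmonic-≤ e j) (subst (\z -> hsum a z ≤ ℓ) (*-comm a B) (hsum-scale-≤ a B (m^n>0 B (e N.+ j)) (<⇒≤ 2≤B)))) (sym (trans (cong (_* ℓ) (trans (ι-+ 1 j) (cong (_+ ι j) (ι-def 1)))) (id173 (ι j) ℓ)))) where
     a = B ^ (e N.+ j)
    W≤ℓ : ι W ≤ ℓ
    W≤ℓ = ≤-trans (ι-mono (m≤n*m W (2 · c · (W N.+ 2)) {{>-nonZero (*-mono-≤ {1} {2 · c} {1} {W N.+ 2} (≦-trans 1≤c (m≤n*m c 2)) (≦-trans 1≤W (m≤m+n W 2)))}})) hℓ
    1≤ℓ : 1ℚ ≤ ℓ
    1≤ℓ = ≤-trans ιW≥1 W≤ℓ
    1≤L : 1ℚ ≤ L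
    1≤L = ≡≤ (sym (trans (ℚ.*-comm iW (ι W)) (*-inv W 1≤W))) (*-mono (0≤inv W) 0≤ℓ iW≤c W≤ℓ)
    1≤* : ∀ {x y} -> 1ℚ ≤ x -> 1ℚ ≤ y -> 1ℚ ≤ x * y
    1≤* h1 h2 = ≡≤ (sym (*-idˡ 1ℚ)) (*-mono 0≤1 (≤-trans 0≤1 h2) h1 h2)
    1≤L³ : 1ℚ ≤ L³
    1≤L³ = 1≤* 1≤L (1≤* 1≤L 1≤L)
    G = v̄ * (v̄ * (v̄ * γ∞))
    K = Er.K∞ C C'
    E = K * inv (b ^ 1)
    E≤ : E ≤ iW * L³
    E≤ = ≤-trans (*-monoʳ (inv (b ^ 1)) (0≤inv (b ^ 1)) K≤) (≡≤ (cong (\z -> ι m * inv z) (^-identityʳ b)) (≤-trans mb (≡≤ (sym (*-idʳ iW)) (*-monoˡ iW (0≤inv W) 1≤L³)))) where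
     mb : ι m * inv b ≤ iW
     mb = ≤≡ (≤inv W 1≤W (≡≤ (trans (sym (*-assoc (ι W) (ι m) (inv b))) (cong (_* inv b) (trans (ℚ.*-comm (ι W) (ι m)) (sym (ι-* m W))))) (≤≡ (*-monoʳ (inv b) (0≤inv b) (ι-mono b≥m)) (*-inv b (<⇒≤ 2≤b))))) (*-idʳ iW)
   impossible : ∀ M1 M2 -> (∀ m -> M1 ≦ m -> m N.< M2 -> ¬ (P₂ m × P₂ (m N.+ 2) × P₂ (m N.+ 6))) -> M1 N.+ 6 ≦ B ^ (2 · n N.+ 1) -> B ^ M N.+ (B ^ M N.+ 7) ≦ M2 -> ⊥
   impossible M1 M2 none hM1 hM2 = ℚ.<-irrefl refl (ℚ.<-≤-trans win (*-cancel (ℓ * L³) (ℚ.<-≤-trans (0<ι {1} N.≤-refl) (≡≤ (ι-def 1) (1≤* 1≤ℓ 1≤L³))) scaled)) where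
    Ns = range X0 X1
    main : ℕ -> ℚ
    main = main-count
    rate = 2ℚ * σ * iW * G + E
    0≤γ∞ : 0ℚ ≤ γ∞
    0≤γ∞ = ∑-nonneg (range 0 n) (\h -> ∑-nonneg (range 0 n) (\i -> ∑-nonneg (range 0 n) (\j -> 0≤sq (ι (F (h N.+ (i N.+ j)))))))
    0≤G : 0ℚ ≤ G
    0≤G = 0≤* 0≤v̄ (0≤* 0≤v̄ (0≤* 0≤v̄ 0≤γ∞))
    0≤K : 0ℚ ≤ K
    0≤K = 0≤+ (0≤* 0≤3 (0≤+ (0≤* 0≤UU (Er.0≤K C)) (0≤+ (0≤* 0≤UU (Er.0≤K C')) (0≤* (0≤* (0≤* (0≤+ 0≤1 0≤1) 0≤3) (0≤* 0≤UU (Er.0≤K C))) 0≤G0)))) (0≤* 0≤2 (0≤* 0≤UU (Er.0≤K 0))) where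
     0≤UU : 0ℚ ≤ U * U
     0≤UU = 0≤sq U
    0≤rate : 0ℚ ≤ rate
    0≤rate = 0≤+ (0≤* (0≤* (0≤* 0≤2 0≤σ) (0≤inv W)) 0≤G) (0≤* 0≤K (0≤inv (b ^ 1)))
    at-N : ∀ N -> N ∈ Ns -> 3ℚ * (iφ * (inv N * inv N * main N)) ≤ rate * inv N
    at-N N N∈ = ≡≤ (id174 iφ (inv N) (main N)) (≤-trans (*-monoˡ (inv N * inv N) (0≤sq (inv N)) (per-N N M1 M2 none RR≤N (≦-trans hM1 low) (≦-trans (+-mono-≤ (<⇒≤ high) (N.+-monoˡ-≤ 7 (<⇒≤ high))) hM2)))
     (≤by (2ℚ * iW * G * inv N * (δ - ι 7 * inv N) + inv N * inv N * (E' - errs)) (0≤+ (0≤* (0≤* (0≤* (0≤* 0≤2 (0≤inv W)) 0≤G) (0≤inv N)) (diff 7≤)) (0≤* (0≤sq (inv N)) (diff (Er.At-N.errorSum-≤ b≥W b≥D 2≤b C C' hP hβ N low1 high))))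
      (trans (cong (\z -> inv N * inv N * (2ℚ * (z * iW * G) + errs) + (2ℚ * iW * G * inv N * (δ - ι 7 * inv N) + inv N * inv N * (E' - errs))) (ι-+ N 7)) (trans (id175 (inv N) (ι N) (ι 7) iW G errs δ K (inv (b ^ 1))) (trans (cong (\z -> 2ℚ * iW * G * inv N * (z + δ) + K * z * inv N * inv (b ^ 1)) (*-inv N 1≤N)) (id176 iW G (inv N) δ K (inv (b ^ 1)))))))) where
     low : X0 ≦ N
     low = proj₁ (∈-range⁻ {X0} {X1} N∈)
     high : N N.< X1
     high = proj₂ (∈-range⁻ {X0} {X1} N∈)
     low1 : B · (R · R) ≦ N
     low1 = ≡≤ℕ (sym X0≡) low
     RR≤N : R · R ≦ N
     RR≤N = ≦-trans (m≤n*m (R · R) B) low1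
     1≤N : 1 ≦ N
     1≤N = ≦-trans (m^n>0 B (2 · n N.+ 1)) low
     E' = K * ι N * inv (b ^ 1)
     errs = all-errors N
     7≤ : ι 7 * inv N ≤ δ
     7≤ = ≤≡ (*-monoˡ (ι 7) (0≤ι 7) (inv-anti (≦-trans 1≤c (m≤n*m c 7)) (≦-trans 7c≤X0 low))) (trans (cong (ι 7 *_) (inv-* 7 c)) (trans (sym (*-assoc (ι 7) (inv 7) δ)) (trans (cong (_* δ) (*-inv 7 N.z<s)) (*-idˡ δ))))
    summed : 3ℚ * (iφ * ∑ Ns (\N -> inv N * inv N * main N)) ≤ rate * (ι k * ℓ)
    summed = ≡≤ (sym (trans (∑-*ˡ Ns 3ℚ (\N -> iφ * (inv N * inv N * main N))) (cong (3ℚ *_) (∑-*ˡ Ns iφ (\N -> inv N * inv N * main N))))) (≤-trans (∑-mono∈ Ns at-N) (≡≤ (∑-*ˡ Ns rate inv) (*-monoˡ rate 0≤rate (harmonic-≤ (2 · n N.+ 1) k))))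
    mixed : ρ c * ρ c * ρ c * (L⁴ * mix (\l -> ω * α∞ l - 2ℚ)) ≤ ∑ Ns (\N -> inv N * inv N * main N)
    mixed = ≤-trans (*-monoˡ (ρ c * ρ c * ρ c) (0≤* (0≤* (0≤ρ c 1≤c) (0≤ρ c 1≤c)) (0≤ρ c 1≤c)) (≡≤ (sym (mix-* L⁴ (\l -> ω * α∞ l - 2ℚ))) (mix-mono {\l -> L⁴ * (ω * α∞ l - 2ℚ)} {θ} Q-lb)))
     (average-≥ 2≤k (≦-trans (*-monoˡ-≤ c (m≤m+n 4 3)) 7c≤X0))
    scaled : ℓ * L³ * gain ≤ ℓ * L³ * cost
    scaled = *-cancel iW 0<iW (≡≤ left (≤-trans (≤-trans (*-monoˡ 3ℚ 0≤3 (*-monoˡ iφ (0≤inv (φ W)) mixed)) summed)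
     (≤by ((iW * L³ - E) * (ι k * ℓ)) (0≤* (diff E≤) (0≤* (0≤ι k) 0≤ℓ)) (id177 σ iW L γ∞ E (ι k) ℓ)))) where
     0<iW : 0ℚ ℚ.< iW
     0<iW = ℚ.≰⇒> (\le -> ℚ.<-irrefl refl (ℚ.<-≤-trans (0<ι {1} N.≤-refl) (≡≤ (trans (ι-def 1) (sym (*-inv W 1≤W))) (≤≡ (*-monoˡ (ι W) (0≤ι W) le) (*-zeroʳ (ι W))))))
     x = ρ c * ρ c * ρ c * mix (\l -> ω * α∞ l - 2ℚ)
     left : iW * (ℓ * L³ * gain) ≡ 3ℚ * (iφ * (ρ c * ρ c * ρ c * (L⁴ * mix (\l -> ω * α∞ l - 2ℚ))))
     left = sym (trans (cong (\z -> 3ℚ * (iφ * (ρ c * ρ c * ρ c * (z * ℓ * L³ * mix (\l -> ω * α∞ l - 2ℚ))))) c≡) (trans (id160 iφ (ι (φ W)) iW ℓ L³ (ρ c * ρ c * ρ c) (mix (\l -> ω * α∞ l - 2ℚ))) (trans (cong (_* (iW * (ℓ * L³ * gain))) (*-inv (φ W) (1≤φ W 1≤W))) (*-idˡ (iW * (ℓ * L³ * gain))))))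

module Numeric where

 open Identities
 open Field
 open Sums
 open Forms using (0≤2; 0≤3; 2ℚ; 3ℚ)
 open Average using (ρ; 0≤ρ)
 open Endgame
 open Mertens using (inv1)
 open import Defs using (range; toℚ)
 open Rationals

 -- One downward pass accumulates f to T, T² to A and A to B.
 pass1 pass2 pass3 : (ℕ -> ℕ) -> ℕ -> ℕ -> ℕ -> ℕ -> ℕ
 pass1 f zero T A B = B
 pass1 f (suc u) T A B = pass2 f u (T N.+ f u) A B
 pass2 f u T A B = pass3 f u T (A N.+ T · T) B
 pass3 f u T A B = pass1 f u T A (B N.+ A)

 cubic1 cubic2 cubic3 : (ℕ -> ℕ) -> ℕ -> ℕ -> ℕ -> ℕ -> ℕ
 cubic1 f zero T A B = B
 cubic1 f (suc u) T A B = cubic2 f u (T N.+ f u · f u) A B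
 cubic2 f u T A B = cubic3 f u T (A N.+ T) B
 cubic3 f u T A B = cubic1 f u T A (B N.+ A)

 module _ (n : ℕ) where
  suffix : (ℕ -> ℚ) -> ℕ -> ℚ
  suffix g s = ∑ (range 0 n) (\i -> g (i N.+ s))
  Supported : (ℕ -> ℚ) -> Set
  Supported g = ∀ {u} -> n ≦ u -> g u ≡ 0ℚ
  suffix-0 : ∀ g -> Supported g -> Supported (suffix g)
  suffix-0 g h {u} le = trans (∑-cong (range 0 n) (\i -> h (≦-trans le (m≤n+m u i)))) (∑-0 (range 0 n))
  suffix-suc : ∀ g -> Supported g -> ∀ s -> suffix g s ≡ suffix g (suc s) + g s
  suffix-suc g h s = trans (sym (trans (cong (suffix g s +_) (h (m≤m+n n s))) (+-idʳ (suffix g s)))) (trans (sym (∑-range-last 0 n f z≤n)) (trans (∑-range-split 0 1 (suc n) f z≤n N.z<s)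
   (trans (cong₂ _+_ (+-idʳ (g s)) (trans (∑-range-shift 0 n 1 f) (∑-cong (range 0 n) (\i -> cong g (sym (+-suc i s)))))) (ℚ.+-comm (g s) (suffix g (suc s)))))) where
   f : ℕ -> ℚ
   f i = g (i N.+ s)
  iterated : ∀ g -> ∑ (range 0 n) (\i -> ∑ (range 0 n) (\j -> g (i N.+ j))) ≡ suffix (suffix g) 0
  iterated g = ∑-cong (range 0 n) (\i -> trans (∑-cong (range 0 n) (\j -> cong g (+-comm i j))) (cong (suffix g) (sym (N.+-identityʳ i))))
  private
   0ι : ∀ {x} -> x ≡ 0ℚ -> ι 0 ≡ x
   0ι h = trans (ι-def 0) (sym h)
   ι+ : ∀ x y {a b} -> ι x ≡ a -> ι y ≡ b -> ι (x N.+ y) ≡ a + b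
   ι+ x y h k = trans (ι-+ x y) (cong₂ _+_ h k)
  module _ (f : ℕ -> ℕ) (f-0 : ∀ {u} -> n ≦ u -> f u ≡ 0) where
   private
    g g² T A : ℕ -> ℚ
    g u = ι (f u)
    T = suffix g
    g² s = T s * T s
    A = suffix g²
    g-0 : Supported g
    g-0 h = trans (cong ι (f-0 h)) (ι-def 0)
    g²-0 : Supported g²
    g²-0 {u} h = trans (cong (_* T u) (suffix-0 g g-0 h)) (*-zeroˡ (T u))
    go : ∀ u t a b -> ι t ≡ T u -> ι a ≡ A u -> ι b ≡ suffix A u -> ι (pass1 f u t a b) ≡ suffix A 0
    go zero t a b hT hA hB = hB
    go (suc u) t a b hT hA hB = go u t' a' (b N.+ a') eT eA (trans (ι+ b a' hB eA) (sym (suffix-suc A (suffix-0 g² g²-0) u))) where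
     t' = t N.+ f u
     a' = a N.+ t' · t'
     eT : ι t' ≡ T u
     eT = trans (ι+ t (f u) hT refl) (sym (suffix-suc g g-0 u))
     eA : ι a' ≡ A u
     eA = trans (ι+ a (t' · t') hA (trans (ι-* t' t') (cong₂ _*_ eT eT))) (sym (suffix-suc g² g²-0 u))
   pass≡ : ι (pass1 f n 0 0 0) ≡ ∑ (range 0 n) (\i -> ∑ (range 0 n) (\j -> suffix g (i N.+ j) * suffix g (i N.+ j)))
   pass≡ = trans (go n 0 0 0 (0ι (suffix-0 g g-0 N.≤-refl)) (0ι (suffix-0 g² g²-0 N.≤-refl)) (0ι (suffix-0 A (suffix-0 g² g²-0) N.≤-refl))) (sym (iterated g²))
   private
    h S : ℕ -> ℚ
    h u = g u * g u
    S = suffix h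
    h-0 : Supported h
    h-0 {u} le = trans (cong (_* g u) (g-0 le)) (*-zeroˡ (g u))
    go3 : ∀ u t a b -> ι t ≡ S u -> ι a ≡ suffix S u -> ι b ≡ suffix (suffix S) u -> ι (cubic1 f u t a b) ≡ suffix (suffix S) 0
    go3 zero t a b hT hA hB = hB
    go3 (suc u) t a b hT hA hB = go3 u t' (a N.+ t') (b N.+ (a N.+ t')) eT eA (trans (ι+ b (a N.+ t') hB eA) (sym (suffix-suc (suffix S) (suffix-0 S (suffix-0 h h-0)) u))) where
     t' = t N.+ f u · f u
     eT : ι t' ≡ S u
     eT = trans (ι+ t (f u · f u) hT (ι-* (f u) (f u))) (sym (suffix-suc h h-0 u))
     eA : ι (a N.+ t') ≡ suffix S u
     eA = trans (ι+ a t' hA eT) (sym (suffix-suc S (suffix-0 h h-0) u))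
   cubic≡ : ι (cubic1 f n 0 0 0) ≡ ∑ (range 0 n) (\i -> ∑ (range 0 n) (\j -> ∑ (range 0 n) (\k -> g (i N.+ (j N.+ k)) * g (i N.+ (j N.+ k)))))
   cubic≡ = trans (go3 n 0 0 0 (0ι (suffix-0 h h-0 N.≤-refl)) (0ι (suffix-0 S (suffix-0 h h-0) N.≤-refl)) (0ι (suffix-0 (suffix S) (suffix-0 S (suffix-0 h h-0)) N.≤-refl)))
    (sym (∑-cong (range 0 n) (\i -> trans (∑-cong (range 0 n) (\j -> ∑-cong (range 0 n) (\k -> cong h (trans (sym (+-assoc i j k)) (trans (+-comm (i N.+ j) k) (cong (k N.+_) (+-comm i j))))))) (trans (∑-cong (range 0 n) (\j -> ∑-cong (range 0 n) (\k -> cong h (e k j i)))) (cong (\z -> ∑ (range 0 n) (\j -> S (j N.+ z))) (sym (N.+-identityʳ i)))))))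
    where
    e : ∀ k j i -> k N.+ (j N.+ i) ≡ k N.+ (j N.+ i)
    e k j i = refl

 module Criterion (n k : ℕ) (F : ℕ -> ℕ) (F-0 : ∀ {i} -> n ≦ i -> F i ≡ 0) (q : ℕ) where
  open Limits n k F
  -- floors of the reciprocals, in units of 1/(q+1)
  recips : ℕ -> ℕ -> ℕ
  recips i zero = 0
  recips i (suc k) = suc q N./ suc i N.+ recips (suc i) k
  αₙ : ℕ -> ℕ
  αₙ l = pass1 (\u -> F (u N.+ 2) ∸ F (u N.+ l)) n 0 0 0
  factorsₙ : ℕ -> ℕ
  factorsₙ zero = 0
  factorsₙ (suc l) = factorsₙ l N.+ αₙ (suc l) · (suc q N./ suc (suc l) · recips (2 · n N.+ 2 ∸ suc l) (k ∸ 2))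
  mixₙ = suc q · recips (2 · n N.+ 2) (k ∸ 1) · αₙ n N.+ factorsₙ (n ∸ 1)
  γₙ = cubic1 F n 0 0 0
  private
   iq = inv (suc q)
   0≤iq : 0ℚ ≤ iq
   0≤iq = 0≤inv (suc q)
  α≡ : ∀ l -> ι (αₙ l) ≡ α∞ l
  α≡ l = pass≡ n (\u -> F (u N.+ 2) ∸ F (u N.+ l)) (λ {u} h -> trans (cong (_∸ F (u N.+ l)) (F-0 (≦-trans h (m≤m+n u 2)))) (0∸n≡0 (F (u N.+ l))))
  γ≡ : ι γₙ ≡ γ∞
  γ≡ = cubic≡ n F F-0
  floor : ∀ i -> ι (suc q N./ suc i) * iq ≤ inv (suc i)
  floor i = ≤≡ (≤inv (suc i) N.z<s (≡≤ (trans (sym (*-assoc (ι (suc i)) (ι (suc q N./ suc i)) iq)) (cong (_* iq) (sym (ι-* (suc i) (suc q N./ suc i)))))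
   (≤≡ (*-monoʳ iq 0≤iq (ι-mono (≡≤ℕ (*-comm (suc i) (suc q N./ suc i)) (m/n*n≤m (suc q) (suc i))))) (*-inv (suc q) N.z<s)))) (*-idʳ (inv (suc i)))
  recips≤ : ∀ i k -> ι (recips i k) * iq ≤ ∑ (range i (i N.+ k)) (\l -> inv (suc l))
  recips≤ i zero = ≡≤ (trans (cong (_* iq) (ι-def 0)) (*-zeroˡ iq)) (∑-nonneg (range i (i N.+ 0)) (\l -> 0≤inv (suc l)))
  recips≤ i (suc k) = ≡≤ (trans (cong (_* iq) (ι-+ (suc q N./ suc i) (recips (suc i) k))) (*-distribʳ-+ iq (ι (suc q N./ suc i)) (ι (recips (suc i) k)))) (≤≡ (+-mono (floor i) (recips≤ (suc i) k))
   (sym (trans (cong (\z -> ∑ (range i z) (\l -> inv (suc l))) (+-suc i k)) (trans (∑-range-split i (suc i) (suc i N.+ k) (\l -> inv (suc l)) (n≤1+n i) (s≤s (m≤m+n i k)))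
    (cong (_+ ∑ (range (suc i) (suc i N.+ k)) (\l -> inv (suc l))) (trans (cong (\z -> ∑ z (\l -> inv (suc l))) (range-suc i)) (+-idʳ (inv (suc i)))))))))
  private
   0≤α : ∀ l -> 0ℚ ≤ α∞ l
   0≤α l = ≤≡ (0≤ι (αₙ l)) (α≡ l)
  factors≤ : ∀ l -> ι (factorsₙ l) * (iq * iq) ≤ ∑ (range 1 (suc l)) (\l -> α∞ l * coef l)
  factors≤ zero = ≡⇒≤ (trans (cong (_* (iq * iq)) (ι-def 0)) (trans (*-zeroˡ (iq * iq)) (sym (cong (\z -> ∑ z (\l -> α∞ l * coef l)) (range-[] 1)))))
  factors≤ (suc l) = ≡≤ (trans (cong (_* (iq * iq)) (trans (ι-+ (factorsₙ l) (αₙ (suc l) · (x · y))) (cong (ι (factorsₙ l) +_) (trans (ι-* (αₙ (suc l)) (x · y)) (cong₂ _*_ (α≡ (suc l)) (ι-* x y)))))) (trans (*-distribʳ-+ (iq * iq) (ι (factorsₙ l)) (α∞ (suc l) * (ι x * ι y))) (cong (ι (factorsₙ l) * (iq * iq) +_) (id192 (α∞ (suc l)) (ι x) (ι y) iq))))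
   (≤≡ (+-mono (factors≤ l) (*-monoˡ (α∞ (suc l)) (0≤α (suc l)) (*-mono (0≤* (0≤ι x) 0≤iq) (∑-nonneg (range i (i N.+ (k ∸ 2))) (\j -> 0≤inv (suc j))) (floor (suc l)) (recips≤ i (k ∸ 2))))) (sym (∑-range-last 1 (suc l) (\l -> α∞ l * coef l) N.z<s))) where
   i = 2 · n N.+ 2 ∸ suc l
   x = suc q N./ suc (suc l)
   y = recips i (k ∸ 2)
  module _ (1≤n : 1 ≦ n) where
   mix≥ : ι mixₙ * (iq * iq) ≤ mix α∞
   mix≥ = ≡≤ (trans (cong (_* (iq * iq)) (trans (ι-+ (suc q · x · αₙ n) (factorsₙ (n ∸ 1))) (cong (_+ ι (factorsₙ (n ∸ 1))) (trans (ι-* (suc q · x) (αₙ n)) (cong₂ _*_ (ι-* (suc q) x) (α≡ n)))))) (trans (id191 (ι (suc q)) (ι x) (α∞ n) (ι (factorsₙ (n ∸ 1))) iq) (cong (\z -> z * (ι x * iq) * α∞ n + ι (factorsₙ (n ∸ 1)) * (iq * iq)) (*-inv (suc q) N.z<s))))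
    (+-mono (*-monoʳ (α∞ n) (0≤α n) (≡≤ (*-idˡ (ι x * iq)) (recips≤ (2 · n N.+ 2) (k ∸ 1)))) (≤≡ (factors≤ (n ∸ 1)) (cong (\z -> ∑ (range 1 z) (\l -> α∞ l * coef l)) (m+[n∸m]≡n 1≤n)))) where
    x = recips (2 · n N.+ 2) (k ∸ 1)
   private
    ∑inv≤ : ∀ i k -> ∑ (range i (i N.+ k)) (\l -> inv (suc l)) ≤ ι k
    ∑inv≤ i k = ≤≡ (∑-mono (range i (i N.+ k)) (\l -> inv-suc≤1 l)) (trans (∑-const (range i (i N.+ k)) 1ℚ) (trans (*-idʳ _) (cong ι (trans (length-range i (i N.+ k)) (m+n∸m≡n i k))))) where
     inv-suc≤1 : ∀ l -> inv (suc l) ≤ 1ℚ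
     inv-suc≤1 l = ≤≡ (inv-anti {1} {suc l} N.≤-refl N.z<s) inv1
   mix-1 : mix (\_ -> 1ℚ) ≤ ι (n · k N.+ k)
   mix-1 = ≤-trans (+-mono (≡≤ (*-idʳ _) (≤-trans (∑inv≤ (2 · n N.+ 2) (k ∸ 1)) (ι-mono (m∸n≤m k 1)))) (≤≡ (∑-mono (range 1 n) (\l -> ≡≤ (*-idˡ (coef l)) (c≤ l))) (∑-const (range 1 n) (ι k))))
    (≤≡ (+-monoʳ-≤ (ι k) (*-monoʳ (ι k) (0≤ι k) (ι-mono (≡≤ℕ (length-range 1 n) (m∸n≤m n 1))))) (trans (ℚ.+-comm (ι k) (ι n * ι k)) (sym (trans (ι-+ (n · k) k) (cong (_+ ι k) (ι-* n k)))))) where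
    c≤ : ∀ l -> coef l ≤ ι k
    c≤ l = ≤≡ (*-mono (0≤inv (suc l)) (0≤ι k) (≤-trans (≡≤ (sym (+-idʳ (inv (suc l)))) (≡⇒≤ (sym (cong (\z -> ∑ z (\i -> inv (suc i))) (range-suc l))))) (≡≤ (cong (\z -> ∑ (range l z) (\i -> inv (suc i))) (sym (+-comm l 1))) (∑inv≤ l 1))) (≤-trans (∑inv≤ (2 · n N.+ 2 ∸ l) (k ∸ 2)) (ι-mono (m∸n≤m k 2)))) (trans (cong (_* ι k) (ι-def 1)) (*-idˡ (ι k)))
   -- The powers of 1 ± 1/c are replaced by their linear bounds.
   win : ∀ c -> 12 ≦ c -> suc q · suc q · (k · (2 · γₙ · (c N.+ 30) N.+ c) N.+ 6 · (n · k N.+ k) · c) N.< 3 · mixₙ · (c ∸ 12) -> Tolerance.cost c ℚ.< Tolerance.gain c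
   win c 12≤c h = ℚ.≰⇒> (\le -> <-irrefl refl (<-≤-trans h (ι-cancel (chain le)))) where
    open Tolerance c
    1≤c : 1 ≦ c
    1≤c = ≦-trans N.z<s 12≤c
    C = ι c
    d = inv c
    X = mix α∞
    m = ι (n · k N.+ k)
    Q = ι (suc q)
    κ = ι k
    Xₙ = ι mixₙ * (iq * iq)
    12ℚ = toℚ 12
    30ℚ = toℚ 30
    6ℚ = toℚ 6
    0≤t : ∀ k -> 0ℚ ≤ toℚ k
    0≤t k = ≤≡ (0≤ι k) (ι-def k)
    Cd : C * d ≡ 1ℚ
    Cd = *-inv c 1≤c
    Qi : Q * iq ≡ 1ℚ
    Qi = *-inv (suc q) N.z<s
    0≤d : 0ℚ ≤ d
    0≤d = 0≤inv c
    0≤Xₙ : 0ℚ ≤ Xₙ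
    0≤Xₙ = 0≤* (0≤ι mixₙ) (0≤* 0≤iq 0≤iq)
    0≤ρ0 : 0ℚ ≤ ρ c
    0≤ρ0 = 0≤ρ c 1≤c
    12d≤1 : 12ℚ * d ≤ 1ℚ
    12d≤1 = ≤≡ (*-monoʳ d 0≤d (≡≤ (sym (ι-def 12)) (ι-mono 12≤c))) Cd
    0≤9 : 0ℚ ≤ 1ℚ - toℚ 9 * d
    0≤9 = ≤≡ (0≤+ (diff 12d≤1) (0≤* 0≤3 0≤d)) (id185 d)
    ω≥ : 1ℚ - toℚ 9 * d ≤ ω
    ω≥ = ≤by (d + 3ℚ * (d * d) + 2ℚ * (d * d * ρ c)) (0≤+ (0≤+ 0≤d (0≤* 0≤3 (0≤* 0≤d 0≤d))) (0≤* 0≤2 (0≤* (0≤* 0≤d 0≤d) 0≤ρ0))) (id186 d)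
    p = ρ c * ρ c * ρ c
    0≤p : 0ℚ ≤ p
    0≤p = 0≤* (0≤* 0≤ρ0 0≤ρ0) 0≤ρ0
    mix-lin : mix (\l -> ω * α∞ l - 2ℚ) ≡ ω * X - 2ℚ * mix (\_ -> 1ℚ)
    mix-lin = trans (mix-- (\l -> ω * α∞ l) (\l -> 2ℚ * 1ℚ)) (cong₂ _-_ (mix-* ω α∞) (mix-* 2ℚ (\_ -> 1ℚ)))
    gain≥ : 3ℚ * ((1ℚ - 12ℚ * d) * Xₙ) - 6ℚ * m ≤ gain
    gain≥ = ≤≡ (≤by (3ℚ * ((2ℚ * (d * d) + d * d * ρ c) * ((1ℚ - toℚ 9 * d) * Xₙ) + toℚ 27 * (d * d) * Xₙ + p * (1ℚ - toℚ 9 * d) * (X - Xₙ) + p * (ω - (1ℚ - toℚ 9 * d)) * X + 2ℚ * (m - m₁) + 2ℚ * ((1ℚ - p) * m₁)))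
      (0≤* 0≤3 (0≤+ (0≤+ (0≤+ (0≤+ (0≤+ (0≤* (0≤+ (0≤* 0≤2 (0≤* 0≤d 0≤d)) (0≤* (0≤* 0≤d 0≤d) 0≤ρ0)) (0≤* 0≤9 0≤Xₙ)) (0≤* (0≤* (0≤t 27) (0≤* 0≤d 0≤d)) 0≤Xₙ)) (0≤* (0≤* 0≤p 0≤9) (diff mix≥))) (0≤* (0≤* 0≤p (diff ω≥)) (≤-trans 0≤Xₙ mix≥))) (0≤* 0≤2 (diff mix-1))) (0≤* 0≤2 (0≤* (diff p≤1) 0≤m1)))) (id187 d Xₙ X m m₁ ω))
     (cong (\z -> 3ℚ * (p * z)) (sym mix-lin)) where
     m₁ = mix (\_ -> 1ℚ)
     0≤m1 : 0ℚ ≤ m₁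
     0≤m1 = ≡≤ (sym (trans (mix-* 0ℚ (\_ -> 1ℚ)) (*-zeroˡ m₁))) (mix-mono {\_ -> 0ℚ * 1ℚ} {\_ -> 1ℚ} (\_ -> 0≤1))
     p≤1 : p ≤ 1ℚ
     p≤1 = ≤by (d * (1ℚ + ρ c + ρ c * ρ c)) (0≤* 0≤d (0≤+ (0≤+ 0≤1 0≤ρ0) (0≤* 0≤ρ0 0≤ρ0))) (id180 d)
    σσ≤ : σ * σ ≤ 1ℚ + 3ℚ * d
    σσ≤ = ≤by (d * ρ c) (0≤* 0≤d 0≤ρ0) (id188 d)
    σ⁴≤ : σ * σ * σ * σ ≤ 1ℚ + 30ℚ * d
    σ⁴≤ = ≡≤ (*-assoc (σ * σ) σ σ) (≤-trans (*-mono (0≤sq σ) (0≤+ 0≤1 (0≤* 0≤3 0≤d)) σσ≤ σσ≤) (≤by (toℚ 15 * d + toℚ 9 * (d * ρ c)) (0≤+ (0≤* (0≤t 15) 0≤d) (0≤* (0≤t 9) (0≤* 0≤d 0≤ρ0))) (id189 d)))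
    cost≤ : cost ≤ κ * (2ℚ * (1ℚ + 30ℚ * d) * γ∞ + 1ℚ)
    cost≤ = *-monoˡ κ (0≤ι k) (+-monoˡ-≤ 1ℚ (*-monoʳ γ∞ (≤≡ (0≤ι γₙ) γ≡) (*-monoˡ 2ℚ 0≤2 σ⁴≤)))
    chain : gain ≤ cost -> ι (3 · mixₙ · (c ∸ 12)) ≤ ι (suc q · suc q · (k · (2 · γₙ · (c N.+ 30) N.+ c) N.+ 6 · (n · k N.+ k) · c))
    chain le = ≡≤ left (≤≡ (*-monoˡ (Q * Q * C) (0≤* (0≤* (0≤ι (suc q)) (0≤ι (suc q))) (0≤ι c))
      (≤by ((gain - (3ℚ * ((1ℚ - 12ℚ * d) * Xₙ) - 6ℚ * m)) + (cost - gain) + (κ * (2ℚ * (1ℚ + 30ℚ * d) * γ∞ + 1ℚ) - cost)) (0≤+ (0≤+ (diff gain≥) (diff le)) (diff cost≤)) (id190 (3ℚ * ((1ℚ - 12ℚ * d) * Xₙ)) (6ℚ * m) gain cost (κ * (2ℚ * (1ℚ + 30ℚ * d) * γ∞ + 1ℚ))))) right) where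
     ιc∸ : ι (c ∸ 12) ≡ C - 12ℚ
     ιc∸ = trans (id181 (ι (c ∸ 12)) 12ℚ) (cong (_- 12ℚ) (trans (cong (_+ ι (c ∸ 12)) (sym (ι-def 12))) (trans (sym (ι-+ 12 (c ∸ 12))) (cong ι (m+[n∸m]≡n 12≤c)))))
     left : ι (3 · mixₙ · (c ∸ 12)) ≡ Q * Q * C * (3ℚ * ((1ℚ - 12ℚ * d) * Xₙ))
     left = trans (trans (ι-* (3 · mixₙ) (c ∸ 12)) (cong₂ _*_ (trans (ι-* 3 mixₙ) (cong (_* ι mixₙ) (ι-def 3))) ιc∸)) (sym (trans (id182 Q C d iq (ι mixₙ)) (trans (cong₂ (\x y -> x * x * (3ℚ * ι mixₙ * (C - 12ℚ * y))) Qi Cd) (id183 (ι mixₙ) C))))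
     right : Q * Q * C * (κ * (2ℚ * (1ℚ + 30ℚ * d) * γ∞ + 1ℚ) + 6ℚ * m) ≡ ι (suc q · suc q · (k · (2 · γₙ · (c N.+ 30) N.+ c) N.+ 6 · (n · k N.+ k) · c))
     right = sym (trans (ι-* (suc q · suc q) rest) (trans (cong₂ _*_ (ι-* (suc q) (suc q)) (trans (ι-+ (k · inner) (6 · nk · c)) (cong₂ _+_ (trans (ι-* k inner) (cong (κ *_) (trans (ι-+ (2 · γₙ · (c N.+ 30)) c) (cong (_+ C) (trans (ι-* (2 · γₙ) (c N.+ 30)) (cong₂ _*_ (trans (ι-* 2 γₙ) (cong₂ _*_ (ι-def 2) γ≡)) (trans (ι-+ c 30) (cong (C +_) (ι-def 30)))))))))
       (trans (ι-* (6 · nk) c) (cong (_* C) (trans (ι-* 6 nk) (cong (_* m) (ι-def 6))))))))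
      (sym (trans (id184 Q C d κ γ∞ m) (cong (\y -> Q * Q * (κ * (2ℚ * γ∞ * (C + 30ℚ * y) + C) + 6ℚ * m * C)) Cd))))) where
      nk = n · k N.+ k
      inner = 2 · γₙ · (c N.+ 30) N.+ c
      rest = k · inner N.+ 6 · nk · c

module Final where

 open Field
 open Sums
 open Setup using (∈⇒∣∏)
 open Bins using (hsum; hsum-mono; hsum-log)
 open BVErr
 open Counts using (module Level)
 open Errors
 open Combine
 open Endgame
 open Numeric
 open import Defs using (E₂; P₂; BV1-P; BV1-E₂; toℚ)
 open import Data.Bool using (T)
 import Defs
 open Rationals

 archimedean : ∀ q -> ∃[ m ] q ≤ ι m
 archimedean (ℚ.mkℚ (ℤ.+ a) d-1 co) = a , ≤≡ (toℚᵘ-cancel-≤ (ℚᵘ.≤-trans {j = ℚᵘ.mkℚᵘ (ℤ.+ a) 0} (ℚᵘ.*≤* (subst₂ ℤ._≤_ (sym (ℤ.*-identityʳ (ℤ.+ a))) (ℤ.pos-* a (suc d-1)) (ℤ.+≤+ (m≤m*n a (suc d-1))))) (ℚᵘ.≤-reflexive (ℚᵘ.≃-sym (toℚᵘ-fromℚᵘ (ℚᵘ.mkℚᵘ (ℤ.+ a) 0)))))) (sym (ι-def a))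
 archimedean (ℚ.mkℚ (ℤ.-[1+ a ]) d-1 co) = 0 , ≤-trans (nonPositive⁻¹ (ℚ.mkℚ (ℤ.-[1+ a ]) d-1 co)) (0≤ι 0)

 P2? : ∀ n -> Dec (P₂ n)
 P2? n = prime? n ⊎-dec map′ (λ { (p , _ , q , _ , h) -> p , q , h }) (λ { (p , q , pp , pq , lt , e) -> p , s≤s (le p q (pos q pq) e) , q , s≤s (le q p (pos p pp) (trans e (*-comm p q))) , pp , pq , lt , e })
  (anyUpTo? (\p -> anyUpTo? (\q -> prime? p ×-dec prime? q ×-dec p N.<? q ×-dec n N.≟ p · q) (suc n)) (suc n)) where
  pos : ∀ p -> Prime p -> 1 ≦ p
  pos zero h = ⊥-elim (¬prime[0] h)
  pos (suc p) h = s≤s z≤n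
  le : ∀ p q -> 1 ≦ q -> n ≡ p · q -> p ≦ n
  le p q h e = ≤≡ℕ (m≤m*n p q {{>-nonZero h}}) (sym e)

 next : ∀ a k -> P₂ (a N.+ suc k) -> ∃[ z ] (a N.< z × z ≦ a N.+ suc k × P₂ z × (∀ w -> a N.< w -> w N.< z -> ¬ P₂ w))
 next a zero h = a N.+ 1 , m<m+n a N.z<s , N.≤-refl , h , \w lo hi _ -> <-irrefl refl (<-≤-trans (subst (w N.<_) (+-comm a 1) hi) lo)
 next a (suc k) h with P2? (suc a)
 ... | yes p = suc a , N.≤-refl , subst (suc a N.≤_) (sym (+-suc a (suc k))) (s≤s (m≤m+n a (suc k))) , p , \w lo hi _ -> <-irrefl refl (<-≤-trans hi lo)
 ... | no np with next (suc a) k (subst P₂ (+-suc a (suc k)) h)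
 ... | z , lo , hi , p , none = z , <-trans (n<1+n a) lo , subst (z N.≤_) (sym (+-suc a (suc k))) hi , p , \w l1 l2 pw -> between w (m≤n⇒m<n∨m≡n l1) l2 pw where
  between : ∀ w -> suc a N.< w ⊎ suc a ≡ w -> w N.< z -> ¬ P₂ w
  between w (inj₁ lt) l2 pw = none w lt l2 pw
  between w (inj₂ refl) l2 pw = np pw

 consecutive : ∀ n -> P₂ n -> P₂ (n N.+ 2) -> P₂ (n N.+ 6) ->
  ∃[ y ] ∃[ z ] (n N.< y × y N.< z × P₂ n × P₂ y × P₂ z × z ≦ n N.+ 6 × (∀ w -> n N.< w -> w N.< z -> P₂ w -> w ≡ y))
 consecutive n p0 p₂ p6 = first (next n 1 p₂) where
  Next : ℕ -> ℕ -> Set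
  Next a b = ∃[ z ] (a N.< z × z ≦ b × P₂ z × (∀ w -> a N.< w -> w N.< z -> ¬ P₂ w))
  first : Next n (n N.+ 2) -> ∃[ y ] ∃[ z ] (n N.< y × y N.< z × P₂ n × P₂ y × P₂ z × z ≦ n N.+ 6 × (∀ w -> n N.< w -> w N.< z -> P₂ w -> w ≡ y))
  first (y , n<y , y≤ , py , none) = second (subst (Next y) eq (next y j (subst P₂ (sym eq) p6))) where
   j = n N.+ 6 ∸ suc y
   eq : y N.+ suc j ≡ n N.+ 6
   eq = trans (+-suc y j) (m+[n∸m]≡n (≦-trans (s≤s y≤) (≡≤ℕ (sym (+-suc n 2)) (N.+-monoʳ-≤ n (m≤m+n 3 3)))))
   second : Next y (n N.+ 6) -> ∃[ y ] ∃[ z ] (n N.< y × y N.< z × P₂ n × P₂ y × P₂ z × z ≦ n N.+ 6 × (∀ w -> n N.< w -> w N.< z -> P₂ w -> w ≡ y))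
   second (z , y<z , z≤ , pz , none') = y , z , n<y , y<z , p0 , py , pz , z≤ , only where
    only : ∀ w -> n N.< w -> w N.< z -> P₂ w -> w ≡ y
    only w lo hi pw with <-cmp w y
    ... | tri< lt _ _ = contradiction pw (none w lo lt)
    ... | tri≈ _ e _ = e
    ... | tri> _ _ gt = contradiction pw (none' w gt hi)

 module Infinite (D n k c : ℕ) (7≤D : 7 ≦ D) (2≤n : 2 ≦ n) (2≤k : 2 ≦ k) (1≤c : 1 ≦ c) (F : ℕ -> ℕ) (F-anti : ∀ {i j} -> i ≦ j -> F j ≦ F i) (F-0 : ∀ {i} -> n ≦ i -> F i ≡ 0)
  (D≥1 : 8 · n · c ≦ D) (D≥2 : 232 · (n · n · n · n · (F 0 · F 0)) ≦ D)
  (win : Limits.Tolerance.cost n k F c ℚ.< Limits.Tolerance.gain n k F c) (bvP : BV1-P) (bvE : BV1-E₂) where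
  private
   1≤n : 1 ≦ n
   1≤n = <⇒≤ 2≤n
   M A : ℕ
   M = 2 · n N.+ 1 N.+ k
   A = Bound.A D n k 7≤D 1≤n 0 F F-anti F-0
   Wᵇ : ℕ -> ℕ
   Wᵇ b = Level.W D n k 7≤D 1≤n b F F-anti F-0
   K : ℕ -> ℕ -> ℕ -> ℚ
   K b = Bound.K∞ D n k 7≤D 1≤n b F F-anti F-0
   W = Wᵇ 0
   4<M : 4 N.< M
   4<M = ≦-trans (m≤m+n 5 2) (+-mono-≤ (N.+-monoˡ-≤ 1 (*-monoʳ-≤ 2 2≤n)) 2≤k)
   1≤2M : 1 ≦ 2 · M
   1≤2M = ≦-trans (≦-trans N.z<s 4<M) (m≤n*m M 2)
   2∣W : 2 ∣ W
   2∣W = ∈⇒∣∏ (Level.Qs D n k 7≤D 1≤n 0 F F-anti F-0) (Level.2∈Qs D n k 7≤D 1≤n 0 F F-anti F-0)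
   W' = _∣_.quotient 2∣W
   W≡ : W ≡ 2 · W'
   W≡ = trans (_∣_.equality 2∣W) (*-comm W' 2)
   odd : 2 ∤ W'
   odd d = proj₂ (Level.Wsf D n k 7≤D 1≤n 0 F F-anti F-0) 2 N.≤-refl (subst (4 ∣_) (sym W≡) (*-monoʳ-∣ 2 d))
  module Search (M0 C N1 C' N2 m : ℕ)
   (hP : ∀ N -> N1 ≦ N -> Defs.BVsumP 1 (2 · M) N * toℚ (⌊log₂ N ⌋ ^ A) ≤ toℚ (C · N))
   (hβ : ∀ N -> N2 ≦ N -> Defs.BVsumE₂ 1 M 1 (2 · M) N * toℚ (⌊log₂ N ⌋ ^ A) ≤ toℚ (C' · N))
   (hK : K 0 C C' ≤ ι m) where
   private
    X b : ℕ
    X = 2 · c · (W N.+ 2) · W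
    s7 = M0 N.+ 7 N.+ 2 · X
    s6 = N2 N.+ s7
    s5 = N1 N.+ s6
    s4 = 14 · c N.+ s5
    s₃ = m · W N.+ s4
    s₂ = D N.+ s₃
    b = W N.+ s₂
    ≤2 : ∀ {x} -> x ≦ s₂ -> x ≦ b
    ≤2 h = ≦-trans h (m≤n+m s₂ W)
    ≤3 : ∀ {x} -> x ≦ s₃ -> x ≦ b
    ≤3 h = ≤2 (≦-trans h (m≤n+m s₃ D))
    ≤4 : ∀ {x} -> x ≦ s4 -> x ≦ b
    ≤4 h = ≤3 (≦-trans h (m≤n+m s4 (m · W)))
    ≤5 : ∀ {x} -> x ≦ s5 -> x ≦ b
    ≤5 h = ≤4 (≦-trans h (m≤n+m s5 (14 · c)))
    ≤6 : ∀ {x} -> x ≦ s6 -> x ≦ b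
    ≤6 h = ≤5 (≦-trans h (m≤n+m s6 N1))
    ≤7 : ∀ {x} -> x ≦ s7 -> x ≦ b
    ≤7 h = ≤6 (≦-trans h (m≤n+m s7 N2))
    B : ℕ
    B = Level.B D n k 7≤D 1≤n b F F-anti F-0
    ℓ : ℚ
    ℓ = Level.ℓ D n k 7≤D 1≤n b F F-anti F-0
    2≤B : 2 ≦ B
    2≤B = Level.2≤B D n k 7≤D 1≤n b F F-anti F-0
    1≤W : 1 ≦ W
    1≤W = Level.1≤W D n k 7≤D 1≤n 0 F F-anti F-0
    up : ∀ {x} -> x ≦ b -> x ≦ 2 ^ b
    up h = ≦-trans h (<⇒≤ (n<2^n b))
    2^b≤B : 2 ^ b ≦ B
    2^b≤B = m≤n*m (2 ^ b) W {{>-nonZero 1≤W}}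
    hℓ : ι X ≤ ℓ
    hℓ = ≤-trans (≡≤ (trans (sym (*-idˡ (ι X))) (trans (cong (_* ι X) (sym (trans (ℚ.*-comm (inv 2) (ι 2)) (*-inv 2 N.z<s)))) (trans (*-assoc (inv 2) (ι 2) (ι X)) (cong (inv 2 *_) (sym (ι-* 2 X))))))
     (*-monoˡ (inv 2) (0≤inv 2) (ι-mono (≤7 (m≤n+m (2 · X) (M0 N.+ 7)))))) (≤-trans (hsum-log b) (hsum-mono 1 (m^n>0 2 b) 2^b≤B))
    M2 = B ^ M N.+ (B ^ M N.+ 7)
    Good : ℕ -> Set
    Good x = suc M0 ≦ x × P₂ x × P₂ (x N.+ 2) × P₂ (x N.+ 6)
    start : suc M0 N.+ 6 ≦ B ^ (2 · n N.+ 1)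
    start = ≡≤ℕ (sym (+-suc M0 6)) (≦-trans (up (≤7 (m≤m+n (M0 N.+ 7) (2 · X)))) (≦-trans 2^b≤B (≡≤ℕ (sym (^-identityʳ B)) (^-monoʳ-≤ B {{>-nonZero (<⇒≤ 2≤B)}} (m≤n+m 1 (2 · n))))))
   found : ∃[ x ] Good x
   found = decide (anyUpTo? (\x -> suc M0 N.≤? x ×-dec P2? x ×-dec P2? (x N.+ 2) ×-dec P2? (x N.+ 6)) M2) where
    decide : Dec (∃[ x ] (x N.< M2 × Good x)) -> ∃[ x ] Good x
    decide (yes (x , _ , h)) = x , h
    decide (no none) = ⊥-elim (Contradiction.impossible D n k c m 7≤D 2≤n 2≤k 1≤c F F-anti F-0 D≥1 D≥2 win b C C' hK
     (up (m≤m+n W s₂)) (up (≤2 (m≤m+n D s₃))) (≤3 (m≤m+n (m · W) s4)) (≤4 (m≤m+n (14 · c) s5)) hℓ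
     (\N h -> hP N (≦-trans (up (≤5 (m≤m+n N1 s6))) h)) (\N h -> hβ N (≦-trans (up (≤6 (m≤m+n N2 s7))) h)) W' W≡ odd
     (suc M0) M2 (\x lo hi p -> none (x , hi , lo , p)) start N.≤-refl)
  triples : ∀ M0 -> ∃[ x ] (suc M0 ≦ x × P₂ x × P₂ (x N.+ 2) × P₂ (x N.+ 6))
  triples M0 = go (bvP 1 (2 · M) N.≤-refl 1≤2M A) (bvE 1 M N.≤-refl 4<M 1 (2 · M) N.≤-refl 1≤2M A) where
   go : ∃[ C ] ∃[ N1 ] (∀ N -> N1 ≦ N -> Defs.BVsumP 1 (2 · M) N * toℚ (⌊log₂ N ⌋ ^ A) ≤ toℚ (C · N)) ->
    ∃[ C' ] ∃[ N2 ] (∀ N -> N2 ≦ N -> Defs.BVsumE₂ 1 M 1 (2 · M) N * toℚ (⌊log₂ N ⌋ ^ A) ≤ toℚ (C' · N)) ->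
    ∃[ x ] (suc M0 ≦ x × P₂ x × P₂ (x N.+ 2) × P₂ (x N.+ 6))
   go (C , N1 , hP) (C' , N2 , hβ) = Search.found M0 C N1 C' N2 (proj₁ (archimedean (K 0 C C'))) hP hβ (proj₂ (archimedean (K 0 C C')))

 ramp : ℕ -> ℕ -> ℕ -> ℕ
 ramp n s u = if u <ᵇ n then s ∸ u else 0

 ramp-anti : ∀ n s {i j} -> i ≦ j -> ramp n s j ≦ ramp n s i
 ramp-anti n s {i} {j} h with j <ᵇ n in e
 ... | false = z≤n
 ... | true with i <ᵇ n | <⇒<ᵇ (≤-<-trans h (<ᵇ⇒< j n (subst T (sym e) tt)))
 ... | true | _ = ∸-monoʳ-≤ s h

 ramp-0 : ∀ n s {i} -> n ≦ i -> ramp n s i ≡ 0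
 ramp-0 n s {i} h with i <ᵇ n in e
 ... | false = refl
 ... | true = contradiction (<ᵇ⇒< i n (subst T (sym e) tt)) (≤⇒≯ h)

 -- The constants were found by a numerical search; they give gain/cost = 1.005.
 win : Limits.Tolerance.cost 800 55 (ramp 800 928) 100000 ℚ.< Limits.Tolerance.gain 800 55 (ramp 800 928) 100000
 win = Criterion.win 800 55 (ramp 800 928) (ramp-0 800 928) 999999999 (<ᵇ⇒< 0 800 tt) 100000 (≤ᵇ⇒≤ 12 100000 tt) (<ᵇ⇒< _ _ tt)

 infinitely-many : BV1-P -> BV1-E₂ -> ∀ M0 -> ∃[ x ] (suc M0 ≦ x × P₂ x × P₂ (x N.+ 2) × P₂ (x N.+ 6))
 infinitely-many = Infinite.triples 100000000000000000000 800 55 100000 (≤ᵇ⇒≤ 7 100000000000000000000 tt) (≤ᵇ⇒≤ 2 800 tt) (≤ᵇ⇒≤ 2 55 tt) (≤ᵇ⇒≤ 1 100000 tt) (ramp 800 928) (ramp-anti 800 928) (ramp-0 800 928) (≤ᵇ⇒≤ _ _ tt) (≤ᵇ⇒≤ _ _ tt) win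

open import Defs
open import Data.Nat using (ℕ; _+_; _≤_; _<_)
open import Data.Product using (_×_; ∃-syntax)
open import Relation.Binary.PropositionalEquality using (_≡_)

theorem1p3 : BV1-P → BV1-E₂ →
    (∀ (M : ℕ) → ∃[ n ] (M ≤ n × 0 < n × P₂ n × P₂ (n + 2) × P₂ (n + 6)))
    × (∀ (M : ℕ) → ∃[ x ] ∃[ y ] ∃[ z ]
         (M ≤ x × x < y × y < z × P₂ x × P₂ y × P₂ z × z ≤ x + 6
          × (∀ w → x < w → w < z → P₂ w → w ≡ y)))
theorem1p3 bvP bvE =
  (λ M → let (n , M<n , p₀ , p₂ , p₆) = Final.infinitely-many bvP bvE M in
    n , N.<⇒≤ M<n , N.≤-trans N.z<s M<n , p₀ , p₂ , p₆) ,
  (λ M → let (n , M<n , p₀ , p₂ , p₆) = Final.infinitely-many bvP bvE M; (y , z , h) = Final.consecutive n p₀ p₂ p₆ in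
    n , y , z , N.<⇒≤ M<n , h)
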